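{- Let $w\in B_n$ avoid the patterns $3412$ and $4231$, and let $Q=Q(w)$ be its type-$\mathsf{BC}$ unit interval order. Then $$Y^{\mathsf{BC}}(C'_w(1))=X^{\mathsf{BC}}_{\mathrm{inc}(Q)}.$$
   Context: Notation: $[\bar n,n]=\{ -n,\dots,-1,1,\dots,n\}$, $\bar a=-a$, $[n]=\{1,\dots,n\}$; for $h\le l$, $[h,l]=\{h,\dots,l\}\setminus\{0\}$. $B_n$ is the group of permutations $w$ of $[\bar n,n]$ with $w(\bar i)=\overline{w(i)}$ (Coxeter group of type $B_n=C_n$, Bruhat order $\le_{B_n}$); $w_i=w(i)$. $w$ avoids $3412$ and $4231$ means $w_{\bar n}\cdots w_{\bar1}w_1\cdots w_n$ has no subsequence order-isomorphic to $3412$ or $4231$. For such $w$, $C'_w(1)$ is the Kazhdan–Lusztig basis element $C'_w(q)$ of the Hecke algebra of $B_n$ at $q=1$; it equals $\sum_{v\le_{B_n}w}v$. Characters: for $u\in B_m$, $\ell_t(u)=\#\{i:u_i<0\}$ and $\varphi(u)\in S_m$ is $i\mapsto|u_i|$; $\epsilon^\lambda$ is the sign character of the Young subgroup $S_{\lambda_1}\times\cdots\times S_{\lambda_r}$ induced to $S_m$. For $(\lambda,\mu)\vdash n$ (pairs of partitions with $|\lambda|+|\mu|=n$), $|\lambda|=k$, $(\epsilon\epsilon)^{\lambda,\mu}$ is the induction from $B_k\times B_{n-k}=\{w\in B_n:\{|w_1|,\dots,|w_k|\}=[k]\}$ to $B_n$ of $u\mapsto\epsilon^\lambda(\varphi(u))$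 tensored with $u\mapsto(-1)^{\ell_t(u)}\epsilon^\mu(\varphi(u))$. For $D\in\mathbb Z[B_n]$ define $Y^{\mathsf{BC}}(D)=\sum_{(\lambda,\mu)\vdash n}(\epsilon\epsilon)^{\lambda,\mu}(D)\,m_\lambda(x)m_\mu(y)$, where $m_\lambda$ are monomial symmetric functions in $x=(x_1,x_2,\dots)$, $y=(y_1,y_2,\dots)$. Networks: a type-A planar network on an interval $[h,l]$ is a directed planar acyclic multigraph in a disc with boundary vertices labelled clockwise source $h,\dots,$ source $l$, sink $l,\dots,$ sink $h$, edges possibly with positive integer multiplicities, sources of indegree 0 and outdegree 1, sinks of indegree 1 and outdegree 0. For $[a,b]\subseteq[h,l]$, $F_{[a,b]}$ has an edge source $i\to$ sink $i$ for $i\notin[a,b]$ and one interior vertex $z$ with edges source $i\to z\to$ sink $i$ for $i\in[a,b]$ (no interior vertex if $a=b$). $E\circ F$ merges the edge into sink $i$ of $E$ with the edge out of source $i$ of $F$; $E\bullet F$ further replaces each set of $m>1$ parallel edges by one edge of multiplicity $m$. Intervals $[c_1,d_1],\dots,[c_t,d_t]$ satisfy the zig-zag conditions if distinct, pairwise non-nesting, and for $i<j<k$ with $[c_i,d_i]\cap[c_j,d_j]\ne\emptyset\ne[c_j,d_j]\cap[c_k,d_k]$ one has $c_i<c_j<c_k$ or $c_i>c_j>c_k$; a type-A zig-zag network is $F_{[c_1,d_1]}\bullet\cdots\bullet F_{[c_t,d_t]}$ with such intervals (or trivial). A path family of type $u$ is $(\pi_h,\dots,\pi_l)$ with $\pi_i$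 from source $i$ to sink $u(i)$, covering the network if every edge lies on some path. For a zig-zag network $F$, the covering types have a unique maximal-length element $w(F)$; $F\mapsto w(F)$ is a bijection onto permutations avoiding $3412,4231$, with inverse $w\mapsto F_w$. $F_w$ has a unique type-$e$ covering family $\pi$; $P(w)$ is the order with $i<_{P(w)}j$ iff $i<j$ and $\pi_i,\pi_j$ share no vertex. For $w\in B_n$ avoiding $3412,4231$, $i\in[n]$ is grounded if $\pi_i,\pi_{\bar i}$ share a vertex; $Q(w)$ is the subposet of $P(w)$ on $[n]$ with grounded elements distinguished. Chromatic function: $\mathrm{inc}(Q)$ is the graph on the elements of $Q$ (keeping the grounded ones distinguished) with an edge for each pair of $Q$-incomparable elements. A marked $\mathsf{BC}$-coloring of a graph $\Gamma=(V,E)$ with distinguished grounded vertices is $\kappa=(\kappa_1,\kappa_2):V\to(\mathbb Z\setminus\{0\})\times\{0,1\}$ with $\kappa_1(b)>0$ for grounded $b$ and $\kappa_2(b)=0$ for non-grounded $b$; it is proper if $\{a,b\}\in E$ implies $\kappa_1(a)\ne\kappa_1(b)$. Then $X^{\mathsf{BC}}_\Gamma=\sum_\kappa\prod_{i\ge1}x_i^{|\kappa_1^{ -1}(i)|}\,y_i^{|\kappa_1^{ -1}(-i)|}$, summed over proper marked $\mathsf{BC}$-colorings. -}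

module Defs where

open import Data.Bool using (Bool; true; false; _∧_; _∨_; not; if_then_else_)
open import Data.Nat as ℕ using (ℕ; zero; suc; _∸_)
open import Data.Integer as ℤ using (ℤ; +_; -[1+_]; ∣_∣)
open import Data.Rational as ℚ using (ℚ)
open import Data.Fin as Fin using (Fin; toℕ)
open import Data.List using (List; []; _∷_; _++_; map; concatMap; length; reverse; upTo; take; drop; lookup)
open import Data.Nat.ListAction using (sum)
open import Data.List.Relation.Binary.Permutation.Propositional using (_↭_)
open import Data.List.Relation.Unary.Unique.Propositional using (Unique)
open import Data.List.Membership.Propositional using (_∈_)
open import Data.List.Properties using (≡-dec)
open import Data.Product using (Σ; _×_; _,_; proj₁; proj₂)
open import Data.Sum using (_⊎_)
open import Relation.Nullary using (¬_)
open import Relation.Nullary.Decidable using (⌊_⌋)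
open import Relation.Binary.PropositionalEquality using (_≡_; _≢_)

anyB : {A : Set} → (A → Bool) → List A → Bool
anyB p []       = false
anyB p (x ∷ xs) = p x ∨ anyB p xs

allB : {A : Set} → (A → Bool) → List A → Bool
allB p []       = true
allB p (x ∷ xs) = p x ∧ allB p xs

countB : {A : Set} → (A → Bool) → List A → ℕ
countB p []       = 0
countB p (x ∷ xs) = if p x then suc (countB p xs) else countB p xs

filterB : {A : Set} → (A → Bool) → List A → List A
filterB p []       = []
filterB p (x ∷ xs) = if p x then x ∷ filterB p xs else filterB p xs

allLists : {A : Set} → ℕ → List A → List (List A)
allLists zero    xs = [] ∷ []
allLists (suc m) xs = concatMap (λ x → map (x ∷_) (allLists m xs)) xs

insertAll : {A : Set} → A → List A → List (List A)
insertAll x []       = (x ∷ []) ∷ []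
insertAll x (y ∷ ys) = (x ∷ y ∷ ys) ∷ map (y ∷_) (insertAll x ys)

perms : {A : Set} → List A → List (List A)
perms []       = [] ∷ []
perms (x ∷ xs) = concatMap (insertAll x) (perms xs)

nthZ : List ℤ → ℕ → ℤ
nthZ []       k       = + 0
nthZ (x ∷ xs) zero    = x
nthZ (x ∷ xs) (suc k) = nthZ xs k

nthN : List ℕ → ℕ → ℕ
nthN []       k       = 0
nthN (x ∷ xs) zero    = x
nthN (x ∷ xs) (suc k) = nthN xs k

nthL : List (List ℤ) → ℕ → List ℤ
nthL []       k       = []
nthL (x ∷ xs) zero    = x
nthL (x ∷ xs) (suc k) = nthL xs k

hdZ : List ℤ → ℤ
hdZ []      = + 0
hdZ (x ∷ _) = x

lstZ : List ℤ → ℤ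
lstZ []           = + 0
lstZ (x ∷ [])     = x
lstZ (_ ∷ y ∷ ys) = lstZ (y ∷ ys)

eqZ : ℤ → ℤ → Bool
eqZ x y = ⌊ x ℤ.≟ y ⌋

ltZ : ℤ → ℤ → Bool
ltZ x y = not (y ℤ.≤ᵇ x)

eqLZ : List ℤ → List ℤ → Bool
eqLZ x y = ⌊ ≡-dec ℤ._≟_ x y ⌋

eqLN : List ℕ → List ℕ → Bool
eqLN x y = ⌊ ≡-dec ℕ._≟_ x y ⌋

sumQ : List ℚ → ℚ
sumQ []       = ℚ.0ℚ
sumQ (x ∷ xs) = x ℚ.+ sumQ xs

upto1 : ℕ → List ℕ
upto1 n = map suc (upTo n)

posZ : ℕ → List ℤ
posZ n = map +_ (upto1 n)

invZ : List ℤ → ℕ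
invZ []       = 0
invZ (x ∷ xs) = countB (λ y → ltZ y x) xs ℕ.+ invZ xs

-- Signed permutations: w ∈ B_n in window notation  w_1 ⋯ w_n  (List ℤ)

ev : List ℤ → ℤ → ℤ
ev w (+ zero)  = + 0
ev w (+ suc k) = nthZ w k
ev w -[1+ k ]  = ℤ.- (nthZ w k)

compose : List ℤ → List ℤ → List ℤ
compose u v = map (ev u) v

SignedPerm : ℕ → List ℤ → Set
SignedPerm n w = (length w ≡ n) × (map ∣_∣ w ↭ upto1 n)

idP : ℕ → List ℤ
idP n = posZ n

gen : ℕ → ℕ → List ℤ
gen n zero    = map (λ k → if k ℕ.≡ᵇ 1 then -[1+ 0 ] else + k) (upto1 n)
gen n (suc i) = map (λ k → if k ℕ.≡ᵇ suc i then + (suc (suc i))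
                           else if k ℕ.≡ᵇ suc (suc i) then + (suc i) else + k) (upto1 n)

prodW : (n : ℕ) → List (Fin n) → List ℤ
prodW n []       = idP n
prodW n (i ∷ is) = compose (gen n (toℕ i)) (prodW n is)

Len : ℕ → List ℤ → ℕ → Set
Len n w k = (Σ (List (Fin n)) λ ws → (length ws ≡ k) × (prodW n ws ≡ w))
          × ((ws : List (Fin n)) → prodW n ws ≡ w → k ℕ.≤ length ws)

Reflection : ℕ → List ℤ → Set
Reflection n t = Σ (List ℤ) λ v → SignedPerm n v ×
                 (Σ (Fin n) λ i → compose t v ≡ compose v (gen n (toℕ i)))

data BruhatLe (n : ℕ) (u : List ℤ) : List ℤ → Set where
  bRefl : BruhatLe n u u
  bStep : ∀ {v t k k'} → BruhatLe n u v → Reflection n t →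
          Len n v k → Len n (compose v t) k' → k ℕ.< k' → BruhatLe n u (compose v t)

-- L lists the Bruhat interval {v ∈ B_n : v ≤ w} without repetition
-- (so ∑_{v ∈ L} v = ∑_{v ≤ w} v = C'_w(1))
BruhatEnum : ℕ → List ℤ → List (List ℤ) → Set
BruhatEnum n w L = Unique L ×
  ((v : List ℤ) → (v ∈ L → SignedPerm n v × BruhatLe n v w) × (SignedPerm n v × BruhatLe n v w → v ∈ L))

full : List ℤ → List ℤ
full w = reverse (map ℤ.-_ w) ++ w

Has3412 : List ℤ → Set
Has3412 s = Σ ℕ λ a → Σ ℕ λ b → Σ ℕ λ c → Σ ℕ λ d →
  (a ℕ.< b) × (b ℕ.< c) × (c ℕ.< d) × (d ℕ.< length s) ×
  (nthZ s c ℤ.< nthZ s d) × (nthZ s d ℤ.< nthZ s a) × (nthZ s a ℤ.< nthZ s b)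

Has4231 : List ℤ → Set
Has4231 s = Σ ℕ λ a → Σ ℕ λ b → Σ ℕ λ c → Σ ℕ λ d →
  (a ℕ.< b) × (b ℕ.< c) × (c ℕ.< d) × (d ℕ.< length s) ×
  (nthZ s d ℤ.< nthZ s b) × (nthZ s b ℤ.< nthZ s c) × (nthZ s c ℤ.< nthZ s a)

Avoids3412-4231 : List ℤ → Set
Avoids3412-4231 w = (¬ Has3412 (full w)) × (¬ Has4231 (full w))

-- Zig-zag networks on [n̄,n]:  F_{[c_1,d_1]} • ⋯ • F_{[c_t,d_t]}
-- An interval [c,d] is the set {c,…,d} ∖ {0}.

Interval : Set
Interval = ℤ × ℤ

wiresZ : ℕ → List ℤ
wiresZ n = reverse (map ℤ.-_ (posZ n)) ++ posZ n

InIv : Interval → ℤ → Set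
InIv (c , d) x = (x ≢ + 0) × (c ℤ.≤ x) × (x ℤ.≤ d)

Nested : Interval → Interval → Set
Nested I J = (x : ℤ) → InIv I x → InIv J x

Meets : Interval → Interval → Set
Meets I J = Σ ℤ λ x → InIv I x × InIv J x

ZigZag : ℕ → List Interval → Set
ZigZag n Is =
  ((j : Fin (length Is)) → (proj₁ (lookup Is j) ≢ + 0) × (proj₂ (lookup Is j) ≢ + 0) ×
     (ℤ.- (+ n) ℤ.≤ proj₁ (lookup Is j)) × (proj₁ (lookup Is j) ℤ.≤ proj₂ (lookup Is j)) ×
     (proj₂ (lookup Is j) ℤ.≤ + n))
  × Unique Is
  × ((j k : Fin (length Is)) → j ≢ k → ¬ Nested (lookup Is j) (lookup Is k))
  × ((i j k : Fin (length Is)) → i Fin.< j → j Fin.< k →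
       Meets (lookup Is i) (lookup Is j) → Meets (lookup Is j) (lookup Is k) →
       ((proj₁ (lookup Is i) ℤ.< proj₁ (lookup Is j)) × (proj₁ (lookup Is j) ℤ.< proj₁ (lookup Is k)))
     ⊎ ((proj₁ (lookup Is j) ℤ.< proj₁ (lookup Is i)) × (proj₁ (lookup Is k) ℤ.< proj₁ (lookup Is j))))

inIvB : Interval → ℤ → Bool
inIvB (c , d) x = (c ℤ.≤ᵇ x) ∧ (x ℤ.≤ᵇ d) ∧ not (eqZ x (+ 0))

-- layer [c,d] has an interior vertex through which wire p passes
touch : Interval → ℤ → Bool
touch (c , d) p = ltZ c d ∧ inIvB (c , d) p

-- vertices of the network: sources, sinks, and the interior vertex z_j of layer j
data Vtx : Set where
  src : ℤ → Vtx
  mid : ℕ → Vtx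
  snk : ℤ → Vtx

eqV : Vtx → Vtx → Bool
eqV (src a) (src b) = eqZ a b
eqV (mid a) (mid b) = a ℕ.≡ᵇ b
eqV (snk a) (snk b) = eqZ a b
eqV _       _       = false

eqE : Vtx × Vtx → Vtx × Vtx → Bool
eqE (a , b) (c , d) = eqV a c ∧ eqV b d

consec : List Vtx → List (Vtx × Vtx)
consec []           = []
consec (x ∷ [])     = []
consec (x ∷ y ∷ ys) = (x , y) ∷ consec (y ∷ ys)

-- edges (after merging parallel edges) : consecutive vertices along each wire
wireMids : ℕ → List Interval → ℤ → List Vtx
wireMids j []       p = []
wireMids j (I ∷ Is) p = if touch I p then mid j ∷ wireMids (suc j) Is p else wireMids (suc j) Is p

netEdges : List Interval → List ℤ → List (Vtx × Vtx)
netEdges Is ws = concatMap (λ p → consec (src p ∷ wireMids 0 Is p ++ snk p ∷ [])) ws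

-- a path is given by its wire positions p_0, p_1, …, p_t between the layers
validPath : List Interval → List ℤ → Bool
validPath []       (p ∷ [])    = true
validPath []       _           = false
validPath (I ∷ Is) (p ∷ q ∷ r) = (if touch I p then inIvB I q else eqZ p q) ∧ validPath Is (q ∷ r)
validPath (I ∷ Is) _           = false

pathMids : ℕ → List Interval → List ℤ → List Vtx
pathMids j []       _           = []
pathMids j (I ∷ Is) (p ∷ q ∷ r) =
  if touch I p then mid j ∷ pathMids (suc j) Is (q ∷ r) else pathMids (suc j) Is (q ∷ r)
pathMids j (I ∷ Is) _           = []

pathVerts : List Interval → List ℤ → List Vtx
pathVerts Is ps = src (hdZ ps) ∷ pathMids 0 Is ps ++ snk (lstZ ps) ∷ []

famOk : List Interval → List ℤ → List ℤ → List (List ℤ) → Bool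
famOk Is []       []       []       = true
famOk Is (s ∷ ws) (t ∷ us) (p ∷ π) =
  validPath Is p ∧ eqZ (hdZ p) s ∧ eqZ (lstZ p) t ∧ famOk Is ws us π
famOk Is _        _        _        = false

covers : List Interval → List ℤ → List (List ℤ) → Bool
covers Is ws π = allB (λ e → anyB (λ p → anyB (eqE e) (consec (pathVerts Is p))) π) (netEdges Is ws)

CoveringType : List Interval → List ℤ → List ℤ → Set
CoveringType Is ws u = Σ (List (List ℤ)) λ π → (famOk Is ws u π ≡ true) × (covers Is ws π ≡ true)

IsMaxType : List Interval → List ℤ → List ℤ → Set
IsMaxType Is ws w = CoveringType Is ws w ×
  ((u : List ℤ) → u ↭ ws → CoveringType Is ws u → u ≢ w → invZ u ℕ.< invZ w)

-- path of the family (listed in order of wiresZ n) starting at label x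
pathOf : ℕ → List (List ℤ) → ℤ → List ℤ
pathOf n π (+ zero)  = []
pathOf n π (+ suc k) = nthL π (n ℕ.+ k)
pathOf n π -[1+ k ]  = nthL π (n ∸ suc k)

shares : List Interval → List ℤ → List ℤ → Bool
shares Is p q = anyB (λ v → anyB (eqV v) (pathVerts Is q)) (pathVerts Is p)

ltP : ℕ → List Interval → List (List ℤ) → ℤ → ℤ → Bool
ltP n Is π x y = ltZ x y ∧ not (shares Is (pathOf n π x) (pathOf n π y))

grounded : ℕ → List Interval → List (List ℤ) → ℕ → Bool
grounded n Is π i = shares Is (pathOf n π (+ i)) (pathOf n π (ℤ.- (+ i)))

incEdge : ℕ → List Interval → List (List ℤ) → ℕ → ℕ → Bool
incEdge n Is π a b = not (a ℕ.≡ᵇ b) ∧ not (ltP n Is π (+ a) (+ b)) ∧ not (ltP n Is π (+ b) (+ a))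

-- X^BC_{inc(Q)}: coefficient of  x^α y^β  (α_i = exponent of x_{i+1}, missing = 0)
-- A coloring κ is a list (κ(1),…,κ(n)) of pairs (κ₁,κ₂), κ₂ ∈ {0,1} as Bool.
-- Only colors in [-(length β), length α]∖{0} can contribute to x^α y^β.

colorsFor : List ℕ → List ℕ → List (ℤ × Bool)
colorsFor α β = concatMap (λ c → (c , false) ∷ (c , true) ∷ [])
                  (map (λ k → ℤ.- (+ k)) (upto1 (length β)) ++ map +_ (upto1 (length α)))

kap : List (ℤ × Bool) → ℕ → ℤ × Bool
kap []       _       = (+ 0 , false)
kap (x ∷ xs) zero    = x
kap (x ∷ xs) (suc k) = kap xs k

goodColoring : ℕ → List Interval → List (List ℤ) → List ℕ → List ℕ → List (ℤ × Bool) → Bool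
goodColoring n Is π α β κ =
  allB (λ i → if grounded n Is π i then ltZ (+ 0) (proj₁ (kap κ (i ∸ 1)))
              else not (proj₂ (kap κ (i ∸ 1)))) (upto1 n)
  ∧ allB (λ a → allB (λ b → not (incEdge n Is π a b) ∨
              not (eqZ (proj₁ (kap κ (a ∸ 1))) (proj₁ (kap κ (b ∸ 1))))) (upto1 n)) (upto1 n)
  ∧ allB (λ i → countB (λ c → eqZ (proj₁ c) (+ i)) κ ℕ.≡ᵇ nthN α (i ∸ 1)) (upto1 (length α))
  ∧ allB (λ i → countB (λ c → eqZ (proj₁ c) (ℤ.- (+ i))) κ ℕ.≡ᵇ nthN β (i ∸ 1)) (upto1 (length β))

XBC : ℕ → List Interval → List (List ℤ) → List ℕ → List ℕ → ℚ
XBC n Is π α β = (+ countB (goodColoring n Is π α β) (allLists n (colorsFor α β))) ℚ./ 1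

allPerm : ℕ → List (List ℤ)
allPerm m = perms (posZ m)

signs : List ℤ → List (List ℤ)
signs []       = [] ∷ []
signs (x ∷ xs) = concatMap (λ r → (x ∷ r) ∷ (ℤ.- x ∷ r) ∷ []) (signs xs)

allSigned : ℕ → List (List ℤ)
allSigned n = concatMap signs (allPerm n)

divQ : ℚ → ℕ → ℚ
divQ q zero    = ℚ.0ℚ
divQ q (suc m) = q ℚ.* ((+ 1) ℚ./ suc m)

-- induced character:  Ind_H^G χ (g) = (1/|H|) ∑_{x ∈ G, x⁻¹gx ∈ H} χ(x⁻¹gx)
-- (y = x⁻¹gx  iff  x∘y = g∘x)
ind : List (List ℤ) → (List ℤ → Bool) → (List ℤ → ℚ) → List ℤ → ℚ
ind G inH χ g = divQ (sumQ (concatMap (λ x → map (λ y →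
                  if inH y ∧ eqLZ (compose x y) (compose g x) then χ y else ℚ.0ℚ) G) G))
                (countB inH G)

powNeg1 : ℕ → ℚ
powNeg1 zero    = ℚ.1ℚ
powNeg1 (suc k) = ℚ.- powNeg1 k

sgnPerm : List ℤ → ℚ
sgnPerm σ = powNeg1 (invZ σ)

-- block (0-based) of position i ∈ [1, |λ|] in the composition λ
blockOf : List ℕ → ℕ → ℕ
blockOf []       i = 0
blockOf (l ∷ ls) i = if i ℕ.≤ᵇ l then 0 else suc (blockOf ls (i ∸ l))

inYoungAux : List ℕ → ℕ → List ℤ → Bool
inYoungAux λ' i []       = true
inYoungAux λ' i (x ∷ xs) = (blockOf λ' ∣ x ∣ ℕ.≡ᵇ blockOf λ' i) ∧ inYoungAux λ' (suc i) xs

inYoung : List ℕ → List ℤ → Bool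
inYoung λ' σ = inYoungAux λ' 1 σ

epsChar : List ℕ → List ℤ → ℚ
epsChar λ' σ = ind (allPerm (length σ)) (inYoung λ') sgnPerm σ

absL : List ℤ → List ℤ
absL u = map (λ x → + ∣ x ∣) u

shiftDown : ℕ → ℤ → ℤ
shiftDown k (+ m)     = + (m ∸ k)
shiftDown k -[1+ m ]  = ℤ.- (+ (suc m ∸ k))

negCount : List ℤ → ℕ
negCount u = countB (λ x → ltZ x (+ 0)) u

epsEps : ℕ → List ℕ → List ℕ → List ℤ → ℚ
epsEps n λ' μ g = ind (allSigned n) inH χ g
  where
  k : ℕ
  k = sum λ'
  inH : List ℤ → Bool
  inH u = allB (λ x → ∣ x ∣ ℕ.≤ᵇ k) (take k u)
  χ : List ℤ → ℚ
  χ u = epsChar λ' (absL (take k u)) ℚ.*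
        (powNeg1 (negCount (drop k u)) ℚ.* epsChar μ (absL (map (shiftDown k) (drop k u))))

partsF : ℕ → ℕ → ℕ → List (List ℕ)
partsF f       m zero    = [] ∷ []
partsF zero    m (suc k) = []
partsF (suc f) m (suc k) =
  concatMap (λ j → map (j ∷_) (partsF f j (suc k ∸ j))) (filterB (λ j → j ℕ.≤ᵇ m) (upto1 (suc k)))

partitions : ℕ → List (List ℕ)
partitions k = partsF k k k

bipartitions : ℕ → List (List ℕ × List ℕ)
bipartitions n = concatMap (λ k → concatMap (λ l → map (l ,_) (partitions (n ∸ k))) (partitions k))
                   (upTo (suc n))

insD : ℕ → List ℕ → List ℕ
insD x []       = x ∷ []
insD x (y ∷ ys) = if y ℕ.≤ᵇ x then x ∷ y ∷ ys else y ∷ insD x ys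

sortDesc : List ℕ → List ℕ
sortDesc []       = []
sortDesc (x ∷ xs) = insD x (sortDesc xs)

-- coefficient of the monomial with exponent vector α in m_λ
mCoef : List ℕ → List ℕ → ℚ
mCoef λ' α = if eqLN (sortDesc (filterB (λ a → not (a ℕ.≡ᵇ 0)) α)) λ' then ℚ.1ℚ else ℚ.0ℚ

-- coefficient of x^α y^β in Y^BC(D),  D = ∑_{v ∈ L} v
YBC : ℕ → List (List ℤ) → List ℕ → List ℕ → ℚ
YBC n L α β = sumQ (map (λ lm → sumQ (map (epsEps n (proj₁ lm) (proj₂ lm)) L)
                                 ℚ.* (mCoef (proj₁ lm) α ℚ.* mCoef (proj₂ lm) β))
                        (bipartitions n))

{-# OPTIONS --safe #-}
module Submission where

-- Write i → j if some path of the network leads from source i to sink j.  Crossing paths can exchange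
-- their tails, so the permutations v with i → v i for all i are closed downwards in Bruhat order.
-- Peeling off the first layer [c , d] and sorting v increasingly on it leaves a permutation with the
-- same property for the remaining layers (this uses the zig-zag conditions), so by the lifting property
-- these permutations form a lower interval; its maximum is full w.  As full w commutes with negation,
-- so does →, and the interval below w in B_n consists of the signed permutations v with i → v i.
--
-- Since sign ∘ φ is a character of B_n, (εε)^{λ,μ} (v) is sign (φ v) times the sum, over the colorings κ of
-- [n] of content (λ , μ) fixed by φ v, of (-1) to the number of negative v i with κ i < 0.  So it suffices
-- to sum over v for each fixed κ.  If two elements of a color class lie in a common layer, take such a
-- pair i < j with j maximal: the class cannot leave [- j , j], so exchanging i with j in v, on the right or
-- on the left, is a sign-reversing involution.  Otherwise v i = ± i for all i, with v i = - i only for grounded i: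
-- a grounded i of negative color cancels, and one of positive color contributes a factor 2.

open import Defs
open import Data.Bool using (Bool; true; false; _∧_; _∨_; not; if_then_else_; T)
import Data.Bool as Bool
open import Data.Nat as ℕ using (ℕ; zero; suc; _∸_; z≤n; s≤s)
import Data.Nat.Properties as ℕP
open import Data.Nat.Induction using (<-wellFounded)
open import Induction.WellFounded using (Acc; acc)
open import Data.Integer as ℤ using (ℤ; +_; -[1+_]; ∣_∣; -_; _≤_; _<_)
import Data.Integer.Properties as ℤP
open import Data.Fin as Fin using (Fin; toℕ)
import Data.Fin.Properties as FinP
open import Data.List using (List; []; _∷_; _++_; map; concatMap; length; reverse; upTo; take; drop; lookup; replicate; applyUpTo; applyDownFrom; allFin; filter; zipWith)
import Data.List.Properties as LP
open import Data.List.Membership.Propositional using (_∈_)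
import Data.List.Membership.Propositional.Properties as ∈P
open import Data.List.Relation.Unary.All as All using (All; []; _∷_)
import Data.List.Relation.Unary.All.Properties as AllP
open import Data.List.Relation.Unary.Any as Any using (Any; here; there)
import Data.List.Relation.Unary.Any.Properties as AnyP
open import Data.List.Relation.Unary.AllPairs as AllPairs using (AllPairs; []; _∷_)
import Data.List.Relation.Unary.AllPairs.Properties as APP
open import Data.List.Relation.Unary.Unique.Propositional using (Unique)
import Data.List.Relation.Unary.Unique.Propositional.Properties as UP
open import Data.List.Relation.Binary.Permutation.Propositional using (_↭_; ↭-sym; ↭-refl; ↭-trans; prep; swap)
import Data.List.Relation.Binary.Permutation.Propositional as ↭
import Data.List.Relation.Binary.Permutation.Propositional.Properties as ↭P
open import Data.Product using (Σ; ∃; _×_; _,_; proj₁; proj₂)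
open import Data.Sum using (_⊎_; inj₁; inj₂; [_,_]′)
open import Data.Empty using (⊥; ⊥-elim)
open import Function using (_∘_; id; case_of_)
open import Relation.Nullary using (¬_; Dec; yes; no)
open import Relation.Nullary.Decidable using (_×-dec_)
open import Relation.Binary.PropositionalEquality using (_≡_; _≢_; refl; sym; trans; cong; cong₂; subst; subst₂)
open import Relation.Binary.Definitions using (tri<; tri≈; tri>)
open import Data.Nat.Tactic.RingSolver using (solve-∀)
open import Data.Rational as ℚ using (ℚ)
import Data.Rational.Properties as ℚP
import Data.Rational.Unnormalised as ℚᵘ
import Data.Rational.Unnormalised.Properties as ℚᵘP
open import Data.Bool.Properties using (∧-zeroʳ; ∧-identityʳ)
open import Data.Nat.ListAction using (sum)

-- Two facts about single paths carry the argument. First, if a path that started at y and one that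
-- will end at y touch a common layer, then y is on that layer; so paths from i to j and back force
-- a layer through i and j. Second, every path extends to a compatible permutation, which is how the
-- symmetry of `full w` under negation passes to →. The top compatible permutation is `full w`
-- because it is itself the type of a covering family and, lying above `full w` in Bruhat order, has
-- at least as many inversions. In the cancellation the difficulty is to stay inside the interval
-- after exchanging i and j. Maximality of j controls one of the two new paths: a cycle of v in the
-- class that rose above j would have to come back, and its two strands would make j share a layer
-- with a larger member. The other new path comes from a one-sided fact: the first or the last layer
-- on wire i contains j, and this decides on which side to multiply. Colorings of a given content
-- are the cosets of a Young subgroup, which is why induction turns into a sum over them.

<⇒≱ᶻ : ∀ {i j : ℤ} → i < j → j ≤ i → ⊥
<⇒≱ᶻ p q = ℤP.<-irrefl refl (ℤP.<-≤-trans p q)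

-- Layers, paths and the zig-zag conditions.

infix 4 _∈ᴵ_ _∉ᴵ_
_∈ᴵ_ _∉ᴵ_ : ℤ → Interval → Set
x ∈ᴵ I = InIv I x
x ∉ᴵ I = ¬ (x ∈ᴵ I)

lo hi : Interval → ℤ
lo = proj₁
hi = proj₂

_∈ᴵ?_ : (x : ℤ) (I : Interval) → Dec (x ∈ᴵ I)
x ∈ᴵ? (c , d) with x ℤ.≟ + 0 | c ℤ.≤? x | x ℤ.≤? d
... | yes p | _     | _     = no λ q → proj₁ q p
... | no _  | no p  | _     = no λ q → p (proj₁ (proj₂ q))
... | no _  | yes _ | no p  = no λ q → p (proj₂ (proj₂ q))
... | no p  | yes q | yes r = yes (p , q , r)

Lo : Interval → Interval → Set
Lo I J = (lo I < lo J) × (hi I < hi J)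

Comparable : Interval → Interval → Set
Comparable I J = Lo I J ⊎ Lo J I

Monotone : Interval → Interval → Interval → Set
Monotone I J K = (Lo I J × Lo J K) ⊎ (Lo J I × Lo K J)

Tri : Interval → Interval → Interval → Set
Tri I J K = Meets I J → Meets J K → Monotone I J K

-- Non-nesting orders any two layers by both endpoints at once, so the zig-zag condition on left
-- ends becomes `Monotone`. The head is related to everything after it, so that the conditions for
-- the remaining layers are a component.
data ZZ : List Interval → Set where
  []  : ZZ []
  zz  : ∀ {I Is} → All (Comparable I) Is → AllPairs (Tri I) Is → ZZ Is → ZZ (I ∷ Is)

Lo-asym : ∀ {I J} → Lo I J → Lo J I → ⊥
Lo-asym p q = ℤP.<-asym (proj₁ p) (proj₁ q)

-- Edge multiplicities are forgotten. A layer with a single wire has no interior vertex in the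
-- network but is still recorded by `move`, which then leaves the position unchanged.
data Path : List Interval → ℤ → ℤ → Set where
  []   : ∀ {p} → Path [] p p
  move : ∀ {I Is p q r} → p ∈ᴵ I → q ∈ᴵ I → Path Is q r → Path (I ∷ Is) p r
  stay : ∀ {I Is p r} → p ∉ᴵ I → Path Is p r → Path (I ∷ Is) p r

straight : ∀ Is p → Path Is p p
straight []       p = []
straight (I ∷ Is) p with p ∈ᴵ? I
... | yes q = move q q (straight Is p)
... | no q  = stay q (straight Is p)

-- A layer is an interval of integers with 0 removed, so a wire outside it lies on one side of all
-- of its wires.
stays-below : ∀ {I p q p′} → q ∉ᴵ I → q ≢ + 0 → p ∈ᴵ I → p′ ∈ᴵ I → p < q → p′ < q
stays-below {I} {p} {q} {p′} q∉ q≢0 p∈ p′∈ p<q with p′ ℤ.<? q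
... | yes r = r
... | no r  = ⊥-elim (q∉ (q≢0 , ℤP.≤-trans (proj₁ (proj₂ p∈)) (ℤP.<⇒≤ p<q) , ℤP.≤-trans (ℤP.≮⇒≥ r) (proj₂ (proj₂ p′∈))))

stays-above : ∀ {I p q p′} → q ∉ᴵ I → q ≢ + 0 → p ∈ᴵ I → p′ ∈ᴵ I → q < p → q < p′
stays-above {I} {p} {q} {p′} q∉ q≢0 p∈ p′∈ q<p with q ℤ.<? p′
... | yes r = r
... | no r  = ⊥-elim (q∉ (q≢0 , ℤP.≤-trans (proj₁ (proj₂ p′∈)) (ℤP.≮⇒≥ r) , ℤP.≤-trans (ℤP.<⇒≤ q<p) (proj₂ (proj₂ p∈))))

-- Two crossing paths touch a common layer, where their tails can be exchanged.
uncross : ∀ {Is i j x y} → i ≢ + 0 → j ≢ + 0 → i < j → x < y →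
          Path Is i y → Path Is j x → Path Is i x × Path Is j y
uncross _ _ i<j x<y [] [] = ⊥-elim (ℤP.<-asym i<j x<y)
uncross _ _ i<j x<y (move p q P) (move p′ q′ Q) = move p q′ Q , move p′ q P
uncross _ j≢0 i<j x<y (move p q P) (stay p′ Q) =
  let R , S = uncross (proj₁ q) j≢0 (stays-below p′ j≢0 p q i<j) x<y P Q in move p q R , stay p′ S
uncross i≢0 _ i<j x<y (stay p P) (move p′ q′ Q) =
  let R , S = uncross i≢0 (proj₁ q′) (stays-above p i≢0 p′ q′ i<j) x<y P Q in stay p R , move p′ q′ S
uncross i≢0 j≢0 i<j x<y (stay p P) (stay p′ Q) =
  let R , S = uncross i≢0 j≢0 i<j x<y P Q in stay p R , stay p′ S

-- What a path that started at x and is now at p remembers of its last layer A: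
-- the layers it has touched are monotone, so x lies on the side of A from which it came.
Hist : ℤ → ℤ → List Interval → Set
Hist x p Is = (x ≡ p) ⊎ Σ Interval λ A → (p ∈ᴵ A) × AllPairs (Tri A) Is × All (Comparable A) Is
  × All (λ K → Meets A K → (Lo A K → x ≤ hi A) × (Lo K A → lo A ≤ x)) Is

hist-tail : ∀ {x p I Is} → Hist x p (I ∷ Is) → Hist x p Is
hist-tail (inj₁ e) = inj₁ e
hist-tail (inj₂ (A , p∈ , (_ ∷ t) , (_ ∷ c) , (_ ∷ h))) = inj₂ (A , p∈ , t , c , h)

meet : ∀ {x I J} → x ∈ᴵ I → x ∈ᴵ J → Meets I J
meet p q = _ , p , q

-- The past of a path at a touched layer `K`: its origin `x` is on `K`, or it came from a layer `A`
-- on one side. In the second case every later layer meeting `K` lies on the other side, and `x`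
-- does not go beyond the end of `K` on that side.
From : ℤ → Interval → List Interval → Set
From x K Is = (x ∈ᴵ K) ⊎ Σ Interval λ A → ((Lo A K × x ≤ hi K) ⊎ (Lo K A × lo K ≤ x))
  × All (λ B → Meets K B → Monotone A K B) Is

hist-from : ∀ {x p K Is} → Hist x p (K ∷ Is) → p ∈ᴵ K → From x K Is
hist-from (inj₁ refl) p∈ = inj₁ p∈
hist-from (inj₂ (A , p∈A , (t ∷ _) , (c ∷ _) , (h ∷ _))) p∈K = inj₂ (A , side c , All.map (λ f → f m) t)
  where
  m = meet p∈A p∈K
  side : Comparable A _ → _
  side (inj₁ l) = inj₁ (l , ℤP.≤-trans (proj₁ (h m) l) (ℤP.<⇒≤ (proj₂ l)))
  side (inj₂ l) = inj₂ (l , ℤP.≤-trans (ℤP.<⇒≤ (proj₁ l)) (proj₂ (h m) l))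

from-hist : ∀ {x K q Is} → ZZ (K ∷ Is) → From x K Is → q ∈ᴵ K → Hist x q Is
from-hist {x} {K} (zz c t _) F q∈ = inj₂ (K , q∈ , t , c , hs F)
  where
  hs : From x K _ → All (λ B → Meets K B → (Lo K B → x ≤ hi K) × (Lo B K → lo K ≤ x)) _
  hs (inj₁ x∈) = All.map (λ _ _ → (λ _ → proj₂ (proj₂ x∈)) , (λ _ → proj₁ (proj₂ x∈))) c
  hs (inj₂ (A , inj₁ (l , b) , ms)) = All.map (λ f m → (λ _ → b) , λ l′ →
    case f m of λ { (inj₁ (_ , l″)) → ⊥-elim (Lo-asym l′ l″) ; (inj₂ (l″ , _)) → ⊥-elim (Lo-asym l l″) }) ms
  hs (inj₂ (A , inj₂ (l , b) , ms)) = All.map (λ f m → (λ l′ →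
    case f m of λ { (inj₁ (l″ , _)) → ⊥-elim (Lo-asym l l″) ; (inj₂ (_ , l″)) → ⊥-elim (Lo-asym l′ l″) }) , λ _ → b) ms

-- The future of a path at `K`, mirror image of `From`: it ends on `K`, or it goes on through a
-- layer `B` on one side, and its end does not go beyond the end of `K` on the opposite side.
To : ℤ → Interval → List Interval → Set
To y K Is = (y ∈ᴵ K) ⊎ Σ Interval λ B → (B ∈ Is) × Meets K B × ((Lo K B × lo K ≤ y) ⊎ (Lo B K × y ≤ hi K))

to-weaken : ∀ {y K I Is} → To y K Is → To y K (I ∷ Is)
to-weaken (inj₁ e) = inj₁ e
to-weaken (inj₂ (B , B∈ , r)) = inj₂ (B , there B∈ , r)

path-to : ∀ {Is K q y} → ZZ (K ∷ Is) → q ∈ᴵ K → Path Is q y → To y K Is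
path-to z q∈ [] = inj₁ q∈
path-to (zz (_ ∷ c) (_ ∷ t) (zz _ _ z)) q∈ (stay p P) = to-weaken (path-to (zz c t z) q∈ P)
path-to {I ∷ Is} {K} {q} {y} (zz (cI ∷ c) (t ∷ _) z) q∈ (move p q′ P) =
  inj₂ (I , here refl , meet q∈ p , side cI (path-to z q′ P))
  where
  side : Comparable K I → To y I Is → (Lo K I × lo K ≤ y) ⊎ (Lo I K × y ≤ hi K)
  side (inj₁ l) (inj₁ y∈) = inj₁ (l , ℤP.≤-trans (ℤP.<⇒≤ (proj₁ l)) (proj₁ (proj₂ y∈)))
  side (inj₂ l) (inj₁ y∈) = inj₂ (l , ℤP.≤-trans (proj₂ (proj₂ y∈)) (ℤP.<⇒≤ (proj₂ l)))
  side (inj₁ l) (inj₂ (B , B∈ , m , inj₁ (l′ , b))) = inj₁ (l , ℤP.≤-trans (ℤP.<⇒≤ (proj₁ l)) b)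
  side (inj₂ l) (inj₂ (B , B∈ , m , inj₂ (l′ , b))) = inj₂ (l , ℤP.≤-trans b (ℤP.<⇒≤ (proj₂ l)))
  side (inj₁ l) (inj₂ (B , B∈ , m , inj₂ (l′ , b))) =
    case All.lookup t B∈ (meet q∈ p) m of λ { (inj₁ (_ , l″)) → ⊥-elim (Lo-asym l′ l″) ; (inj₂ (l″ , _)) → ⊥-elim (Lo-asym l l″) }
  side (inj₂ l) (inj₂ (B , B∈ , m , inj₁ (l′ , b))) =
    case All.lookup t B∈ (meet q∈ p) m of λ { (inj₁ (l″ , _)) → ⊥-elim (Lo-asym l l″) ; (inj₂ (_ , l″)) → ⊥-elim (Lo-asym l′ l″) }

-- One path started at `x`, another one, possibly different, will end at `x`, and both touch `K`.
-- Monotonicity makes `A`, `K`, `B` run in one direction, so the bound in `From` and the bound in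
-- `To` concern opposite ends of `K` and enclose `x`.
through : ∀ {x K Is} → x ≢ + 0 → From x K Is → To x K Is → x ∈ᴵ K
through _ (inj₁ e) _ = e
through _ _ (inj₁ e) = e
through x≢0 (inj₂ (A , s , ms)) (inj₂ (B , B∈ , m , s′)) with All.lookup ms B∈ m | s | s′
... | inj₁ (l , l′) | inj₁ (_ , b) | inj₁ (_ , b′) = x≢0 , b′ , b
... | inj₂ (l , l′) | inj₂ (_ , b) | inj₂ (_ , b′) = x≢0 , b , b′
... | inj₁ (l , l′) | inj₂ (k , _) | _             = ⊥-elim (Lo-asym l k)
... | inj₂ (l , l′) | inj₁ (k , _) | _             = ⊥-elim (Lo-asym l k)
... | inj₁ (l , l′) | _            | inj₂ (k , _) = ⊥-elim (Lo-asym l′ k)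
... | inj₂ (l , l′) | _            | inj₁ (k , _) = ⊥-elim (Lo-asym l′ k)

Share : List Interval → ℤ → ℤ → Set
Share Is i j = Any (λ K → (i ∈ᴵ K) × (j ∈ᴵ K)) Is

private
  -- The paths start in one order and end in the opposite one, so they touch a common layer. There
  -- one path has the past of `l` and the other the future of `l`, so `through` puts `l` on the
  -- layer; with the roles of the paths exchanged it does the same for `j`.
  both⇒share′ : ∀ {Is l j p q} → ZZ Is → l ≢ + 0 → j ≢ + 0 → p ≢ + 0 → q ≢ + 0 → l < j → p < q →
                Hist l p Is → Hist j q Is → Path Is p j → Path Is q l → Share Is l j
  both⇒share′ z _ _ _ _ l<j p<q _ _ [] [] = ⊥-elim (ℤP.<-asym l<j p<q)
  both⇒share′ z@(zz _ _ _) l≢0 j≢0 _ _ l<j p<q hl hj (move p p′ P) (move q q′ Q) =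
    here (through l≢0 (hist-from hl p) (path-to z q′ Q) , through j≢0 (hist-from hj q) (path-to z p′ P))
  both⇒share′ z@(zz _ _ z′) l≢0 j≢0 p≢0 q≢0 l<j p<q hl hj (move p p′ P) (stay q Q) =
    there (both⇒share′ z′ l≢0 j≢0 (proj₁ p′) q≢0 l<j (stays-below q q≢0 p p′ p<q) (from-hist z (hist-from hl p) p′) (hist-tail hj) P Q)
  both⇒share′ z@(zz _ _ z′) l≢0 j≢0 p≢0 q≢0 l<j p<q hl hj (stay p P) (move q q′ Q) =
    there (both⇒share′ z′ l≢0 j≢0 p≢0 (proj₁ q′) l<j (stays-above p p≢0 q q′ p<q) (hist-tail hl) (from-hist z (hist-from hj q) q′) P Q)
  both⇒share′ (zz _ _ z′) l≢0 j≢0 p≢0 q≢0 l<j p<q hl hj (stay p P) (stay q Q) =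
    there (both⇒share′ z′ l≢0 j≢0 p≢0 q≢0 l<j p<q (hist-tail hl) (hist-tail hj) P Q)

both⇒share : ∀ {Is l j} → ZZ Is → l ≢ + 0 → j ≢ + 0 → l < j → Path Is l j → Path Is j l → Share Is l j
both⇒share z l≢0 j≢0 l<j P Q = both⇒share′ z l≢0 j≢0 l≢0 j≢0 l<j l<j (inj₁ refl) (inj₁ refl) P Q

share⇒path : ∀ {Is i j} → Share Is i j → Path Is i j
share⇒path {I ∷ Is} (here (p , q)) = move p q (straight Is _)
share⇒path {I ∷ Is} {i} (there s) with i ∈ᴵ? I
... | yes p = move p p (share⇒path s)
... | no p  = stay p (share⇒path s)

share-sym : ∀ {Is i j} → Share Is i j → Share Is j i
share-sym = Any.map (λ (p , q) → q , p)

-- Given a layer K through both i < j, the first or the last layer on wire i contains j as well;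
-- then j can join the paths out of i, or follow the paths into i.
data OneSided (Is : List Interval) (i j : ℤ) : Set where
  rows : (∀ x → Path Is i x → Path Is j x) → OneSided Is i j
  cols : (∀ x → Path Is x i → Path Is x j) → OneSided Is i j

private
  path-avoid : ∀ {Is p i} → All (i ∉ᴵ_) Is → Path Is p i → p ≡ i
  path-avoid _ [] = refl
  path-avoid (_ ∷ a) (stay _ P) = path-avoid a P
  path-avoid (n ∷ a) (move _ q P) with path-avoid a P
  ... | refl = ⊥-elim (n q)

  -- The last layer on wire `i` contains `j` too. A path that ends at `i` must leave this layer at
  -- `i`, since no later layer contains `i`; it may leave at `j` instead and then go straight.
  cols-of-last : ∀ {Is i j} → AllPairs (λ K L → (i ∈ᴵ K) × (j ∈ᴵ K) → i ∈ᴵ L → j ∈ᴵ L) Is →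
                 Share Is i j → ∀ x → Path Is x i → Path Is x j
  cols-of-last (_ ∷ c) (there s) x (move p q P) = move p q (cols-of-last c s _ P)
  cols-of-last (_ ∷ c) (there s) x (stay p P)   = stay p (cols-of-last c s _ P)
  cols-of-last {K ∷ Is} {i} {j} (h ∷ c) (here ij) x P with Any.any? (i ∈ᴵ?_) Is
  cols-of-last {K ∷ Is} {i} {j} (h ∷ c) (here ij) x P | yes a = lift P
    where
    again : ∀ {Is} → All (λ L → (i ∈ᴵ K) × (j ∈ᴵ K) → i ∈ᴵ L → j ∈ᴵ L) Is → Any (i ∈ᴵ_) Is → Share Is i j
    again (f ∷ _) (here p)  = here (p , f ij p)
    again (_ ∷ f) (there p) = there (again f p)
    lift : Path (K ∷ Is) x i → Path (K ∷ Is) x j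
    lift (move p q P) = move p q (cols-of-last c (again h a) _ P)
    lift (stay p P)   = stay p (cols-of-last c (again h a) _ P)
  cols-of-last {K ∷ Is} {i} {j} (h ∷ c) (here (p , q)) x (move p′ q′ P) | no a = move p′ q (straight Is j)
  cols-of-last {K ∷ Is} {i} {j} (h ∷ c) (here (p , q)) x (stay p′ P) | no a
    with path-avoid (AllP.¬Any⇒All¬ Is a) P
  ... | refl = ⊥-elim (p′ p)

-- If the first layer `I` on wire `i` contains `j`, then `j` can go straight to `I` and enter it
-- together with `i`. If not, the shared layer reaches higher than `I`; by monotonicity every later
-- layer on wire `i` reaches higher still and contains `j`.
one-sided : ∀ {Is i j} → ZZ Is → i < j → Share Is i j → OneSided Is i j
one-sided {I ∷ Is} {i} {j} (zz _ t z) i<j s with i ∈ᴵ? I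
one-sided {I ∷ Is} {i} {j} (zz _ t z) i<j s | yes i∈ with j ∈ᴵ? I
... | yes j∈ = rows λ { x (move _ q P) → move j∈ q P ; x (stay n _) → ⊥-elim (n i∈) }
one-sided {I ∷ Is} {i} {j} (zz _ t z) i<j (here (_ , j∈)) | yes i∈ | no j∉ = ⊥-elim (j∉ j∈)
one-sided {I ∷ Is} {i} {j} (zz _ t z) i<j (there s) | yes i∈ | no j∉ =
  cols λ { x (move p q P) → move p q (tl _ P) ; x (stay p P) → stay p (tl _ P) }
  where
  tl = cols-of-last (AllPairs.map (λ {K} {L} tr (iK , jK) iL → case tr (meet i∈ iK) (meet iK iL) of λ
        { (inj₁ (_ , l)) → proj₁ jK , ℤP.≤-trans (proj₁ (proj₂ iL)) (ℤP.<⇒≤ i<j) , ℤP.≤-trans (proj₂ (proj₂ jK)) (ℤP.<⇒≤ (proj₂ l))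
        ; (inj₂ (l , _)) → ⊥-elim (j∉ (proj₁ jK , ℤP.≤-trans (proj₁ (proj₂ i∈)) (ℤP.<⇒≤ i<j) , ℤP.≤-trans (proj₂ (proj₂ jK)) (ℤP.<⇒≤ (proj₂ l)))) }) t) s
one-sided {I ∷ Is} {i} {j} (zz _ t z) i<j (here (i∈ , _)) | no i∉ = ⊥-elim (i∉ i∈)
one-sided {I ∷ Is} {i} {j} (zz _ t z) i<j (there s) | no i∉ with one-sided z i<j s
... | cols f = cols λ { x (move p q P) → move p q (f _ P) ; x (stay p P) → stay p (f _ P) }
... | rows f = rows λ { x (move p _ _) → ⊥-elim (i∉ p) ; x (stay _ P) → lift (f _ P) }
  where
  lift : ∀ {x} → Path Is j x → Path (I ∷ Is) j x
  lift P with j ∈ᴵ? I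
  ... | yes q = move q q P
  ... | no q  = stay q P

-- The path need not be on wire `i`; it only touches the same layers, and so visits the same
-- interior vertices.
data Follows (i : ℤ) : ∀ {Is p r} → Path Is p r → Set where
  []   : ∀ {p} → Follows i {r = p} []
  move : ∀ {I Is p q r} {a : p ∈ᴵ I} {b : q ∈ᴵ I} {P : Path Is q r} → i ∈ᴵ I → Follows i P → Follows i (move a b P)
  stay : ∀ {I Is p r} {a : p ∉ᴵ I} {P : Path Is p r} → i ∉ᴵ I → Follows i P → Follows i (stay a P)

private
  next-layer : ∀ {Is i p} {P : Path Is p i} → Follows i P → (p ≡ i) ⊎ Σ Interval λ B → (B ∈ Is) × (p ∈ᴵ B) × (i ∈ᴵ B)
  next-layer [] = inj₁ refl
  next-layer (move {a = a} q _) = inj₂ (_ , here refl , a , q)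
  next-layer (stay _ F) with next-layer F
  ... | inj₁ e = inj₁ e
  ... | inj₂ (B , B∈ , r) = inj₂ (B , there B∈ , r)

  -- A touched layer contains `i` by `through`. Conversely, let the path pass a layer `I` of wire
  -- `i` untouched, at a position `p` other than `i`. The layers `A` and `B` touched before and
  -- after contain both `i` and `p`; as `I` lies between them by monotonicity, it contains `p`, a
  -- contradiction.
  closed-follows′ : ∀ {Is i p} → ZZ Is → i ≢ + 0 → Hist i p Is →
    (i ≡ p) ⊎ (Σ Interval λ A → (p ∈ᴵ A) × (i ∈ᴵ A) × AllPairs (Tri A) Is) → (P : Path Is p i) → Follows i P
  closed-follows′ z i≢0 h g [] = []
  closed-follows′ z@(zz _ t z′) i≢0 h g (move p q P) = move i∈ (closed-follows′ z′ i≢0 (from-hist z (hist-from h p) q) (inj₂ (_ , q , i∈ , t)) P)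
    where i∈ = through i≢0 (hist-from h p) (path-to z q P)
  closed-follows′ {I ∷ Is} {i} {p} (zz _ _ z′) i≢0 h g (stay n P) = stay (i∉ g) F
    where
    tl : (i ≡ p) ⊎ (Σ Interval λ A → (p ∈ᴵ A) × (i ∈ᴵ A) × AllPairs (Tri A) (I ∷ Is)) → _
    tl (inj₁ e) = inj₁ e
    tl (inj₂ (A , a , b , (_ ∷ c))) = inj₂ (A , a , b , c)
    F = closed-follows′ z′ i≢0 (hist-tail h) (tl g) P
    i∉ : (i ≡ p) ⊎ (Σ Interval λ A → (p ∈ᴵ A) × (i ∈ᴵ A) × AllPairs (Tri A) (I ∷ Is)) → i ∉ᴵ I
    i∉ (inj₁ refl) i∈ = n i∈
    i∉ (inj₂ (A , p∈A , i∈A , (t ∷ _))) i∈ with next-layer F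
    ... | inj₁ refl = n i∈
    ... | inj₂ (B , B∈ , p∈B , i∈B) with All.lookup t B∈ (meet i∈A i∈) (meet i∈ i∈B)
    ... | inj₁ (l , l′) = n (proj₁ p∈A , ℤP.≤-trans (ℤP.<⇒≤ (proj₁ l′)) (proj₁ (proj₂ p∈B)) , ℤP.≤-trans (proj₂ (proj₂ p∈A)) (ℤP.<⇒≤ (proj₂ l)))
    ... | inj₂ (l , l′) = n (proj₁ p∈A , ℤP.≤-trans (ℤP.<⇒≤ (proj₁ l)) (proj₁ (proj₂ p∈A)) , ℤP.≤-trans (proj₂ (proj₂ p∈B)) (ℤP.<⇒≤ (proj₂ l′)))

closed-follows : ∀ {Is i} → ZZ Is → i ≢ + 0 → (P : Path Is i i) → Follows i P
closed-follows z i≢0 = closed-follows′ z i≢0 (inj₁ refl) (inj₁ refl)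

-- Rerouting after the first layer.

Sep : ℤ → Interval → Set
Sep e T = (hi T ≤ e) ⊎ (e < lo T)

-- Here `e` marks the gap just above the wire `e`; no layer lies astride it, so no path crosses it.
path-sep : ∀ {Is p y e} → All (Sep e) Is → e < p → Path Is p y → e < y
path-sep _ e<p [] = e<p
path-sep (_ ∷ s) e<p (stay _ P) = path-sep s e<p P
path-sep (inj₁ h ∷ s) e<p (move p q P) = ⊥-elim (<⇒≱ᶻ e<p (ℤP.≤-trans (proj₂ (proj₂ p)) h))
path-sep (inj₂ h ∷ s) e<p (move p q P) = path-sep s (ℤP.<-≤-trans h (proj₁ (proj₂ q))) P

private
  path-via : ∀ pre {K post p q y} → All (p ∉ᴵ_) pre → All (q ∉ᴵ_) pre → p ∈ᴵ K → q ∈ᴵ K →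
             Path (pre ++ K ∷ post) p y → Path (pre ++ K ∷ post) q y
  path-via [] _ _ p∈ q∈ (move _ r P) = move q∈ r P
  path-via [] _ _ p∈ q∈ (stay n _)   = ⊥-elim (n p∈)
  path-via (I ∷ pre) (n ∷ _) _ p∈ q∈ (move p _ _) = ⊥-elim (n p)
  path-via (I ∷ pre) (_ ∷ a) (m ∷ b) p∈ q∈ (stay _ P) = stay m (path-via pre a b p∈ q∈ P)

first-layer : ∀ q Is → All (q ∉ᴵ_) Is ⊎
  Σ (List Interval) λ pre → Σ Interval λ K → Σ (List Interval) λ post → (Is ≡ pre ++ K ∷ post) × All (q ∉ᴵ_) pre × (q ∈ᴵ K)
first-layer q [] = inj₁ []
first-layer q (I ∷ Is) with q ∈ᴵ? I
... | yes q∈ = inj₂ ([] , I , Is , refl , [] , q∈)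
... | no q∉ with first-layer q Is
... | inj₁ a = inj₁ (q∉ ∷ a)
... | inj₂ (pre , K , post , refl , a , q∈) = inj₂ (I ∷ pre , K , post , refl , q∉ ∷ a , q∈)

private
  AllPairs-split : ∀ {A : Set} {R : A → A → Set} xs {y ys} → AllPairs R (xs ++ y ∷ ys) → All (λ x → R x y) xs × All (R y) ys
  AllPairs-split [] (h ∷ _) = [] , h
  AllPairs-split (x ∷ xs) (h ∷ t) = let a , b = AllPairs-split xs t in (All.lookup h (∈-mid xs) ∷ a) , b
    where
    ∈-mid : ∀ {A : Set} (xs : List A) {y ys} → y ∈ xs ++ y ∷ ys
    ∈-mid [] = here refl
    ∈-mid (_ ∷ xs) = there (∈-mid xs)

  All-mid : ∀ {A : Set} {P : A → Set} {xs} {y : A} {ys} → All P xs → P y → All P ys → All P (xs ++ y ∷ ys)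
  All-mid [] p b = p ∷ b
  All-mid (x ∷ a) p b = x ∷ All-mid a p b

-- K is the first layer after I on wire q, and it leaves I downwards.
module Exit {I : Interval} {pre : List Interval} {K : Interval} {post : List Interval} {q : ℤ} (t : AllPairs (Tri I) (pre ++ K ∷ post)) (q∈I : q ∈ᴵ I) (q∈K : q ∈ᴵ K)
            (q∉ : All (q ∉ᴵ_) pre) (l : Lo K I) (hi≢0 : hi K ≢ + 0) where

  hi∈I : hi K ∈ᴵ I
  hi∈I = hi≢0 , ℤP.≤-trans (proj₁ (proj₂ q∈I)) (proj₂ (proj₂ q∈K)) , ℤP.<⇒≤ (proj₂ l)

  private
    lo≤hi : ∀ {x T} → x ∈ᴵ T → lo T ≤ hi T
    lo≤hi r = ℤP.≤-trans (proj₁ (proj₂ r)) (proj₂ (proj₂ r))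
    hi∈K : hi K ∈ᴵ K
    hi∈K = hi≢0 , lo≤hi q∈K , ℤP.≤-refl
    before-after = AllPairs-split pre t

    -- Monotonicity through the common wire `x` puts `T` between `K` and `I`; then `T` encloses `q`,
    -- which lies in both. This contradicts the choice of `K` as the first layer on wire `q`.
    up-to-hi : ∀ {T x} → x ∈ᴵ T → x ∈ᴵ I → x ∈ᴵ K → Tri I T K → q ∉ᴵ T → ⊥
    up-to-hi xT xI xK tr n with tr (meet xI xT) (meet xT xK)
    ... | inj₁ (a , b) = ℤP.<-asym (proj₁ l) (ℤP.<-trans (proj₁ a) (proj₁ b))
    ... | inj₂ (a , b) = n (proj₁ q∈I , ℤP.≤-trans (ℤP.<⇒≤ (proj₁ a)) (proj₁ (proj₂ q∈I)) , ℤP.≤-trans (proj₂ (proj₂ q∈K)) (ℤP.<⇒≤ (proj₂ b)))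

    sep : ∀ {T} → (lo T ≤ hi K → hi K < hi T → ⊥) → Sep (hi K) T
    sep {T} f with hi T ℤ.≤? hi K | hi K ℤ.<? lo T
    ... | yes a | _     = inj₁ a
    ... | no _  | yes b = inj₂ b
    ... | no a  | no b  = ⊥-elim (f (ℤP.≮⇒≥ b) (ℤP.≰⇒> a))

  -- A layer astride the gap above `hi K` contains the wire `hi K`. Before `K` this is excluded by
  -- `up-to-hi`; after `K` the layer would have to lie below `K`, since `K` lies below `I`.
  all-sep : All (Sep (hi K)) (pre ++ K ∷ post)
  all-sep = All-mid
    (All.zipWith (λ (tr , n) → sep λ a b → up-to-hi (hi≢0 , a , ℤP.<⇒≤ b) hi∈I hi∈K tr n) (proj₁ before-after , q∉))
    (inj₁ ℤP.≤-refl)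
    (All.map (λ tr → sep λ a b → case tr (meet q∈I q∈K) (meet hi∈K (hi≢0 , a , ℤP.<⇒≤ b)) of λ
       { (inj₁ (c , _)) → Lo-asym l c ; (inj₂ (_ , c)) → ℤP.<-asym b (proj₂ c) }) (proj₂ before-after))

  -- A path ending at or below `hi K` also starts there, by `all-sep`. So `q₀` is on `K` and, like
  -- `q`, on no layer before it; at `K` one may replace the other.
  reroute : ∀ {q₀ y} → q₀ ∈ᴵ I → y ≤ hi K → Path (pre ++ K ∷ post) q₀ y → Path (pre ++ K ∷ post) q y
  reroute {q₀} q₀∈ y≤ P = path-via pre (All.zipWith (λ (tr , n) q₀∈T → up-to-hi q₀∈T q₀∈ q₀∈K tr n) (proj₁ before-after , q∉)) q∉ q₀∈K q∈K P
    where
    q₀≤ : q₀ ≤ hi K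
    q₀≤ with hi K ℤ.<? q₀
    ... | yes h = ⊥-elim (<⇒≱ᶻ (path-sep all-sep h P) y≤)
    ... | no h  = ℤP.≮⇒≥ h
    q₀∈K : q₀ ∈ᴵ K
    q₀∈K = proj₁ q₀∈ , ℤP.≤-trans (ℤP.<⇒≤ (proj₁ l)) (proj₁ (proj₂ q₀∈)) , q₀≤

-- Inversions and transpositions.

ltZ-true : ∀ {x y} → x < y → ltZ x y ≡ true
ltZ-true {x} {y} p with y ℤ.≤ᵇ x in e
... | false = refl
... | true  = ⊥-elim (<⇒≱ᶻ p (ℤP.≤ᵇ⇒≤ (subst T (sym e) _)))

ltZ-false : ∀ {x y} → y ≤ x → ltZ x y ≡ false
ltZ-false {x} {y} p with y ℤ.≤ᵇ x in e
... | true  = refl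
... | false = ⊥-elim (subst T e (ℤP.≤⇒≤ᵇ p))

module _ {A : Set} where
  countB-++ : ∀ (p : A → Bool) xs ys → countB p (xs ++ ys) ≡ countB p xs ℕ.+ countB p ys
  countB-++ p []       ys = refl
  countB-++ p (x ∷ xs) ys with p x
  ... | true  = cong suc (countB-++ p xs ys)
  ... | false = countB-++ p xs ys

  countB-↭ : ∀ (p : A → Bool) {xs ys} → xs ↭ ys → countB p xs ≡ countB p ys
  countB-↭ p ↭.refl = refl
  countB-↭ p (prep x r) with p x
  ... | true  = cong suc (countB-↭ p r)
  ... | false = countB-↭ p r
  countB-↭ p (swap x y r) with p x | p y
  ... | true  | true  = cong (suc ∘ suc) (countB-↭ p r)
  ... | true  | false = cong suc (countB-↭ p r)
  ... | false | true  = cong suc (countB-↭ p r)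
  ... | false | false = countB-↭ p r
  countB-↭ p (↭.trans r s) = trans (countB-↭ p r) (countB-↭ p s)

below above : ℤ → List ℤ → ℕ
below x = countB (λ y → ltZ y x)
above x = countB (λ y → ltZ x y)

inv-insert : ∀ B z C → invZ (B ++ z ∷ C) ≡ invZ (B ++ C) ℕ.+ above z B ℕ.+ below z C
inv-insert [] z C = trans (ℕP.+-comm (below z C) (invZ C)) (cong (ℕ._+ below z C) (sym (ℕP.+-identityʳ _)))
inv-insert (b ∷ B) z C rewrite inv-insert B z C
  | countB-++ (λ y → ltZ y b) B (z ∷ C) | countB-++ (λ y → ltZ y b) B C with ltZ z b
... | true  = lemma (below b B) (below b C) (invZ (B ++ C)) (above z B) (below z C)
  where
  lemma : ∀ a b c d e → a ℕ.+ suc b ℕ.+ (c ℕ.+ d ℕ.+ e) ≡ a ℕ.+ b ℕ.+ c ℕ.+ suc d ℕ.+ e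
  lemma = solve-∀
... | false = lemma (below b B) (below b C) (invZ (B ++ C)) (above z B) (below z C)
  where
  lemma : ∀ a b c d e → a ℕ.+ b ℕ.+ (c ℕ.+ d ℕ.+ e) ≡ a ℕ.+ b ℕ.+ c ℕ.+ d ℕ.+ e
  lemma = solve-∀

inv-prefix : ∀ A {L L′ k} → L ↭ L′ → invZ L′ ≡ invZ L ℕ.+ k → invZ (A ++ L′) ≡ invZ (A ++ L) ℕ.+ k
inv-prefix [] r e = e
inv-prefix (a ∷ A) {L} {L′} {k} r e
  rewrite inv-prefix A r e | countB-↭ (λ y → ltZ y a) (↭P.++⁺ˡ A r) = sym (ℕP.+-assoc (below a (A ++ L′)) (invZ (A ++ L)) k)

private
  swap-↭ : ∀ (p q : ℤ) B C → p ∷ B ++ q ∷ C ↭ q ∷ B ++ p ∷ C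
  swap-↭ p q B C = ↭-trans (prep p (↭P.shift q B C)) (↭-trans (swap p q ↭-refl) (prep q (↭-sym (↭P.shift p B C))))

  -- `m` is the number of entries of `B` whose value lies between `p` and `q`.
  window : ∀ {p q} B → p < q → All (_≢ p) B → All (_≢ q) B →
           ∃ λ m → (below q B ≡ below p B ℕ.+ m) × (above p B ≡ above q B ℕ.+ m)
  window [] _ _ _ = 0 , refl , refl
  window {p} {q} (b ∷ B) p<q (b≢p ∷ np) (b≢q ∷ nq) with window B p<q np nq | ℤP.<-cmp b p | ℤP.<-cmp b q
  ... | m , e , e′ | tri< b<p _ _ | tri< b<q _ _
    rewrite ltZ-true b<p | ltZ-true b<q | ltZ-false (ℤP.<⇒≤ b<p) | ltZ-false (ℤP.<⇒≤ b<q) = m , cong suc e , e′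
  ... | _ | tri< b<p _ _ | tri≈ _ r _ = ⊥-elim (b≢q r)
  ... | _ | tri< b<p _ _ | tri> _ _ r = ⊥-elim (ℤP.<-asym (ℤP.<-trans b<p p<q) r)
  ... | _ | tri≈ _ r _ | _ = ⊥-elim (b≢p r)
  ... | m , e , e′ | tri> _ _ p<b | tri< b<q _ _
    rewrite ltZ-false (ℤP.<⇒≤ p<b) | ltZ-true b<q | ltZ-true p<b | ltZ-false (ℤP.<⇒≤ b<q) =
      suc m , trans (cong suc e) (sym (ℕP.+-suc _ _)) , trans (cong suc e′) (sym (ℕP.+-suc _ _))
  ... | _ | tri> _ _ p<b | tri≈ _ r _ = ⊥-elim (b≢q r)
  ... | m , e , e′ | tri> _ _ p<b | tri> _ _ q<b
    rewrite ltZ-false (ℤP.<⇒≤ p<b) | ltZ-false (ℤP.<⇒≤ q<b) | ltZ-true p<b | ltZ-true q<b = m , e , cong suc e′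

-- Each of the `m` entries of `B` with value between `p` and `q` adds two inversions, and the pair
-- itself adds one. That the increase is positive serves the Bruhat order; that it is odd serves the
-- sign.
inv-swap : ∀ {p q} A B C → p < q → All (_≢ p) B → All (_≢ q) B →
           ∃ λ m → invZ (A ++ q ∷ B ++ p ∷ C) ≡ invZ (A ++ p ∷ B ++ q ∷ C) ℕ.+ suc (m ℕ.+ m)
inv-swap {p} {q} A B C p<q np nq with window B p<q np nq
... | m , e , e′ = m , inv-prefix A (swap-↭ p q B C) eq
  where
  lemma : ∀ a m c d i g → a ℕ.+ m ℕ.+ suc d ℕ.+ (i ℕ.+ (g ℕ.+ m) ℕ.+ c) ≡ a ℕ.+ c ℕ.+ (i ℕ.+ g ℕ.+ d) ℕ.+ suc (m ℕ.+ m)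
  lemma = solve-∀
  eq : invZ (q ∷ B ++ p ∷ C) ≡ invZ (p ∷ B ++ q ∷ C) ℕ.+ suc (m ℕ.+ m)
  eq rewrite inv-insert B p C | inv-insert B q C
     | countB-++ (λ y → ltZ y q) B (p ∷ C) | countB-++ (λ y → ltZ y p) B (q ∷ C)
     | ltZ-true p<q | ltZ-false (ℤP.<⇒≤ p<q) | e | e′ = lemma (below p B) m (below p C) (below q C) (invZ (B ++ C)) (above q B)

-- Permutations of the wires.

Wire : ℕ → ℤ → Set
Wire n z = z ∈ᴵ (- (+ n) , + n)

Wire-neg : ∀ {n z} → Wire n z → Wire n (- z)
Wire-neg {n} {z} (a , b , c) = (λ e → a (trans (sym (ℤP.neg-involutive z)) (cong -_ e))) , ℤP.neg-mono-≤ c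
  , subst (- z ≤_) (ℤP.neg-involutive (+ n)) (ℤP.neg-mono-≤ b)

≢-neg : ∀ {z} → z ≢ + 0 → z ≢ - z
≢-neg {+ zero} a _ = a refl
≢-neg {+ suc _} a ()
≢-neg { -[1+ _ ]} a ()

swp : ℤ → ℤ → ℤ → ℤ
swp a b z with z ℤ.≟ a | z ℤ.≟ b
... | yes _ | _     = b
... | no _  | yes _ = a
... | no _  | no _  = z

swp-l : ∀ a b → swp a b a ≡ b
swp-l a b with a ℤ.≟ a | a ℤ.≟ b
... | yes _ | _ = refl
... | no n  | _ = ⊥-elim (n refl)

swp-r : ∀ a b → swp a b b ≡ a
swp-r a b with b ℤ.≟ a | b ℤ.≟ b
... | yes e | _     = e
... | no _  | yes _ = refl
... | no _  | no n  = ⊥-elim (n refl)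

swp-o : ∀ {a b z} → z ≢ a → z ≢ b → swp a b z ≡ z
swp-o {a} {b} {z} p q with z ℤ.≟ a | z ℤ.≟ b
... | yes e | _     = ⊥-elim (p e)
... | no _  | yes e = ⊥-elim (q e)
... | no _  | no _  = refl

data SwpView (a b z : ℤ) : Set where
  isˡ : z ≡ a → swp a b z ≡ b → SwpView a b z
  isʳ : z ≡ b → swp a b z ≡ a → SwpView a b z
  isᵒ : z ≢ a → z ≢ b → swp a b z ≡ z → SwpView a b z

swpView : ∀ a b z → SwpView a b z
swpView a b z with z ℤ.≟ a
... | yes refl = isˡ refl (swp-l a b)
... | no p with z ℤ.≟ b
... | yes refl = isʳ refl (swp-r a b)
... | no q = isᵒ p q (swp-o p q)

swp-inv : ∀ a b z → swp a b (swp a b z) ≡ z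
swp-inv a b z with swpView a b z
... | isˡ refl e   = trans (cong (swp a b) e) (swp-r a b)
... | isʳ refl e   = trans (cong (swp a b) e) (swp-l a b)
... | isᵒ p q e    = trans (cong (swp a b) e) e

swp-closed : ∀ {P : ℤ → Set} {a b z} → P a → P b → P z → P (swp a b z)
swp-closed {P} {a} {b} {z} pa pb pz with swpView a b z
... | isˡ _ e   = subst P (sym e) pb
... | isʳ _ e   = subst P (sym e) pa
... | isᵒ _ _ e = subst P (sym e) pz

swp-conj : ∀ (h : ℤ → ℤ) (P : ℤ → Set) → (∀ {x y} → P x → P y → h x ≡ h y → x ≡ y) → ∀ {a b z} → P a → P b → P z →
           h (swp a b z) ≡ swp (h a) (h b) (h z)
swp-conj h P inj {a} {b} {z} pa pb pz with swpView a b z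
... | isˡ refl e = trans (cong h e) (sym (swp-l (h a) (h b)))
... | isʳ refl e = trans (cong h e) (sym (swp-r (h a) (h b)))
... | isᵒ p q e  = trans (cong h e) (sym (swp-o (λ r → p (inj pz pa r)) (λ r → q (inj pz pb r))))

-- A permutation is a function on all integers that matters on the wires only. Injectivity is enough
-- because the wires are finite; `surj` recovers preimages from orbits.
record Perm (n : ℕ) (f : ℤ → ℤ) : Set where
  field
    wire : ∀ {p} → Wire n p → Wire n (f p)
    inj  : ∀ {p q} → Wire n p → Wire n q → f p ≡ f q → p ≡ q
open Perm

swp-perm : ∀ {n a b} → Wire n a → Wire n b → Perm n (swp a b)
swp-perm {n} {a} {b} wa wb = record
  { wire = swp-closed {Wire n} wa wb
  ; inj = λ {p} {q} _ _ e → trans (sym (swp-inv a b p)) (trans (cong (swp a b) e) (swp-inv a b q)) }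

∘-perm : ∀ {n f g} → Perm n f → Perm n g → Perm n (f ∘ g)
∘-perm F G = record { wire = wire F ∘ wire G ; inj = λ p q e → inj G p q (inj F (wire G p) (wire G q) e) }

-- The list of wires.

AllPairs-reverse : ∀ {A : Set} {R : A → A → Set} {xs} → AllPairs R xs → AllPairs (λ x y → R y x) (reverse xs)
AllPairs-reverse [] = []
AllPairs-reverse {R = R} {x ∷ xs} (h ∷ t) rewrite LP.unfold-reverse x xs =
  APP.++⁺ (AllPairs-reverse t) ([] ∷ []) (All.map (λ r → r ∷ []) (↭P.All-resp-↭ (↭-sym (↭P.↭-reverse xs)) h))

∈-posZ : ∀ {n z} → + 0 < z → z ≤ + n → z ∈ posZ n
∈-posZ {n} {+ suc k} _ (ℤ.+≤+ (s≤s q)) = ∈P.∈-map⁺ +_ (∈P.∈-map⁺ suc (∈P.∈-upTo⁺ (s≤s q)))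
∈-posZ {n} {+ zero} p _ = ⊥-elim (ℤP.<-irrefl refl p)

∈-posZ⁻ : ∀ {n z} → z ∈ posZ n → (+ 0 < z) × (z ≤ + n)
∈-posZ⁻ m with ∈P.∈-map⁻ +_ m
... | _ , m′ , refl with ∈P.∈-map⁻ suc m′
... | k , m″ , refl = ℤ.+<+ (s≤s z≤n) , ℤ.+≤+ (∈P.∈-upTo⁻ m″)

posZ-wire : ∀ {n z} → z ∈ posZ n → Wire n z
posZ-wire {n} m = let a , b = ∈-posZ⁻ m in (λ e → ℤP.<-irrefl (sym e) a) , ℤP.≤-trans (ℤP.neg-≤-pos {n} {0}) (ℤP.<⇒≤ a) , b

posZ-sorted : ∀ n → AllPairs _<_ (posZ n)
posZ-sorted n = APP.map⁺ (APP.map⁺ (APP.applyUpTo⁺₁ id n (λ i<j _ → ℤ.+<+ (s≤s i<j))))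

∈-wiresZ : ∀ {n z} → Wire n z → z ∈ wiresZ n
∈-wiresZ {n} {z} w@(a , b , c) with ℤP.<-cmp z (+ 0)
... | tri≈ _ e _ = ⊥-elim (a e)
... | tri> _ _ p = ∈P.∈-++⁺ʳ _ (∈-posZ p c)
... | tri< p _ _ = ∈P.∈-++⁺ˡ (↭P.∈-resp-↭ (↭-sym (↭P.↭-reverse _))
      (subst (_∈ map -_ (posZ n)) (ℤP.neg-involutive z) (∈P.∈-map⁺ -_ (∈-posZ (ℤP.neg-mono-< p) (proj₂ (proj₂ (Wire-neg w)))))))

∈-wiresZ⁻ : ∀ {n z} → z ∈ wiresZ n → Wire n z
∈-wiresZ⁻ {n} {z} m with ∈P.∈-++⁻ (reverse (map -_ (posZ n))) m
... | inj₂ m′ = posZ-wire m′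
... | inj₁ m′ with ∈P.∈-map⁻ -_ (↭P.∈-resp-↭ (↭P.↭-reverse _) m′)
... | x , m″ , refl = Wire-neg (posZ-wire m″)

wiresZ-sorted : ∀ n → AllPairs _<_ (wiresZ n)
wiresZ-sorted n = APP.++⁺ (AllPairs-reverse (APP.map⁺ (AllPairs.map ℤP.neg-mono-< (posZ-sorted n)))) (posZ-sorted n)
  (All.tabulate λ {x} m → All.tabulate λ {y} m′ → case ∈P.∈-map⁻ -_ (↭P.∈-resp-↭ (↭P.↭-reverse (map -_ (posZ n))) m) of λ
    { (z , m″ , refl) → ℤP.<-trans (ℤP.neg-mono-< (proj₁ (∈-posZ⁻ m″))) (proj₁ (∈-posZ⁻ m′)) })

sorted-unique : ∀ {xs} → AllPairs _<_ xs → Unique xs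
sorted-unique = AllPairs.map ℤP.<⇒≢

AllPairs-++ʳ : ∀ {A : Set} {R : A → A → Set} xs {ys} → AllPairs R (xs ++ ys) → AllPairs R ys
AllPairs-++ʳ [] t = t
AllPairs-++ʳ (x ∷ xs) (_ ∷ t) = AllPairs-++ʳ xs t

AllPairs-++-cross : ∀ {A : Set} {R : A → A → Set} xs {ys} → AllPairs R (xs ++ ys) → All (λ x → All (R x) ys) xs
AllPairs-++-cross [] t = []
AllPairs-++-cross (x ∷ xs) (h ∷ t) = AllP.++⁻ʳ xs h ∷ AllPairs-++-cross xs t

split₂ : ∀ {xs a b} → AllPairs _<_ xs → a ∈ xs → b ∈ xs → a < b →
         ∃ λ A → ∃ λ B → ∃ λ C → xs ≡ A ++ a ∷ B ++ b ∷ C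
split₂ {xs} {a} {b} s a∈ b∈ a<b with ∈P.∈-∃++ a∈
... | A , R , refl with ∈P.∈-++⁻ A b∈
... | inj₁ m = ⊥-elim (ℤP.<-asym a<b (All.head (All.lookup (AllPairs-++-cross A s) m)))
... | inj₂ (here refl) = ⊥-elim (ℤP.<-irrefl refl a<b)
... | inj₂ (there m) with ∈P.∈-∃++ m
... | B , C , refl = A , B , C , refl

module _ {A : List ℤ} {a : ℤ} {B : List ℤ} {b : ℤ} {C : List ℤ} (s : AllPairs _<_ (A ++ a ∷ B ++ b ∷ C)) where
  private
    s₁ = AllPairs-++ʳ A s
    cA = AllPairs-++-cross A s
    aS = AllPairs.head s₁
    s₂ = AllPairs.tail s₁
    s₃ = AllPairs-++ʳ B s₂
    cB = AllPairs-++-cross B s₂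
    >≢ : ∀ {x y} → x < y → y ≢ x
    >≢ p e = ℤP.<⇒≢ p (sym e)
  split-B : All (λ x → (x ≢ a) × (x ≢ b)) B
  split-B = All.zipWith (λ (p , q) → >≢ p , ℤP.<⇒≢ (All.head q)) (AllP.++⁻ˡ B aS , cB)
  map-swp : ∀ (f : ℤ → ℤ) → map (f ∘ swp a b) (A ++ a ∷ B ++ b ∷ C) ≡ map f A ++ f b ∷ map f B ++ f a ∷ map f C
  map-swp f = trans (LP.map-++ (f ∘ swp a b) A _) (cong₂ _++_
      (LP.map-cong-local (All.map (λ h → cong f (swp-o (ℤP.<⇒≢ (All.head h)) (ℤP.<⇒≢ (All.lookup h (there (∈P.∈-insert B)))))) cA))
      (cong₂ _∷_ (cong f (swp-l a b)) (trans (LP.map-++ (f ∘ swp a b) B _) (cong₂ _++_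
        (LP.map-cong-local (All.map (λ (p , q) → cong f (swp-o p q)) split-B))
        (cong₂ _∷_ (cong f (swp-r a b))
          (LP.map-cong-local (All.zipWith (λ (p , q) → cong f (swp-o (>≢ q) (>≢ p))) (AllPairs.head s₃ , All.tail (AllP.++⁻ʳ B aS)))))))))

module _ {xs : List ℤ} (s : AllPairs _<_ xs) {f : ℤ → ℤ} (fi : ∀ {p q} → p ∈ xs → q ∈ xs → f p ≡ f q → p ≡ q)
         {a b : ℤ} (a∈ : a ∈ xs) (b∈ : b ∈ xs) (a<b : a < b) where
  inv-map-swp : f a < f b → ∃ λ m → invZ (map (f ∘ swp a b) xs) ≡ invZ (map f xs) ℕ.+ suc (m ℕ.+ m)
  inv-map-swp fa<fb with split₂ s a∈ b∈ a<b
  ... | A , B , C , refl rewrite map-swp {A} {a} {B} {b} {C} s f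
    | LP.map-++ f A (a ∷ B ++ b ∷ C) | LP.map-++ f B (b ∷ C) =
    inv-swap (map f A) (map f B) (map f C) fa<fb
      (AllP.map⁺ (All.tabulate λ m e → proj₁ (All.lookup (split-B {A} s) m) (fi (in-B m) a∈ e)))
      (AllP.map⁺ (All.tabulate λ m e → proj₂ (All.lookup (split-B {A} s) m) (fi (in-B m) b∈ e)))
    where
    in-B : ∀ {x} → x ∈ B → x ∈ A ++ a ∷ B ++ b ∷ C
    in-B m = ∈P.∈-++⁺ʳ A (there (∈P.∈-++⁺ˡ m))

inv-up : ∀ {n f a b} → Perm n f → Wire n a → Wire n b → a < b → f a < f b →
         invZ (map f (wiresZ n)) ℕ.< invZ (map (f ∘ swp a b) (wiresZ n))
inv-up {n} {f} F wa wb a<b r with inv-map-swp (wiresZ-sorted n) {f} (λ p q → inj F (∈-wiresZ⁻ p) (∈-wiresZ⁻ q)) (∈-wiresZ wa) (∈-wiresZ wb) a<b r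
... | m , e = subst (invZ (map f (wiresZ n)) ℕ.<_) (sym e) (ℕP.m<m+n _ (s≤s z≤n))

iter : (ℤ → ℤ) → ℕ → ℤ → ℤ
iter f zero    a = a
iter f (suc k) a = f (iter f k a)

iter-wire : ∀ {n f} → Perm n f → ∀ k {a} → Wire n a → Wire n (iter f k a)
iter-wire F zero w = w
iter-wire F (suc k) w = wire F (iter-wire F k w)

private
  cancel : ∀ {n f} → Perm n f → ∀ i j {a} → Wire n a → iter f i a ≡ iter f (i ℕ.+ j) a → a ≡ iter f j a
  cancel F zero j w e = e
  cancel F (suc i) j w e = cancel F i j w (inj F (iter-wire F i w) (iter-wire F (i ℕ.+ j) w) e)

abstract
  -- Two iterates coincide by the pigeonhole principle, and injectivity cancels the steps that they
  -- have in common.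
  orbit : ∀ {n f a} → Perm n f → Wire n a → ∃ λ m → iter f (suc m) a ≡ a
  orbit {n} {f} {a} F w with FinP.pigeonhole {length (wiresZ n)} ℕP.≤-refl
                               (λ k → Any.index (∈-wiresZ (iter-wire F (toℕ k) w)))
  ... | i , j , i<j , e with ℕP.m≤n⇒∃[o]m+o≡n i<j
  ... | m , r = m , sym (cancel F (toℕ i) (suc m) w
          (trans eq (cong (λ k → iter f k a) (sym (trans (ℕP.+-suc (toℕ i) m) r)))))
    where
    idx : ∀ k → lookup (wiresZ n) (Any.index (∈-wiresZ (iter-wire F k w))) ≡ iter f k a
    idx k = sym (AnyP.lookup-index (∈-wiresZ (iter-wire F k w)))
    eq : iter f (toℕ i) a ≡ iter f (toℕ j) a
    eq = trans (sym (idx (toℕ i))) (trans (cong (lookup (wiresZ n)) e) (idx (toℕ j)))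

  surj : ∀ {n f q} → Perm n f → Wire n q → ∃ λ p → Wire n p × (f p ≡ q)
  surj {f = f} {q} F w = let m , e = orbit F w in iter f m q , iter-wire F m w , e

  -- The orbit is a cycle and returns to `a`, hence to `P`. Going backwards from that return through
  -- members of `P` leads to the step at which `P` was entered, since `f a` is outside.
  cross-back : ∀ {n f a} {P : ℤ → Set} → Perm n f → Wire n a → (∀ z → Dec (P z)) → P a → ¬ P (f a) →
               ∃ λ k → ¬ P (iter f k a) × P (iter f (suc k) a)
  cross-back {n} {f} {a} {P} F w P? pa npfa = let m , e = orbit F w in go m (subst P (sym e) pa)
    where
    go : ∀ m → P (iter f (suc m) a) → ∃ λ k → ¬ P (iter f k a) × P (iter f (suc k) a)
    go zero p = ⊥-elim (npfa p)
    go (suc m) p with P? (iter f (suc m) a)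
    ... | yes q = go m q
    ... | no q  = suc m , q , p

-- If `f q` exceeds `e`, the orbit of `q` leaves the wires up to `e` and later enters them again;
-- the point from which it enters is above `e`, hence above `q`.
pig : ∀ {n f q e} → Perm n f → Wire n q → q ≤ e → ∃ λ p → Wire n p × (q ≤ p) × (f p ≤ e)
pig {n} {f} {q} {e} F w q≤e with f q ℤ.≤? e
... | yes r = q , w , ℤP.≤-refl , r
... | no r with cross-back {P = _≤ e} F w (ℤ._≤? e) q≤e r
... | k , a , b = iter f k q , iter-wire F k w , ℤP.≤-trans q≤e (ℤP.<⇒≤ (ℤP.≰⇒> a)) , b

-- The Bruhat order of the full symmetric group.

module _ (n : ℕ) where
  private W = wiresZ n

  -- Bruhat order as a chain of transpositions of positions, each creating an inversion; a step need
  -- not be a cover.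
  data Le (f g : ℤ → ℤ) : Set where
    done : (∀ p → Wire n p → f p ≡ g p) → Le f g
    up   : ∀ {a b} → Wire n a → Wire n b → a < b → f a < f b → Le (f ∘ swp a b) g → Le f g

  Le-ext : ∀ {f f′ g} → (∀ p → Wire n p → f p ≡ f′ p) → Le f g → Le f′ g
  Le-ext e (done d) = done λ p w → trans (sym (e p w)) (d p w)
  Le-ext e (up wa wb a<b r l) = up wa wb a<b (subst₂ _<_ (e _ wa) (e _ wb) r)
    (Le-ext (λ p w → e _ (swp-closed {Wire n} wa wb w)) l)

  Le-trans : ∀ {f g h} → Le f g → Le g h → Le f h
  Le-trans (done d) m = Le-ext (λ p w → sym (d p w)) m
  Le-trans (up wa wb a<b r l) m = up wa wb a<b r (Le-trans l m)

  Compat : List Interval → (ℤ → ℤ) → Set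
  Compat Is f = ∀ p → Wire n p → Path Is p (f p)

  -- A step of the chain inverts the ends of the paths from `a < b`; undoing it is `uncross`.
  Le-compat : ∀ {Is f g} → Le f g → Compat Is g → Compat Is f
  Le-compat {Is} (done d) c p w = subst (Path Is p) (sym (d p w)) (c p w)
  Le-compat {Is} {f} (up {a} {b} wa wb a<b r l) c p w with Le-compat l c | swpView a b p
  ... | c′ | isᵒ _ _ e = subst (Path Is p ∘ f) e (c′ p w)
  ... | c′ | isˡ refl e = proj₁ (uncross (proj₁ wa) (proj₁ wb) a<b r
          (subst (Path Is a ∘ f) (swp-l a b) (c′ a wa)) (subst (Path Is b ∘ f) (swp-r a b) (c′ b wb)))
  ... | c′ | isʳ refl e = proj₂ (uncross (proj₁ wa) (proj₁ wb) a<b r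
          (subst (Path Is a ∘ f) (swp-l a b) (c′ a wa)) (subst (Path Is b ∘ f) (swp-r a b) (c′ b wb)))

  Le-inv : ∀ {f g} → Perm n f → Le f g → invZ (map f W) ℕ.≤ invZ (map g W)
  Le-inv F (done d) = ℕP.≤-reflexive (cong invZ (LP.map-cong-local (All.tabulate λ m → d _ (∈-wiresZ⁻ m))))
  Le-inv F (up wa wb a<b r l) = ℕP.≤-trans (ℕP.<⇒≤ (inv-up F wa wb a<b r)) (Le-inv (∘-perm F (swp-perm wa wb)) l)

  record Adj (k l : ℤ) : Set where
    constructor adj
    field
      wk   : Wire n k
      wl   : Wire n l
      k<l  : k < l
      none : ∀ z → Wire n z → k < z → z < l → ⊥

  adj-mono : ∀ {k l a b} → Adj k l → Wire n a → Wire n b → a < b → ¬ ((a ≡ k) × (b ≡ l)) → swp k l a < swp k l b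
  adj-mono {k} {l} {a} {b} (adj _ _ k<l nn) wa wb a<b ne with swpView k l a | swpView k l b
  ... | isˡ refl e | isˡ refl e′ = ⊥-elim (ℤP.<-irrefl refl a<b)
  ... | isˡ refl e | isʳ refl e′ = ⊥-elim (ne (refl , refl))
  ... | isʳ refl e | isˡ refl e′ = ⊥-elim (ℤP.<-asym k<l a<b)
  ... | isʳ refl e | isʳ refl e′ = ⊥-elim (ℤP.<-irrefl refl a<b)
  ... | isʳ refl e | isᵒ p q e′ = subst₂ _<_ (sym e) (sym e′) (ℤP.<-trans k<l a<b)
  ... | isᵒ p q e | isˡ refl e′ = subst₂ _<_ (sym e) (sym e′) (ℤP.<-trans a<b k<l)
  ... | isᵒ p q e | isᵒ _ _ e′ = subst₂ _<_ (sym e) (sym e′) a<b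
  ... | isˡ refl e | isᵒ p q e′ with ℤP.<-cmp l b
  ... | tri< x _ _ = subst₂ _<_ (sym e) (sym e′) x
  ... | tri≈ _ x _ = ⊥-elim (q (sym x))
  ... | tri> _ _ x = ⊥-elim (nn b wb a<b x)
  adj-mono {k} {l} {a} {b} (adj _ _ k<l nn) wa wb a<b ne | isᵒ p q e | isʳ refl e′ with ℤP.<-cmp a k
  ... | tri< x _ _ = subst₂ _<_ (sym e) (sym e′) x
  ... | tri≈ _ x _ = ⊥-elim (p x)
  ... | tri> _ _ x = ⊥-elim (nn a wa x a<b)

  -- Conjugating the step by the adjacent transposition gives a transposition of the moved
  -- positions. The only pair of positions whose order this could destroy is (`k`, `l`) itself.
  shift-step : ∀ {k l a b u g} → Adj k l → Wire n a → Wire n b → a < b → u a < u b → ¬ ((a ≡ k) × (b ≡ l)) →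
               Le (u ∘ swp a b ∘ swp k l) g → Le (u ∘ swp k l) g
  shift-step {k} {l} {a} {b} {u} A wa wb a<b r ne L = up (ws wa) (ws wb) (adj-mono A wa wb a<b ne)
    (subst₂ _<_ (cong u (sym (swp-inv k l a))) (cong u (sym (swp-inv k l b))) r)
    (Le-ext (λ p w → cong u (sym (trans (swp-conj (swp k l) (Wire n) (inj (swp-perm (Adj.wk A) (Adj.wl A))) (ws wa) (ws wb) w)
       (cong₂ (λ x y → swp x y (swp k l p)) (swp-inv k l a) (swp-inv k l b))))) L)
    where
    ws : ∀ {z} → Wire n z → Wire n (swp k l z)
    ws = swp-closed {Wire n} (Adj.wk A) (Adj.wl A)

  -- The lifting property of the Bruhat order.
  lift : ∀ {k l u y} → Adj k l → Le u y → Le (u ∘ swp k l) y ⊎ Le (u ∘ swp k l) (y ∘ swp k l)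
  lift A (done d) = inj₂ (done λ p w → d _ (swp-closed {Wire n} (Adj.wk A) (Adj.wl A) w))
  lift {k} {l} {u} {y} A (up {a} {b} wa wb a<b r L) with a ℤ.≟ k | b ℤ.≟ l
  -- The step is the exchange of `k` and `l`, so the rest of the chain is already the first
  -- alternative.
  ... | yes refl | yes refl = inj₁ L
  ... | yes _ | no q = [ inj₁ ∘ shift-step A wa wb a<b r (q ∘ proj₂) , inj₂ ∘ shift-step A wa wb a<b r (q ∘ proj₂) ]′ (lift A L)
  ... | no q | _     = [ inj₁ ∘ shift-step A wa wb a<b r (q ∘ proj₁) , inj₂ ∘ shift-step A wa wb a<b r (q ∘ proj₁) ]′ (lift A L)

  lift-descent : ∀ {k l u y} → Adj k l → y l < y k → Le u y → Le (u ∘ swp k l) y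
  lift-descent {k} {l} {u} {y} A r L with lift A L
  ... | inj₁ x = x
  ... | inj₂ x = Le-trans x (up (Adj.wk A) (Adj.wl A) (Adj.k<l A)
    (subst₂ _<_ (cong y (sym (swp-l k l))) (cong y (sym (swp-r k l))) r) (done λ p w → cong y (swp-inv k l p)))

  -- Sorting on an interval.

  nxt : ℤ → ℤ
  nxt (+ k)          = + suc k
  nxt -[1+ zero ]    = + 1
  nxt -[1+ suc k ]   = -[1+ k ]

  nxt-> : ∀ a → a < nxt a
  nxt-> (+ k)        = ℤ.+<+ ℕP.≤-refl
  nxt-> -[1+ zero ]  = ℤ.-<+
  nxt-> -[1+ suc k ] = ℤ.-<- ℕP.≤-refl

  nxt-≤ : ∀ {a z} → z ≢ + 0 → a < z → nxt a ≤ z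
  nxt-≤ {+ k} _ (ℤ.+<+ p) = ℤ.+≤+ p
  nxt-≤ { -[1+ zero ]} {+ zero} z≢0 _ = ⊥-elim (z≢0 refl)
  nxt-≤ { -[1+ zero ]} {+ suc k} z≢0 _ = ℤ.+≤+ (s≤s z≤n)
  nxt-≤ { -[1+ zero ]} { -[1+ k ]} z≢0 (ℤ.-<- ())
  nxt-≤ { -[1+ suc k ]} {+ m} z≢0 _ = ℤ.-≤+
  nxt-≤ { -[1+ suc k ]} { -[1+ m ]} z≢0 (ℤ.-<- (s≤s p)) = ℤ.-≤- p

  adj-nxt : ∀ {a} → Wire n a → Wire n (nxt a) → Adj a (nxt a)
  adj-nxt {a} wa wb = adj wa wb (nxt-> a) λ z wz p q → <⇒≱ᶻ q (nxt-≤ (proj₁ wz) p)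

  walk : ℕ → ℤ → ℤ
  walk zero    a = a
  walk (suc m) a = walk m (nxt a)

  reach-nxt : ∀ a b → ∃ λ m → b ≤ walk m a
  reach-nxt (+ i) b = ∣ b ∣ , ℤP.≤-trans (abs b) (ℤP.≤-trans (ℤ.+≤+ (ℕP.m≤m+n ∣ b ∣ i)) (ℤP.≤-reflexive (go ∣ b ∣ i)))
    where
    abs : ∀ b → b ≤ + ∣ b ∣
    abs (+ k) = ℤP.≤-refl
    abs -[1+ k ] = ℤ.-≤+
    go : ∀ m i → + (m ℕ.+ i) ≡ walk m (+ i)
    go zero i = refl
    go (suc m) i = trans (cong +_ (sym (ℕP.+-suc m i))) (go m (suc i))
  reach-nxt -[1+ zero ] b  = let m , p = reach-nxt (+ 1) b in suc m , p
  reach-nxt -[1+ suc k ] b = let m , p = reach-nxt -[1+ k ] b in suc m , p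

  Asc : Interval → (ℤ → ℤ) → Set
  Asc I f = ∀ {a b} → a ∈ᴵ I → b ∈ᴵ I → a < b → f a < f b

  nxt≢0 : ∀ a → nxt a ≢ + 0
  nxt≢0 (+ k) ()
  nxt≢0 -[1+ zero ] ()
  nxt≢0 -[1+ suc k ] ()

  asc-local : ∀ {I f} → (∀ {a} → a ∈ᴵ I → nxt a ∈ᴵ I → f a < f (nxt a)) → Asc I f
  asc-local {I} {f} h {a} {b} a∈ b∈ a<b = let m , p = reach-nxt a b in go m a∈ a<b p
    where
    go : ∀ m {a} → a ∈ᴵ I → a < b → b ≤ walk m a → f a < f b
    go zero a∈ a<b p = ⊥-elim (<⇒≱ᶻ a<b p)
    go (suc m) {a} a∈ a<b p with ℤP.<-cmp (nxt a) b
    ... | tri≈ _ refl _ = h a∈ b∈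
    ... | tri> _ _ x = ⊥-elim (<⇒≱ᶻ x (nxt-≤ (proj₁ b∈) a<b))
    ... | tri< x _ _ = ℤP.<-trans (h a∈ n∈) (go m n∈ x p)
      where
      n∈ : nxt a ∈ᴵ I
      n∈ = nxt≢0 a , ℤP.≤-trans (proj₁ (proj₂ a∈)) (ℤP.<⇒≤ (nxt-> a)) , ℤP.≤-trans (ℤP.<⇒≤ x) (proj₂ (proj₂ b∈))

  Within : Interval → Set
  Within I = ∀ {z} → z ∈ᴵ I → Wire n z

  -- Exchanges of neighbouring wires of `I`, in either direction: the record of a sorting run.
  data Sw (I : Interval) (f f′ : ℤ → ℤ) : Set where
    done : (∀ p → Wire n p → f p ≡ f′ p) → Sw I f f′
    step : ∀ {a b} → Adj a b → a ∈ᴵ I → b ∈ᴵ I → Sw I (f ∘ swp a b) f′ → Sw I f f′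

  -- Bubble sort on `I` by the key `h`, which is the identity for increasing and negation for
  -- decreasing order; the inversion number of `h ∘ f` drops at each exchange. `R` is an invariant
  -- carried along: for the decreasing sort, that the current permutation is above the original one.
  module Bubble (I : Interval) (wI : Within I) (h : ℤ → ℤ) (h-inj : ∀ {x y} → h x ≡ h y → x ≡ y)
                (h-wire : ∀ {x} → Wire n x → Wire n (h x)) (R : (ℤ → ℤ) → Set)
                (R-step : ∀ {f a b} → Perm n f → Adj a b → h (f b) < h (f a) → R f → R (f ∘ swp a b)) where
    private
      hP : ∀ {f} → Perm n f → Perm n (h ∘ f)
      hP F = record { wire = λ w → h-wire (wire F w) ; inj = λ p q e → inj F p q (h-inj e) }

      go : ∀ {f} → Perm n f → R f → Acc ℕ._<_ (invZ (map (h ∘ f) W)) →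
           ∃ λ f′ → Perm n f′ × R f′ × Sw I f f′ × Asc I (h ∘ f′)
      go {f} F r (acc rs) with Any.any? (λ a → (a ∈ᴵ? I) ×-dec ((nxt a ∈ᴵ? I) ×-dec (h (f (nxt a)) ℤ.<? h (f a)))) W
      ... | no none = f , F , r , done (λ _ _ → refl) , asc-local λ {a} a∈ n∈ → case ℤP.<-cmp (h (f a)) (h (f (nxt a))) of λ
              { (tri< x _ _) → x
              ; (tri≈ _ x _) → ⊥-elim (ℤP.<⇒≢ (nxt-> a) (inj F (wI a∈) (wI n∈) (h-inj x)))
              ; (tri> _ _ x) → ⊥-elim (none (Any.map (λ { refl → a∈ , n∈ , x }) (∈-wiresZ (wI a∈)))) }
      ... | yes some with Any.satisfied some
      ... | a , a∈ , n∈ , x with go F′ (R-step F A x r) (rs less)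
        where
        A = adj-nxt (wI a∈) (wI n∈)
        F′ = ∘-perm F (swp-perm (wI a∈) (wI n∈))
        less : invZ (map (h ∘ f ∘ swp a (nxt a)) W) ℕ.< invZ (map (h ∘ f) W)
        less = subst (invZ (map (h ∘ f ∘ swp a (nxt a)) W) ℕ.<_)
          (cong invZ (LP.map-cong (λ z → cong (h ∘ f) (swp-inv a (nxt a) z)) W))
          (inv-up (hP F′) (wI a∈) (wI n∈) (nxt-> a)
            (subst₂ _<_ (cong (h ∘ f) (sym (swp-l a (nxt a)))) (cong (h ∘ f) (sym (swp-r a (nxt a)))) x))
      ... | f′ , F″ , r′ , s , asc = f′ , F″ , r′ , step (adj-nxt (wI a∈) (wI n∈)) a∈ n∈ s , asc

    bubble : ∀ {f} → Perm n f → R f → ∃ λ f′ → Perm n f′ × R f′ × Sw I f f′ × Asc I (h ∘ f′)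
    bubble F r = go F r (<-wellFounded _)

  sort↑ : ∀ {I f} → Within I → Perm n f → ∃ λ f′ → Perm n f′ × Sw I f f′ × Asc I f′
  sort↑ {I} wI F = let f′ , F′ , _ , s , a = Bubble.bubble I wI id id id (λ _ → ℕ) (λ _ _ _ x → x) F 0 in f′ , F′ , s , a

  sort↓ : ∀ {I f} → Within I → Perm n f → ∃ λ f′ → Perm n f′ × Le f f′ × Sw I f f′ × Asc I (-_ ∘ f′)
  sort↓ {I} {f} wI F = Bubble.bubble I wI -_ ℤP.neg-injective Wire-neg (Le f)
    (λ {g} {a} {b} _ A x l → Le-trans l (up (Adj.wk A) (Adj.wl A) (Adj.k<l A) (ℤP.neg-cancel-< x) (done λ _ _ → refl)))
    F (done λ _ _ → refl)

  -- Every neighbouring pair of `I` is a descent of `y`, so by the lifting property an exchange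
  -- inside `I` cannot destroy being below `y`.
  sw-≤ : ∀ {I v v′ y} → Asc I (-_ ∘ y) → Sw I v v′ → Le v′ y → Le v y
  sw-≤ d (done e) l = Le-ext (λ p w → sym (e p w)) l
  sw-≤ {v = v} d (step {a} {b} A a∈ b∈ s) l =
    Le-ext (λ p w → cong v (swp-inv a b p)) (lift-descent A (ℤP.neg-cancel-< (d a∈ b∈ (Adj.k<l A))) (sw-≤ d s l))

  sw-perm : ∀ {I f f′} → Sw I f f′ → ∃ λ g → Perm n g × (∀ {p} → p ∈ᴵ I → g p ∈ᴵ I) × (∀ {p} → p ∉ᴵ I → g p ≡ p)
            × (∀ p → Wire n p → f (g p) ≡ f′ p)
  sw-perm (done e) = id , record { wire = id ; inj = λ _ _ → id } , id , (λ _ → refl) , e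
  sw-perm {I} {f} (step {a} {b} A a∈ b∈ s) with sw-perm s
  ... | g , G , g∈ , g∉ , e = swp a b ∘ g , ∘-perm (swp-perm (Adj.wk A) (Adj.wl A)) G , swp-closed {_∈ᴵ I} a∈ b∈ ∘ g∈
    , (λ p∉ → trans (cong (swp a b) (g∉ p∉)) (swp-o (λ { refl → p∉ a∈ }) (λ { refl → p∉ b∈ }))) , e

  -- All wires of `I` have the same continuations through the first layer, so the values on `I` may
  -- be permuted freely.
  sw-compat : ∀ {I Is f f′} → Sw I f f′ → Compat (I ∷ Is) f → Compat (I ∷ Is) f′
  sw-compat {I} {Is} {f} s c p w with sw-perm s
  ... | g , G , g∈ , g∉ , e with p ∈ᴵ? I | c (g p) (wire G w)
  ... | yes p∈ | move _ q P = move p∈ q (subst (Path _ _) (e p w) P)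
  ... | yes p∈ | stay n _   = ⊥-elim (n (g∈ p∈))
  ... | no p∉  | P = subst₂ (Path (I ∷ Is)) (g∉ p∉) (e p w) P

-- The symmetry by negation.

negI : Interval → Interval
negI (c , d) = - d , - c

negI-inv : ∀ I → negI (negI I) ≡ I
negI-inv (c , d) = cong₂ _,_ (ℤP.neg-involutive c) (ℤP.neg-involutive d)

neg-inv = ℤP.neg-involutive

neg-≢0 : ∀ {z} → z ≢ + 0 → - z ≢ + 0
neg-≢0 {z} a e = a (trans (sym (neg-inv z)) (cong -_ e))

∈ᴵ-neg : ∀ {I z} → z ∈ᴵ I → - z ∈ᴵ negI I
∈ᴵ-neg (a , b , c) = neg-≢0 a , ℤP.neg-mono-≤ c , ℤP.neg-mono-≤ b

∈ᴵ-neg⁻ : ∀ {I z} → z ∈ᴵ negI I → - z ∈ᴵ I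
∈ᴵ-neg⁻ {I} m = subst (_ ∈ᴵ_) (negI-inv I) (∈ᴵ-neg m)

∉ᴵ-neg : ∀ {I z} → z ∉ᴵ I → - z ∉ᴵ negI I
∉ᴵ-neg {I} {z} n m = n (subst (_∈ᴵ I) (neg-inv z) (∈ᴵ-neg⁻ m))

path-neg : ∀ {Is p r} → Path Is p r → Path (map negI Is) (- p) (- r)
path-neg [] = []
path-neg (move p q P) = move (∈ᴵ-neg p) (∈ᴵ-neg q) (path-neg P)
path-neg (stay p P) = stay (∉ᴵ-neg p) (path-neg P)

path-neg⁻ : ∀ {Is p r} → Path (map negI Is) (- p) (- r) → Path Is p r
path-neg⁻ {Is} {p} {r} P = subst (λ Js → Path Js p r) (map-neg-neg Is)
    (subst₂ (Path (map negI (map negI Is))) (neg-inv p) (neg-inv r) (path-neg P))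
  where
  map-neg-neg : ∀ Is → map negI (map negI Is) ≡ Is
  map-neg-neg [] = refl
  map-neg-neg (I ∷ Is) = cong₂ _∷_ (negI-inv I) (map-neg-neg Is)

Lo-neg : ∀ {I J} → Lo I J → Lo (negI J) (negI I)
Lo-neg (a , b) = ℤP.neg-mono-< b , ℤP.neg-mono-< a

Tri-neg : ∀ {I J K} → Tri I J K → Tri (negI I) (negI J) (negI K)
Tri-neg {I} {J} {K} t m m′ with t (ng m) (ng m′)
  where
  ng : ∀ {I J} → Meets (negI I) (negI J) → Meets I J
  ng (x , p , q) = - x , ∈ᴵ-neg⁻ p , ∈ᴵ-neg⁻ q
... | inj₁ (a , b) = inj₂ (Lo-neg a , Lo-neg b)
... | inj₂ (a , b) = inj₁ (Lo-neg a , Lo-neg b)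

-- Conjugation by the longest element. It reverses the order of the wires, so that statements about
-- layers above `I` follow from those about layers below.
conj⁻ : (ℤ → ℤ) → ℤ → ℤ
conj⁻ f z = - f (- z)

conj⁻-perm : ∀ {n f} → Perm n f → Perm n (conj⁻ f)
conj⁻-perm F = record { wire = Wire-neg ∘ wire F ∘ Wire-neg
  ; inj = λ p q e → ℤP.neg-injective (inj F (Wire-neg p) (Wire-neg q) (ℤP.neg-injective e)) }

conj⁻-compat : ∀ {n Is f} → Compat n Is f → Compat n (map negI Is) (conj⁻ f)
conj⁻-compat {f = f} c p w = subst (λ x → Path _ x (- f (- p))) (neg-inv p) (path-neg (c (- p) (Wire-neg w)))

-- Compatibility after removal of the first layer.

private
  path-above : ∀ {Is p y q} → q ≢ + 0 → All (q ∉ᴵ_) Is → q < p → Path Is p y → q < y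
  path-above _ _ r [] = r
  path-above z (n ∷ a) r (stay _ P) = path-above z a r P
  path-above z (n ∷ a) r (move p p′ P) = path-above z a (stays-above n z p p′ r) P

  tail-outside : ∀ {I Is p y} → p ∉ᴵ I → Path (I ∷ Is) p y → Path Is p y
  tail-outside n (move p _ _) = ⊥-elim (n p)
  tail-outside n (stay _ P) = P

  above-hi : ∀ {I p q} → q ∈ᴵ I → q ≤ p → p ≢ + 0 → p ∉ᴵ I → hi I < p
  above-hi {I} {p} q∈ q≤p p≢0 p∉ with hi I ℤ.<? p
  ... | yes r = r
  ... | no r  = ⊥-elim (p∉ (p≢0 , ℤP.≤-trans (proj₁ (proj₂ q∈)) q≤p , ℤP.≮⇒≥ r))

  -- e is a level that the paths outside I do not cross downwards
  asc-bound : ∀ {n I Is v q e} → Perm n v → Compat n (I ∷ Is) v → Asc n I v → Wire n q → q ∈ᴵ I → q ≤ e →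
              (∀ {p} → q < p → p ≢ + 0 → p ∉ᴵ I → Path Is p (v p) → e < v p) → v q ≤ e
  asc-bound {n} {I} {v = v} {q} {e} F c asc w q∈ q≤e f with pig F w q≤e
  -- This `p` is not outside `I`, where `f` would put `v p` above `e`; inside `I` the ascent bounds
  -- `v q` by `v p`.
  ... | p , wp , q≤p , vp≤ with p ∈ᴵ? I
  ... | no p∉ = ⊥-elim (<⇒≱ᶻ (f (ℤP.≤∧≢⇒< q≤p (λ { refl → p∉ q∈ })) (proj₁ wp) p∉ (tail-outside p∉ (c p wp))) vp≤)
  ... | yes p∈ with q ℤ.≟ p
  ... | yes refl = vp≤
  ... | no ne = ℤP.≤-trans (ℤP.<⇒≤ (asc q∈ p∈ (ℤP.≤∧≢⇒< q≤p ne))) vp≤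

  -- Paths from wires above `I` stay above `hi K`, so the ascent of `v` on `I` forces `v q` to be at
  -- most `hi K`. The remainder of the path to `v q`, wherever it left `I`, can then be rerouted to
  -- start at `q`.
  exit↓ : ∀ {n I pre K post v q} → Perm n v → Compat n (I ∷ pre ++ K ∷ post) v → Asc n I v → Wire n q →
          AllPairs (Tri I) (pre ++ K ∷ post) → q ∈ᴵ I → q ∈ᴵ K → All (q ∉ᴵ_) pre → Lo K I → hi K ≢ + 0 →
          Path (pre ++ K ∷ post) q (v q)
  exit↓ {n} {I} {pre} {K} {post} {v} {q} F c asc w t q∈I q∈K q∉ l hi≢0 with c q w
  ... | stay m _ = ⊥-elim (m q∈I)
  ... | move _ q₀ P = E.reroute q₀ (asc-bound F c asc w q∈I (proj₂ (proj₂ q∈K)) λ q<p p≢0 p∉ P →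
      path-sep E.all-sep (ℤP.<-trans (proj₂ l) (above-hi q∈I (ℤP.<⇒≤ q<p) p≢0 p∉)) P) P
    where module E = Exit {I} {pre} {K} {post} {q} t q∈I q∈K q∉ l hi≢0

  asc-neg : ∀ {n I v} → Asc n I v → Asc n (negI I) (conj⁻ v)
  asc-neg asc a b r = ℤP.neg-mono-< (asc (∈ᴵ-neg⁻ b) (∈ᴵ-neg⁻ a) (ℤP.neg-mono-< r))

  exit↑ : ∀ {n I pre K post v q} → Perm n v → Compat n (I ∷ pre ++ K ∷ post) v → Asc n I v → Wire n q →
          AllPairs (Tri I) (pre ++ K ∷ post) → q ∈ᴵ I → q ∈ᴵ K → All (q ∉ᴵ_) pre → Lo I K → lo K ≢ + 0 →
          Path (pre ++ K ∷ post) q (v q)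
  exit↑ {n} {I} {pre} {K} {post} {v} {q} F c asc w t q∈I q∈K q∉ l lo≢0 =
    path-neg⁻ {pre ++ K ∷ post} (subst₂ (λ Js x → Path Js (- q) (- v x)) (sym eq) (neg-inv q)
      (exit↓ {n} {negI I} {map negI pre} {negI K} {map negI post} {conj⁻ v} { - q} (conj⁻-perm F)
        (subst (λ Js → Compat n (negI I ∷ Js) (conj⁻ v)) eq (conj⁻-compat c)) (asc-neg {n} {I} {v} asc) (Wire-neg w)
        (subst (AllPairs (Tri (negI I))) eq (APP.map⁺ (AllPairs.map (λ {J} {K} → Tri-neg {I} {J} {K}) t)))
        (∈ᴵ-neg q∈I) (∈ᴵ-neg q∈K) (AllP.map⁺ (All.map ∉ᴵ-neg q∉)) (Lo-neg {I} {K} l) (neg-≢0 lo≢0)))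
    where
    eq : map negI (pre ++ K ∷ post) ≡ map negI pre ++ negI K ∷ map negI post
    eq = LP.map-++ negI pre (K ∷ post)

  -- The level is `q` itself: no remaining layer contains the wire `q`, so no path crosses it.
  isolated : ∀ {n I Is v q} → Perm n v → Compat n (I ∷ Is) v → Asc n I v → Wire n q → q ∈ᴵ I → All (q ∉ᴵ_) Is → v q ≤ q
  isolated F c asc w q∈ q∉ = asc-bound F c asc w q∈ ℤP.≤-refl λ q<p _ _ → path-above (proj₁ w) q∉ q<p

Good : ℕ → Interval → Set
Good n I = (lo I ≢ + 0) × (hi I ≢ + 0) × (- (+ n) ≤ lo I) × (hi I ≤ + n)

good-within : ∀ {n I} → Good n I → Within n I
good-within (_ , _ , a , b) (c , d , e) = c , ℤP.≤-trans a d , ℤP.≤-trans e b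

-- A path that uses `I` may leave it away from `q`, so one that starts at `q` has to be found. If no
-- later layer contains `q`, then `isolated` and its mirror image give `v q ≡ q`. Otherwise the next
-- layer on wire `q` lies below or above `I`, and the ascent of `v` bounds `v q` so that the path
-- can be rerouted through that layer.
compat-tail : ∀ {n I Is v} → ZZ (I ∷ Is) → All (Good n) (I ∷ Is) → Perm n v → Compat n (I ∷ Is) v → Asc n I v → Compat n Is v
compat-tail {n} {I} {Is} {v} (zz cmp t z) (gI ∷ gs) F c asc q w with q ∈ᴵ? I
... | no q∉ = tail-outside q∉ (c q w)
... | yes q∈ with first-layer q Is
... | inj₁ q∉ = subst (Path Is q) (ℤP.≤-antisym
        (ℤP.neg-cancel-≤ (subst (λ x → - v x ≤ - q) (neg-inv q)
          (isolated (conj⁻-perm F) (conj⁻-compat c) (asc-neg {n} {I} {v} asc) (Wire-neg w) (∈ᴵ-neg q∈) (AllP.map⁺ (All.map ∉ᴵ-neg q∉)))))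
        (isolated F c asc w q∈ q∉)) (straight Is q)
... | inj₂ (pre , K , post , refl , q∉ , q∈K) with All.lookup cmp (∈P.∈-insert pre) | All.lookup gs (∈P.∈-insert pre)
... | inj₂ l | g = exit↓ F c asc w t q∈ q∈K q∉ l (proj₁ (proj₂ g))
... | inj₁ l | g = exit↑ F c asc w t q∈ q∈K q∉ l (proj₁ g)

-- All paths of a family at once: one permutation per layer, supported on that layer, with composite
-- `x`.
data FamC (n : ℕ) : List Interval → (ℤ → ℤ) → Set where
  []  : ∀ {x} → (∀ p → Wire n p → x p ≡ p) → FamC n [] x
  _∷_ : ∀ {I Is x x′} → Σ (ℤ → ℤ) (λ g → Perm n g × (∀ {p} → p ∈ᴵ I → g p ∈ᴵ I) × (∀ {p} → p ∉ᴵ I → g p ≡ p)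
          × (∀ p → Wire n p → x′ (g p) ≡ x p)) → FamC n Is x′ → FamC n (I ∷ Is) x

record Top (n : ℕ) (Is : List Interval) : Set where
  field
    top      : ℤ → ℤ
    top-perm : Perm n top
    top-fam  : FamC n Is top
    top-max  : ∀ {v} → Perm n v → Compat n Is v → Le n v top

path-[] : ∀ {p q} → Path [] p q → q ≡ p
path-[] [] = refl

-- Sort the top of the remaining layers decreasingly on `I` to get `x`. Given a compatible `v`, sort
-- it increasingly on `I`; by `compat-tail` the result is below the old top, hence below `x`. Since
-- `x` is decreasing on `I`, `sw-≤` undoes the sorting of `v`.
topOf : ∀ {n} Is → ZZ Is → All (Good n) Is → Top n Is
topOf [] _ _ = record { top = id ; top-perm = record { wire = id ; inj = λ _ _ → id } ; top-fam = [] (λ _ _ → refl)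
  ; top-max = λ _ c → done λ p w → path-[] (c p w) }
topOf {n} (I ∷ Is) z@(zz _ _ z′) gs@(gI ∷ gs′) =
  let T = topOf {n} Is z′ gs′
      x , X , ≤x , s , desc = sort↓ n (good-within {n} {I} gI) (Top.top-perm T)
  in record { top = x ; top-perm = X ; top-fam = sw-perm n s ∷ Top.top-fam T
    ; top-max = λ F c → let v′ , F′ , s′ , asc = sort↑ n (good-within {n} {I} gI) F
        in sw-≤ n desc s′ (Le-trans n (Top.top-max T F′ (compat-tail z gs F′ (sw-compat n s′ c) asc)) ≤x) }

-- Boolean tests and path families.

≡ᵇ-true : ∀ k → (k ℕ.≡ᵇ k) ≡ true
≡ᵇ-true zero = refl
≡ᵇ-true (suc k) = ≡ᵇ-true k

≡ᵇ-false : ∀ {k l} → k ≢ l → (k ℕ.≡ᵇ l) ≡ false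
≡ᵇ-false {zero} {zero} ne = ⊥-elim (ne refl)
≡ᵇ-false {zero} {suc l} ne = refl
≡ᵇ-false {suc k} {zero} ne = refl
≡ᵇ-false {suc k} {suc l} ne = ≡ᵇ-false (ne ∘ cong suc)

eqZ-refl : ∀ x → eqZ x x ≡ true
eqZ-refl x with x ℤ.≟ x
... | yes _ = refl
... | no n  = ⊥-elim (n refl)

eqZ-sound : ∀ {x y} → eqZ x y ≡ true → x ≡ y
eqZ-sound {x} {y} e with x ℤ.≟ y
... | yes p = p
eqZ-sound () | no _

eqZ-false : ∀ {x y} → x ≢ y → eqZ x y ≡ false
eqZ-false {x} {y} ne with x ℤ.≟ y
... | yes p = ⊥-elim (ne p)
... | no _  = refl

∧-true : ∀ {a b} → a ∧ b ≡ true → (a ≡ true) × (b ≡ true)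
∧-true {true} {true} _ = refl , refl

∧-intro : ∀ {a b} → a ≡ true → b ≡ true → a ∧ b ≡ true
∧-intro refl refl = refl

≤ᵇ-true : ∀ {x y} → x ≤ y → (x ℤ.≤ᵇ y) ≡ true
≤ᵇ-true {x} {y} p with x ℤ.≤ᵇ y | ℤP.≤⇒≤ᵇ p
... | true | _ = refl

≤ᵇ-sound : ∀ {x y} → (x ℤ.≤ᵇ y) ≡ true → x ≤ y
≤ᵇ-sound e = ℤP.≤ᵇ⇒≤ (subst T (sym e) _)

ltZ-sound : ∀ {x y} → ltZ x y ≡ true → x < y
ltZ-sound {x} {y} e with x ℤ.<? y
... | yes p = p
... | no p = case trans (sym e) (ltZ-false (ℤP.≮⇒≥ p)) of λ ()

inIvB-true : ∀ {I x} → x ∈ᴵ I → inIvB I x ≡ true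
inIvB-true {c , d} (a , b , e) = ∧-intro (≤ᵇ-true b) (∧-intro (≤ᵇ-true e) (cong not (eqZ-false a)))

inIvB-sound : ∀ {I x} → inIvB I x ≡ true → x ∈ᴵ I
inIvB-sound {c , d} {x} e with ∧-true {c ℤ.≤ᵇ x} e
... | a , r with ∧-true {x ℤ.≤ᵇ d} r
... | b , s = (λ { refl → case s of λ () }) , ≤ᵇ-sound a , ≤ᵇ-sound b

inIvB-false : ∀ {I x} → x ∉ᴵ I → inIvB I x ≡ false
inIvB-false {I} {x} n with inIvB I x in e
... | true  = ⊥-elim (n (inIvB-sound {I} e))
... | false = refl

-- The middle case is a layer reduced to one wire: it contains `p`, but the network has no interior
-- vertex there.
data TouchView (I : Interval) (p : ℤ) : Set where
  touched   : lo I < hi I → p ∈ᴵ I → touch I p ≡ true → TouchView I p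
  collapsed : hi I ≤ lo I → p ∈ᴵ I → touch I p ≡ false → TouchView I p
  missed    : p ∉ᴵ I → touch I p ≡ false → TouchView I p

touchView : ∀ I p → TouchView I p
touchView I@(c , d) p with p ∈ᴵ? I | c ℤ.<? d
... | yes p∈ | yes r = touched r p∈ (∧-intro (ltZ-true r) (inIvB-true {I} p∈))
... | yes p∈ | no r  = collapsed (ℤP.≮⇒≥ r) p∈ (cong (_∧ inIvB I p) (ltZ-false (ℤP.≮⇒≥ r)))
... | no p∉  | _     = missed p∉ (trans (cong (ltZ c d ∧_) (inIvB-false {I} p∉)) (∧-zero (ltZ c d)))
  where
  ∧-zero : ∀ b → b ∧ false ≡ false
  ∧-zero true  = refl
  ∧-zero false = refl

collapsed-≡ : ∀ {I p q} → hi I ≤ lo I → p ∈ᴵ I → q ∈ᴵ I → p ≡ q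
collapsed-≡ h (_ , a , b) (_ , c , d) = ℤP.≤-antisym (ℤP.≤-trans b (ℤP.≤-trans h c)) (ℤP.≤-trans d (ℤP.≤-trans h a))

touch-same : ∀ {I p q} → p ∈ᴵ I → q ∈ᴵ I → touch I p ≡ touch I q
touch-same {I} {p} {q} p∈ q∈ = trans (cong (ltZ (lo I) (hi I) ∧_) (inIvB-true {I} p∈)) (sym (cong (ltZ (lo I) (hi I) ∧_) (inIvB-true {I} q∈)))

untouched : ∀ {I p} → p ∉ᴵ I → touch I p ≡ false
untouched {I} {p} p∉ with touchView I p
... | touched _ p∈ _ = ⊥-elim (p∉ p∈)
... | collapsed _ p∈ _ = ⊥-elim (p∉ p∈)
... | missed _ e = e

module _ {A : Set} where
  allB-true : ∀ {p : A → Bool} xs → (∀ {x} → x ∈ xs → p x ≡ true) → allB p xs ≡ true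
  allB-true [] f = refl
  allB-true (x ∷ xs) f = ∧-intro (f (here refl)) (allB-true xs (f ∘ there))

  allB-sound : ∀ {p : A → Bool} xs → allB p xs ≡ true → ∀ {x} → x ∈ xs → p x ≡ true
  allB-sound {p} (y ∷ xs) e (here refl) = proj₁ (∧-true {p y} e)
  allB-sound {p} (y ∷ xs) e (there m) = allB-sound xs (proj₂ (∧-true {p y} e)) m

  anyB-true : ∀ {p : A → Bool} {x} xs → x ∈ xs → p x ≡ true → anyB p xs ≡ true
  anyB-true {p} (y ∷ xs) (here refl) e rewrite e = refl
  anyB-true {p} (y ∷ xs) (there m) e with p y
  ... | true  = refl
  ... | false = anyB-true xs m e

  anyB-sound : ∀ {p : A → Bool} xs → anyB p xs ≡ true → ∃ λ x → (x ∈ xs) × (p x ≡ true)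
  anyB-sound {p} (y ∷ xs) e with p y in r
  ... | true  = y , here refl , r
  ... | false = let x , m , q = anyB-sound xs e in x , there m , q

-- Paths as lists of positions.

toPath : ∀ Is ps → validPath Is ps ≡ true → Σ (Path Is (hdZ ps) (lstZ ps)) λ P →
         ∀ {i} j → Follows i P → pathMids j Is ps ≡ wireMids j Is i
toPath [] (p ∷ []) e = [] , λ j _ → refl
toPath (I ∷ Is) (p ∷ q ∷ r) e with touchView I p
... | touched c<d p∈ t rewrite t with ∧-true {inIvB I q} e
...   | a , b with toPath Is (q ∷ r) b
...     | P , f = move p∈ (inIvB-sound {I} a) P , λ { j (move i∈ F) → mids j i∈ F }
  where
  mids : ∀ {i} j → i ∈ᴵ I → Follows i P → mid j ∷ pathMids (suc j) Is (q ∷ r) ≡ wireMids j (I ∷ Is) i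
  mids {i} j i∈ F rewrite trans (sym (touch-same {I} p∈ i∈)) t = cong (mid j ∷_) (f (suc j) F)
toPath (I ∷ Is) (p ∷ q ∷ r) e | collapsed d≤c p∈ t rewrite t with ∧-true {eqZ p q} e
... | a , b with eqZ-sound {p} {q} a | toPath Is (q ∷ r) b
...   | refl | P , f = move p∈ p∈ P , λ { j (move i∈ F) → mids j i∈ F }
  where
  mids : ∀ {i} j → i ∈ᴵ I → Follows i P → pathMids (suc j) Is (q ∷ r) ≡ wireMids j (I ∷ Is) i
  mids {i} j i∈ F rewrite trans (sym (touch-same {I} p∈ i∈)) t = f (suc j) F
toPath (I ∷ Is) (p ∷ q ∷ r) e | missed p∉ t rewrite t with ∧-true {eqZ p q} e
... | a , b with eqZ-sound {p} {q} a | toPath Is (q ∷ r) b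
...   | refl | P , f = stay p∉ P , λ { j (stay i∉ F) → mids j i∉ F }
  where
  mids : ∀ {i} j → i ∉ᴵ I → Follows i P → pathMids (suc j) Is (q ∷ r) ≡ wireMids j (I ∷ Is) i
  mids {i} j i∉ F rewrite untouched {I} i∉ = f (suc j) F

famTail : ∀ {n Is x} → FamC n Is x → ℤ → List ℤ
famTail ([] _) p = []
famTail ((g , _) ∷ Φ) p = g p ∷ famTail Φ (g p)

fam-valid : ∀ {n Is x} (Φ : FamC n Is x) p → validPath Is (p ∷ famTail Φ p) ≡ true
fam-valid ([] _) p = refl
fam-valid (_∷_ {I} (g , G , g∈ , g∉ , e) Φ) p with touchView I p
... | touched _ p∈ t rewrite t = ∧-intro (inIvB-true {I} (g∈ p∈)) (fam-valid Φ (g p))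
... | collapsed h p∈ t rewrite t | sym (collapsed-≡ {I} h p∈ (g∈ p∈)) = ∧-intro (eqZ-refl p) (fam-valid Φ p)
... | missed p∉ t rewrite t | g∉ p∉ = ∧-intro (eqZ-refl p) (fam-valid Φ p)

fam-last : ∀ {n Is x} (Φ : FamC n Is x) p → Wire n p → lstZ (p ∷ famTail Φ p) ≡ x p
fam-last ([] e) p w = sym (e p w)
fam-last ((g , G , g∈ , g∉ , e) ∷ Φ) p w = trans (fam-last Φ (g p) (wire G w)) (e p w)

-- Each layer permutes the wires, so every stretch of wire is occupied by some path of the family.
-- `U` gives the vertex last visited on each wire, which lets the induction start in the middle of
-- the network.
fam-covers : ∀ {n Is x} (Φ : FamC n Is x) j (U : ℤ → Vtx) p → Wire n p → ∀ {e} →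
  e ∈ consec (U p ∷ wireMids j Is p ++ snk p ∷ []) →
  ∃ λ i → Wire n i × (e ∈ consec (U i ∷ pathMids j Is (i ∷ famTail Φ i) ++ snk (x i) ∷ []))
fam-covers ([] r) j U p w {e} m = p , w , subst (λ q → e ∈ consec (U p ∷ snk q ∷ [])) (sym (r p w)) m
fam-covers {n} {I ∷ Is} {x} (_∷_ {x′ = x′} (g , G , g∈ , g∉ , r) Φ) j U p w {e} m = split (touch I p) refl m
  where
  Goal : Set
  Goal = ∃ λ i → Wire n i × (e ∈ consec (U i ∷ pathMids j (I ∷ Is) (i ∷ g i ∷ famTail Φ (g i)) ++ snk (x i) ∷ []))

  U′ : ℤ → Vtx
  U′ q = if touch I q then mid j else U q

  fixed : ∀ {i} → touch I i ≡ false → g i ≡ i → Wire n i →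
          e ∈ consec (U′ (g i) ∷ pathMids (suc j) Is (g i ∷ famTail Φ (g i)) ++ snk (x′ (g i)) ∷ []) →
          e ∈ consec (U i ∷ pathMids j (I ∷ Is) (i ∷ g i ∷ famTail Φ (g i)) ++ snk (x i) ∷ [])
  fixed {i} t gi wi m = subst (λ b → e ∈ consec (U i ∷ (if b then mid j ∷ R else R) ++ snk (x i) ∷ [])) (sym t)
      (subst₂ (λ v y → e ∈ consec (v ∷ R ++ snk y ∷ [])) (trans (cong U′ gi) (cong (if_then mid j else U i) t)) (r i wi) m)
    where R = pathMids (suc j) Is (g i ∷ famTail Φ (g i))

  via : ∀ q → Wire n q → e ∈ consec (U′ q ∷ pathMids (suc j) Is (q ∷ famTail Φ q) ++ snk (x′ q) ∷ []) → Goal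
  via q wq m with surj G wq
  ... | i , wi , refl with touchView I i
  ... | touched _ i∈ t = i , wi , subst (λ b → e ∈ consec (U i ∷ (if b then mid j ∷ R else R) ++ snk (x i) ∷ [])) (sym t)
        (there (subst₂ (λ b y → e ∈ consec ((if b then mid j else U (g i)) ∷ R ++ snk y ∷ [])) (trans (touch-same {I} (g∈ i∈) i∈) t) (r i wi) m))
    where R = pathMids (suc j) Is (g i ∷ famTail Φ (g i))
  ... | collapsed h i∈ t = i , wi , fixed t (sym (collapsed-≡ {I} h i∈ (g∈ i∈))) wi m
  ... | missed i∉ t = i , wi , fixed t (g∉ i∉) wi m

  again : e ∈ consec (U′ p ∷ wireMids (suc j) Is p ++ snk p ∷ []) → Goal
  again m = let q , wq , m′ = fam-covers Φ (suc j) U′ p w m in via q wq m′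

  split : ∀ b → touch I p ≡ b →
          e ∈ consec (U p ∷ (if b then mid j ∷ wireMids (suc j) Is p else wireMids (suc j) Is p) ++ snk p ∷ []) → Goal
  split true t (here refl) = p , w , subst (λ b → e ∈ consec (U p ∷ (if b then mid j ∷ R else R) ++ snk (x p) ∷ [])) (sym t) (here refl)
    where R = pathMids (suc j) Is (g p ∷ famTail Φ (g p))
  split true t (there m) = again (subst (λ b → e ∈ consec ((if b then mid j else U p) ∷ wireMids (suc j) Is p ++ snk p ∷ [])) (sym t) m)
  split false t m = again (subst (λ b → e ∈ consec ((if b then mid j else U p) ∷ wireMids (suc j) Is p ++ snk p ∷ [])) (sym t) m)

eqV-refl : ∀ v → eqV v v ≡ true
eqV-refl (src a) = eqZ-refl a
eqV-refl (mid a) = ≡ᵇ-true a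
eqV-refl (snk a) = eqZ-refl a

eqV-sound : ∀ {u v} → eqV u v ≡ true → u ≡ v
eqV-sound {src a} {src b} e = cong src (eqZ-sound {a} {b} e)
eqV-sound {mid a} {mid b} e = cong mid (ℕP.≡ᵇ⇒≡ a b (subst T (sym e) _))
eqV-sound {snk a} {snk b} e = cong snk (eqZ-sound {a} {b} e)

top-covering : ∀ {n Is x} → FamC n Is x → CoveringType Is (wiresZ n) (map x (wiresZ n))
top-covering {n} {Is} {x} Φ = map P W , ok W (All.tabulate ∈-wiresZ⁻) , allB-true (netEdges Is W) cov
  where
  W = wiresZ n
  P : ℤ → List ℤ
  P p = p ∷ famTail Φ p
  ok : ∀ ws → All (Wire n) ws → famOk Is ws (map x ws) (map P ws) ≡ true
  ok [] _ = refl
  ok (p ∷ ws) (w ∷ a) = ∧-intro (fam-valid Φ p) (∧-intro (eqZ-refl p)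
    (∧-intro (trans (cong (λ q → eqZ q (x p)) (fam-last Φ p w)) (eqZ-refl (x p))) (ok ws a)))
  cov : ∀ {e} → e ∈ netEdges Is W → anyB (λ p → anyB (eqE e) (consec (pathVerts Is p))) (map P W) ≡ true
  cov {e} m with Any.satisfied (find′ (∈P.∈-concatMap⁻ (λ p → consec (src p ∷ wireMids 0 Is p ++ snk p ∷ [])) {xs = W} m))
    where
    find′ : ∀ {ws} → Any (λ p → e ∈ consec (src p ∷ wireMids 0 Is p ++ snk p ∷ [])) ws →
            Any (λ p → (p ∈ ws) × (e ∈ consec (src p ∷ wireMids 0 Is p ++ snk p ∷ []))) ws
    find′ (here m) = here (here refl , m)
    find′ (there a) = there (Any.map (λ (a , b) → there a , b) (find′ a))
  ... | p , p∈ , m′ with fam-covers Φ 0 src p (∈-wiresZ⁻ p∈) m′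
  ... | i , wi , m″ = anyB-true (map P W) (∈P.∈-map⁺ P (∈-wiresZ wi))
        (anyB-true (consec (pathVerts Is (P i))) (subst (λ q → e ∈ consec (src i ∷ pathMids 0 Is (P i) ++ snk q ∷ [])) (sym (fam-last Φ i wi)) m″)
          (∧-intro (eqV-refl (proj₁ e)) (eqV-refl (proj₂ e))))

famOk-nth : ∀ Is ws us π → famOk Is ws us π ≡ true → ∀ k → k ℕ.< length ws →
  (validPath Is (nthL π k) ≡ true) × (hdZ (nthL π k) ≡ nthZ ws k) × (lstZ (nthL π k) ≡ nthZ us k)
famOk-nth Is (s ∷ ws) (t ∷ us) (p ∷ π) e k k< with ∧-true {validPath Is p} e
... | a , e₁ with ∧-true {eqZ (hdZ p) s} e₁
... | b , e₂ with ∧-true {eqZ (lstZ p) t} e₂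
famOk-nth Is (s ∷ ws) (t ∷ us) (p ∷ π) e zero k< | a , _ | b , _ | c , _ = a , eqZ-sound {hdZ p} b , eqZ-sound {lstZ p} c
famOk-nth Is (s ∷ ws) (t ∷ us) (p ∷ π) e (suc k) (s≤s k<) | _ | _ | _ , d = famOk-nth Is ws us π d k k<

famOk-path : ∀ Is ws f π → famOk Is ws (map f ws) π ≡ true → ∀ {p} → p ∈ ws → Path Is p (f p)
famOk-path Is (s ∷ ws) f (p ∷ π) e m with ∧-true {validPath Is p} e
... | a , e₁ with ∧-true {eqZ (hdZ p) s} e₁
... | b , e₂ with ∧-true {eqZ (lstZ p) (f s)} e₂
famOk-path Is (s ∷ ws) f (p ∷ π) e (here refl) | a , _ | b , _ | c , _ =
  subst₂ (Path Is) (eqZ-sound {hdZ p} b) (eqZ-sound {lstZ p} c) (proj₁ (toPath Is p a))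
famOk-path Is (s ∷ ws) f (p ∷ π) e (there m) | _ | _ | _ , d = famOk-path Is ws f π d m

-- Signed permutations in window notation.

ev-neg : ∀ w z → ev w (- z) ≡ - ev w z
ev-neg w (+ zero)  = refl
ev-neg w (+ suc k) = refl
ev-neg w -[1+ k ]  = sym (neg-inv _)

nthZ-map : ∀ (f : ℤ → ℤ) → f (+ 0) ≡ + 0 → ∀ v k → nthZ (map f v) k ≡ f (nthZ v k)
nthZ-map f f0 [] k = sym f0
nthZ-map f f0 (x ∷ v) zero = refl
nthZ-map f f0 (x ∷ v) (suc k) = nthZ-map f f0 v k

ev-compose : ∀ u v z → ev (compose u v) z ≡ ev u (ev v z)
ev-compose u v (+ zero)  = refl
ev-compose u v (+ suc k) = nthZ-map (ev u) refl v k
ev-compose u v -[1+ k ]  = trans (cong -_ (nthZ-map (ev u) refl v k)) (sym (ev-neg u (nthZ v k)))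

map-posZ : ∀ {A : Set} (f : ℤ → A) n → map f (posZ n) ≡ applyUpTo (λ k → f (+ suc k)) n
map-posZ f n = trans (sym (LP.map-∘ (map suc (upTo n)))) (trans (sym (LP.map-∘ (upTo n))) (LP.map-upTo _ n))

length-posZ : ∀ n → length (posZ n) ≡ n
length-posZ n = trans (LP.length-map +_ (upto1 n)) (trans (LP.length-map suc (upTo n)) (LP.length-upTo n))

win-map : ∀ {n} w → length w ≡ n → map (ev w) (posZ n) ≡ w
win-map {n} w refl = trans (map-posZ (ev w) (length w)) (go w)
  where
  go : ∀ w → applyUpTo (nthZ w) (length w) ≡ w
  go [] = refl
  go (x ∷ w) = cong (x ∷_) (go w)

win-ext : ∀ {n} u v → length u ≡ n → length v ≡ n → (∀ z → Wire n z → ev u z ≡ ev v z) → u ≡ v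
win-ext u v lu lv e = trans (sym (win-map u lu)) (trans (LP.map-cong-local (All.tabulate λ m → e _ (posZ-wire m))) (win-map v lv))

full-map : ∀ {n} w → length w ≡ n → full w ≡ map (ev w) (wiresZ n)
full-map {n} w l = sym (trans (LP.map-++ (ev w) (reverse (map -_ (posZ n))) (posZ n)) (cong₂ _++_ left (win-map w l)))
  where
  left : map (ev w) (reverse (map -_ (posZ n))) ≡ reverse (map -_ w)
  left = trans (LP.reverse-map (ev w) (map -_ (posZ n))) (cong reverse (trans (sym (LP.map-∘ (posZ n)))
    (trans (LP.map-cong (ev-neg w) (posZ n)) (trans (LP.map-∘ (posZ n)) (cong (map -_) (win-map w l))))))

nthZ-applyUpTo : ∀ (g : ℕ → ℤ) n k → k ℕ.< n → nthZ (applyUpTo g n) k ≡ g k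
nthZ-applyUpTo g (suc n) zero _ = refl
nthZ-applyUpTo g (suc n) (suc k) (s≤s p) = nthZ-applyUpTo (g ∘ suc) n k p

wire-pos : ∀ {n k} → Wire n (+ suc k) → k ℕ.< n
wire-pos (_ , _ , ℤ.+≤+ p) = p

wire-negsuc : ∀ {n k} → Wire n -[1+ k ] → k ℕ.< n
wire-negsuc {suc n} (_ , ℤ.-≤- p , _) = s≤s p
wire-negsuc {zero} (_ , () , _)

pos-wire : ∀ {n k} → k ℕ.< n → Wire n (+ suc k)
pos-wire p = (λ ()) , ℤP.neg-≤-pos , ℤ.+≤+ p

nthZ-posZ : ∀ {n k} (f : ℤ → ℤ) → k ℕ.< n → nthZ (map f (posZ n)) k ≡ f (+ suc k)
nthZ-posZ {n} {k} f k<n = trans (cong (λ l → nthZ l k) (map-posZ f n)) (nthZ-applyUpTo _ n k k<n)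

Odd : ℕ → (ℤ → ℤ) → Set
Odd n f = ∀ z → Wire n z → f (- z) ≡ - f z

ev-map : ∀ {n f} → Odd n f → ∀ z → Wire n z → ev (map f (posZ n)) z ≡ f z
ev-map o (+ zero) w = ⊥-elim (proj₁ w refl)
ev-map {n} {f} o (+ suc k) w = nthZ-posZ f (wire-pos w)
ev-map {n} {f} o -[1+ k ] w = trans (cong -_ (nthZ-posZ f (wire-negsuc w))) (sym (o (+ suc k) (pos-wire (wire-negsuc w))))

unique-⊆-↭ : ∀ {A : Set} {xs ys : List A} → Unique xs → (∀ {x} → x ∈ xs → x ∈ ys) → length ys ℕ.≤ length xs → xs ↭ ys
unique-⊆-↭ {xs = []} {[]} _ _ _ = ↭-refl
unique-⊆-↭ {xs = x ∷ xs} {ys} (x∉ ∷ u) sub len with ∈P.∈-∃++ (sub (here refl))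
... | A , B , refl = ↭-trans (prep x (unique-⊆-↭ u sub′ len′)) (↭-sym (↭P.shift x A B))
  where
  sub′ : ∀ {y} → y ∈ xs → y ∈ A ++ B
  sub′ m with ∈P.∈-++⁻ A (sub (there m))
  ... | inj₁ a = ∈P.∈-++⁺ˡ a
  ... | inj₂ (here refl) = ⊥-elim (All.lookup x∉ m refl)
  ... | inj₂ (there b) = ∈P.∈-++⁺ʳ A b
  len′ : length (A ++ B) ℕ.≤ length xs
  len′ = ℕP.≤-pred (subst (ℕ._≤ suc (length xs)) (↭P.↭-length (↭P.shift x A B)) len)

unique-↭ : ∀ {A : Set} {xs ys : List A} → Unique xs → Unique ys → (∀ {x} → x ∈ xs → x ∈ ys) → (∀ {x} → x ∈ ys → x ∈ xs) → xs ↭ ys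
unique-↭ {xs = xs} {ys} u v f g = unique-⊆-↭ u f (len v g)
  where
  len : ∀ {xs ys} → Unique xs → (∀ {x} → x ∈ xs → x ∈ ys) → length xs ℕ.≤ length ys
  len {[]} _ _ = z≤n
  len {x ∷ xs} {ys} (x∉ ∷ u) sub with ∈P.∈-∃++ (sub (here refl))
  ... | A , B , refl = subst (suc (length xs) ℕ.≤_) (sym (↭P.↭-length (↭P.shift x A B))) (s≤s (len u sub′))
    where
    sub′ : ∀ {y} → y ∈ xs → y ∈ A ++ B
    sub′ m with ∈P.∈-++⁻ A (sub (there m))
    ... | inj₁ a = ∈P.∈-++⁺ˡ a
    ... | inj₂ (here refl) = ⊥-elim (All.lookup x∉ m refl)
    ... | inj₂ (there b) = ∈P.∈-++⁺ʳ A b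

unique-map : ∀ {A B : Set} (f : A → B) {xs} → (∀ {p q} → p ∈ xs → q ∈ xs → f p ≡ f q → p ≡ q) → Unique xs → Unique (map f xs)
unique-map f {[]} i [] = []
unique-map f {x ∷ xs} i (x∉ ∷ u) = AllP.map⁺ (All.tabulate λ m e → All.lookup x∉ m (i (here refl) (there m) e))
  ∷ unique-map f (λ p q → i (there p) (there q)) u

wiresZ-unique : ∀ n → Unique (wiresZ n)
wiresZ-unique n = sorted-unique (wiresZ-sorted n)

perm-↭ : ∀ {n f} → Perm n f → map f (wiresZ n) ↭ wiresZ n
perm-↭ {n} {f} F = unique-⊆-↭ (unique-map f (λ p q → inj F (∈-wiresZ⁻ p) (∈-wiresZ⁻ q)) (wiresZ-unique n))
  (λ m → case ∈P.∈-map⁻ f m of λ { (y , m′ , refl) → ∈-wiresZ (wire F (∈-wiresZ⁻ m′)) })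
  (ℕP.≤-reflexive (sym (LP.length-map f (wiresZ n))))

abs-wire : ∀ {n z} → ∣ z ∣ ∈ upto1 n → Wire n z
abs-wire {n} {z} m with ∈P.∈-map⁻ suc m
abs-wire {n} {+ _} m | k , m′ , refl = pos-wire (∈P.∈-upTo⁻ m′)
abs-wire {n} { -[1+ _ ]} m | k , m′ , refl = Wire-neg (pos-wire (∈P.∈-upTo⁻ m′))

wire-abs : ∀ {n z} → Wire n z → ∣ z ∣ ∈ upto1 n
wire-abs {n} {+ zero} w = ⊥-elim (proj₁ w refl)
wire-abs {n} {+ suc k} w = ∈P.∈-map⁺ suc (∈P.∈-upTo⁺ (wire-pos w))
wire-abs {n} { -[1+ k ]} w = ∈P.∈-map⁺ suc (∈P.∈-upTo⁺ (wire-negsuc w))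

upto1-unique : ∀ n → Unique (upto1 n)
upto1-unique n = APP.map⁺ (AllPairs.map (λ ne e → ne (ℕP.suc-injective e)) (UP.upTo⁺ n))

↭-unique : ∀ {A : Set} {xs ys : List A} → xs ↭ ys → Unique xs → Unique ys
↭-unique ↭.refl u = u
↭-unique (prep x r) (h ∷ u) = ↭P.All-resp-↭ r h ∷ ↭-unique r u
↭-unique (swap x y r) ((ne ∷ h) ∷ (h′ ∷ u)) = ((ne ∘ sym) ∷ ↭P.All-resp-↭ r h′) ∷ (↭P.All-resp-↭ r h ∷ ↭-unique r u)
↭-unique (↭.trans r s) u = ↭-unique s (↭-unique r u)

nthZ-∈ : ∀ w {k} → k ℕ.< length w → nthZ w k ∈ w
nthZ-∈ (x ∷ w) {zero} _ = here refl
nthZ-∈ (x ∷ w) {suc k} (s≤s p) = there (nthZ-∈ w p)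

abs-inj : ∀ w → Unique (map ∣_∣ w) → ∀ {i j} → i ℕ.< length w → j ℕ.< length w → ∣ nthZ w i ∣ ≡ ∣ nthZ w j ∣ → i ≡ j
abs-inj (x ∷ w) u {zero} {zero} _ _ e = refl
abs-inj (x ∷ w) (h ∷ u) {zero} {suc j} _ (s≤s q) e = ⊥-elim (All.lookup h (∈P.∈-map⁺ ∣_∣ (nthZ-∈ w q)) e)
abs-inj (x ∷ w) (h ∷ u) {suc i} {zero} (s≤s p) _ e = ⊥-elim (All.lookup h (∈P.∈-map⁺ ∣_∣ (nthZ-∈ w p)) (sym e))
abs-inj (x ∷ w) (h ∷ u) {suc i} {suc j} (s≤s p) (s≤s q) e = cong suc (abs-inj w u p q e)

sp-perm : ∀ {n w} → SignedPerm n w → Perm n (ev w)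
sp-perm {n} {w} (refl , r) = record { wire = wr ; inj = ij }
  where
  u = ↭-unique (↭-sym r) (upto1-unique n)
  nw : ∀ {k} → k ℕ.< n → Wire n (nthZ w k)
  nw p = abs-wire (↭P.∈-resp-↭ r (∈P.∈-map⁺ ∣_∣ (nthZ-∈ w p)))
  wr : ∀ {p} → Wire n p → Wire n (ev w p)
  wr {+ zero} a = ⊥-elim (proj₁ a refl)
  wr {+ suc k} a = nw (wire-pos a)
  wr { -[1+ k ]} a = Wire-neg (nw (wire-negsuc a))
  opp : ∀ {i j} → i ℕ.< n → j ℕ.< n → nthZ w i ≡ - nthZ w j → ⊥
  opp {i} {j} p q e with abs-inj w u p q (trans (cong ∣_∣ e) (ℤP.∣-i∣≡∣i∣ (nthZ w j)))
  ... | refl = ≢-neg (proj₁ (nw p)) e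
  ij : ∀ {p q} → Wire n p → Wire n q → ev w p ≡ ev w q → p ≡ q
  ij {+ zero} a b e = ⊥-elim (proj₁ a refl)
  ij {+ suc i} {+ zero} a b e = ⊥-elim (proj₁ b refl)
  ij { -[1+ i ]} {+ zero} a b e = ⊥-elim (proj₁ b refl)
  ij {+ suc i} {+ suc j} a b e = cong (λ k → + suc k) (abs-inj w u (wire-pos a) (wire-pos b) (cong ∣_∣ e))
  ij {+ suc i} { -[1+ j ]} a b e = ⊥-elim (opp (wire-pos a) (wire-negsuc b) e)
  ij { -[1+ i ]} {+ suc j} a b e = ⊥-elim (opp (wire-pos b) (wire-negsuc a) (sym e))
  ij { -[1+ i ]} { -[1+ j ]} a b e = cong -[1+_] (abs-inj w u (wire-negsuc a) (wire-negsuc b) (cong ∣_∣ (ℤP.neg-injective e)))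

abs-≡ : ∀ {x y} → ∣ x ∣ ≡ ∣ y ∣ → (x ≡ y) ⊎ (x ≡ - y)
abs-≡ {+ a} {+ b} refl = inj₁ refl
abs-≡ {+ .(suc b)} { -[1+ b ]} refl = inj₂ refl
abs-≡ { -[1+ a ]} {+ .(suc a)} refl = inj₂ refl
abs-≡ { -[1+ a ]} { -[1+ .a ]} refl = inj₁ refl

pos-≢-neg : ∀ {n p q} → p ∈ posZ n → q ∈ posZ n → p ≡ - q → ⊥
pos-≢-neg a b refl = ℤP.<-asym (proj₁ (∈-posZ⁻ a)) (ℤP.neg-mono-< (proj₁ (∈-posZ⁻ b)))

mkSP : ∀ {n f} → Perm n f → Odd n f → SignedPerm n (map f (posZ n))
mkSP {n} {f} F o = trans (LP.length-map f (posZ n)) (length-posZ n)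
  , subst (_↭ upto1 n) (LP.map-∘ (posZ n)) (unique-⊆-↭ (unique-map (∣_∣ ∘ f) ij (sorted-unique (posZ-sorted n)))
      (λ m → case ∈P.∈-map⁻ (∣_∣ ∘ f) m of λ { (y , m′ , refl) → wire-abs (wire F (posZ-wire m′)) })
      (ℕP.≤-reflexive (trans (trans (LP.length-map suc (upTo n)) (LP.length-upTo n)) (sym (trans (LP.length-map (∣_∣ ∘ f) (posZ n)) (length-posZ n))))))
  where
  ij : ∀ {p q} → p ∈ posZ n → q ∈ posZ n → ∣ f p ∣ ≡ ∣ f q ∣ → p ≡ q
  ij {p} {q} a b e with abs-≡ {f p} e
  ... | inj₁ r = inj F (posZ-wire a) (posZ-wire b) r
  ... | inj₂ r = ⊥-elim (pos-≢-neg a b (inj F (posZ-wire a) (Wire-neg (posZ-wire b)) (trans r (sym (o q (posZ-wire b))))))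

ev-odd : ∀ {n} w → Odd n (ev w)
ev-odd w z _ = ev-neg w z

sp-compose : ∀ {n u v} → SignedPerm n u → SignedPerm n v → SignedPerm n (compose u v)
sp-compose {n} {u} {v} U V = subst (SignedPerm n) (trans (LP.map-∘ (posZ n)) (cong (map (ev u)) (win-map v (proj₁ V))))
  (mkSP {n} {ev u ∘ ev v} (∘-perm (sp-perm U) (sp-perm V)) (λ z _ → trans (cong (ev u) (ev-neg v z)) (ev-neg u (ev v z))))

-- Inversion by search. The default `+ 0` is not a wire, and for a permutation it is never returned
-- at a wire.
preimage : (ℤ → ℤ) → List ℤ → ℤ → ℤ
preimage f [] z = + 0
preimage f (p ∷ ps) z = if eqZ (f p) z then p else preimage f ps z

module _ {n : ℕ} {f : ℤ → ℤ} (F : Perm n f) where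
  private
    pre-∈ : ∀ ps {p z} → p ∈ ps → f p ≡ z → (f (preimage f ps z) ≡ z) × (preimage f ps z ∈ ps)
    pre-∈ (q ∷ ps) {p} {z} m e with f q ℤ.≟ z
    ... | yes r = r , here refl
    ... | no r with m
    ... | here refl = ⊥-elim (r e)
    ... | there m′ = let a , b = pre-∈ ps m′ e in a , there b

  inverse : ℤ → ℤ
  inverse = preimage f (wiresZ n)

  inverse-wire : ∀ {z} → Wire n z → Wire n (inverse z)
  inverse-wire w = let p , wp , e = surj F w in ∈-wiresZ⁻ (proj₂ (pre-∈ (wiresZ n) (∈-wiresZ wp) e))

  inverseʳ : ∀ {z} → Wire n z → f (inverse z) ≡ z
  inverseʳ w = let p , wp , e = surj F w in proj₁ (pre-∈ (wiresZ n) (∈-wiresZ wp) e)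

  inverse-perm : Perm n inverse
  inverse-perm = record { wire = inverse-wire ; inj = λ p q e → trans (sym (inverseʳ p)) (trans (cong f e) (inverseʳ q)) }

  inverseˡ : ∀ {z} → Wire n z → inverse (f z) ≡ z
  inverseˡ w = inj F (inverse-wire (wire F w)) w (inverseʳ (wire F w))

  inverse-odd : Odd n f → Odd n inverse
  inverse-odd o z w = inj F (inverse-wire (Wire-neg w)) (Wire-neg (inverse-wire w))
    (trans (inverseʳ (Wire-neg w)) (trans (cong -_ (sym (inverseʳ w))) (sym (o (inverse z) (inverse-wire w)))))

invW : ∀ {n v} → SignedPerm n v → List ℤ
invW {n} V = map (inverse (sp-perm V)) (posZ n)

invW-sp : ∀ {n v} (V : SignedPerm n v) → SignedPerm n (invW V)
invW-sp {n} {v} V = mkSP (inverse-perm (sp-perm V)) (inverse-odd (sp-perm V) (ev-odd v))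

ev-invW : ∀ {n v} (V : SignedPerm n v) z → Wire n z → ev (invW V) z ≡ inverse (sp-perm V) z
ev-invW {n} {v} V = ev-map (inverse-odd (sp-perm V) (ev-odd v))

idP-sp : ∀ n → SignedPerm n (idP n)
idP-sp n = subst (SignedPerm n) (LP.map-id (posZ n)) (mkSP {n} {id} (record { wire = id ; inj = λ _ _ → id }) (λ _ _ → refl))

ev-id : ∀ {n} z → Wire n z → ev (idP n) z ≡ z
ev-id {n} z w = trans (cong (λ l → ev l z) (sym (LP.map-id (posZ n)))) (ev-map {n} {id} (λ _ _ → refl) z w)

sp-ext : ∀ {n u v} → SignedPerm n u → SignedPerm n v → (∀ z → Wire n z → ev u z ≡ ev v z) → u ≡ v
sp-ext (a , _) (b , _) = win-ext _ _ a b

compose-assoc : ∀ u v x → compose (compose u v) x ≡ compose u (compose v x)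
compose-assoc u v x = trans (LP.map-cong (ev-compose u v) x) (LP.map-∘ x)

compose-idʳ : ∀ {n v} → SignedPerm n v → compose v (idP n) ≡ v
compose-idʳ {n} {v} V = win-map v (proj₁ V)

compose-idˡ : ∀ {n v} → SignedPerm n v → compose (idP n) v ≡ v
compose-idˡ {n} {v} V = sp-ext (sp-compose (idP-sp n) V) V λ z w → trans (ev-compose (idP n) v z) (ev-id _ (wire (sp-perm V) w))

invW-r : ∀ {n v} (V : SignedPerm n v) → compose v (invW V) ≡ idP n
invW-r {n} {v} V = sp-ext (sp-compose V (invW-sp V)) (idP-sp n) λ z w →
  trans (ev-compose v (invW V) z) (trans (cong (ev v) (ev-invW V z w)) (trans (inverseʳ (sp-perm V) w) (sym (ev-id z w))))

invW-l : ∀ {n v} (V : SignedPerm n v) → compose (invW V) v ≡ idP n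
invW-l {n} {v} V = sp-ext (sp-compose (invW-sp V) V) (idP-sp n) λ z w →
  trans (ev-compose (invW V) v z) (trans (ev-invW V _ (wire (sp-perm V) w)) (trans (inverseˡ (sp-perm V) w) (sym (ev-id z w))))

-- The zig-zag conditions and the maximal type.

all-lookup : ∀ {A : Set} {P : A → Set} (xs : List A) → (∀ k → P (lookup xs k)) → All P xs
all-lookup [] f = []
all-lookup (x ∷ xs) f = f Fin.zero ∷ all-lookup xs (f ∘ Fin.suc)

allPairs-lookup : ∀ {A : Set} {R : A → A → Set} (xs : List A) → (∀ j k → j Fin.< k → R (lookup xs j) (lookup xs k)) → AllPairs R xs
allPairs-lookup [] f = []
allPairs-lookup (x ∷ xs) f = all-lookup xs (λ k → f Fin.zero (Fin.suc k) (s≤s z≤n))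
  ∷ allPairs-lookup xs (λ j k p → f (Fin.suc j) (Fin.suc k) (s≤s p))

non-nested : ∀ {I J} → ¬ Nested I J → ¬ Nested J I → Comparable I J
non-nested {c , d} {c′ , d′} n n′ with ℤP.<-cmp c c′ | d ℤ.<? d′ | d′ ℤ.<? d
... | tri< r _ _ | yes s | _ = inj₁ (r , s)
... | tri< r _ _ | no s | _ = ⊥-elim (n′ λ x (a , b , e) → a , ℤP.≤-trans (ℤP.<⇒≤ r) b , ℤP.≤-trans e (ℤP.≮⇒≥ s))
... | tri> _ _ r | _ | yes s = inj₂ (r , s)
... | tri> _ _ r | _ | no s = ⊥-elim (n λ x (a , b , e) → a , ℤP.≤-trans (ℤP.<⇒≤ r) b , ℤP.≤-trans e (ℤP.≮⇒≥ s))
... | tri≈ _ refl _ | _ | no s = ⊥-elim (n λ x (a , b , e) → a , b , ℤP.≤-trans e (ℤP.≮⇒≥ s))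
... | tri≈ _ refl _ | _ | yes s = ⊥-elim (n′ λ x (a , b , e) → a , b , ℤP.≤-trans e (ℤP.<⇒≤ s))

zigzag-good : ∀ {n} Is → ZigZag n Is → All (Good n) Is
zigzag-good Is (g , _) = all-lookup Is λ j → let a , b , c , _ , d = g j in a , b , c , d

-- The definition compares left ends only; as the layers are not nested, their right ends are
-- ordered in the same way.
zigzag-zz : ∀ {n} Is → ZigZag n Is → ZZ Is
zigzag-zz {n} Is (_ , _ , nn , tri) = go Is nn tri
  where
  go : ∀ Is → ((j k : Fin (length Is)) → j ≢ k → ¬ Nested (lookup Is j) (lookup Is k)) →
       ((i j k : Fin (length Is)) → i Fin.< j → j Fin.< k →
         Meets (lookup Is i) (lookup Is j) → Meets (lookup Is j) (lookup Is k) →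
         ((lo (lookup Is i) < lo (lookup Is j)) × (lo (lookup Is j) < lo (lookup Is k)))
       ⊎ ((lo (lookup Is j) < lo (lookup Is i)) × (lo (lookup Is k) < lo (lookup Is j)))) → ZZ Is
  go [] _ _ = []
  go (I ∷ Is) nn tri = zz (all-lookup Is λ k → cmp Fin.zero (Fin.suc k) λ ())
    (allPairs-lookup Is λ j k j<k m m′ → case tri Fin.zero (Fin.suc j) (Fin.suc k) (s≤s z≤n) (s≤s j<k) m m′ of λ
      { (inj₁ (a , b)) → inj₁ (low (cmp Fin.zero (Fin.suc j) λ ()) a , low (cmp (Fin.suc j) (Fin.suc k) (<≢ j<k)) b)
      ; (inj₂ (a , b)) → inj₂ (low (cmp (Fin.suc j) Fin.zero λ ()) a , low (cmp (Fin.suc k) (Fin.suc j) (<≢ j<k ∘ sym)) b) })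
    (go Is (λ j k ne → nn (Fin.suc j) (Fin.suc k) (ne ∘ FinP.suc-injective))
           (λ i j k p q → tri (Fin.suc i) (Fin.suc j) (Fin.suc k) (s≤s p) (s≤s q)))
    where
    cmp : ∀ j k → j ≢ k → Comparable (lookup (I ∷ Is) j) (lookup (I ∷ Is) k)
    cmp j k ne = non-nested (nn j k ne) (nn k j (ne ∘ sym))
    low : ∀ {J K} → Comparable J K → lo J < lo K → Lo J K
    low (inj₁ l) _ = l
    low (inj₂ l) r = ⊥-elim (ℤP.<-asym r (proj₁ l))
    <≢ : ∀ {m} {j k : Fin m} → j Fin.< k → Fin.suc j ≢ Fin.suc k
    <≢ p refl = ℕP.<-irrefl refl p

-- The maximal type dominates all types in the Bruhat order of the full symmetric group.
module Maximal {n : ℕ} {Is : List Interval} {w : List ℤ} (z : ZZ Is) (gs : All (Good n) Is) (sp : SignedPerm n w) (mx : IsMaxType Is (wiresZ n) (full w)) where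
  private
    W = wiresZ n
    tp = topOf {n} Is z gs
    F = sp-perm sp

  w-compat : Compat n Is (ev w)
  w-compat p wp = let π , ok , _ = proj₁ mx in
    famOk-path Is W (ev w) π (subst (λ u → famOk Is W u π ≡ true) (full-map w (proj₁ sp)) ok) (∈-wiresZ wp)

  private
    top-is-w : ∀ p → Wire n p → Top.top tp p ≡ ev w p
    top-is-w with LP.≡-dec ℤ._≟_ (map (Top.top tp) W) (full w)
    ... | yes e = λ p wp → ptw W (trans e (full-map w (proj₁ sp))) (∈-wiresZ wp)
      where
      ptw : ∀ xs → map (Top.top tp) xs ≡ map (ev w) xs → ∀ {p} → p ∈ xs → Top.top tp p ≡ ev w p
      ptw (x ∷ xs) e (here refl) = LP.∷-injectiveˡ e
      ptw (x ∷ xs) e (there m) = ptw xs (LP.∷-injectiveʳ e) m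
    -- Otherwise the top would be another covering type, with fewer inversions than `full w` by
    -- maximality, although `w` lies below it in Bruhat order.
    ... | no ne = ⊥-elim (ℕP.<⇒≱ (proj₂ mx _ (perm-↭ (Top.top-perm tp)) (top-covering (Top.top-fam tp)) ne)
        (subst (λ u → invZ u ℕ.≤ invZ (map (Top.top tp) W)) (sym (full-map w (proj₁ sp))) (Le-inv n F (Top.top-max tp F w-compat))))

  ≤w : ∀ {v} → Perm n v → Compat n Is v → Le n v (ev w)
  ≤w V c = Le-trans n (Top.top-max tp V c) (done top-is-w)

  private
    -- A path that moves from `p` to `q` in a layer is completed by the transposition of `p` and
    -- `q`, all other wires going straight. So a statement about one path becomes one about a
    -- permutation below `w`.
    realize : ∀ {Is p r} → All (Good n) Is → Path Is p r → Wire n p → ∃ λ u → Perm n u × Compat n Is u × (u p ≡ r)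
    realize _ [] wp = id , record { wire = id ; inj = λ _ _ → id } , (λ _ _ → []) , refl
    realize {I ∷ Is} {p} (g ∷ gs) (stay p∉ P) wp with realize gs P wp
    ... | u , U , c , e = u , U , (λ q wq → ext q (c q wq)) , e
      where
      ext : ∀ q → Path Is q (u q) → Path (I ∷ Is) q (u q)
      ext q P with q ∈ᴵ? I
      ... | yes r = move r r P
      ... | no r  = stay r P
    realize {I ∷ Is} {p} (g ∷ gs) (move {q = q} p∈ q∈ P) wp with realize gs P (good-within {n} {I} g q∈)
    ... | u , U , c , e = u ∘ swp p q , ∘-perm U (swp-perm wp wq) , cc , trans (cong u (swp-l p q)) e
      where
      wq = good-within {n} {I} g q∈
      cc : Compat n (I ∷ Is) (u ∘ swp p q)
      cc x wx with x ∈ᴵ? I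
      ... | yes x∈ = move x∈ (swp-closed {_∈ᴵ I} p∈ q∈ x∈) (c _ (swp-closed {Wire n} wp wq wx))
      ... | no x∉ = stay x∉ (subst (λ y → Path Is x (u y)) (sym (swp-o (λ { refl → x∉ p∈ }) (λ { refl → x∉ q∈ }))) (c x wx))

    conj⁻-≤ : ∀ {f g} → Le n f g → Le n (conj⁻ f) (conj⁻ g)
    conj⁻-≤ (done e) = done λ p w → cong -_ (e _ (Wire-neg w))
    conj⁻-≤ {f} (up {a} {b} wa wb a<b r l) = up (Wire-neg wb) (Wire-neg wa) (ℤP.neg-mono-< a<b)
      (ℤP.neg-mono-< (subst₂ (λ x y → f x < f y) (sym (neg-inv a)) (sym (neg-inv b)) r))
      (Le-ext n (λ p w → cong (-_ ∘ f) (sw p)) (conj⁻-≤ l))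
      where
      sw : ∀ p → swp a b (- p) ≡ - swp (- b) (- a) p
      sw p with swpView (- b) (- a) p
      ... | isˡ refl e = trans (cong (swp a b) (neg-inv b)) (trans (swp-r a b) (trans (sym (neg-inv a)) (cong -_ (sym e))))
      ... | isʳ refl e = trans (cong (swp a b) (neg-inv a)) (trans (swp-l a b) (trans (sym (neg-inv b)) (cong -_ (sym e))))
      ... | isᵒ ne ne′ e = trans (swp-o (λ { refl → ne′ (sym (neg-inv p)) }) (λ { refl → ne (sym (neg-inv p)) })) (cong -_ (sym e))

  -- Realize the path by a compatible `u`, so that `u` is below `w`. Conjugation by negation
  -- preserves the order and fixes `w`; hence `conj⁻ u` is below `w` and compatible too.
  path-symm : ∀ {p r} → Wire n p → Path Is p r → Path Is (- p) (- r)
  path-symm {p} {r} wp P with realize gs P wp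
  ... | u , U , c , refl = subst (λ x → Path Is (- p) (- u x)) (neg-inv p)
        (Le-compat n (Le-trans n (conj⁻-≤ (≤w U c)) (done λ q _ → trans (cong -_ (ev-neg w q)) (neg-inv (ev w q)))) w-compat (- p) (Wire-neg wp))

-- Reflections and generators of the signed group.

ss : ℤ → ℤ → ℤ → ℤ
ss a b z with z ℤ.≟ a | z ℤ.≟ b | z ℤ.≟ - a | z ℤ.≟ - b
... | yes _ | _     | _     | _     = b
... | no _  | yes _ | _     | _     = a
... | no _  | no _  | yes _ | _     = - b
... | no _  | no _  | no _  | yes _ = - a
... | no _  | no _  | no _  | no _  = z

neg-swap : ∀ {a b} → - a ≡ b → a ≡ - b
neg-swap {a} e = trans (sym (neg-inv a)) (cong -_ e)

ss-l : ∀ a b → ss a b a ≡ b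
ss-l a b with a ℤ.≟ a
... | yes _ = refl
... | no n  = ⊥-elim (n refl)

ss-r : ∀ a b → ss a b b ≡ a
ss-r a b with b ℤ.≟ a | b ℤ.≟ b
... | yes e | _     = e
... | no _  | yes _ = refl
... | no _  | no n  = ⊥-elim (n refl)

ss-nl : ∀ {a} b → a ≢ + 0 → ss a b (- a) ≡ - b
ss-nl {a} b a≢0 with - a ℤ.≟ a | - a ℤ.≟ b | - a ℤ.≟ - a
... | yes e | _     | _     = ⊥-elim (≢-neg a≢0 (sym e))
... | no _  | yes e | _     = neg-swap e
... | no _  | no _  | yes _ = refl
... | no _  | no _  | no n  = ⊥-elim (n refl)

ss-nr : ∀ a {b} → b ≢ + 0 → ss a b (- b) ≡ - a
ss-nr a {b} b≢0 with - b ℤ.≟ a | - b ℤ.≟ b | - b ℤ.≟ - a | - b ℤ.≟ - b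
... | yes e | _     | _     | _     = neg-swap e
... | no _  | yes e | _     | _     = ⊥-elim (≢-neg b≢0 (sym e))
... | no _  | no _  | yes e | _     = e
... | no _  | no _  | no _  | yes _ = refl
... | no _  | no _  | no _  | no n  = ⊥-elim (n refl)

ss-o : ∀ {a b z} → z ≢ a → z ≢ b → z ≢ - a → z ≢ - b → ss a b z ≡ z
ss-o {a} {b} {z} p q r s with z ℤ.≟ a | z ℤ.≟ b | z ℤ.≟ - a | z ℤ.≟ - b
... | yes e | _     | _     | _     = ⊥-elim (p e)
... | no _  | yes e | _     | _     = ⊥-elim (q e)
... | no _  | no _  | yes e | _     = ⊥-elim (r e)
... | no _  | no _  | no _  | yes e = ⊥-elim (s e)
... | no _  | no _  | no _  | no _  = refl

data SSView (a b z : ℤ) : Set where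
  at-a  : z ≡ a → SSView a b z
  at-b  : z ≡ b → SSView a b z
  at-a⁻ : z ≡ - a → SSView a b z
  at-b⁻ : z ≡ - b → SSView a b z
  else  : z ≢ a → z ≢ b → z ≢ - a → z ≢ - b → SSView a b z

ssView : ∀ a b z → SSView a b z
ssView a b z with z ℤ.≟ a | z ℤ.≟ b | z ℤ.≟ - a | z ℤ.≟ - b
... | yes e | _     | _     | _     = at-a e
... | no _  | yes e | _     | _     = at-b e
... | no _  | no _  | yes e | _     = at-a⁻ e
... | no _  | no _  | no _  | yes e = at-b⁻ e
... | no p  | no q  | no r  | no s  = else p q r s

module _ {a b : ℤ} (a≢0 : a ≢ + 0) (b≢0 : b ≢ + 0) where
  ss-inv : ∀ z → ss a b (ss a b z) ≡ z
  ss-inv z with ssView a b z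
  ... | at-a refl  = trans (cong (ss a b) (ss-l a b)) (ss-r a b)
  ... | at-b refl  = trans (cong (ss a b) (ss-r a b)) (ss-l a b)
  ... | at-a⁻ refl = trans (cong (ss a b) (ss-nl b a≢0)) (ss-nr a b≢0)
  ... | at-b⁻ refl = trans (cong (ss a b) (ss-nr a b≢0)) (ss-nl b a≢0)
  ... | else p q r s = trans (cong (ss a b) (ss-o p q r s)) (ss-o p q r s)

  ss-odd : ∀ z → ss a b (- z) ≡ - ss a b z
  ss-odd z with ssView a b z
  ... | at-a refl  = trans (ss-nl b a≢0) (cong -_ (sym (ss-l a b)))
  ... | at-b refl  = trans (ss-nr a b≢0) (cong -_ (sym (ss-r a b)))
  ... | at-a⁻ refl = trans (cong (ss a b) (neg-inv a)) (trans (ss-l a b) (trans (sym (neg-inv b)) (cong -_ (sym (ss-nl b a≢0)))))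
  ... | at-b⁻ refl = trans (cong (ss a b) (neg-inv b)) (trans (ss-r a b) (trans (sym (neg-inv a)) (cong -_ (sym (ss-nr a b≢0)))))
  ... | else p q r s = trans (ss-o (r ∘ neg-swap) (s ∘ neg-swap) (p ∘ ℤP.neg-injective) (q ∘ ℤP.neg-injective)) (cong -_ (sym (ss-o p q r s)))

  ss-conj : ∀ {n} (h : ℤ → ℤ) → Perm n h → Odd n h → Wire n a → Wire n b → ∀ {z} → Wire n z →
            h (ss a b z) ≡ ss (h a) (h b) (h z)
  ss-conj h H o wa wb {z} wz with ssView a b z
  ... | at-a refl  = trans (cong h (ss-l a b)) (sym (ss-l (h a) (h b)))
  ... | at-b refl  = trans (cong h (ss-r a b)) (sym (ss-r (h a) (h b)))
  ... | at-a⁻ refl = trans (cong h (ss-nl b a≢0)) (trans (o b wb) (sym (trans (cong (ss (h a) (h b)) (o a wa)) (ss-nl (h b) (proj₁ (wire H wa))))))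
  ... | at-b⁻ refl = trans (cong h (ss-nr a b≢0)) (trans (o a wa) (sym (trans (cong (ss (h a) (h b)) (o b wb)) (ss-nr (h a) (proj₁ (wire H wb))))))
  ... | else p q r s = trans (cong h (ss-o p q r s)) (sym (ss-o (p ∘ inj H wz wa) (q ∘ inj H wz wb)
          (λ e → r (inj H wz (Wire-neg wa) (trans e (sym (o a wa))))) (λ e → s (inj H wz (Wire-neg wb) (trans e (sym (o b wb)))))))

  ss-comm : ∀ z → ss a b z ≡ ss b a z
  ss-comm z with ssView a b z
  ... | at-a refl  = trans (ss-l a b) (sym (ss-r b a))
  ... | at-b refl  = trans (ss-r a b) (sym (ss-l b a))
  ... | at-a⁻ refl = trans (ss-nl b a≢0) (sym (ss-nr b a≢0))
  ... | at-b⁻ refl = trans (ss-nr a b≢0) (sym (ss-nl a b≢0))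
  ... | else p q r s = trans (ss-o p q r s) (sym (ss-o q p s r))

  ss-neg : ∀ z → ss (- b) (- a) z ≡ ss a b z
  ss-neg z with ssView a b z
  ... | at-a refl  = trans (cong (ss (- b) (- a)) (sym (neg-inv a))) (trans (ss-nr (- b) (neg-≢0 a≢0)) (trans (neg-inv b) (sym (ss-l a b))))
  ... | at-b refl  = trans (cong (ss (- b) (- a)) (sym (neg-inv b))) (trans (ss-nl (- a) (neg-≢0 b≢0)) (trans (neg-inv a) (sym (ss-r a b))))
  ... | at-a⁻ refl = trans (ss-r (- b) (- a)) (sym (ss-nl b a≢0))
  ... | at-b⁻ refl = trans (ss-l (- b) (- a)) (sym (ss-nr a b≢0))
  ... | else p q r s = trans (ss-o s r (λ e → q (trans e (neg-inv b))) (λ e → p (trans e (neg-inv a)))) (sym (ss-o p q r s))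

  ss-swp : b ≡ - a → ∀ z → ss a b z ≡ swp a b z
  ss-swp refl z with ssView a b z
  ... | at-a refl  = trans (ss-l a b) (sym (swp-l a b))
  ... | at-b refl  = trans (ss-r a b) (sym (swp-r a b))
  ... | at-a⁻ refl = trans (ss-r a b) (sym (swp-r a b))
  ... | at-b⁻ e rewrite trans e (neg-inv a) = trans (ss-l a b) (sym (swp-l a b))
  ... | else p q r s = trans (ss-o p q r s) (sym (swp-o p q))

  -- As an element of the full symmetric group a reflection is a single transposition when
  -- `b ≡ - a`, and otherwise this product of two commuting ones.
  ss-swp² : a ≢ b → a ≢ - b → ∀ z → ss a b z ≡ swp a b (swp (- b) (- a) z)
  ss-swp² a≢b a≢-b z with ssView a b z
  ... | at-a refl  = trans (ss-l a b) (sym (trans (cong (swp a b) (swp-o a≢-b (≢-neg a≢0))) (swp-l a b)))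
  ... | at-b refl  = trans (ss-r a b) (sym (trans (cong (swp a b) (swp-o (≢-neg b≢0) (λ e → a≢-b (trans (sym (neg-inv a)) (cong -_ (sym e)))))) (swp-r a b)))
  ... | at-a⁻ refl = trans (ss-nl b a≢0) (sym (trans (cong (swp a b) (swp-r (- b) (- a))) (swp-o (a≢-b ∘ sym) (≢-neg b≢0 ∘ sym))))
  ... | at-b⁻ refl = trans (ss-nr a b≢0) (sym (trans (cong (swp a b) (swp-l (- b) (- a))) (swp-o (≢-neg a≢0 ∘ sym) (a≢-b ∘ neg-swap))))
  ... | else p q r s = trans (ss-o p q r s) (sym (trans (cong (swp a b) (swp-o s r)) (swp-o p q)))

ss-closed : ∀ {n a b z} → Wire n a → Wire n b → Wire n z → Wire n (ss a b z)
ss-closed {n} {a} {b} {z} wa wb wz with ssView a b z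
... | at-a refl  = subst (Wire n) (sym (ss-l a b)) wb
... | at-b refl  = subst (Wire n) (sym (ss-r a b)) wa
... | at-a⁻ refl = subst (Wire n) (sym (ss-nl b (proj₁ wa))) (Wire-neg wb)
... | at-b⁻ refl = subst (Wire n) (sym (ss-nr a (proj₁ wb))) (Wire-neg wa)
... | else p q r s = subst (Wire n) (sym (ss-o p q r s)) wz

ss-perm : ∀ {n a b} → Wire n a → Wire n b → Perm n (ss a b)
ss-perm {n} {a} {b} wa wb = record { wire = ss-closed wa wb
  ; inj = λ {p} {q} _ _ e → trans (sym (ss-inv (proj₁ wa) (proj₁ wb) p)) (trans (cong (ss a b) e) (ss-inv (proj₁ wa) (proj₁ wb) q)) }

refl-list : ℕ → ℤ → ℤ → List ℤ
refl-list n a b = map (ss a b) (posZ n)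

module _ {n : ℕ} {a b : ℤ} (wa : Wire n a) (wb : Wire n b) where
  refl-sp : SignedPerm n (refl-list n a b)
  refl-sp = mkSP (ss-perm wa wb) (λ z _ → ss-odd (proj₁ wa) (proj₁ wb) z)

  ev-refl : ∀ z → Wire n z → ev (refl-list n a b) z ≡ ss a b z
  ev-refl = ev-map (λ z _ → ss-odd (proj₁ wa) (proj₁ wb) z)

-- The transposition of `a` and `b` creates an inversion. If there is a second one, of `- b` and
-- `- a`, it creates another: by oddness the values there are ordered like `f a < f b`, and the
-- first exchange does not touch them.
inv-ss : ∀ {n f a b} → Perm n f → Odd n f → Wire n a → Wire n b → a < b → f a < f b →
         invZ (map f (wiresZ n)) ℕ.< invZ (map (f ∘ ss a b) (wiresZ n))
inv-ss {n} {f} {a} {b} F o wa wb a<b r with b ℤ.≟ - a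
... | yes e = subst (λ l → invZ (map f (wiresZ n)) ℕ.< invZ l) (LP.map-cong (λ z → cong f (sym (ss-swp (proj₁ wa) (proj₁ wb) e z))) (wiresZ n))
                (inv-up F wa wb a<b r)
... | no ne = subst (λ l → invZ (map f (wiresZ n)) ℕ.< invZ l) (LP.map-cong (λ z → cong f (sym (ss-swp² (proj₁ wa) (proj₁ wb) a≢b a≢-b z))) (wiresZ n))
    (ℕP.<-trans (inv-up F wa wb a<b r) (inv-up (∘-perm F (swp-perm wa wb)) (Wire-neg wb) (Wire-neg wa) (ℤP.neg-mono-< a<b)
      (subst₂ _<_ (trans (sym (o b wb)) (cong f (sym (swp-o (a≢-b ∘ sym) (≢-neg (proj₁ wb) ∘ sym)))))
                  (trans (sym (o a wa)) (cong f (sym (swp-o (≢-neg (proj₁ wa) ∘ sym) (a≢-b ∘ neg-swap)))))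
        (ℤP.neg-mono-< r))))
  where
  a≢b : a ≢ b
  a≢b = ℤP.<⇒≢ a<b
  a≢-b : a ≢ - b
  a≢-b e = ne (trans (sym (neg-inv b)) (cong -_ (sym e)))

-- The generator i exchanges genA i with genB i = nxt (genA i).
genA genB : ℕ → ℤ
genA zero    = -[1+ 0 ]
genA (suc i) = + suc i
genB zero    = + 1
genB (suc i) = + suc (suc i)

genA-wire : ∀ {n i} → i ℕ.< n → Wire n (genA i)
genA-wire {suc n} {zero} p = (λ ()) , ℤ.-≤- z≤n , ℤ.-≤+
genA-wire {n} {suc i} p = pos-wire (ℕP.<⇒≤ p)

genB-wire : ∀ {n i} → i ℕ.< n → Wire n (genB i)
genB-wire {n} {zero} p = pos-wire p
genB-wire {n} {suc i} p = pos-wire p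

genA≢0 : ∀ i → genA i ≢ + 0
genA≢0 zero ()
genA≢0 (suc i) ()

genB≢0 : ∀ i → genB i ≢ + 0
genB≢0 zero ()
genB≢0 (suc i) ()

private
  gen-value : ∀ i k → (if k ℕ.≡ᵇ suc i then + (suc (suc i)) else if k ℕ.≡ᵇ suc (suc i) then + (suc i) else + k) ≡ ss (+ suc i) (+ suc (suc i)) (+ k)
  gen-value i k = go (k ℕ.≟ suc i) (k ℕ.≟ suc (suc i))
    where
    a = + suc i
    b = + suc (suc i)
    val : Bool → Bool → ℤ
    val x y = if x then b else if y then a else + k
    go : Dec (k ≡ suc i) → Dec (k ≡ suc (suc i)) → val (k ℕ.≡ᵇ suc i) (k ℕ.≡ᵇ suc (suc i)) ≡ ss a b (+ k)
    go (yes e) _ = trans (cong (λ x → val x (k ℕ.≡ᵇ suc (suc i))) (trans (cong (ℕ._≡ᵇ suc i) e) (≡ᵇ-true i)))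
      (trans (sym (ss-l a b)) (cong (ss a b ∘ +_) (sym e)))
    go (no ne) (yes e) = trans (cong₂ val (≡ᵇ-false ne) (trans (cong (ℕ._≡ᵇ suc (suc i)) e) (≡ᵇ-true i)))
      (trans (sym (ss-r a b)) (cong (ss a b ∘ +_) (sym e)))
    go (no ne) (no ne′) = trans (cong₂ val (≡ᵇ-false ne) (≡ᵇ-false ne′))
      (sym (ss-o (ne ∘ ℤP.+-injective) (ne′ ∘ ℤP.+-injective) (λ ()) (λ ())))

gen-refl : ∀ n i → gen n i ≡ refl-list n (genA i) (genB i)
gen-refl n zero = trans (LP.map-cong-local (All.tabulate λ {k} m → val k (∈P.∈-map⁻ suc m))) (LP.map-∘ (upto1 n))
  where
  val : ∀ k → (∃ λ j → (j ∈ upTo n) × (k ≡ suc j)) → (if k ℕ.≡ᵇ 1 then -[1+ 0 ] else + k) ≡ ss -[1+ 0 ] (+ 1) (+ k)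
  val .1 (zero , _ , refl) = refl
  val .(suc (suc j)) (suc j , _ , refl) = refl
gen-refl n (suc i) = trans (LP.map-cong (gen-value i) (upto1 n)) (LP.map-∘ (upto1 n))

module _ {n i : ℕ} (i<n : i ℕ.< n) where
  gen-sp : SignedPerm n (gen n i)
  gen-sp = subst (SignedPerm n) (sym (gen-refl n i)) (refl-sp (genA-wire i<n) (genB-wire i<n))

  ev-gen : ∀ z → Wire n z → ev (gen n i) z ≡ ss (genA i) (genB i) z
  ev-gen z w = trans (cong (λ l → ev l z) (gen-refl n i)) (ev-refl (genA-wire i<n) (genB-wire i<n) z w)

genA<genB : ∀ i → genA i < genB i
genA<genB zero = ℤ.-<+
genA<genB (suc i) = ℤ.+<+ ℕP.≤-refl

gen-order : ∀ {n i p q} → i ℕ.< n → Wire n p → Wire n q → p < q →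
  ¬ ((p ≡ genA i) × (q ≡ genB i)) → ¬ ((p ≡ - genB i) × (q ≡ - genA i)) → ss (genA i) (genB i) p < ss (genA i) (genB i) q
gen-order {n} {zero} {p} {q} i<n wp wq p<q ne _ =
  subst₂ _<_ (sym (ss-swp {genA 0} {genB 0} (λ ()) (λ ()) refl p)) (sym (ss-swp {genA 0} {genB 0} (λ ()) (λ ()) refl q))
    (adj-mono n (adj-nxt n (genA-wire i<n) (genB-wire i<n)) wp wq p<q ne)
gen-order {n} {suc i} {p} {q} i<n wp wq p<q ne ne′ = subst₂ _<_ (sym (dec p)) (sym (dec q))
    (adj-mono n (adj-nxt n (genA-wire i<n) (genB-wire i<n)) (cl wp) (cl wq)
      (adj-mono n (adj-nxt n (Wire-neg (genB-wire i<n)) (Wire-neg (genA-wire i<n))) wp wq p<q ne′)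
      (λ (e , e′) → ne (back p e (swp-o { - b} { - a} (λ ()) (λ ())) , back q e′ (swp-o { - b} { - a} (λ ()) (λ ())))))
  where
  a = + suc i
  b = + suc (suc i)
  cl : ∀ {z} → Wire n z → Wire n (swp (- b) (- a) z)
  cl = swp-closed {Wire n} (Wire-neg (genB-wire i<n)) (Wire-neg (genA-wire i<n))
  dec : ∀ z → ss a b z ≡ swp a b (swp (- b) (- a) z)
  dec = ss-swp² (λ ()) (λ ()) (λ e → ℕP.1+n≢n (sym (ℤP.+-injective e))) (λ ())
  back : ∀ x {y} → swp (- b) (- a) x ≡ y → swp (- b) (- a) y ≡ y → x ≡ y
  back x {y} e f = trans (sym (swp-inv (- b) (- a) x)) (trans (cong (swp (- b) (- a)) e) f)

-- A simple reflection makes only one positive root negative; the pairs (`p`, `q`) and (`- q`,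
-- `- p`) stand for the same root.
gen-mono : ∀ {n i p q} → i ℕ.< n → Wire n p → Wire n q → p < q → ss (genA i) (genB i) q < ss (genA i) (genB i) p →
  ((p ≡ genA i) × (q ≡ genB i)) ⊎ ((p ≡ - genB i) × (q ≡ - genA i))
gen-mono {n} {i} {p} {q} i<n wp wq p<q r = go ((p ℤ.≟ genA i) ×-dec (q ℤ.≟ genB i)) ((p ℤ.≟ - genB i) ×-dec (q ℤ.≟ - genA i))
  where
  go : Dec ((p ≡ genA i) × (q ≡ genB i)) → Dec ((p ≡ - genB i) × (q ≡ - genA i)) → _
  go (yes e) _ = inj₁ e
  go _ (yes e) = inj₂ e
  go (no ne) (no ne′) = ⊥-elim (ℤP.<-asym r (gen-order i<n wp wq p<q ne ne′))

allLists-∈ : ∀ {A : Set} m {xs ys : List A} → length ys ≡ m → All (_∈ xs) ys → ys ∈ allLists m xs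
allLists-∈ zero {ys = []} _ _ = here refl
allLists-∈ (suc m) {xs} {y ∷ ys} e (y∈ ∷ a) =
  ∈P.∈-concatMap⁺ (λ x → map (x ∷_) (allLists m xs)) (Any.map (λ { refl → ∈P.∈-map⁺ (y ∷_) (allLists-∈ m (ℕP.suc-injective e) a) }) y∈)

allLists-∈⁻ : ∀ {A : Set} m {xs ys : List A} → ys ∈ allLists m xs → (length ys ≡ m) × All (_∈ xs) ys
allLists-∈⁻ zero (here refl) = refl , []
allLists-∈⁻ {A} (suc m) {xs} {ys} i = go xs id (∈P.∈-concatMap⁻ (λ x → map (x ∷_) (allLists m xs)) {xs = xs} i)
  where
  go : ∀ zs → (∀ {z} → z ∈ zs → z ∈ xs) → Any (λ x → ys ∈ map (x ∷_) (allLists m xs)) zs → (length ys ≡ suc m) × All (_∈ xs) ys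
  go (z ∷ zs) s (here r) with ∈P.∈-map⁻ (z ∷_) r
  ... | t , t∈ , refl = let e , a = allLists-∈⁻ m t∈ in cong suc e , s (here refl) ∷ a
  go (z ∷ zs) s (there r) = go zs (s ∘ there) r

least : (P : ℕ → Set) → (∀ k → Dec (P k)) → ∀ m → P m → ∃ λ k → P k × (∀ j → P j → k ℕ.≤ j)
least P P? zero p = 0 , p , λ _ _ → z≤n
least P P? (suc m) p with P? 0
... | yes q = 0 , q , λ _ _ → z≤n
... | no q with least (P ∘ suc) (P? ∘ suc) m p
... | k , pk , mn = suc k , pk , λ { zero r → ⊥-elim (q r) ; (suc j) r → s≤s (mn j r) }

-- Words, length and reflections.

module Words (n : ℕ) where
  private W = wiresZ n

  gsp : ∀ (i : Fin n) → SignedPerm n (gen n (toℕ i))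
  gsp i = gen-sp (FinP.toℕ<n i)

  prodW-sp : ∀ ws → SignedPerm n (prodW n ws)
  prodW-sp [] = idP-sp n
  prodW-sp (i ∷ ws) = sp-compose (gsp i) (prodW-sp ws)

  ev-prodW : ∀ i ws z → Wire n z → ev (prodW n (i ∷ ws)) z ≡ ss (genA (toℕ i)) (genB (toℕ i)) (ev (prodW n ws) z)
  ev-prodW i ws z w = trans (ev-compose (gen n (toℕ i)) (prodW n ws) z) (ev-gen (FinP.toℕ<n i) _ (wire (sp-perm (prodW-sp ws)) w))

  -- The strong exchange property: follow the pair (a , b) through the word until it is inverted.
  exchange : ∀ ws {a b} → Wire n a → Wire n b → a < b → ev (prodW n ws) b < ev (prodW n ws) a →
    ∃ λ ws′ → (length ws ≡ suc (length ws′)) × (∀ z → Wire n z → ev (prodW n ws′) z ≡ ev (prodW n ws) (ss a b z))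
  exchange [] wa wb a<b r = ⊥-elim (ℤP.<-asym a<b (subst₂ _<_ (ev-id _ wb) (ev-id _ wa) r))
  exchange (i ∷ ws) {a} {b} wa wb a<b r = go (ℤP.<-cmp (y a) (y b))
    where
    k = toℕ i
    y = ev (prodW n ws)
    Y = sp-perm (prodW-sp ws)
    go : _ → ∃ λ ws′ → (length (i ∷ ws) ≡ suc (length ws′)) × (∀ z → Wire n z → ev (prodW n ws′) z ≡ ev (prodW n (i ∷ ws)) (ss a b z))
    go (tri≈ _ e _) = ⊥-elim (ℤP.<⇒≢ a<b (inj Y wa wb e))
    go (tri> _ _ q) = let ws′ , e , f = exchange ws wa wb a<b q in i ∷ ws′ , cong suc e ,
      λ z w → trans (ev-prodW i ws′ z w) (trans (cong (ss (genA k) (genB k)) (f z w)) (sym (ev-prodW i ws _ (ss-closed wa wb w))))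
    go (tri< q _ _) = ws , refl , λ z w → sym (trans (ev-prodW i ws _ (ss-closed wa wb w))
        (trans (cong (ss (genA k) (genB k)) (ss-conj (proj₁ wa) (proj₁ wb) y Y (ev-odd (prodW n ws)) wa wb w))
          (trans (same (gen-mono (FinP.toℕ<n i) (wire Y wa) (wire Y wb) q (subst₂ _<_ (ev-prodW i ws b wb) (ev-prodW i ws a wa) r)) (ss (y a) (y b) (y z)))
            (ss-inv (proj₁ (wire Y wa)) (proj₁ (wire Y wb)) (y z)))))
      where
      same : ((y a ≡ genA k) × (y b ≡ genB k)) ⊎ ((y a ≡ - genB k) × (y b ≡ - genA k)) → ∀ z →
             ss (genA k) (genB k) z ≡ ss (y a) (y b) z
      same (inj₁ (e , e′)) z = cong₂ (λ p q → ss p q z) (sym e) (sym e′)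
      same (inj₂ (e , e′)) z = trans (sym (ss-neg (genA≢0 k) (genB≢0 k) z)) (cong₂ (λ p q → ss p q z) (sym e) (sym e′))

  prodW-snoc : ∀ ws i → prodW n (ws ++ i ∷ []) ≡ compose (prodW n ws) (gen n (toℕ i))
  prodW-snoc [] i = trans (compose-idʳ (gsp i)) (sym (compose-idˡ (gsp i)))
  prodW-snoc (j ∷ ws) i = trans (cong (compose (gen n (toℕ j))) (prodW-snoc ws i)) (sym (compose-assoc (gen n (toℕ j)) (prodW n ws) (gen n (toℕ i))))

  private
    whole : Interval
    whole = - (+ n) , + n

    asc-id : ∀ {f} → Perm n f → Asc n whole f → ∀ q → Wire n q → f q ≤ q
    asc-id {f} F asc q w with pig F w (ℤP.≤-refl {q})
    ... | p , wp , q≤p , e with q ℤ.≟ p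
    ... | yes refl = e
    ... | no ne = ℤP.≤-trans (ℤP.<⇒≤ (asc w wp (ℤP.≤∧≢⇒< q≤p ne))) e

    -- Up to negation the neighbouring wires are the pairs of the generators, so `v` increases on
    -- all wires. An increasing permutation is the identity by `asc-id` and its mirror image.
    ascends : ∀ {v} → SignedPerm n v → (∀ (i : Fin n) → ev v (genA (toℕ i)) < ev v (genB (toℕ i))) → v ≡ idP n
    ascends {v} V h = sp-ext V (idP-sp n) λ z w → trans (ℤP.≤-antisym (asc-id F asc z w)
        (ℤP.neg-cancel-≤ (subst (λ x → - ev v x ≤ - z) (neg-inv z) (asc-id (conj⁻-perm F)
          (λ a b r → ℤP.neg-mono-< (asc (Wire-neg b) (Wire-neg a) (ℤP.neg-mono-< r))) (- z) (Wire-neg w))))) (sym (ev-id z w))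
      where
      F = sp-perm V
      h′ : ∀ {k} → k ℕ.< n → ev v (genA k) < ev v (genB k)
      h′ {k} k<n = subst (λ j → ev v (genA j) < ev v (genB j)) (FinP.toℕ-fromℕ< k<n) (h (Fin.fromℕ< k<n))
      loc : ∀ {a} → Wire n a → Wire n (nxt n a) → ev v a < ev v (nxt n a)
      loc {+ zero} w _ = ⊥-elim (proj₁ w refl)
      loc {+ suc k} _ w = h′ {suc k} (wire-pos w)
      loc { -[1+ zero ]} _ w = h′ {0} (wire-pos w)
      loc { -[1+ suc k ]} w _ = ℤP.neg-mono-< (h′ {suc k} (wire-negsuc w))
      asc : Asc n whole (ev v)
      asc = asc-local n loc

    ev-∘gen : ∀ {v} → SignedPerm n v → ∀ i z → Wire n z → ev (compose v (gen n (toℕ i))) z ≡ ev v (ss (genA (toℕ i)) (genB (toℕ i)) z)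
    ev-∘gen {v} V i z w = trans (ev-compose v (gen n (toℕ i)) z) (cong (ev v) (ev-gen (FinP.toℕ<n i) z w))

    -- As long as some generator is a descent, multiplying by it on the right lowers the inversion
    -- number.
    word′ : ∀ {v} → SignedPerm n v → Acc ℕ._<_ (invZ (map (ev v) W)) → ∃ λ ws → prodW n ws ≡ v
    word′ {v} V (acc rs) with Any.any? (λ (i : Fin n) → ev v (genB (toℕ i)) ℤ.<? ev v (genA (toℕ i))) (allFin n)
    ... | no none = [] , sym (ascends V λ i → case ℤP.<-cmp (ev v (genA (toℕ i))) (ev v (genB (toℕ i))) of λ
            { (tri< r _ _) → r
            ; (tri≈ _ e _) → ⊥-elim (ℤP.<⇒≢ (genA<genB (toℕ i)) (inj (sp-perm V) (genA-wire (FinP.toℕ<n i)) (genB-wire (FinP.toℕ<n i)) e))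
            ; (tri> _ _ r) → ⊥-elim (none (Any.map (λ { refl → r }) (∈P.∈-allFin i))) })
    ... | yes some with Any.satisfied some
    ... | i , r with word′ V′ (rs less)
      where
      k = toℕ i
      k<n = FinP.toℕ<n i
      v′ = compose v (gen n k)
      V′ = sp-compose V (gsp i)
      ev′ = ev-∘gen V i
      less : invZ (map (ev v′) W) ℕ.< invZ (map (ev v) W)
      less = subst (λ l → invZ (map (ev v′) W) ℕ.< invZ l)
        (LP.map-cong-local (All.tabulate λ {z} m → trans (ev′ _ (ss-closed (genA-wire k<n) (genB-wire k<n) (∈-wiresZ⁻ m))) (cong (ev v) (ss-inv (genA≢0 k) (genB≢0 k) z))))
        (inv-ss (sp-perm V′) (ev-odd v′) (genA-wire k<n) (genB-wire k<n) (genA<genB k)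
          (subst₂ _<_ (sym (trans (ev′ _ (genA-wire k<n)) (cong (ev v) (ss-l (genA k) (genB k)))))
                      (sym (trans (ev′ _ (genB-wire k<n)) (cong (ev v) (ss-r (genA k) (genB k))))) r))
    ... | ws , e = ws ++ i ∷ [] , trans (prodW-snoc ws i) (trans (cong (λ u → compose u (gen n (toℕ i))) e)
          (sp-ext (sp-compose (sp-compose V (gsp i)) (gsp i)) V λ z w →
            trans (ev-∘gen (sp-compose V (gsp i)) i z w) (trans (ev-∘gen V i _ (ss-closed (genA-wire k<n) (genB-wire k<n) w)) (cong (ev v) (ss-inv (genA≢0 k) (genB≢0 k) z)))))
      where
      k = toℕ i
      k<n = FinP.toℕ<n i

  word : ∀ {v} → SignedPerm n v → ∃ λ ws → prodW n ws ≡ v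
  word V = word′ V (<-wellFounded _)

  -- There are finitely many words of each length, so the least length can be found by search.
  len : ∀ {v} → SignedPerm n v → ∃ (Len n v)
  len {v} V with word V
  ... | ws , e with least (λ k → Σ (List (Fin n)) λ ws → (length ws ≡ k) × (prodW n ws ≡ v)) dec (length ws) (ws , refl , e)
    where
    dec : ∀ k → Dec (Σ (List (Fin n)) λ ws → (length ws ≡ k) × (prodW n ws ≡ v))
    dec k with Any.any? (λ ws → LP.≡-dec ℤ._≟_ (prodW n ws) v) (allLists k (allFin n))
    ... | no ne = no λ (ws , l , e) → ne (Any.map (λ { refl → e }) (allLists-∈ k {allFin n} {ws} l (All.tabulate λ {i} _ → ∈P.∈-allFin i)))
    ... | yes a = yes (go (allLists k (allFin n)) id a)
      where
      go : ∀ L → (∀ {ws} → ws ∈ L → ws ∈ allLists k (allFin n)) → Any (λ ws → prodW n ws ≡ v) L → Σ (List (Fin n)) λ ws → (length ws ≡ k) × (prodW n ws ≡ v)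
      go (ws ∷ L) s (here e) = ws , proj₁ (allLists-∈⁻ k {allFin n} {ws} (s (here refl))) , e
      go (ws ∷ L) s (there a) = go L (s ∘ there) a
  ... | k , p , mn = k , p , λ ws e → mn (length ws) (ws , refl , e)

  -- In a shortest word of `v′` the pair is inverted, so `exchange` deletes a letter and leaves a
  -- word of `v`.
  up⇒longer : ∀ {v v′ a b k k′} → SignedPerm n v → Wire n a → Wire n b → a < b → ev v a < ev v b →
    (∀ z → Wire n z → ev v′ z ≡ ev v (ss a b z)) → Len n v k → Len n v′ k′ → k ℕ.< k′
  up⇒longer {v} {v′} {a} {b} V wa wb a<b r e (_ , mn) ((ws , refl , refl) , _)
    with exchange ws wa wb a<b (subst₂ _<_ (sym (trans (e b wb) (cong (ev v) (ss-r a b)))) (sym (trans (e a wa) (cong (ev v) (ss-l a b)))) r)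
  ... | ws′ , l , f = subst (_ ℕ.<_) (sym l) (s≤s (mn ws′ (sp-ext (prodW-sp ws′) V λ z w →
          trans (f z w) (trans (e _ (ss-closed wa wb w)) (cong (ev v) (ss-inv (proj₁ wa) (proj₁ wb) z))))))

  -- If `v` inverted the pair, `exchange` in a shortest word of `v` would give a shorter word of
  -- `v′`.
  longer⇒up : ∀ {v v′ a b k k′} → Wire n a → Wire n b → a < b → SignedPerm n v′ →
    (∀ z → Wire n z → ev v′ z ≡ ev v (ss a b z)) → Len n v k → Len n v′ k′ → k ℕ.< k′ → ev v a < ev v b
  longer⇒up {v} {v′} {a} {b} wa wb a<b V′ e ((ws , refl , refl) , _) (_ , mn) k<k′ with ℤP.<-cmp (ev v a) (ev v b)
  ... | tri< r _ _ = r
  ... | tri≈ _ r _ = ⊥-elim (ℤP.<⇒≢ a<b (inj (sp-perm (prodW-sp ws)) wa wb r))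
  ... | tri> _ _ r with exchange ws wa wb a<b r
  ... | ws′ , l , f = ⊥-elim (ℕP.<-irrefl refl (ℕP.<-≤-trans k<k′ (ℕP.≤-trans (mn ws′ (sp-ext (prodW-sp ws′) V′ λ z w → trans (f z w) (sym (e z w))))
          (ℕP.≤-trans (ℕP.n≤1+n _) (ℕP.≤-reflexive (sym l))))))

  Len-sp : ∀ {v k} → Len n v k → SignedPerm n v
  Len-sp ((ws , _ , refl) , _) = prodW-sp ws

  reflection-ss : ∀ {t} → Reflection n t → ∃ λ a → ∃ λ b → Wire n a × Wire n b × (a < b) × (∀ z → Wire n z → ev t z ≡ ss a b z)
  reflection-ss {t} (x , X , i , e) = order (ℤP.<-cmp a b)
    where
    k = toℕ i
    wA = genA-wire (FinP.toℕ<n i)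
    wB = genB-wire (FinP.toℕ<n i)
    Xp = sp-perm X
    a = ev x (genA k)
    b = ev x (genB k)
    eq : ∀ z → Wire n z → ev t z ≡ ss a b z
    eq z w with surj Xp w
    ... | p , wp , refl = trans (sym (ev-compose t x p)) (trans (cong (λ l → ev l p) e) (trans (ev-compose x (gen n k) p)
          (trans (cong (ev x) (ev-gen (FinP.toℕ<n i) p wp)) (ss-conj (proj₁ wA) (proj₁ wB) (ev x) Xp (ev-odd x) wA wB wp))))
    order : _ → ∃ λ a → ∃ λ b → Wire n a × Wire n b × (a < b) × (∀ z → Wire n z → ev t z ≡ ss a b z)
    order (tri< r _ _) = a , b , wire Xp wA , wire Xp wB , r , eq
    order (tri≈ _ r _) = ⊥-elim (ℤP.<⇒≢ (genA<genB k) (inj Xp wA wB r))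
    order (tri> _ _ r) = b , a , wire Xp wB , wire Xp wA , r , λ z w → trans (eq z w) (ss-comm (proj₁ (wire Xp wA)) (proj₁ (wire Xp wB)) z)

  private
    conj-reflection : ∀ {a b} (wa : Wire n a) (wb : Wire n b) {f} → Perm n f → Odd n f → (i : Fin n) → f (genA (toℕ i)) ≡ a → f (genB (toℕ i)) ≡ b →
                      Reflection n (refl-list n a b)
    conj-reflection {a} {b} wa wb {f} F o i ea eb = x , X , i , sp-ext (sp-compose (refl-sp wa wb) X) (sp-compose X (gsp i)) λ z w →
        trans (ev-compose (refl-list n a b) x z) (trans (ev-refl wa wb _ (wire (sp-perm X) w)) (sym (trans (ev-∘gen X i z w)
          (trans (ss-conj (genA≢0 k) (genB≢0 k) (ev x) (sp-perm X) (ev-odd x) wA wB w)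
            (cong₂ (λ p q → ss p q (ev x z)) (trans (ev-map o _ wA) ea) (trans (ev-map o _ wB) eb))))))
      where
      k = toℕ i
      wA = genA-wire (FinP.toℕ<n i)
      wB = genB-wire (FinP.toℕ<n i)
      x = map f (posZ n)
      X = mkSP F o

  ss-reflection : ∀ {a b} → Wire n a → Wire n b → a < b → Reflection n (refl-list n a b)
  ss-reflection {a} {b} wa wb a<b with b ℤ.≟ - a
  -- A sign change is conjugate to generator 0: `ss (+ 1) b` takes 1 to `b` and -1 to `- b`, which
  -- is `a`.
  ... | yes e = conj-reflection wa wb (ss-perm w1 wb) (λ z _ → ss-odd (λ ()) (proj₁ wb) z) i0
          (trans (cong (λ k → ss (+ 1) b (genA k)) t0) (trans (ss-nl {+ 1} b (λ ())) (sym (neg-swap (sym e)))))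
          (trans (cong (λ k → ss (+ 1) b (genB k)) t0) (ss-l (+ 1) b))
    where
    one : ∀ {n a} → Wire n a → 0 ℕ.< n
    one {zero} {+ zero} w = ⊥-elim (proj₁ w refl)
    one {zero} {+ suc k} w = ⊥-elim (ℕP.n≮0 (wire-pos w))
    one {zero} { -[1+ k ]} w = ⊥-elim (ℕP.n≮0 (wire-negsuc w))
    one {suc n} _ = s≤s z≤n
    w1 = pos-wire (one wa)
    i0 = Fin.fromℕ< (one wa)
    t0 = FinP.toℕ-fromℕ< (one wa)
  -- Otherwise the reflection is conjugate to generator 1. First `u` takes 1 to `a`; exchanging the
  -- image `u2` of 2 with `b` then takes 2 to `b` and leaves `a` in place.
  ... | no ne = conj-reflection wa wb (∘-perm (ss-perm wu2 wb) U) (λ z w → trans (cong (ss u2 b) (ss-odd (λ ()) (proj₁ wa) z)) (ss-odd (proj₁ wu2) (proj₁ wb) (u z))) i1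
          (trans (cong (λ k → ss u2 b (u (genA k))) t1) (trans (cong (ss u2 b) (ss-l (+ 1) a)) (ss-o a≢u2 (ℤP.<⇒≢ a<b) a≢-u2 (ne ∘ neg-swap ∘ sym))))
          (trans (cong (λ k → ss u2 b (u (genB k))) t1) (ss-l u2 b))
    where
    two : ∀ {n} → Wire n a → Wire n b → 1 ℕ.< n
    two {suc (suc n)} _ _ = s≤s (s≤s z≤n)
    two {zero} wa wb = ⊥-elim (case ∈P.∈-map⁻ suc (wire-abs wa) of λ { (_ , () , _) })
    two {suc zero} wa wb = ⊥-elim (case abs-≡ {a} {b} (trans (only (wire-abs wa)) (sym (only (wire-abs wb)))) of λ
      { (inj₁ e) → ℤP.<⇒≢ a<b e ; (inj₂ e) → ne (neg-swap (sym e)) })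
      where
      only : ∀ {k} → k ∈ upto1 1 → k ≡ 1
      only (here e) = e
    1<n = two wa wb
    u = ss (+ 1) a
    w1 = pos-wire {k = 0} (ℕP.<⇒≤ 1<n)
    w2 = pos-wire {k = 1} 1<n
    U = ss-perm w1 wa
    u2 = u (+ 2)
    wu2 = wire U w2
    i1 = Fin.fromℕ< 1<n
    t1 = FinP.toℕ-fromℕ< 1<n
    a≢u2 : a ≢ u2
    a≢u2 e = case inj U w1 w2 (trans (ss-l (+ 1) a) e) of λ ()
    a≢-u2 : a ≢ - u2
    a≢-u2 e = case inj U w1 (Wire-neg w2) (trans (ss-l (+ 1) a) (trans e (sym (ss-odd {+ 1} {a} (λ ()) (proj₁ wa) (+ 2))))) of λ ()

-- The Bruhat interval in the signed group.

bruhat-trans : ∀ {n u v w} → BruhatLe n u v → BruhatLe n v w → BruhatLe n u w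
bruhat-trans p bRefl = p
bruhat-trans p (bStep q r l l′ k) = bStep (bruhat-trans p q) r l l′ k

-- The Bruhat interval below w consists of the signed permutations compatible with the network.
module Interval-below {n : ℕ} {Is : List Interval} {w : List ℤ} (z : ZZ Is) (gs : All (Good n) Is) (sp : SignedPerm n w) (mx : IsMaxType Is (wiresZ n) (full w)) where
  open Maximal z gs sp mx
  open Words n

  private
    -- A step down removes the inversion of the pair `a < b` and that of `- b < - a`; each removal
    -- is an uncrossing.
    down : ∀ {u w} → BruhatLe n u w → Compat n Is (ev w) → Compat n Is (ev u)
    down bRefl c = c
    down (bStep {v} {t} B R Lv Lvt k<k′) c with reflection-ss R
    ... | a , b , wa , wb , a<b , e = down B cv
      where
      ev′ : ∀ x → Wire n x → ev (compose v t) x ≡ ev v (ss a b x)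
      ev′ x wx = trans (ev-compose v t x) (cong (ev v) (e x wx))
      r : ev v a < ev v b
      r = longer⇒up wa wb a<b (Len-sp Lvt) ev′ Lv Lvt k<k′
      P : ∀ {x} → Wire n x → Path Is x (ev v (ss a b x))
      P {x} wx = subst (Path Is x) (ev′ x wx) (c x wx)
      ab = uncross (proj₁ wa) (proj₁ wb) a<b r (subst (Path Is a ∘ ev v) (ss-l a b) (P wa)) (subst (Path Is b ∘ ev v) (ss-r a b) (P wb))
      ba = uncross (neg-≢0 (proj₁ wb)) (neg-≢0 (proj₁ wa)) (ℤP.neg-mono-< a<b)
             (subst₂ _<_ (sym (ev-neg v b)) (sym (ev-neg v a)) (ℤP.neg-mono-< r))
             (subst (Path Is (- b) ∘ ev v) (ss-nr a (proj₁ wb)) (P (Wire-neg wb))) (subst (Path Is (- a) ∘ ev v) (ss-nl b (proj₁ wa)) (P (Wire-neg wa)))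
      cv : Compat n Is (ev v)
      cv x wx with ssView a b x
      ... | at-a refl  = proj₁ ab
      ... | at-b refl  = proj₂ ab
      ... | at-a⁻ refl = proj₂ ba
      ... | at-b⁻ refl = proj₁ ba
      ... | else p q r s = subst (Path Is x ∘ ev v) (ss-o p q r s) (P wx)

    -- A step of `Le` is a transposition of the full symmetric group and may leave the signed group,
    -- so the reflection `ss a b` takes its place. The paths from `a` to `v b` and from `b` to `v a`
    -- exist because the transposed permutation is still below `w`; `path-symm` supplies those from
    -- `- a` and `- b`. The inversion number grows and is bounded by that of `w`.
    climb : ∀ {v} → SignedPerm n v → Compat n Is (ev v) → Acc ℕ._<_ (invZ (map (ev w) (wiresZ n)) ∸ invZ (map (ev v) (wiresZ n))) → BruhatLe n v w
    climb {v} V c (acc rs) with ≤w (sp-perm V) c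
    ... | done e = subst (BruhatLe n v) (sp-ext V sp e) bRefl
    ... | up {a} {b} wa wb a<b r l = bruhat-trans (bStep bRefl (ss-reflection wa wb a<b) (proj₂ Lv) (proj₂ Lv′) (up⇒longer V wa wb a<b r ev′ (proj₂ Lv) (proj₂ Lv′)))
            (climb V′ c′ (rs (ℕP.∸-monoʳ-< less bound)))
      where
      t = refl-list n a b
      v′ = compose v t
      V′ = sp-compose V (refl-sp wa wb)
      Lv = len V
      Lv′ = len V′
      ev′ : ∀ x → Wire n x → ev v′ x ≡ ev v (ss a b x)
      ev′ x wx = trans (ev-compose v t x) (cong (ev v) (ev-refl wa wb x wx))
      less : invZ (map (ev v) (wiresZ n)) ℕ.< invZ (map (ev v′) (wiresZ n))
      less = subst (λ L → invZ (map (ev v) (wiresZ n)) ℕ.< invZ L) (LP.map-cong-local (All.tabulate λ m → sym (ev′ _ (∈-wiresZ⁻ m))))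
        (inv-ss (sp-perm V) (ev-odd v) wa wb a<b r)
      cs : Compat n Is (ev v ∘ swp a b)
      cs = Le-compat n l w-compat
      pa : Path Is a (ev v b)
      pa = subst (Path Is a ∘ ev v) (swp-l a b) (cs a wa)
      pb : Path Is b (ev v a)
      pb = subst (Path Is b ∘ ev v) (swp-r a b) (cs b wb)
      c′ : Compat n Is (ev v′)
      c′ x wx = subst (Path Is x) (sym (ev′ x wx)) (go (ssView a b x))
        where
        go : SSView a b x → Path Is x (ev v (ss a b x))
        go (at-a refl)  = subst (Path Is a ∘ ev v) (sym (ss-l a b)) pa
        go (at-b refl)  = subst (Path Is b ∘ ev v) (sym (ss-r a b)) pb
        go (at-a⁻ refl) = subst (Path Is (- a)) (trans (sym (ev-neg v b)) (cong (ev v) (sym (ss-nl b (proj₁ wa))))) (path-symm wa pa)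
        go (at-b⁻ refl) = subst (Path Is (- b)) (trans (sym (ev-neg v a)) (cong (ev v) (sym (ss-nr a (proj₁ wb))))) (path-symm wb pb)
        go (else p q r s) = subst (Path Is x ∘ ev v) (sym (ss-o p q r s)) (c x wx)
      bound : invZ (map (ev v′) (wiresZ n)) ℕ.≤ invZ (map (ev w) (wiresZ n))
      bound = Le-inv n (sp-perm V′) (≤w (sp-perm V′) c′)

  below⇒compat : ∀ {v} → BruhatLe n v w → Compat n Is (ev v)
  below⇒compat B = down B w-compat

  compat⇒below : ∀ {v} → SignedPerm n v → Compat n Is (ev v) → BruhatLe n v w
  compat⇒below V c = climb V c (<-wellFounded _)

-- Reading the poset from a family of type e.

nthZ-++ˡ : ∀ xs ys {k} → k ℕ.< length xs → nthZ (xs ++ ys) k ≡ nthZ xs k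
nthZ-++ˡ (x ∷ xs) ys {zero} _ = refl
nthZ-++ˡ (x ∷ xs) ys {suc k} (s≤s p) = nthZ-++ˡ xs ys p

nthZ-++ʳ : ∀ xs ys k → nthZ (xs ++ ys) (length xs ℕ.+ k) ≡ nthZ ys k
nthZ-++ʳ [] ys k = refl
nthZ-++ʳ (x ∷ xs) ys k = nthZ-++ʳ xs ys k

nthZ-downFrom : ∀ (f : ℕ → ℤ) n {k} → k ℕ.< n → nthZ (applyDownFrom f n) (n ∸ suc k) ≡ f k
nthZ-downFrom f (suc n) {k} (s≤s k≤n) with k ℕ.≟ n
... | yes refl rewrite ℕP.n∸n≡0 k = refl
... | no ne = trans (cong (nthZ (f n ∷ applyDownFrom f n)) (sym (ℕP.suc-pred (n ∸ k) {{ℕ.>-nonZero (ℕP.m<n⇒0<n∸m k<n)}})))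
    (trans (cong (nthZ (applyDownFrom f n)) (ℕP.pred[m∸n]≡m∸[1+n] n k)) (nthZ-downFrom f n k<n))
  where k<n = ℕP.≤∧≢⇒< k≤n ne

module _ (n : ℕ) where
  private
    negs = reverse (map -_ (posZ n))
    len-negs : length negs ≡ n
    len-negs = trans (LP.length-reverse (map -_ (posZ n))) (trans (LP.length-map -_ (posZ n)) (length-posZ n))

  length-wiresZ : length (wiresZ n) ≡ n ℕ.+ n
  length-wiresZ = trans (LP.length-++ negs) (cong₂ ℕ._+_ len-negs (length-posZ n))

  wiresZ-pos : ∀ {k} → k ℕ.< n → nthZ (wiresZ n) (n ℕ.+ k) ≡ + suc k
  wiresZ-pos {k} k<n = trans (cong (λ m → nthZ (wiresZ n) (m ℕ.+ k)) (sym len-negs)) (trans (nthZ-++ʳ negs (posZ n) k)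
    (trans (cong (λ l → nthZ l k) (sym (LP.map-id (posZ n)))) (nthZ-posZ id k<n)))

  wiresZ-neg : ∀ {k} → k ℕ.< n → nthZ (wiresZ n) (n ∸ suc k) ≡ -[1+ k ]
  wiresZ-neg {k} k<n = trans (nthZ-++ˡ negs (posZ n) (subst (n ∸ suc k ℕ.<_) (sym len-negs) (ℕP.∸-monoʳ-< {n} {suc k} {0} (s≤s z≤n) k<n)))
    (trans (cong (λ l → nthZ l (n ∸ suc k)) (trans (cong reverse (map-posZ -_ n)) (LP.reverse-applyUpTo _ n))) (nthZ-downFrom _ n k<n))

not-not : ∀ {x} → not (not x) ≡ true → x ≡ true
not-not {true} _ = refl

-- By `closed-follows` a path that ends at the label of its source has the vertices of the straight
-- wire. Hence the tests on `π` for shared vertices, groundedness and incomparability all reduce to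
-- `Share`.
module IdentityFamily {n : ℕ} {Is : List Interval} (z : ZZ Is) (π : List (List ℤ)) (ok : famOk Is (wiresZ n) (wiresZ n) π ≡ true) where
  private
    nth : ∀ {k x} → k ℕ.< n ℕ.+ n → nthZ (wiresZ n) k ≡ x → (validPath Is (nthL π k) ≡ true) × (hdZ (nthL π k) ≡ x) × (lstZ (nthL π k) ≡ x)
    nth {k} k< e = let a , b , c = famOk-nth Is (wiresZ n) (wiresZ n) π ok k (subst (k ℕ.<_) (sym (length-wiresZ n)) k<) in a , trans b e , trans c e

    pathOf-ok : ∀ x → Wire n x → (validPath Is (pathOf n π x) ≡ true) × (hdZ (pathOf n π x) ≡ x) × (lstZ (pathOf n π x) ≡ x)
    pathOf-ok (+ zero) w = ⊥-elim (proj₁ w refl)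
    pathOf-ok (+ suc k) w = nth (ℕP.+-monoʳ-< n (wire-pos w)) (wiresZ-pos n (wire-pos w))
    pathOf-ok -[1+ k ] w = nth (ℕP.<-≤-trans (ℕP.∸-monoʳ-< {n} {suc k} {0} (s≤s z≤n) (wire-negsuc w)) (ℕP.m≤m+n n n)) (wiresZ-neg n (wire-negsuc w))

    wireVerts : ℤ → List Vtx
    wireVerts x = src x ∷ wireMids 0 Is x ++ snk x ∷ []

    verts : ∀ x → Wire n x → pathVerts Is (pathOf n π x) ≡ wireVerts x
    verts x w with pathOf n π x | pathOf-ok x w
    ... | ps | v , h , l with toPath Is ps v
    ... | P , f = cong₂ (λ s r → src s ∷ r) h (cong₂ (λ m t → m ++ snk t ∷ []) (f {x} 0 fol) l)
      where
      fol : Follows x P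
      fol = closed (hdZ ps) (lstZ ps) h l P
        where
        closed : ∀ a b → a ≡ x → b ≡ x → (P : Path Is a b) → Follows x P
        closed a b refl refl P = closed-follows z (proj₁ w) P

    mid-≥ : ∀ {k m} Is i → mid m ∈ wireMids k Is i → k ℕ.≤ m
    mid-≥ {k} (I ∷ Is) i e with touch I i
    mid-≥ (I ∷ Is) i (here refl) | true = ℕP.≤-refl
    mid-≥ (I ∷ Is) i (there e) | true = ℕP.<⇒≤ (mid-≥ Is i e)
    ... | false = ℕP.<⇒≤ (mid-≥ Is i e)

    mid-split : ∀ k {m} I Is i → mid m ∈ wireMids k (I ∷ Is) i → ((m ≡ k) × (i ∈ᴵ I)) ⊎ (mid m ∈ wireMids (suc k) Is i)
    mid-split k I Is i a with touchView I i
    mid-split k I Is i a | touched _ i∈ t rewrite t with a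
    ... | here refl = inj₁ (refl , i∈)
    ... | there a′ = inj₂ a′
    mid-split k I Is i a | collapsed _ _ t rewrite t = inj₂ a
    mid-split k I Is i a | missed _ t rewrite t = inj₂ a

    common-mid : ∀ k {m} Is i j → mid m ∈ wireMids k Is i → mid m ∈ wireMids k Is j → Share Is i j
    common-mid k (I ∷ Is) i j a b with mid-split k I Is i a | mid-split k I Is j b
    ... | inj₁ (_ , i∈) | inj₁ (_ , j∈) = here (i∈ , j∈)
    ... | inj₁ (refl , _) | inj₂ b′ = ⊥-elim (ℕP.<-irrefl refl (mid-≥ Is j b′))
    ... | inj₂ a′ | inj₁ (refl , _) = ⊥-elim (ℕP.<-irrefl refl (mid-≥ Is i a′))
    ... | inj₂ a′ | inj₂ b′ = there (common-mid (suc k) Is i j a′ b′)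

    -- Two distinct wires keep the layer from being collapsed, so it has an interior vertex.
    share-mid : ∀ k Is i j → i ≢ j → Share Is i j → ∃ λ m → (mid m ∈ wireMids k Is i) × (mid m ∈ wireMids k Is j)
    share-mid k (I ∷ Is) i j ne (here (i∈ , j∈)) with touchView I i | touchView I j
    ... | touched _ _ t | touched _ _ t′ rewrite t | t′ = k , here refl , here refl
    ... | collapsed h _ _ | _ = ⊥-elim (ne (collapsed-≡ {I} h i∈ j∈))
    ... | missed n _ | _ = ⊥-elim (n i∈)
    ... | touched _ _ _ | missed n _ = ⊥-elim (n j∈)
    ... | touched _ _ _ | collapsed h _ _ = ⊥-elim (ne (collapsed-≡ {I} h i∈ j∈))
    share-mid k (I ∷ Is) i j ne (there s) with share-mid (suc k) Is i j ne s
    ... | m , a , b = m , later I i a , later I j b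
      where
      later : ∀ I i → mid m ∈ wireMids (suc k) Is i → mid m ∈ wireMids k (I ∷ Is) i
      later I i a with touch I i
      ... | true  = there a
      ... | false = a

    only-mids : ∀ k Is i {v} → v ∈ wireMids k Is i → ∃ λ m → v ≡ mid m
    only-mids k (I ∷ Is) i e with touch I i
    only-mids k (I ∷ Is) i (here refl) | true = k , refl
    only-mids k (I ∷ Is) i (there e) | true = only-mids (suc k) Is i e
    ... | false = only-mids (suc k) Is i e

    data On (i : ℤ) : Vtx → Set where
      at-src : On i (src i)
      at-mid : ∀ {m} → mid m ∈ wireMids 0 Is i → On i (mid m)
      at-snk : On i (snk i)

    on : ∀ {i v} → v ∈ wireVerts i → On i v
    on (here refl) = at-src
    on {i} (there e) with ∈P.∈-++⁻ (wireMids 0 Is i) e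
    ... | inj₂ (here refl) = at-snk
    ... | inj₁ e′ with only-mids 0 Is i e′
    ... | m , refl = at-mid e′

  private
    shares-wires : ∀ {i j} → Wire n i → Wire n j →
      shares Is (pathOf n π i) (pathOf n π j) ≡ anyB (λ v → anyB (eqV v) (wireVerts j)) (wireVerts i)
    shares-wires {i} {j} wi wj = cong₂ (λ xs ys → anyB (λ v → anyB (eqV v) ys) xs) (verts i wi) (verts j wj)

  shares-share : ∀ {i j} → Wire n i → Wire n j → i ≢ j → shares Is (pathOf n π i) (pathOf n π j) ≡ true → Share Is i j
  shares-share {i} {j} wi wj ne e with anyB-sound (wireVerts i) (trans (sym (shares-wires wi wj)) e)
  ... | v , v∈ , e′ with anyB-sound (wireVerts j) e′
  ... | v′ , v′∈ , e″ with eqV-sound {v} {v′} e″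
  ... | refl with on v∈ | on v′∈
  ... | at-src | at-src = ⊥-elim (ne refl)
  ... | at-snk | at-snk = ⊥-elim (ne refl)
  ... | at-mid a | at-mid b = common-mid 0 Is i j a b

  share-shares : ∀ {i j} → Wire n i → Wire n j → i ≢ j → Share Is i j → shares Is (pathOf n π i) (pathOf n π j) ≡ true
  share-shares {i} {j} wi wj ne s with share-mid 0 Is i j ne s
  ... | m , a , b = trans (shares-wires wi wj) (anyB-true (wireVerts i) (there (∈P.∈-++⁺ˡ a)) (anyB-true {p = eqV (mid m)} (wireVerts j) (there (∈P.∈-++⁺ˡ b)) (eqV-refl (mid m))))

  incEdge-share : ∀ {a b} → Wire n (+ a) → Wire n (+ b) → incEdge n Is π a b ≡ true → (a ≢ b) × Share Is (+ a) (+ b)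
  incEdge-share {a} {b} wa wb e with ∧-true {not (a ℕ.≡ᵇ b)} e
  ... | ne , e₁ with ∧-true {not (ltP n Is π (+ a) (+ b))} e₁
  ... | e₂ , e₃ with ℕP.<-cmp a b
  ... | tri≈ _ refl _ = ⊥-elim (case trans (sym ne) (cong not (≡ᵇ-true a)) of λ ())
  ... | tri< r nr _ rewrite ltZ-true (ℤ.+<+ r) = nr , shares-share wa wb (nr ∘ ℤP.+-injective) (not-not e₂)
  ... | tri> _ nr r rewrite ltZ-true (ℤ.+<+ r) = nr , share-sym (shares-share wb wa (λ e → nr (sym (ℤP.+-injective e))) (not-not e₃))

  share-incEdge : ∀ {a b} → Wire n (+ a) → Wire n (+ b) → a ≢ b → Share Is (+ a) (+ b) → incEdge n Is π a b ≡ true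
  share-incEdge {a} {b} wa wb ne s = ∧-intro (cong not (≡ᵇ-false ne)) (∧-intro (nolt wa wb ne s) (nolt wb wa (ne ∘ sym) (share-sym s)))
    where
    nolt : ∀ {a b} → Wire n (+ a) → Wire n (+ b) → a ≢ b → Share Is (+ a) (+ b) → not (ltP n Is π (+ a) (+ b)) ≡ true
    nolt {a} {b} wa wb ne s rewrite share-shares wa wb (ne ∘ ℤP.+-injective) s with ltZ (+ a) (+ b)
    ... | true  = refl
    ... | false = refl

-- Finite sums and signs.

module _ {A : Set} where
  sumQ-++ : ∀ xs ys → sumQ (xs ++ ys) ≡ sumQ xs ℚ.+ sumQ ys
  sumQ-++ [] ys = sym (ℚP.+-identityˡ _)
  sumQ-++ (x ∷ xs) ys = trans (cong (x ℚ.+_) (sumQ-++ xs ys)) (sym (ℚP.+-assoc x (sumQ xs) (sumQ ys)))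

  ΣQ : (A → ℚ) → List A → ℚ
  ΣQ f xs = sumQ (map f xs)

  Σ-↭ : ∀ (f : A → ℚ) {xs ys} → xs ↭ ys → ΣQ f xs ≡ ΣQ f ys
  Σ-↭ f ↭.refl = refl
  Σ-↭ f (prep x r) = cong (f x ℚ.+_) (Σ-↭ f r)
  Σ-↭ f {_} {_ ∷ _ ∷ ys} (swap x y r) = trans (cong (λ s → f x ℚ.+ (f y ℚ.+ s)) (Σ-↭ f r))
    (trans (sym (ℚP.+-assoc (f x) (f y) _)) (trans (cong (ℚ._+ ΣQ f ys) (ℚP.+-comm (f x) (f y))) (ℚP.+-assoc (f y) (f x) _)))
  Σ-↭ f (↭.trans r s) = trans (Σ-↭ f r) (Σ-↭ f s)

  Σ-cong : ∀ {f g : A → ℚ} xs → (∀ {x} → x ∈ xs → f x ≡ g x) → ΣQ f xs ≡ ΣQ g xs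
  Σ-cong xs e = cong sumQ (LP.map-cong-local (All.tabulate e))

  Σ-zero : ∀ (f : A → ℚ) xs → (∀ {x} → x ∈ xs → f x ≡ ℚ.0ℚ) → ΣQ f xs ≡ ℚ.0ℚ
  Σ-zero f [] e = refl
  Σ-zero f (x ∷ xs) e = trans (cong₂ ℚ._+_ (e (here refl)) (Σ-zero f xs (e ∘ there))) refl

  Σ-+ : ∀ (f g : A → ℚ) xs → ΣQ (λ x → f x ℚ.+ g x) xs ≡ ΣQ f xs ℚ.+ ΣQ g xs
  Σ-+ f g [] = refl
  Σ-+ f g (x ∷ xs) = trans (cong ((f x ℚ.+ g x) ℚ.+_) (Σ-+ f g xs)) (interchange (f x) (g x) (ΣQ f xs) (ΣQ g xs))
    where
    interchange : ∀ a b c d → (a ℚ.+ b) ℚ.+ (c ℚ.+ d) ≡ (a ℚ.+ c) ℚ.+ (b ℚ.+ d)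
    interchange a b c d = trans (ℚP.+-assoc a b _) (trans (cong (a ℚ.+_) (trans (sym (ℚP.+-assoc b c d)) (trans (cong (ℚ._+ d) (ℚP.+-comm b c)) (ℚP.+-assoc c b d)))) (sym (ℚP.+-assoc a c _)))

  Σ-neg : ∀ (f : A → ℚ) xs → ΣQ (λ x → ℚ.- f x) xs ≡ ℚ.- ΣQ f xs
  Σ-neg f [] = refl
  Σ-neg f (x ∷ xs) = trans (cong ((ℚ.- f x) ℚ.+_) (Σ-neg f xs)) (sym (ℚP.neg-distrib-+ (f x) (ΣQ f xs)))

  Σ-scale : ∀ c (f : A → ℚ) xs → ΣQ (λ x → c ℚ.* f x) xs ≡ c ℚ.* ΣQ f xs
  Σ-scale c f [] = sym (ℚP.*-zeroʳ c)
  Σ-scale c f (x ∷ xs) = trans (cong ((c ℚ.* f x) ℚ.+_) (Σ-scale c f xs)) (sym (ℚP.*-distribˡ-+ c (f x) (ΣQ f xs)))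

  Σ-scaleʳ : ∀ c (f : A → ℚ) xs → ΣQ (λ x → f x ℚ.* c) xs ≡ ΣQ f xs ℚ.* c
  Σ-scaleʳ c f xs = trans (Σ-cong xs (λ {x} _ → ℚP.*-comm (f x) c)) (trans (Σ-scale c f xs) (ℚP.*-comm c _))

  Σ-filter : ∀ (p : A → Bool) (f : A → ℚ) xs → ΣQ (λ x → if p x then f x else ℚ.0ℚ) xs ≡ ΣQ f (filterB p xs)
  Σ-filter p f [] = refl
  Σ-filter p f (x ∷ xs) with p x
  ... | true  = cong (f x ℚ.+_) (Σ-filter p f xs)
  ... | false = trans (ℚP.+-identityˡ _) (Σ-filter p f xs)

  Σ-single : ∀ (f : A → ℚ) {xs x} → Unique xs → x ∈ xs → (∀ {y} → y ∈ xs → y ≢ x → f y ≡ ℚ.0ℚ) → ΣQ f xs ≡ f x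
  Σ-single f {x ∷ xs} (h ∷ u) (here refl) z = trans (cong (f x ℚ.+_) (Σ-zero f xs (λ m → z (there m) (λ e → All.lookup h m (sym e))))) (ℚP.+-identityʳ (f x))
  Σ-single f {y ∷ xs} (h ∷ u) (there m) z = trans (cong₂ ℚ._+_ (z (here refl) (All.lookup h m)) (Σ-single f u m (z ∘ there))) (ℚP.+-identityˡ _)

  filterB-∈ : ∀ (p : A → Bool) xs {x} → x ∈ filterB p xs → (x ∈ xs) × (p x ≡ true)
  filterB-∈ p (y ∷ xs) m with p y in e
  filterB-∈ p (y ∷ xs) (here refl) | true = here refl , e
  filterB-∈ p (y ∷ xs) (there m) | true = let a , b = filterB-∈ p xs m in there a , b
  ... | false = let a , b = filterB-∈ p xs m in there a , b

  ∈-filterB : ∀ (p : A → Bool) xs {x} → x ∈ xs → p x ≡ true → x ∈ filterB p xs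
  ∈-filterB p (y ∷ xs) (here refl) e rewrite e = here refl
  ∈-filterB p (y ∷ xs) (there m) e with p y
  ... | true  = there (∈-filterB p xs m e)
  ... | false = ∈-filterB p xs m e

  filterB-unique : ∀ (p : A → Bool) {xs} → Unique xs → Unique (filterB p xs)
  filterB-unique p [] = []
  filterB-unique p {x ∷ xs} (h ∷ u) with p x
  ... | true  = All.tabulate (λ m → All.lookup h (proj₁ (filterB-∈ p xs m))) ∷ filterB-unique p u
  ... | false = filterB-unique p u

  countB-filter : ∀ (p : A → Bool) xs → countB p xs ≡ length (filterB p xs)
  countB-filter p [] = refl
  countB-filter p (x ∷ xs) with p x
  ... | true  = cong suc (countB-filter p xs)
  ... | false = countB-filter p xs

module _ {A B : Set} where
  Σ-map : ∀ (f : B → ℚ) (g : A → B) xs → ΣQ f (map g xs) ≡ ΣQ (f ∘ g) xs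
  Σ-map f g xs = cong sumQ (sym (LP.map-∘ xs))

  sumQ-concatMap : ∀ (f : A → List ℚ) xs → sumQ (concatMap f xs) ≡ ΣQ (sumQ ∘ f) xs
  sumQ-concatMap f [] = refl
  sumQ-concatMap f (x ∷ xs) = trans (sumQ-++ {A} (f x) (concatMap f xs)) (cong (sumQ (f x) ℚ.+_) (sumQ-concatMap f xs))

  Σ-concatMap : ∀ (h : B → ℚ) (f : A → List B) xs → ΣQ h (concatMap f xs) ≡ ΣQ (λ x → ΣQ h (f x)) xs
  Σ-concatMap h f [] = refl
  Σ-concatMap h f (x ∷ xs) = trans (cong sumQ (LP.map-++ h (f x) (concatMap f xs)))
    (trans (sumQ-++ {A} (map h (f x)) _) (cong (ΣQ h (f x) ℚ.+_) (Σ-concatMap h f xs)))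

  Σ-swap : ∀ (f : A → B → ℚ) xs ys → ΣQ (λ x → ΣQ (f x) ys) xs ≡ ΣQ (λ y → ΣQ (λ x → f x y) xs) ys
  Σ-swap f [] ys = sym (Σ-zero _ ys (λ _ → refl))
  Σ-swap f (x ∷ xs) ys = trans (cong (ΣQ (f x) ys ℚ.+_) (Σ-swap f xs ys)) (sym (Σ-+ (f x) (λ y → ΣQ (λ x → f x y) xs) ys))

ι : ℕ → ℚ
ι k = (+ k) ℚ./ 1

ι-+ : ∀ a b → ι (a ℕ.+ b) ≡ ι a ℚ.+ ι b
ι-+ a b = ℚP.toℚᵘ-injective (ℚᵘP.≃-trans (ℚP.toℚᵘ-fromℚᵘ (ℚᵘ.mkℚᵘ (+ (a ℕ.+ b)) 0)) (ℚᵘP.≃-trans eqn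
    (ℚᵘP.≃-sym (ℚᵘP.≃-trans (ℚP.toℚᵘ-homo-+ (ι a) (ι b)) (ℚᵘP.+-cong (ℚP.toℚᵘ-fromℚᵘ (ℚᵘ.mkℚᵘ (+ a) 0)) (ℚP.toℚᵘ-fromℚᵘ (ℚᵘ.mkℚᵘ (+ b) 0)))))))
  where
  eqn : ℚᵘ.mkℚᵘ (+ (a ℕ.+ b)) 0 ℚᵘ.≃ (ℚᵘ.mkℚᵘ (+ a) 0 ℚᵘ.+ ℚᵘ.mkℚᵘ (+ b) 0)
  eqn = ℚᵘ.*≡* (cong (ℤ._* + 1) (cong₂ ℤ._+_ (sym (ℤP.*-identityʳ (+ a))) (sym (ℤP.*-identityʳ (+ b)))))

Σ-one : ∀ {A : Set} (xs : List A) → ΣQ (λ _ → ℚ.1ℚ) xs ≡ ι (length xs)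
Σ-one [] = refl
Σ-one (x ∷ xs) = trans (cong (ℚ.1ℚ ℚ.+_) (Σ-one xs)) (sym (ι-+ 1 (length xs)))

self-neg⇒0 : ∀ {x} → x ≡ ℚ.- x → x ≡ ℚ.0ℚ
self-neg⇒0 {x} e with ℚP.<-cmp x ℚ.0ℚ
... | tri≈ _ r _ = r
... | tri< r _ _ = ⊥-elim (ℚP.<-asym r (subst (ℚ.0ℚ ℚ.<_) (sym e) (ℚP.neg-antimono-< r)))
... | tri> _ _ r = ⊥-elim (ℚP.<-asym r (subst (ℚ._< ℚ.0ℚ) (sym e) (ℚP.neg-antimono-< r)))

-- Reindexing by `τ` shows that the sum is its own negative. Fixed points are covered as well, since
-- their terms are then their own negatives.
Σ-involution : ∀ {A : Set} (f : A → ℚ) (τ : A → A) {xs} → Unique xs → (∀ {x} → x ∈ xs → τ x ∈ xs) →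
  (∀ {x} → x ∈ xs → τ (τ x) ≡ x) → (∀ {x} → x ∈ xs → f (τ x) ≡ ℚ.- f x) → ΣQ f xs ≡ ℚ.0ℚ
Σ-involution f τ {xs} u cl iv ng = self-neg⇒0 (trans (Σ-↭ f (↭-sym r)) (trans (Σ-map f τ xs) (trans (Σ-cong xs ng) (Σ-neg f xs))))
  where
  r : map τ xs ↭ xs
  r = unique-⊆-↭ (unique-map τ (λ p q e → trans (sym (iv p)) (trans (cong τ e) (iv q))) u)
    (λ m → case ∈P.∈-map⁻ τ m of λ { (y , m′ , refl) → cl m′ }) (ℕP.≤-reflexive (sym (LP.length-map τ xs)))

neg-invQ : ∀ x → ℚ.- (ℚ.- x) ≡ x
neg-invQ (ℚ.mkℚ (+ zero) _ _)  = refl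
neg-invQ (ℚ.mkℚ (+ suc _) _ _) = refl
neg-invQ (ℚ.mkℚ -[1+ _ ] _ _)  = refl

powNeg1-odd : ∀ a m → powNeg1 (a ℕ.+ suc (m ℕ.+ m)) ≡ ℚ.- powNeg1 a
powNeg1-odd a m = trans (cong powNeg1 (trans (ℕP.+-suc a (m ℕ.+ m)) (cong suc (ℕP.+-comm a (m ℕ.+ m))))) (cong ℚ.-_ (even m))
  where
  even : ∀ m → powNeg1 (m ℕ.+ m ℕ.+ a) ≡ powNeg1 a
  even zero = refl
  even (suc m) = trans (cong (λ k → ℚ.- powNeg1 (k ℕ.+ a)) (ℕP.+-suc m m)) (trans (neg-invQ _) (even m))

sgn-swap : ∀ {xs f a b} → AllPairs _<_ xs → (∀ {p q} → p ∈ xs → q ∈ xs → f p ≡ f q → p ≡ q) → a ∈ xs → b ∈ xs → a ≢ b →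
           sgnPerm (map (f ∘ swp a b) xs) ≡ ℚ.- sgnPerm (map f xs)
sgn-swap {xs} {f} {a} {b} s fi a∈ b∈ ne = go (ℤP.<-cmp a b)
  where
  core : ∀ {f a b} → (∀ {p q} → p ∈ xs → q ∈ xs → f p ≡ f q → p ≡ q) → a ∈ xs → b ∈ xs → a < b →
         sgnPerm (map (f ∘ swp a b) xs) ≡ ℚ.- sgnPerm (map f xs)
  core {f} {a} {b} fi a∈ b∈ a<b with ℤP.<-cmp (f a) (f b)
  ... | tri≈ _ e _ = ⊥-elim (ℤP.<⇒≢ a<b (fi a∈ b∈ e))
  ... | tri< r _ _ = let m , e = inv-map-swp s {f} fi a∈ b∈ a<b r in trans (cong powNeg1 e) (powNeg1-odd (invZ (map f xs)) m)
  -- If `f` inverts the pair, then `f ∘ swp a b` does not; the count is applied to the latter, and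
  -- exchanging twice gives back `f`.
  ... | tri> _ _ r = trans (sym (neg-invQ _)) (cong ℚ.-_ (sym (trans (cong powNeg1 (trans (cong invZ (sym twice)) e)) (powNeg1-odd (invZ (map (f ∘ swp a b) xs)) m))))
    where
    g = f ∘ swp a b
    sw∈ : ∀ {p} → p ∈ xs → swp a b p ∈ xs
    sw∈ = swp-closed {_∈ xs} a∈ b∈
    res = inv-map-swp s {g} (λ {p} {q} x y e → trans (sym (swp-inv a b p)) (trans (cong (swp a b) (fi (sw∈ x) (sw∈ y) e)) (swp-inv a b q))) a∈ b∈ a<b
            (subst₂ _<_ (cong f (sym (swp-l a b))) (cong f (sym (swp-r a b))) r)
    m = proj₁ res
    e = proj₂ res
    twice : map (g ∘ swp a b) xs ≡ map f xs
    twice = LP.map-cong (λ z → cong f (swp-inv a b z)) xs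
  swp-comm : ∀ z → swp a b z ≡ swp b a z
  swp-comm z with swpView a b z
  ... | isˡ refl e = trans e (sym (swp-r b a))
  ... | isʳ refl e = trans e (sym (swp-l b a))
  ... | isᵒ p q e = trans e (sym (swp-o q p))
  go : _ → sgnPerm (map (f ∘ swp a b) xs) ≡ ℚ.- sgnPerm (map f xs)
  go (tri< r _ _) = core fi a∈ b∈ r
  go (tri≈ _ e _) = ⊥-elim (ne e)
  go (tri> _ _ r) = trans (cong sgnPerm (LP.map-cong (λ z → cong f (swp-comm z)) xs)) (core fi b∈ a∈ r)

prodQ : List ℚ → ℚ
prodQ []       = ℚ.1ℚ
prodQ (x ∷ xs) = x ℚ.* prodQ xs

prodQ-↭ : ∀ {xs ys} → xs ↭ ys → prodQ xs ≡ prodQ ys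
prodQ-↭ ↭.refl = refl
prodQ-↭ (prep x r) = cong (x ℚ.*_) (prodQ-↭ r)
prodQ-↭ {_} {_ ∷ _ ∷ ys} (swap x y r) = trans (cong (λ s → x ℚ.* (y ℚ.* s)) (prodQ-↭ r))
  (trans (sym (ℚP.*-assoc x y _)) (trans (cong (ℚ._* prodQ ys) (ℚP.*-comm x y)) (ℚP.*-assoc y x _)))
prodQ-↭ (↭.trans r s) = trans (prodQ-↭ r) (prodQ-↭ s)

-- Colorings and their signed terms.

col : List ℤ → ℤ → ℤ
col κ z = nthZ κ (∣ z ∣ ∸ 1)

col-neg : ∀ κ z → col κ (- z) ≡ col κ z
col-neg κ z = cong (λ k → nthZ κ (k ∸ 1)) (ℤP.∣-i∣≡∣i∣ z)

map-col : ∀ {n} κ → length κ ≡ n → map (col κ) (posZ n) ≡ κ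
map-col {n} κ l = trans (LP.map-cong-local (All.tabulate λ m → same (∈-posZ⁻ m))) (win-map κ l)
  where
  same : ∀ {z} → (+ 0 < z) × (z ≤ + n) → col κ z ≡ ev κ z
  same {+ zero} (p , _) = ⊥-elim (ℤP.<-irrefl refl p)
  same {+ suc k} _ = refl

map-≡-∈ : ∀ {A B : Set} {f g : A → B} xs → map f xs ≡ map g xs → ∀ {x} → x ∈ xs → f x ≡ g x
map-≡-∈ (x ∷ xs) e (here refl) = LP.∷-injectiveˡ e
map-≡-∈ (x ∷ xs) e (there m) = map-≡-∈ xs (LP.∷-injectiveʳ e) m

eqLZ-true : ∀ {x y} → x ≡ y → eqLZ x y ≡ true
eqLZ-true {x} refl with LP.≡-dec ℤ._≟_ x x
... | yes _ = refl
... | no n  = ⊥-elim (n refl)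

eqLZ-sound : ∀ {x y} → eqLZ x y ≡ true → x ≡ y
eqLZ-sound {x} {y} e with LP.≡-dec ℤ._≟_ x y
... | yes p = p
eqLZ-sound () | no _

posOrNeg : ∀ {n z} → Wire n z → (z ∈ posZ n) ⊎ (- z ∈ posZ n)
posOrNeg {n} {z} w with ℤP.<-cmp z (+ 0)
... | tri≈ _ e _ = ⊥-elim (proj₁ w e)
... | tri> _ _ p = inj₁ (∈-posZ p (proj₂ (proj₂ w)))
... | tri< p _ _ = inj₂ (∈-posZ (ℤP.neg-mono-< p) (proj₂ (proj₂ (Wire-neg w))))

presB : List ℤ → List ℤ → Bool
presB κ v = eqLZ (map (col κ) v) κ

Pres : ℕ → List ℤ → List ℤ → Set
Pres n κ v = ∀ z → Wire n z → col κ (ev v z) ≡ col κ z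

module _ {n : ℕ} {κ v : List ℤ} (lκ : length κ ≡ n) (lv : length v ≡ n) where
  presB-sound : presB κ v ≡ true → Pres n κ v
  presB-sound e z w = [ at , (λ m → trans (sym (col-neg κ (ev v z))) (trans (cong (col κ) (sym (ev-neg v z))) (trans (at m) (col-neg κ z)))) ]′ (posOrNeg w)
    where
    at : ∀ {z} → z ∈ posZ n → col κ (ev v z) ≡ col κ z
    at = map-≡-∈ (posZ n) (trans (LP.map-∘ (posZ n)) (trans (cong (map (col κ)) (win-map v lv)) (trans (eqLZ-sound e) (sym (map-col κ lκ)))))

  presB-true : Pres n κ v → presB κ v ≡ true
  presB-true p = eqLZ-true (trans (cong (map (col κ)) (sym (win-map v lv))) (trans (sym (LP.map-∘ (posZ n)))
    (trans (LP.map-cong-local (All.tabulate λ m → p _ (posZ-wire m))) (map-col κ lκ))))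

sgf : ℤ → ℤ → ℚ
sgf c x = if ltZ c (+ 0) ∧ ltZ x (+ 0) then ℚ.- ℚ.1ℚ else ℚ.1ℚ

negSign : ℕ → List ℤ → List ℤ → ℚ
negSign n κ v = prodQ (map (λ z → sgf (col κ z) (ev v z)) (posZ n))

-- The contribution to the induced character at `v` of a coloring fixed by `φ v`.
signedTerm : ℕ → List ℤ → List ℤ → ℚ
signedTerm n κ v = sgnPerm (absL v) ℚ.* negSign n κ v

pos-swp : ∀ {n i j z} → i ∈ posZ n → j ∈ posZ n → z ∈ posZ n → ss i j z ≡ swp i j z
pos-swp {n} {i} {j} {z} i∈ j∈ z∈ with ssView i j z
... | at-a refl = trans (ss-l i j) (sym (swp-l i j))
... | at-b refl = trans (ss-r i j) (sym (swp-r i j))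
... | at-a⁻ e = ⊥-elim (pos-≢-neg z∈ i∈ e)
... | at-b⁻ e = ⊥-elim (pos-≢-neg z∈ j∈ e)
... | else p q r s = trans (ss-o p q r s) (sym (swp-o p q))

pos-abs : ∀ {n z} → z ∈ posZ n → + ∣ z ∣ ≡ z
pos-abs m = ℤP.0≤i⇒+∣i∣≡i (ℤP.<⇒≤ (proj₁ (∈-posZ⁻ m)))

abs-pos : ∀ {n z} → Wire n z → + ∣ z ∣ ∈ posZ n
abs-pos {n} {z} w = ∈P.∈-map⁺ +_ (wire-abs w)

abs-ss : ∀ {n i j y} → i ∈ posZ n → j ∈ posZ n → + ∣ ss i j y ∣ ≡ swp i j (+ ∣ y ∣)
abs-ss {n} {i} {j} {y} i∈ j∈ with ssView i j y
... | at-a refl = trans (cong (λ x → + ∣ x ∣) (ss-l i j)) (trans (pos-abs j∈) (sym (trans (cong (swp i j) (pos-abs i∈)) (swp-l i j))))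
... | at-b refl = trans (cong (λ x → + ∣ x ∣) (ss-r i j)) (trans (pos-abs i∈) (sym (trans (cong (swp i j) (pos-abs j∈)) (swp-r i j))))
... | at-a⁻ refl = trans (cong (λ x → + ∣ x ∣) (ss-nl j (proj₁ (posZ-wire i∈)))) (trans (cong +_ (ℤP.∣-i∣≡∣i∣ j)) (trans (pos-abs j∈)
      (sym (trans (cong (swp i j) (trans (cong +_ (ℤP.∣-i∣≡∣i∣ i)) (pos-abs i∈))) (swp-l i j)))))
... | at-b⁻ refl = trans (cong (λ x → + ∣ x ∣) (ss-nr i (proj₁ (posZ-wire j∈)))) (trans (cong +_ (ℤP.∣-i∣≡∣i∣ i)) (trans (pos-abs i∈)
      (sym (trans (cong (swp i j) (trans (cong +_ (ℤP.∣-i∣≡∣i∣ j)) (pos-abs j∈))) (swp-r i j)))))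
... | else p q r s = trans (cong (λ x → + ∣ x ∣) (ss-o p q r s)) (sym (swp-o (off p r) (off q s)))
  where
  off : ∀ {k} → y ≢ k → y ≢ - k → + ∣ y ∣ ≢ k
  off {k} a b e with ℤP.+∣i∣≡i⊎+∣i∣≡-i y
  ... | inj₁ r = a (trans (sym r) e)
  ... | inj₂ r = b (neg-swap (trans (sym r) e))

absF : List ℤ → ℤ → ℤ
absF v z = + ∣ ev v z ∣

absL-map : ∀ {n v} → length v ≡ n → absL v ≡ map (absF v) (posZ n)
absL-map {n} {v} l = trans (cong absL (sym (win-map v l))) (sym (LP.map-∘ (posZ n)))

absF-inj : ∀ {n v} → SignedPerm n v → ∀ {p q} → p ∈ posZ n → q ∈ posZ n → absF v p ≡ absF v q → p ≡ q
absF-inj {n} {v} V {p} {q} a b e with abs-≡ {ev v p} (ℤP.+-injective e)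
... | inj₁ r = inj (sp-perm V) (posZ-wire a) (posZ-wire b) r
... | inj₂ r = ⊥-elim (pos-≢-neg a b (inj (sp-perm V) (posZ-wire a) (Wire-neg (posZ-wire b)) (trans r (sym (ev-neg v q)))))

sgn-row : ∀ {n v v′ i j} → SignedPerm n v → length v′ ≡ n → i ∈ posZ n → j ∈ posZ n → i ≢ j →
          (∀ z → Wire n z → ev v′ z ≡ ev v (ss i j z)) → sgnPerm (absL v′) ≡ ℚ.- sgnPerm (absL v)
sgn-row {n} {v} {v′} {i} {j} V l i∈ j∈ ne e =
  trans (cong sgnPerm (trans (absL-map l) (LP.map-cong-local (All.tabulate λ m → cong (λ x → + ∣ x ∣) (trans (e _ (posZ-wire m)) (cong (ev v) (pos-swp i∈ j∈ m)))))))
    (trans (sgn-swap (posZ-sorted n) (absF-inj V) i∈ j∈ ne) (cong (ℚ.-_ ∘ sgnPerm) (sym (absL-map (proj₁ V)))))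

-- On absolute values, exchanging the values `i` and `j` is the same as exchanging the two positions
-- at which they are taken.
sgn-col : ∀ {n v v′ i j} → SignedPerm n v → length v′ ≡ n → i ∈ posZ n → j ∈ posZ n → i ≢ j →
          (∀ z → Wire n z → ev v′ z ≡ ss i j (ev v z)) → sgnPerm (absL v′) ≡ ℚ.- sgnPerm (absL v)
sgn-col {n} {v} {v′} {i} {j} V l i∈ j∈ ne e =
  trans (cong sgnPerm (trans (absL-map l) (LP.map-cong-local (All.tabulate λ {z} m →
      trans (cong (λ x → + ∣ x ∣) (e z (posZ-wire m))) (trans (abs-ss {y = ev v z} i∈ j∈)
        (sym (trans (swp-conj (absF v) (_∈ posZ n) (absF-inj V) i′∈ j′∈ m) (cong₂ (λ p q → swp p q (absF v z)) fi fj))))))))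
    (trans (sgn-swap (posZ-sorted n) (absF-inj V) i′∈ j′∈ (λ { r → ne (trans (sym fi) (trans (cong (absF v) r) fj)) })) (cong (ℚ.-_ ∘ sgnPerm) (sym (absL-map (proj₁ V)))))
  where
  pre : ∀ {k} → k ∈ posZ n → ∃ λ k′ → (k′ ∈ posZ n) × (absF v k′ ≡ k)
  pre {k} k∈ with surj (sp-perm V) (posZ-wire k∈)
  ... | p , wp , r with posOrNeg wp
  ... | inj₁ m = p , m , trans (cong (λ x → + ∣ x ∣) r) (pos-abs k∈)
  ... | inj₂ m = - p , m , trans (cong (λ x → + ∣ x ∣) (trans (ev-neg v p) (cong -_ r))) (trans (cong +_ (ℤP.∣-i∣≡∣i∣ k)) (pos-abs k∈))
  i′∈ = proj₁ (proj₂ (pre i∈))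
  j′∈ = proj₁ (proj₂ (pre j∈))
  fi = proj₂ (proj₂ (pre i∈))
  fj = proj₂ (proj₂ (pre j∈))

col-ss : ∀ κ {a b} → a ≢ + 0 → b ≢ + 0 → col κ a ≡ col κ b → ∀ z → col κ (ss a b z) ≡ col κ z
col-ss κ {a} {b} a≢0 b≢0 e z with ssView a b z
... | at-a refl = trans (cong (col κ) (ss-l a b)) (sym e)
... | at-b refl = trans (cong (col κ) (ss-r a b)) e
... | at-a⁻ refl = trans (cong (col κ) (ss-nl b a≢0)) (trans (col-neg κ b) (trans (sym e) (sym (col-neg κ a))))
... | at-b⁻ refl = trans (cong (col κ) (ss-nr a b≢0)) (trans (col-neg κ a) (trans e (sym (col-neg κ b))))
... | else p q r s = cong (col κ) (ss-o p q r s)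

-- The two positions have the same color, so the factors of the product are only permuted.
negSign-row : ∀ {n κ v v′ i j} → i ∈ posZ n → j ∈ posZ n → col κ i ≡ col κ j →
              (∀ z → Wire n z → ev v′ z ≡ ev v (ss i j z)) → negSign n κ v′ ≡ negSign n κ v
negSign-row {n} {κ} {v} {v′} {i} {j} i∈ j∈ ce e = trans (cong prodQ (trans (LP.map-cong-local (All.tabulate λ {z} m →
      cong₂ sgf (sym (trans (cong (col κ) (sym (pos-swp i∈ j∈ m))) (col-ss κ (proj₁ (posZ-wire i∈)) (proj₁ (posZ-wire j∈)) ce z)))
        (trans (e z (posZ-wire m)) (cong (ev v) (pos-swp i∈ j∈ m))))) (LP.map-∘ (posZ n))))
    (prodQ-↭ (↭P.map⁺ h (unique-⊆-↭ (unique-map (swp i j) (λ {p} {q} _ _ r → trans (sym (swp-inv i j p)) (trans (cong (swp i j) r) (swp-inv i j q))) (sorted-unique (posZ-sorted n)))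
      (λ m → case ∈P.∈-map⁻ (swp i j) m of λ { (y , m′ , refl) → swp-closed {_∈ posZ n} i∈ j∈ m′ }) (ℕP.≤-reflexive (sym (LP.length-map (swp i j) (posZ n)))))))
  where
  h : ℤ → ℚ
  h z = sgf (col κ z) (ev v z)

sgf-sign : ∀ c {x y} → ltZ x (+ 0) ≡ ltZ y (+ 0) → sgf c x ≡ sgf c y
sgf-sign c e = cong (λ b → if ltZ c (+ 0) ∧ b then ℚ.- ℚ.1ℚ else ℚ.1ℚ) e

pos-ltZ : ∀ {n k} → k ∈ posZ n → ltZ k (+ 0) ≡ false
pos-ltZ m = ltZ-false (ℤP.<⇒≤ (proj₁ (∈-posZ⁻ m)))

neg-ltZ : ∀ {n k} → k ∈ posZ n → ltZ (- k) (+ 0) ≡ true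
neg-ltZ m = ltZ-true (ℤP.neg-mono-< (proj₁ (∈-posZ⁻ m)))

ss-sign : ∀ {n i j y} → i ∈ posZ n → j ∈ posZ n → ltZ (ss i j y) (+ 0) ≡ ltZ y (+ 0)
ss-sign {n} {i} {j} {y} i∈ j∈ with ssView i j y
... | at-a refl = trans (cong (λ x → ltZ x (+ 0)) (ss-l i j)) (trans (pos-ltZ j∈) (sym (pos-ltZ i∈)))
... | at-b refl = trans (cong (λ x → ltZ x (+ 0)) (ss-r i j)) (trans (pos-ltZ i∈) (sym (pos-ltZ j∈)))
... | at-a⁻ refl = trans (cong (λ x → ltZ x (+ 0)) (ss-nl j (proj₁ (posZ-wire i∈)))) (trans (neg-ltZ j∈) (sym (neg-ltZ i∈)))
... | at-b⁻ refl = trans (cong (λ x → ltZ x (+ 0)) (ss-nr i (proj₁ (posZ-wire j∈)))) (trans (neg-ltZ i∈) (sym (neg-ltZ j∈)))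
... | else p q r s = cong (λ x → ltZ x (+ 0)) (ss-o p q r s)

negSign-col : ∀ {n κ v v′ i j} → i ∈ posZ n → j ∈ posZ n → (∀ z → Wire n z → ev v′ z ≡ ss i j (ev v z)) → negSign n κ v′ ≡ negSign n κ v
negSign-col {n} {κ} {v} {v′} i∈ j∈ e = cong prodQ (LP.map-cong-local (All.tabulate λ {z} m →
  sgf-sign (col κ z) {ev v′ z} {ev v z} (trans (cong (λ x → ltZ x (+ 0)) (e z (posZ-wire m))) (ss-sign {y = ev v z} i∈ j∈))))

below-none : ∀ {x ys} → All (x <_) ys → below x ys ≡ 0
below-none [] = refl
below-none (p ∷ ps) rewrite ltZ-false (ℤP.<⇒≤ p) = below-none ps

inv-sorted : ∀ {xs} → AllPairs _<_ xs → invZ xs ≡ 0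
inv-sorted [] = refl
inv-sorted (h ∷ t) = cong₂ ℕ._+_ (below-none h) (inv-sorted t)

prodQ-ones : ∀ {xs} → All (_≡ ℚ.1ℚ) xs → prodQ xs ≡ ℚ.1ℚ
prodQ-ones [] = refl
prodQ-ones (refl ∷ a) = trans (ℚP.*-identityˡ _) (prodQ-ones a)

signChoices : (ℤ → Bool) → List ℤ → List (List ℤ)
signChoices G []       = [] ∷ []
signChoices G (z ∷ zs) = if G z then map (z ∷_) (signChoices G zs) ++ map (- z ∷_) (signChoices G zs) else map (z ∷_) (signChoices G zs)

groundWeight : (ℤ → Bool) → List ℤ → ℕ
groundWeight G []       = 1
groundWeight G (z ∷ zs) = (if G z then 2 else 1) ℕ.* groundWeight G zs

length-signChoices : ∀ G zs → length (signChoices G zs) ≡ groundWeight G zs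
length-signChoices G [] = refl
length-signChoices G (z ∷ zs) with G z
... | true  = trans (LP.length-++ (map (z ∷_) (signChoices G zs))) (cong₂ ℕ._+_ (trans (LP.length-map (z ∷_) (signChoices G zs)) (length-signChoices G zs))
                (trans (LP.length-map (- z ∷_) (signChoices G zs)) (trans (length-signChoices G zs) (sym (ℕP.+-identityʳ _)))))
... | false = trans (LP.length-map (z ∷_) (signChoices G zs)) (trans (length-signChoices G zs) (sym (ℕP.+-identityʳ _)))

Flip : (ℤ → Bool) → ℤ → ℤ → Set
Flip G z x = (x ≡ z) ⊎ ((x ≡ - z) × (G z ≡ true))

signChoices-∈ : ∀ G zs (f : ℤ → ℤ) → (∀ {z} → z ∈ zs → Flip G z (f z)) → map f zs ∈ signChoices G zs
signChoices-∈ G [] f h = here refl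
signChoices-∈ G (z ∷ zs) f h with G z in g | h (here refl)
... | true  | inj₁ e rewrite e = ∈P.∈-++⁺ˡ (∈P.∈-map⁺ (z ∷_) (signChoices-∈ G zs f (h ∘ there)))
... | true  | inj₂ (e , _) rewrite e = ∈P.∈-++⁺ʳ _ (∈P.∈-map⁺ (- z ∷_) (signChoices-∈ G zs f (h ∘ there)))
... | false | inj₁ e rewrite e = ∈P.∈-map⁺ (z ∷_) (signChoices-∈ G zs f (h ∘ there))
... | false | inj₂ (_ , ())

signChoices-∈⁻ : ∀ G zs {v} → v ∈ signChoices G zs → (length v ≡ length zs) × (map ∣_∣ v ≡ map ∣_∣ zs) × (∀ k → k ℕ.< length zs → Flip G (nthZ zs k) (nthZ v k))
signChoices-∈⁻ G [] (here refl) = refl , refl , λ k ()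
signChoices-∈⁻ G (z ∷ zs) {v} m with G z in g
... | false with ∈P.∈-map⁻ (z ∷_) m
...   | v′ , m′ , refl = let a , b , c = signChoices-∈⁻ G zs m′ in cong suc a , cong (∣ z ∣ ∷_) b , λ { zero _ → inj₁ refl ; (suc k) (s≤s p) → c k p }
signChoices-∈⁻ G (z ∷ zs) {v} m | true with ∈P.∈-++⁻ (map (z ∷_) (signChoices G zs)) m
... | inj₁ m₁ with ∈P.∈-map⁻ (z ∷_) m₁
...   | v′ , m′ , refl = let a , b , c = signChoices-∈⁻ G zs m′ in cong suc a , cong (∣ z ∣ ∷_) b , λ { zero _ → inj₁ refl ; (suc k) (s≤s p) → c k p }
signChoices-∈⁻ G (z ∷ zs) {v} m | true | inj₂ m₁ with ∈P.∈-map⁻ (- z ∷_) m₁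
...   | v′ , m′ , refl = let a , b , c = signChoices-∈⁻ G zs m′ in cong suc a , cong₂ _∷_ (ℤP.∣-i∣≡∣i∣ z) b , λ { zero _ → inj₂ (refl , g) ; (suc k) (s≤s p) → c k p }

signChoices-unique : ∀ G zs → All (_≢ + 0) zs → Unique (signChoices G zs)
signChoices-unique G [] _ = [] ∷ []
signChoices-unique G (z ∷ zs) (z≢0 ∷ a) with G z
... | false = UP.map⁺ LP.∷-injectiveʳ (signChoices-unique G zs a)
... | true = UP.++⁺ (UP.map⁺ LP.∷-injectiveʳ (signChoices-unique G zs a)) (UP.map⁺ LP.∷-injectiveʳ (signChoices-unique G zs a))
  λ (p , q) → case ∈P.∈-map⁻ (z ∷_) p of λ { (_ , _ , refl) → case ∈P.∈-map⁻ (- z ∷_) q of λ { (_ , _ , e) → ≢-neg z≢0 (LP.∷-injectiveˡ e) } }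

share? : ∀ Is i j → Dec (Share Is i j)
share? Is i j = Any.any? (λ K → (i ∈ᴵ? K) ×-dec (j ∈ᴵ? K)) Is

-- The signed sum for a fixed coloring.

module SignedSum {n : ℕ} {Is : List Interval} {w : List ℤ} (z : ZZ Is) (gs : All (Good n) Is) (sp : SignedPerm n w) (mx : IsMaxType Is (wiresZ n) (full w))
                 (L : List (List ℤ)) (be : BruhatEnum n w L) (κ : List ℤ) (lκ : length κ ≡ n) where
  open Maximal z gs sp mx using (path-symm)
  open Interval-below z gs sp mx

  private
    L-out : ∀ {v} → v ∈ L → SignedPerm n v × Compat n Is (ev v)
    L-out {v} m = let a , b = proj₁ (proj₂ be v) m in a , below⇒compat b

    L-in : ∀ {v} → SignedPerm n v → Compat n Is (ev v) → v ∈ L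
    L-in {v} V c = proj₂ (proj₂ be v) (V , compat⇒below V c)

    L′ : List (List ℤ)
    L′ = filterB (presB κ) L

    L′-unique : Unique L′
    L′-unique = filterB-unique (presB κ) (proj₁ be)

    record Fixed (v : List ℤ) : Set where
      constructor fixed
      field
        spv  : SignedPerm n v
        comp : Compat n Is (ev v)
        pres : Pres n κ v
    open Fixed

    L′-out : ∀ {v} → v ∈ L′ → Fixed v
    L′-out m = let a , b = filterB-∈ (presB κ) L m
                   V , c = L-out a in fixed V c (presB-sound lκ (proj₁ V) b)

    L′-in : ∀ {v} → Fixed v → v ∈ L′
    L′-in (fixed V c p) = ∈-filterB (presB κ) L (L-in V c) (presB-true lκ (proj₁ V) p)

  total : ℚ
  total = ΣQ (λ v → if presB κ v then signedTerm n κ v else ℚ.0ℚ) L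

  private
    total-L′ : total ≡ ΣQ (signedTerm n κ) L′
    total-L′ = Σ-filter (presB κ) (signedTerm n κ) L

  Clash : ℤ → ℤ → Set
  Clash i j = (i < j) × (col κ i ≡ col κ j) × Share Is i j

  private
    pos-between : ∀ {e l} → e ∈ posZ n → Wire n l → e < l → l ∈ posZ n
    pos-between e∈ wl r = ∈-posZ (ℤP.<-trans (proj₁ (∈-posZ⁻ e∈)) r) (proj₂ (proj₂ wl))

    -- A class that crosses the level e upwards also crosses it downwards, and the two paths make e share a layer.
    crossing : ∀ {v} → Fixed v → ∀ {e a} → e ∈ posZ n → Wire n a → col κ a ≡ col κ e → a ≤ e → e < ev v a →
               ∃ λ l → (l ∈ posZ n) × Clash e l
    crossing {v} (fixed V c p) {e} {a} e∈ wa ce a≤e e<va with cross-back {P = _≤ e} (sp-perm V) wa (ℤ._≤? e) a≤e (<⇒≱ᶻ e<va)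
    ... | k , nb , fb = go (ℤP.≤-total x b)
      where
      f = ev v
      F = sp-perm V
      x = f a
      wx = wire F wa
      b = iter f k a
      wb = iter-wire F k wa
      we = posZ-wire e∈
      cb : ∀ k → col κ (iter f k a) ≡ col κ e
      cb zero = ce
      cb (suc k) = trans (p _ (iter-wire F k wa)) (cb k)
      e<b = ℤP.≰⇒> nb
      nz : ∀ {y} → Wire n y → y ≢ + 0
      nz = proj₁
      up-e : Path Is e x
      up-e with ℤP.<-cmp a e
      ... | tri≈ _ refl _ = c a wa
      ... | tri> _ _ r = ⊥-elim (<⇒≱ᶻ r a≤e)
      ... | tri< r _ _ = proj₂ (uncross (nz wa) (nz we) r e<va (c a wa) (straight Is e))
      down-e : Path Is b e
      down-e with ℤP.<-cmp (f b) e
      ... | tri≈ _ r _ = subst (Path Is b) r (c b wb)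
      ... | tri> _ _ r = ⊥-elim (<⇒≱ᶻ r fb)
      ... | tri< r _ _ = proj₂ (uncross (nz we) (nz wb) e<b r (straight Is e) (c b wb))
      -- There are paths from `e` to `x` and from `b` to `e`. The smaller of `x` and `b` is taken as
      -- `l`: uncrossing with its straight path turns the path at the larger one into a path at the
      -- smaller.
      go : (x ≤ b) ⊎ (b ≤ x) → ∃ λ l → (l ∈ posZ n) × Clash e l
      go (inj₁ x≤b) = x , pos-between e∈ wx e<va , e<va , sym (trans (p a wa) ce) , both⇒share z (nz we) (nz wx) e<va up-e back
        where
        back : Path Is x e
        back with ℤP.<-cmp x b
        ... | tri≈ _ r _ = subst (λ y → Path Is y e) (sym r) down-e
        ... | tri> _ _ r = ⊥-elim (<⇒≱ᶻ r x≤b)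
        ... | tri< r _ _ = proj₁ (uncross (nz wx) (nz wb) r e<va (straight Is x) down-e)
      go (inj₂ b≤x) = b , pos-between e∈ wb e<b , e<b , sym (cb k) , both⇒share z (nz we) (nz wb) e<b fwd down-e
        where
        fwd : Path Is e b
        fwd with ℤP.<-cmp b x
        ... | tri≈ _ r _ = subst (Path Is e) (sym r) up-e
        ... | tri> _ _ r = ⊥-elim (<⇒≱ᶻ r b≤x)
        ... | tri< r _ _ = proj₁ (uncross (nz we) (nz wb) e<b r up-e (straight Is b))

    -- The orbit has to rise above `e` again, and `crossing` applies to that step.
    crossing-down : ∀ {v} → Fixed v → ∀ {e b} → e ∈ posZ n → Wire n b → col κ b ≡ col κ e → e < b → ev v b ≤ e →
                    ∃ λ l → (l ∈ posZ n) × Clash e l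
    crossing-down {v} Φ@(fixed V c p) {e} {b} e∈ wb ce e<b fb with cross-back {P = e <_} (sp-perm V) wb (e ℤ.<?_) e<b (λ r → <⇒≱ᶻ r fb)
    ... | k , na , fa = crossing Φ e∈ (iter-wire (sp-perm V) k wb) (ca k) (ℤP.≮⇒≥ na) fa
      where
      ca : ∀ k → col κ (iter (ev v) k b) ≡ col κ e
      ca zero = ce
      ca (suc k) = trans (p _ (iter-wire (sp-perm V) k wb)) (ca k)

  -- The largest j that clashes with a smaller i: its class stays within [- j , j].
  module Clashing {i j : ℤ} (i∈ : i ∈ posZ n) (j∈ : j ∈ posZ n) (cl : Clash i j) (mxj : ∀ {l} → l ∈ posZ n → ¬ Clash j l) where
    private
      i<j = proj₁ cl
      ce = proj₁ (proj₂ cl)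
      sh = proj₂ (proj₂ cl)
      wi = posZ-wire i∈
      wj = posZ-wire j∈
      Rf = refl-list n i j
      Tsp = refl-sp wi wj
      ne : i ≢ j
      ne = ℤP.<⇒≢ i<j

      stays : ∀ {v} → Fixed v → ∀ {a} → Wire n a → col κ a ≡ col κ j → a ≤ j → ev v a ≤ j
      stays {v} Φ {a} wa ca a≤j with ev v a ℤ.≤? j
      ... | yes r = r
      ... | no r = let l , l∈ , c = crossing Φ j∈ wa ca a≤j (ℤP.≰⇒> r) in ⊥-elim (mxj l∈ c)

      comes : ∀ {v} → Fixed v → ∀ {a} → Wire n a → ev v a ≡ j → a ≤ j
      comes {v} Φ {a} wa e with a ℤ.≤? j
      ... | yes r = r
      ... | no r = let l , l∈ , c = crossing-down Φ j∈ wa (trans (sym (pres Φ a wa)) (cong (col κ) e)) (ℤP.≰⇒> r) (ℤP.≤-reflexive e) in ⊥-elim (mxj l∈ c)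

      -- After right multiplication, paths from `j` to `v i` and from `i` to `v j` are needed. The
      -- first is the hypothesis. For the second, maximality of `j` gives `v j ≤ j`, so the path
      -- from `j` to `v j` can be uncrossed with the one from `i` to `j` through the shared layer.
      rows-zero : (∀ x → Path Is i x → Path Is j x) → ΣQ (signedTerm n κ) L′ ≡ ℚ.0ℚ
      rows-zero rw = Σ-involution (signedTerm n κ) (λ v → compose v Rf) L′-unique (λ m → L′-in (closed (L′-out m))) (λ m → twice (L′-out m)) (λ m → flip (L′-out m))
        where
        evT : ∀ {v} x → Wire n x → ev (compose v Rf) x ≡ ev v (ss i j x)
        evT {v} x wx = trans (ev-compose v Rf x) (cong (ev v) (ev-refl wi wj x wx))
        spT : ∀ {v} → Fixed v → SignedPerm n (compose v Rf)
        spT Φ = sp-compose (spv Φ) Tsp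
        to-j : ∀ {v} → Fixed v → Path Is j (ev v i)
        to-j {v} Φ = rw _ (comp Φ i wi)
        to-i : ∀ {v} → Fixed v → Path Is i (ev v j)
        to-i {v} Φ with ℤP.<-cmp (ev v j) j
        ... | tri≈ _ r _ = subst (Path Is i) (sym r) (share⇒path sh)
        ... | tri> _ _ r = ⊥-elim (<⇒≱ᶻ r (stays Φ wj refl ℤP.≤-refl))
        ... | tri< r _ _ = proj₁ (uncross (proj₁ wi) (proj₁ wj) i<j r (share⇒path sh) (comp Φ j wj))
        closed : ∀ {v} → Fixed v → Fixed (compose v Rf)
        closed {v} Φ = fixed (spT Φ) (λ x wx → subst (Path Is x) (sym (evT {v} x wx)) (go x wx (ssView i j x)))
            (λ x wx → trans (cong (col κ) (evT {v} x wx)) (trans (pres Φ _ (ss-closed wi wj wx)) (col-ss κ (proj₁ wi) (proj₁ wj) ce x)))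
          where
          go : ∀ x → Wire n x → SSView i j x → Path Is x (ev v (ss i j x))
          go x wx (at-a refl) = subst (Path Is i ∘ ev v) (sym (ss-l i j)) (to-i Φ)
          go x wx (at-b refl) = subst (Path Is j ∘ ev v) (sym (ss-r i j)) (to-j Φ)
          go x wx (at-a⁻ refl) = subst (Path Is (- i)) (trans (sym (ev-neg v j)) (cong (ev v) (sym (ss-nl j (proj₁ wi))))) (path-symm wi (to-i Φ))
          go x wx (at-b⁻ refl) = subst (Path Is (- j)) (trans (sym (ev-neg v i)) (cong (ev v) (sym (ss-nr i (proj₁ wj))))) (path-symm wj (to-j Φ))
          go x wx (else p q r s) = subst (Path Is x ∘ ev v) (sym (ss-o p q r s)) (comp Φ x wx)
        twice : ∀ {v} → Fixed v → compose (compose v Rf) Rf ≡ v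
        twice {v} Φ = sp-ext (sp-compose (spT Φ) Tsp) (spv Φ) λ x wx → trans (evT {compose v Rf} x wx) (trans (evT {v} _ (ss-closed wi wj wx)) (cong (ev v) (ss-inv (proj₁ wi) (proj₁ wj) x)))
        flip : ∀ {v} → Fixed v → signedTerm n κ (compose v Rf) ≡ ℚ.- signedTerm n κ v
        flip {v} Φ = trans (cong₂ ℚ._*_ (sgn-row (spv Φ) (proj₁ (spT Φ)) i∈ j∈ ne (evT {v})) (negSign-row {κ = κ} {v = v} {v′ = compose v Rf} i∈ j∈ ce (evT {v})))
          (sym (ℚP.neg-distribˡ-* (sgnPerm (absL v)) (negSign n κ v)))

      -- The same on the side of values: if `v x ≡ j`, maximality gives `x ≤ j`, and the path from
      -- `x` to `j` is uncrossed with the one from `j` to `i`.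
      cols-zero : (∀ x → Path Is x i → Path Is x j) → ΣQ (signedTerm n κ) L′ ≡ ℚ.0ℚ
      cols-zero cw = Σ-involution (signedTerm n κ) (compose Rf) L′-unique (λ m → L′-in (closed (L′-out m))) (λ m → twice (L′-out m)) (λ m → flip (L′-out m))
        where
        evT : ∀ {v} → Fixed v → ∀ x → Wire n x → ev (compose Rf v) x ≡ ss i j (ev v x)
        evT {v} Φ x wx = trans (ev-compose Rf v x) (ev-refl wi wj _ (wire (sp-perm (spv Φ)) wx))
        spT : ∀ {v} → Fixed v → SignedPerm n (compose Rf v)
        spT Φ = sp-compose Tsp (spv Φ)
        into-j : ∀ {v} → Fixed v → ∀ {x} → Wire n x → ev v x ≡ i → Path Is x j
        into-j Φ {x} wx e = cw x (subst (Path Is x) e (comp Φ x wx))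
        into-i : ∀ {v} → Fixed v → ∀ {x} → Wire n x → ev v x ≡ j → Path Is x i
        into-i Φ {x} wx e with ℤP.<-cmp x j
        ... | tri≈ _ refl _ = share⇒path (share-sym sh)
        ... | tri> _ _ r = ⊥-elim (<⇒≱ᶻ r (comes Φ wx e))
        ... | tri< r _ _ = proj₁ (uncross (proj₁ wx) (proj₁ wj) r i<j (subst (Path Is x) e (comp Φ x wx)) (share⇒path (share-sym sh)))
        un : ∀ {v x k} → ev v x ≡ - k → ev v (- x) ≡ k
        un {v} {x} {k} e = trans (ev-neg v x) (trans (cong -_ e) (neg-inv k))
        closed : ∀ {v} → Fixed v → Fixed (compose Rf v)
        closed {v} Φ = fixed (spT Φ) (λ x wx → subst (Path Is x) (sym (evT Φ x wx)) (go x wx (ssView i j (ev v x))))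
            (λ x wx → trans (cong (col κ) (evT Φ x wx)) (trans (col-ss κ (proj₁ wi) (proj₁ wj) ce (ev v x)) (pres Φ x wx)))
          where
          go : ∀ x → Wire n x → SSView i j (ev v x) → Path Is x (ss i j (ev v x))
          go x wx (at-a e) = subst (Path Is x) (sym (trans (cong (ss i j) e) (ss-l i j))) (into-j Φ wx e)
          go x wx (at-b e) = subst (Path Is x) (sym (trans (cong (ss i j) e) (ss-r i j))) (into-i Φ wx e)
          go x wx (at-a⁻ e) = subst₂ (Path Is) (neg-inv x) (sym (trans (cong (ss i j) e) (ss-nl j (proj₁ wi)))) (path-symm (Wire-neg wx) (into-j Φ (Wire-neg wx) (un {v} {x} e)))
          go x wx (at-b⁻ e) = subst₂ (Path Is) (neg-inv x) (sym (trans (cong (ss i j) e) (ss-nr i (proj₁ wj)))) (path-symm (Wire-neg wx) (into-i Φ (Wire-neg wx) (un {v} {x} e)))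
          go x wx (else p q r s) = subst (Path Is x) (sym (ss-o p q r s)) (comp Φ x wx)
        twice : ∀ {v} → Fixed v → compose Rf (compose Rf v) ≡ v
        twice {v} Φ = sp-ext (sp-compose Tsp (spT Φ)) (spv Φ) λ x wx → trans (evT (closed Φ) x wx) (trans (cong (ss i j) (evT Φ x wx)) (ss-inv (proj₁ wi) (proj₁ wj) (ev v x)))
        flip : ∀ {v} → Fixed v → signedTerm n κ (compose Rf v) ≡ ℚ.- signedTerm n κ v
        flip {v} Φ = trans (cong₂ ℚ._*_ (sgn-col (spv Φ) (proj₁ (spT Φ)) i∈ j∈ ne (evT Φ)) (negSign-col {κ = κ} {v = v} {v′ = compose Rf v} i∈ j∈ (evT Φ)))
          (sym (ℚP.neg-distribˡ-* (sgnPerm (absL v)) (negSign n κ v)))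

    total-zero : total ≡ ℚ.0ℚ
    total-zero with one-sided z i<j sh
    ... | rows f = trans total-L′ (rows-zero f)
    ... | cols f = trans total-L′ (cols-zero f)

  module Proper (G : ℤ → Bool) (G-share : ∀ {x} → x ∈ posZ n → G x ≡ true → Share Is x (- x)) (share-G : ∀ {x} → x ∈ posZ n → Share Is x (- x) → G x ≡ true)
                (proper : ∀ {i j} → i ∈ posZ n → j ∈ posZ n → ¬ Clash i j) where
    private
      -- Any value other than `x` and `- x` makes the class cross a level and hence clash: `v x`
      -- above `x` crosses `x`; `v x` below `- x` makes the value at `- x` cross `x`; and in
      -- between, the level of the absolute value of `v x` is crossed downwards. For `v x ≡ - x` the
      -- paths between `x` and `- x` in both directions make `x` grounded.
      rigid : ∀ {v} → Fixed v → ∀ {x} → x ∈ posZ n → Flip G x (ev v x)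
      rigid {v} Φ {x} x∈ = go (ℤP.<-cmp y x)
        where
        wx = posZ-wire x∈
        y = ev v x
        wy = wire (sp-perm (spv Φ)) wx
        no-up : ∀ {a} → Wire n a → col κ a ≡ col κ x → a ≤ x → x < ev v a → ⊥
        no-up wa ca a≤ r = let l , l∈ , c = crossing Φ x∈ wa ca a≤ r in proper x∈ l∈ c
        no-down : + ∣ y ∣ < x → ⊥
        no-down r = let l , l∈ , c = crossing-down Φ (abs-pos wy) wx (sym (trans (abs-col y) (pres Φ x wx))) r (≤abs y) in proper (abs-pos wy) l∈ c
          where
          abs-col : ∀ y → col κ (+ ∣ y ∣) ≡ col κ y
          abs-col y = refl
          ≤abs : ∀ y → y ≤ + ∣ y ∣
          ≤abs (+ k) = ℤP.≤-refl
          ≤abs -[1+ k ] = ℤ.-≤+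
        flipped : y ≡ - x → Flip G x y
        flipped e = inj₂ (e , share-G x∈ (share-sym (both⇒share z (neg-≢0 (proj₁ wx)) (proj₁ wx)
            (ℤP.<-trans (ℤP.neg-mono-< (proj₁ (∈-posZ⁻ x∈))) (proj₁ (∈-posZ⁻ x∈)))
            (subst (Path Is (- x)) (neg-inv x) (path-symm wx P)) P)))
          where
          P : Path Is x (- x)
          P = subst (Path Is x) e (comp Φ x wx)
        go : _ → Flip G x y
        go (tri≈ _ e _) = inj₁ e
        go (tri> _ _ r) = ⊥-elim (no-up wx refl ℤP.≤-refl r)
        go (tri< r _ _) with ℤP.<-cmp y (- x)
        ... | tri≈ _ e _ = flipped e
        ... | tri< r′ _ _ = ⊥-elim (no-up (Wire-neg wx) (col-neg κ x) (ℤP.<⇒≤ (ℤP.<-trans (ℤP.neg-mono-< (proj₁ (∈-posZ⁻ x∈))) (proj₁ (∈-posZ⁻ x∈))))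
                (subst₂ _<_ (neg-inv x) (sym (ev-neg v x)) (ℤP.neg-mono-< r′)))
        ... | tri> _ _ r′ = ⊥-elim (no-down (abs-< r r′))
          where
          abs-< : y < x → - x < y → + ∣ y ∣ < x
          abs-< p q with ℤP.+∣i∣≡i⊎+∣i∣≡-i y
          ... | inj₁ e = subst (_< x) (sym e) p
          ... | inj₂ e = subst (_< x) (sym e) (subst (- y <_) (neg-inv x) (ℤP.neg-mono-< q))

      rigid-abs : ∀ {v} → Fixed v → ∀ {x} → x ∈ posZ n → absF v x ≡ x
      rigid-abs Φ {x} x∈ with rigid Φ x∈
      ... | inj₁ e = trans (cong (λ y → + ∣ y ∣) e) (pos-abs x∈)
      ... | inj₂ (e , _) = trans (cong (λ y → + ∣ y ∣) e) (trans (cong +_ (ℤP.∣-i∣≡∣i∣ x)) (pos-abs x∈))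

      ground-paths : ∀ {g y} → g ∈ posZ n → G g ≡ true → (y ≡ g) ⊎ (y ≡ - g) → Path Is g y
      ground-paths g∈ _ (inj₁ refl) = straight Is _
      ground-paths g∈ Gg (inj₂ refl) = share⇒path (G-share g∈ Gg)

    -- Right multiplication by the sign change of `g` keeps all absolute values and negates exactly
    -- one factor of `negSign`, the one at `g`.
    ground-zero : ∀ {g} → g ∈ posZ n → G g ≡ true → col κ g < + 0 → total ≡ ℚ.0ℚ
    ground-zero {g} g∈ Gg cg = trans total-L′ (Σ-involution (signedTerm n κ) (λ v → compose v Rf) L′-unique
        (λ m → L′-in (closed (L′-out m))) (λ m → twice (L′-out m)) (λ m → flip (L′-out m)))
      where
      wg = posZ-wire g∈
      wg⁻ = Wire-neg wg
      Rf = refl-list n (- g) g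
      Tsp = refl-sp wg⁻ wg
      evT : ∀ {v} x → Wire n x → ev (compose v Rf) x ≡ ev v (ss (- g) g x)
      evT {v} x wx = trans (ev-compose v Rf x) (cong (ev v) (ev-refl wg⁻ wg x wx))
      spT : ∀ {v} → Fixed v → SignedPerm n (compose v Rf)
      spT Φ = sp-compose (spv Φ) Tsp
      at-g : ∀ v → ev v (ss (- g) g g) ≡ - ev v g
      at-g v = trans (cong (ev v) (ss-r (- g) g)) (ev-neg v g)
      off-g : ∀ {x} → x ≢ g → x ≢ - g → ss (- g) g x ≡ x
      off-g a b = ss-o b a (λ e → a (trans e (neg-inv g))) b
      P : ∀ {v} → Fixed v → Path Is g (- ev v g)
      P {v} Φ = ground-paths g∈ Gg (sw (rigid Φ g∈))
        where
        sw : Flip G g (ev v g) → (- ev v g ≡ g) ⊎ (- ev v g ≡ - g)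
        sw (inj₁ e) = inj₂ (cong -_ e)
        sw (inj₂ (e , _)) = inj₁ (trans (cong -_ e) (neg-inv g))
      closed : ∀ {v} → Fixed v → Fixed (compose v Rf)
      closed {v} Φ = fixed (spT Φ) (λ x wx → subst (Path Is x) (sym (evT {v} x wx)) (go x wx (x ℤ.≟ g) (x ℤ.≟ - g)))
          (λ x wx → trans (cong (col κ) (evT {v} x wx)) (trans (pres Φ _ (ss-closed wg⁻ wg wx)) (col-ss κ (proj₁ wg⁻) (proj₁ wg) (col-neg κ g) x)))
        where
        go : ∀ x → Wire n x → Dec (x ≡ g) → Dec (x ≡ - g) → Path Is x (ev v (ss (- g) g x))
        go x wx (yes refl) _ = subst (Path Is x) (sym (at-g v)) (P Φ)
        go x wx (no _) (yes refl) = subst (Path Is (- g)) (trans (neg-inv (ev v g)) (cong (ev v) (sym (ss-l (- g) g)))) (path-symm wg (P Φ))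
        go x wx (no a) (no b) = subst (Path Is x ∘ ev v) (sym (off-g a b)) (comp Φ x wx)
      twice : ∀ {v} → Fixed v → compose (compose v Rf) Rf ≡ v
      twice {v} Φ = sp-ext (sp-compose (spT Φ) Tsp) (spv Φ) λ x wx → trans (evT {compose v Rf} x wx) (trans (evT {v} _ (ss-closed wg⁻ wg wx)) (cong (ev v) (ss-inv (proj₁ wg⁻) (proj₁ wg) x)))
      same-abs : ∀ {v} → Fixed v → absL (compose v Rf) ≡ absL v
      same-abs {v} Φ = trans (absL-map (proj₁ (spT Φ))) (trans (LP.map-cong-local (All.tabulate λ m → trans (rigid-abs (closed Φ) m) (sym (rigid-abs Φ m)))) (sym (absL-map (proj₁ (spv Φ)))))
      neg-factor : ∀ {v} → Fixed v → sgf (col κ g) (- ev v g) ≡ ℚ.- sgf (col κ g) (ev v g)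
      neg-factor {v} Φ with rigid Φ g∈
      ... | inj₁ e rewrite e | ltZ-true cg | pos-ltZ g∈ | neg-ltZ g∈ = refl
      ... | inj₂ (e , _) rewrite e | ltZ-true cg | neg-ltZ g∈ | neg-inv g | pos-ltZ g∈ = refl
      negs : ∀ {v} → Fixed v → negSign n κ (compose v Rf) ≡ ℚ.- negSign n κ v
      negs {v} Φ with ∈P.∈-∃++ g∈
      ... | A , B , eq = trans (cong (λ l → prodQ (map h′ l)) eq) (trans (prod-flip A B (subst Unique eq (sorted-unique (posZ-sorted n))) (subst (λ l → ∀ {x} → x ∈ l → x ∈ posZ n) eq id))
            (cong (λ l → ℚ.- prodQ (map h l)) (sym eq)))
        where
        h h′ : ℤ → ℚ
        h x = sgf (col κ x) (ev v x)
        h′ x = sgf (col κ x) (ev (compose v Rf) x)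
        same : ∀ {x} → x ∈ posZ n → x ≢ g → h′ x ≡ h x
        same {x} m ne = cong (sgf (col κ x)) (trans (evT {v} x (posZ-wire m)) (cong (ev v) (off-g ne (pos-≢-neg m g∈))))
        at : h′ g ≡ ℚ.- h g
        at = trans (cong (sgf (col κ g)) (trans (evT {v} g wg) (at-g v))) (neg-factor Φ)
        prod-flip : ∀ A B → Unique (A ++ g ∷ B) → (∀ {x} → x ∈ A ++ g ∷ B → x ∈ posZ n) → prodQ (map h′ (A ++ g ∷ B)) ≡ ℚ.- prodQ (map h (A ++ g ∷ B))
        prod-flip [] B (u ∷ _) s = trans (cong₂ (λ a l → a ℚ.* prodQ l) at (LP.map-cong-local (All.tabulate λ m → same (s (there m)) (λ e → All.lookup u m (sym e)))))
          (sym (ℚP.neg-distribˡ-* (h g) (prodQ (map h B))))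
        prod-flip (x ∷ A) B (u ∷ us) s = trans (cong₂ ℚ._*_ (same (s (here refl)) (All.lookup u (∈P.∈-insert A))) (prod-flip A B us (s ∘ there)))
          (sym (ℚP.neg-distribʳ-* (h x) (prodQ (map h (A ++ g ∷ B)))))
      flip : ∀ {v} → Fixed v → signedTerm n κ (compose v Rf) ≡ ℚ.- signedTerm n κ v
      flip {v} Φ = trans (cong₂ (λ l s → sgnPerm l ℚ.* s) (same-abs Φ) (negs Φ)) (sym (ℚP.neg-distribʳ-* (sgnPerm (absL v)) (negSign n κ v)))

    -- What remains are the sign choices at grounded elements. A changed sign occurs only at a color
    -- that is not negative, so each term is 1.
    total-count : (∀ {x} → x ∈ posZ n → col κ x < + 0 → G x ≡ false) → total ≡ ι (groundWeight G (posZ n))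
    total-count ng = trans total-L′ (trans (Σ-cong L′ (λ m → one (L′-out m))) (trans (Σ-one L′) (cong ι (trans (↭P.↭-length perm) (length-signChoices G (posZ n))))))
      where
      one : ∀ {v} → Fixed v → signedTerm n κ v ≡ ℚ.1ℚ
      one {v} Φ = cong₂ ℚ._*_ (cong powNeg1 (trans (cong invZ (trans (absL-map (proj₁ (spv Φ))) (trans (LP.map-cong-local (All.tabulate (rigid-abs Φ))) (LP.map-id (posZ n))))) (inv-sorted (posZ-sorted n))))
          (prodQ-ones (AllP.map⁺ (All.tabulate factor)))
        where
        factor : ∀ {x} → x ∈ posZ n → sgf (col κ x) (ev v x) ≡ ℚ.1ℚ
        factor {x} m with rigid Φ m
        ... | inj₁ e rewrite e | pos-ltZ m = cong (λ b → if b then ℚ.- ℚ.1ℚ else ℚ.1ℚ) (∧-false (ltZ (col κ x) (+ 0)))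
          where
          ∧-false : ∀ b → b ∧ false ≡ false
          ∧-false true = refl
          ∧-false false = refl
        ... | inj₂ (e , Gx) with col κ x ℤ.<? + 0
        ...   | yes r = ⊥-elim (case trans (sym Gx) (ng m r) of λ ())
        ...   | no r rewrite ltZ-false (ℤP.≮⇒≥ r) = refl
      perm : L′ ↭ signChoices G (posZ n)
      perm = unique-↭ L′-unique (signChoices-unique G (posZ n) (All.tabulate (proj₁ ∘ posZ-wire))) into outof
        where
        into : ∀ {v} → v ∈ L′ → v ∈ signChoices G (posZ n)
        into {v} m = let Φ = L′-out m in subst (_∈ signChoices G (posZ n)) (win-map v (proj₁ (spv Φ))) (signChoices-∈ G (posZ n) (ev v) (rigid Φ))
        outof : ∀ {v} → v ∈ signChoices G (posZ n) → v ∈ L′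
        outof {v} m = L′-in (fixed V (λ x wx → cmp x wx (posOrNeg wx)) (λ x wx → prs x wx (posOrNeg wx)))
          where
          facts = signChoices-∈⁻ G (posZ n) m
          V : SignedPerm n v
          V = trans (proj₁ facts) (length-posZ n) , subst (_↭ upto1 n) (sym (trans (proj₁ (proj₂ facts)) (trans (sym (LP.map-∘ (upto1 n))) (LP.map-id (upto1 n))))) ↭-refl
          fl : ∀ {x} → x ∈ posZ n → Flip G x (ev v x)
          fl {+ zero} x∈ = ⊥-elim (proj₁ (posZ-wire x∈) refl)
          fl {+ suc k} x∈ = subst (λ y → Flip G y (nthZ v k)) (trans (cong (λ l → nthZ l k) (sym (LP.map-id (posZ n)))) (nthZ-posZ id k<n))
              (proj₂ (proj₂ facts) k (subst (k ℕ.<_) (sym (length-posZ n)) k<n))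
            where k<n = wire-pos (posZ-wire x∈)
          fl { -[1+ k ]} x∈ = ⊥-elim (ℤP.<-asym (proj₁ (∈-posZ⁻ x∈)) ℤ.-<+)
          cmp⁺ : ∀ {x} → x ∈ posZ n → Path Is x (ev v x)
          cmp⁺ {x} x∈ with fl x∈
          ... | inj₁ e = subst (Path Is x) (sym e) (straight Is x)
          ... | inj₂ (e , g) = subst (Path Is x) (sym e) (share⇒path (G-share x∈ g))
          cmp : ∀ x → Wire n x → (x ∈ posZ n) ⊎ (- x ∈ posZ n) → Path Is x (ev v x)
          cmp x wx (inj₁ x∈) = cmp⁺ x∈
          cmp x wx (inj₂ x∈) = subst₂ (Path Is) (neg-inv x) (trans (cong -_ (ev-neg v x)) (neg-inv (ev v x))) (path-symm (Wire-neg wx) (cmp⁺ x∈))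
          prs⁺ : ∀ {x} → x ∈ posZ n → col κ (ev v x) ≡ col κ x
          prs⁺ {x} x∈ with fl x∈
          ... | inj₁ e = cong (col κ) e
          ... | inj₂ (e , _) = trans (cong (col κ) e) (col-neg κ x)
          prs : ∀ x → Wire n x → (x ∈ posZ n) ⊎ (- x ∈ posZ n) → col κ (ev v x) ≡ col κ x
          prs x wx (inj₁ x∈) = prs⁺ x∈
          prs x wx (inj₂ x∈) = trans (sym (col-neg κ (ev v x))) (trans (cong (col κ) (sym (ev-neg v x))) (trans (prs⁺ x∈) (col-neg κ x)))

-- Enumerations of the groups.

concatMap-∈ : ∀ {A B : Set} (f : A → List B) {xs x y} → x ∈ xs → y ∈ f x → y ∈ concatMap f xs
concatMap-∈ f m m′ = ∈P.∈-concatMap⁺ f (Any.map (λ { refl → m′ }) m)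

concatMap-∈⁻ : ∀ {A B : Set} (f : A → List B) xs {y} → y ∈ concatMap f xs → ∃ λ x → (x ∈ xs) × (y ∈ f x)
concatMap-∈⁻ f (x ∷ xs) m with ∈P.∈-++⁻ (f x) m
... | inj₁ a = x , here refl , a
... | inj₂ b = let y , p , q = concatMap-∈⁻ f xs b in y , there p , q

concatMap-unique : ∀ {A B : Set} (f : A → List B) {xs} → Unique xs → (∀ {x} → x ∈ xs → Unique (f x)) →
  (∀ {x x′ y} → x ∈ xs → x′ ∈ xs → y ∈ f x → y ∈ f x′ → x ≡ x′) → Unique (concatMap f xs)
concatMap-unique f [] _ _ = []
concatMap-unique f {x ∷ xs} (h ∷ u) uf d = UP.++⁺ (uf (here refl)) (concatMap-unique f u (uf ∘ there) (λ p q → d (there p) (there q)))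
  λ (a , b) → case concatMap-∈⁻ f xs b of λ { (x′ , m , b′) → All.lookup h m (d (here refl) (there m) a b′) }

allLists-unique : ∀ {A : Set} m {xs : List A} → Unique xs → Unique (allLists m xs)
allLists-unique zero u = [] ∷ []
allLists-unique (suc m) {xs} u = concatMap-unique (λ x → map (x ∷_) (allLists m xs)) u (λ _ → UP.map⁺ LP.∷-injectiveʳ (allLists-unique m u))
  (λ {x} {x′} _ _ a b → case ∈P.∈-map⁻ (x ∷_) a of λ { (_ , _ , refl) → case ∈P.∈-map⁻ (x′ ∷_) b of λ { (_ , _ , e) → LP.∷-injectiveˡ e } })

insertAll-∈ : ∀ {A : Set} (x : A) as {bs} → as ++ x ∷ bs ∈ insertAll x (as ++ bs)
insertAll-∈ x [] {[]} = here refl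
insertAll-∈ x [] {b ∷ bs} = here refl
insertAll-∈ x (a ∷ as) = there (∈P.∈-map⁺ (a ∷_) (insertAll-∈ x as))

insertAll-∈⁻ : ∀ {A : Set} (x : A) ys {zs} → zs ∈ insertAll x ys → ∃ λ as → ∃ λ bs → (ys ≡ as ++ bs) × (zs ≡ as ++ x ∷ bs)
insertAll-∈⁻ x [] (here refl) = [] , [] , refl , refl
insertAll-∈⁻ x (y ∷ ys) (here refl) = [] , y ∷ ys , refl , refl
insertAll-∈⁻ x (y ∷ ys) (there m) with ∈P.∈-map⁻ (y ∷_) m
... | zs , m′ , refl with insertAll-∈⁻ x ys m′
... | as , bs , refl , refl = y ∷ as , bs , refl , refl

perms-∈ : ∀ {A : Set} (xs : List A) {zs} → zs ↭ xs → zs ∈ perms xs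
perms-∈ [] r with ↭P.↭-empty-inv r
... | refl = here refl
perms-∈ (x ∷ xs) r with ∈P.∈-∃++ (↭P.∈-resp-↭ (↭-sym r) (here refl))
... | as , bs , refl = concatMap-∈ (insertAll x) (perms-∈ xs (↭P.drop-mid as [] r)) (insertAll-∈ x as)

perms-∈⁻ : ∀ {A : Set} (xs : List A) {zs} → zs ∈ perms xs → zs ↭ xs
perms-∈⁻ [] (here refl) = ↭-refl
perms-∈⁻ (x ∷ xs) m with concatMap-∈⁻ (insertAll x) (perms xs) m
... | ys , m₁ , m₂ with insertAll-∈⁻ x ys m₂
... | as , bs , refl , refl = ↭-trans (↭P.shift x as bs) (prep x (perms-∈⁻ xs m₁))

perms-unique : ∀ {A : Set} {xs : List A} → Unique xs → Unique (perms xs)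
perms-unique [] = [] ∷ []
perms-unique {A} {x ∷ xs} (h ∷ u) = concatMap-unique (insertAll x) (perms-unique u) (λ m → ins _ (x∉ m)) disj
  where
  x∉ : ∀ {ys} → ys ∈ perms xs → All (x ≢_) ys
  x∉ m = ↭P.All-resp-↭ (↭-sym (perms-∈⁻ xs m)) h
  ins : ∀ ys → All (x ≢_) ys → Unique (insertAll x ys)
  ins [] _ = [] ∷ []
  ins (y ∷ ys) (ne ∷ a) = All.tabulate (λ m e → case ∈P.∈-map⁻ (y ∷_) m of λ { (_ , _ , r) → ne (LP.∷-injectiveˡ (trans e r)) })
    ∷ UP.map⁺ LP.∷-injectiveʳ (ins ys a)
  cut : ∀ as as′ {bs bs′} → All (x ≢_) (as ++ bs) → All (x ≢_) (as′ ++ bs′) → as ++ x ∷ bs ≡ as′ ++ x ∷ bs′ → as ++ bs ≡ as′ ++ bs′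
  cut [] [] _ _ e = LP.∷-injectiveʳ e
  cut [] (a ∷ as′) _ (ne ∷ _) e = ⊥-elim (ne (LP.∷-injectiveˡ e))
  cut (a ∷ as) [] (ne ∷ _) _ e = ⊥-elim (ne (sym (LP.∷-injectiveˡ e)))
  cut (a ∷ as) (a′ ∷ as′) (_ ∷ p) (_ ∷ q) e = cong₂ _∷_ (LP.∷-injectiveˡ e) (cut as as′ p q (LP.∷-injectiveʳ e))
  disj : ∀ {ys ys′ zs} → ys ∈ perms xs → ys′ ∈ perms xs → zs ∈ insertAll x ys → zs ∈ insertAll x ys′ → ys ≡ ys′
  disj {ys} {ys′} m m′ a b with insertAll-∈⁻ x ys a | insertAll-∈⁻ x ys′ b
  ... | as , bs , refl , refl | as′ , bs′ , refl , e = cut as as′ (x∉ m) (x∉ m′) e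

signs-∈ : ∀ v → v ∈ signs (absL v)
signs-∈ [] = here refl
signs-∈ (x ∷ v) = concatMap-∈ (λ r → (+ ∣ x ∣ ∷ r) ∷ (- (+ ∣ x ∣) ∷ r) ∷ []) (signs-∈ v) (pick (ℤP.+∣i∣≡i⊎+∣i∣≡-i x))
  where
  pick : (+ ∣ x ∣ ≡ x) ⊎ (+ ∣ x ∣ ≡ - x) → x ∷ v ∈ (+ ∣ x ∣ ∷ v) ∷ (- (+ ∣ x ∣) ∷ v) ∷ []
  pick (inj₁ e) = here (cong (_∷ v) (sym e))
  pick (inj₂ e) = there (here (cong (_∷ v) (sym (trans (cong -_ e) (neg-inv x)))))

signs-∈⁻ : ∀ xs {v} → v ∈ signs xs → map ∣_∣ v ≡ map ∣_∣ xs
signs-∈⁻ [] (here refl) = refl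
signs-∈⁻ (x ∷ xs) m with concatMap-∈⁻ (λ r → (x ∷ r) ∷ (- x ∷ r) ∷ []) (signs xs) m
... | r , m′ , here refl = cong (∣ x ∣ ∷_) (signs-∈⁻ xs m′)
... | r , m′ , there (here refl) = cong₂ _∷_ (ℤP.∣-i∣≡∣i∣ x) (signs-∈⁻ xs m′)

signs-unique : ∀ xs → All (_≢ + 0) xs → Unique (signs xs)
signs-unique [] _ = [] ∷ []
signs-unique (x ∷ xs) (ne ∷ a) = concatMap-unique (λ r → (x ∷ r) ∷ (- x ∷ r) ∷ []) (signs-unique xs a)
  (λ _ → ((λ e → ≢-neg ne (LP.∷-injectiveˡ e)) ∷ []) ∷ [] ∷ [])
  (λ _ _ p q → trans (sym (tl p)) (tl q))
  where
  tl : ∀ {r y} → y ∈ (x ∷ r) ∷ (- x ∷ r) ∷ [] → drop 1 y ≡ r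
  tl (here refl) = refl
  tl (there (here refl)) = refl

absL-abs : ∀ v → absL v ≡ map +_ (map ∣_∣ v)
absL-abs v = LP.map-∘ v

allSigned-∈ : ∀ {n v} → SignedPerm n v → v ∈ allSigned n
allSigned-∈ {n} {v} (_ , r) = concatMap-∈ signs (perms-∈ (posZ n) (subst (_↭ posZ n) (sym (absL-abs v)) (↭P.map⁺ +_ r))) (signs-∈ v)

perm-pos : ∀ {n x} → x ↭ posZ n → All (_∈ posZ n) x
perm-pos r = All.tabulate (↭P.∈-resp-↭ r)

pos-sp : ∀ {n x} → x ↭ posZ n → SignedPerm n x
pos-sp {n} {x} r = trans (↭P.↭-length r) (length-posZ n) , subst (map ∣_∣ x ↭_) (trans (sym (LP.map-∘ (upto1 n))) (LP.map-id (upto1 n))) (↭P.map⁺ ∣_∣ r)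

absL-pos : ∀ {n x} → All (_∈ posZ n) x → absL x ≡ x
absL-pos [] = refl
absL-pos (m ∷ a) = cong₂ _∷_ (pos-abs m) (absL-pos a)

allSigned-∈⁻ : ∀ {n v} → v ∈ allSigned n → SignedPerm n v
allSigned-∈⁻ {n} {v} m with concatMap-∈⁻ signs (allPerm n) m
... | x , m₁ , m₂ = trans (trans (sym (LP.length-map ∣_∣ v)) (trans (cong length e) (LP.length-map ∣_∣ x))) (proj₁ X) , subst (_↭ upto1 n) (sym e) (proj₂ X)
  where
  X = pos-sp (perms-∈⁻ (posZ n) m₁)
  e = signs-∈⁻ x m₂

allSigned-unique : ∀ n → Unique (allSigned n)
allSigned-unique n = concatMap-unique signs (perms-unique (sorted-unique (posZ-sorted n)))
  (λ {x} m → signs-unique x (All.map (proj₁ ∘ posZ-wire) (pos m)))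
  (λ {x} {x′} {v} m m′ a b → trans (sym (rec m a)) (rec m′ b))
  where
  pos : ∀ {x} → x ∈ allPerm n → All (_∈ posZ n) x
  pos m = perm-pos (perms-∈⁻ (posZ n) m)
  rec : ∀ {x v} → x ∈ allPerm n → v ∈ signs x → absL v ≡ x
  rec {x} {v} m a = trans (absL-abs v) (trans (cong (map +_) (signs-∈⁻ x a)) (trans (sym (absL-abs x)) (absL-pos (pos m))))

record Subgroup (n : ℕ) (G : List (List ℤ)) : Set where
  field
    uniqueG : Unique G
    sp-of   : ∀ {v} → v ∈ G → SignedPerm n v
    comp-in : ∀ {u v} → u ∈ G → v ∈ G → compose u v ∈ G
    inv-in  : ∀ {v} (m : v ∈ G) → invW (sp-of m) ∈ G
    id-in   : idP n ∈ G
open Subgroup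

signedGroup : ∀ n → Subgroup n (allSigned n)
signedGroup n = record { uniqueG = allSigned-unique n ; sp-of = allSigned-∈⁻ {n}
  ; comp-in = λ a b → allSigned-∈ {n} (sp-compose (allSigned-∈⁻ {n} a) (allSigned-∈⁻ {n} b))
  ; inv-in = λ m → allSigned-∈ {n} (invW-sp (allSigned-∈⁻ {n} m)) ; id-in = allSigned-∈ (idP-sp n) }

symGroup : ∀ n → Subgroup n (allPerm n)
symGroup n = record { uniqueG = perms-unique (sorted-unique (posZ-sorted n)) ; sp-of = sp
  ; comp-in = λ {u} {v} a b → perms-∈ (posZ n) (↭-trans (↭P.map⁺ (ev u) (out b)) (subst (_↭ posZ n) (sym (win-map u (proj₁ (sp a)))) (out a)))
  ; inv-in = λ {v} m → perms-∈ (posZ n) (subst (_↭ posZ n) (trans (sym (absL-abs (invW (sp m)))) (inv-pos m)) (↭P.map⁺ +_ (proj₂ (invW-sp (sp m)))))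
  ; id-in = perms-∈ (posZ n) ↭-refl }
  where
  out : ∀ {v} → v ∈ allPerm n → v ↭ posZ n
  out = perms-∈⁻ (posZ n)
  sp : ∀ {v} → v ∈ allPerm n → SignedPerm n v
  sp m = pos-sp (out m)
  inv-pos : ∀ {v} (m : v ∈ allPerm n) → absL (invW (sp m)) ≡ invW (sp m)
  inv-pos {v} m = absL-pos (AllP.map⁺ (All.tabulate λ {z} z∈ → go z∈ (posOrNeg (inverse-wire F (posZ-wire z∈)))))
    where
    F = sp-perm (sp m)
    ev-pos : ∀ {p} → p ∈ posZ n → ev v p ∈ posZ n
    ev-pos {p} p∈ = ↭P.∈-resp-↭ (out m) (subst (ev v p ∈_) (win-map v (proj₁ (sp m))) (∈P.∈-map⁺ (ev v) p∈))
    go : ∀ {z} → z ∈ posZ n → _ → inverse F z ∈ posZ n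
    go z∈ (inj₁ p) = p
    go {z} z∈ (inj₂ p) = ⊥-elim (pos-≢-neg (ev-pos p) z∈ (trans (ev-neg v (inverse F z)) (cong -_ (inverseʳ F (posZ-wire z∈)))))

translate-↭ : ∀ {n G t} → Subgroup n G → t ∈ G → map (compose t) G ↭ G
translate-↭ {n} {G} {t} S t∈ = unique-⊆-↭ (unique-map (compose t) (λ p q e → trans (sym (undo p)) (trans (cong (compose t⁻) e) (undo q))) (uniqueG S))
    (λ m → case ∈P.∈-map⁻ (compose t) m of λ { (v , m′ , refl) → comp-in S t∈ m′ }) (ℕP.≤-reflexive (sym (LP.length-map (compose t) G)))
  where
  Tsp = sp-of S t∈
  t⁻ = invW Tsp
  undo : ∀ {v} → v ∈ G → compose t⁻ (compose t v) ≡ v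
  undo {v} m = trans (sym (compose-assoc t⁻ t v)) (trans (cong (λ u → compose u v) (invW-l Tsp)) (compose-idˡ (sp-of S m)))

countB-map : ∀ {A B : Set} (p : B → Bool) (f : A → B) xs → countB p (map f xs) ≡ countB (p ∘ f) xs
countB-map p f [] = refl
countB-map p f (x ∷ xs) with p (f x)
... | true  = cong suc (countB-map p f xs)
... | false = countB-map p f xs

countB-cong-∈ : ∀ {A : Set} {p q : A → Bool} xs → (∀ {x} → x ∈ xs → p x ≡ q x) → countB p xs ≡ countB q xs
countB-cong-∈ [] e = refl
countB-cong-∈ {p = p} {q} (x ∷ xs) e rewrite e (here refl) | countB-cong-∈ {p = p} {q} xs (e ∘ there) = refl

count-translate : ∀ {n G t} → Subgroup n G → t ∈ G → (p : List ℤ → Bool) → countB p G ≡ countB (p ∘ compose t) G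
count-translate {G = G} {t} S t∈ p = trans (sym (countB-↭ p (translate-↭ S t∈))) (countB-map p (compose t) G)

bool-iff : ∀ {a b : Bool} → (a ≡ true → b ≡ true) → (b ≡ true → a ≡ true) → a ≡ b
bool-iff {true}  {true}  _ _ = refl
bool-iff {true}  {false} f _ = sym (f refl)
bool-iff {false} {true}  _ g = g refl
bool-iff {false} {false} _ _ = refl

-- Colorings as lists; permutations act on the positions.

act : List ℤ → List ℤ → List ℤ
act κ x = map (col κ) x

col-abs : ∀ κ {x y} → ∣ x ∣ ≡ ∣ y ∣ → col κ x ≡ col κ y
col-abs κ e = cong (λ k → nthZ κ (k ∸ 1)) e

nthZ-map-< : ∀ (f : ℤ → ℤ) v {k} → k ℕ.< length v → nthZ (map f v) k ≡ f (nthZ v k)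
nthZ-map-< f (x ∷ v) {zero} _ = refl
nthZ-map-< f (x ∷ v) {suc k} (s≤s p) = nthZ-map-< f v p

col-act : ∀ {n x} κ → length x ≡ n → ∀ z → Wire n z → col (act κ x) z ≡ col κ (ev x z)
col-act κ l (+ zero) w = ⊥-elim (proj₁ w refl)
col-act {x = x} κ refl (+ suc k) w = nthZ-map-< (col κ) x (wire-pos w)
col-act {x = x} κ refl -[1+ k ] w = trans (nthZ-map-< (col κ) x (wire-negsuc w)) (sym (col-neg κ (nthZ x k)))

sp-wires : ∀ {n x} → SignedPerm n x → All (Wire n) x
sp-wires {n} {x} X = subst (All (Wire n)) (win-map x (proj₁ X)) (AllP.map⁺ (All.tabulate λ m → wire (sp-perm X) (posZ-wire m)))

act-compose : ∀ {n x y} κ → length x ≡ n → All (Wire n) y → act (act κ x) y ≡ act κ (compose x y)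
act-compose {x = x} {y} κ l a = trans (LP.map-cong-local (All.map (λ w → col-act κ l _ w) a)) (LP.map-∘ y)

act-id : ∀ {n} κ → length κ ≡ n → act κ (idP n) ≡ κ
act-id κ l = map-col κ l

act-inj : ∀ {n x κ κ′} → SignedPerm n x → length κ ≡ n → length κ′ ≡ n → act κ x ≡ act κ′ x → κ ≡ κ′
act-inj {n} {x} {κ} {κ′} X l l′ e = trans (sym (back κ l)) (trans (cong (λ c → act c (invW X)) e) (back κ′ l′))
  where
  back : ∀ κ → length κ ≡ n → act (act κ x) (invW X) ≡ κ
  back κ l = trans (act-compose κ (proj₁ X) (sp-wires (invW-sp X))) (trans (cong (act κ) (invW-r X)) (act-id κ l))

act-↭ : ∀ {n x κ} → SignedPerm n x → length κ ≡ n → act κ x ↭ κ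
act-↭ {n} {x} {κ} X l = subst (act κ x ↭_) (map-col κ l) (subst (_↭ map (col κ) (posZ n)) eq (↭P.map⁺ (col κ) r))
  where
  r : absL x ↭ posZ n
  r = subst (_↭ posZ n) (sym (absL-abs x)) (↭P.map⁺ +_ (proj₂ X))
  eq : map (col κ) (absL x) ≡ act κ x
  eq = trans (sym (LP.map-∘ x)) (LP.map-cong (λ z → col-abs κ {+ ∣ z ∣} {z} refl) x)

act-find : ∀ {n κ κ₀} → length κ ≡ n → κ₀ ↭ κ → ∃ λ t → (t ↭ posZ n) × (act κ t ≡ κ₀)
act-find {n} {κ} {κ₀} l r with ↭P.↭-map-inv (col κ) (subst (_↭ κ₀) (sym (map-col κ l)) (↭-sym r))
... | t , e , s = t , ↭-sym s , sym e

-- x ∘ y = g ∘ x turns "κ is fixed by g" into "κ ∘ x is fixed by y".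
pres-conj : ∀ {n x y g κ} → SignedPerm n x → SignedPerm n y → SignedPerm n g → length κ ≡ n → compose x y ≡ compose g x →
            presB κ g ≡ presB (act κ x) y
pres-conj {n} {x} {y} {g} {κ} X Y Gs l e = bool-iff
    (λ p → eqLZ-true (trans via (cong (λ c → act c x) (eqLZ-sound p))))
    (λ p → eqLZ-true (act-inj X (trans (LP.length-map (col κ) g) (proj₁ Gs)) l (trans (sym via) (eqLZ-sound p))))
  where
  via : act (act κ x) y ≡ act (act κ g) x
  via = trans (act-compose κ (proj₁ X) (sp-wires Y)) (trans (cong (act κ) e) (sym (act-compose κ (proj₁ Gs) (sp-wires X))))

-- The sign character of the signed group.

sgnφ : List ℤ → ℚ
sgnφ v = sgnPerm (absL v)

module _ (n : ℕ) where
  open Words n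

  private
    ε : ℕ → ℚ
    ε zero = ℚ.1ℚ
    ε (suc _) = ℚ.- ℚ.1ℚ

    sgnφ-gen : ∀ {u} → SignedPerm n u → (i : Fin n) → sgnφ (compose u (gen n (toℕ i))) ≡ ε (toℕ i) ℚ.* sgnφ u
    sgnφ-gen {u} U i = go (toℕ i) (FinP.toℕ<n i)
      where
      ev′ : ∀ {k} → (k<n : k ℕ.< n) → ∀ z → Wire n z → ev (compose u (gen n k)) z ≡ ev u (ss (genA k) (genB k) z)
      ev′ {k} k<n z w = trans (ev-compose u (gen n k) z) (cong (ev u) (ev-gen k<n z w))
      go : ∀ k → k ℕ.< n → sgnφ (compose u (gen n k)) ≡ ε k ℚ.* sgnφ u
      go (suc k) k<n = trans (sgn-row U (proj₁ (sp-compose U (gen-sp k<n))) (∈-posZ (ℤ.+<+ (s≤s z≤n)) (ℤ.+≤+ (ℕP.<⇒≤ k<n))) (∈-posZ (ℤ.+<+ (s≤s z≤n)) (ℤ.+≤+ k<n))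
          (λ e → ℕP.1+n≢n (sym (ℤP.+-injective e))) (ev′ k<n))
        (trans (cong ℚ.-_ (sym (ℚP.*-identityˡ (sgnφ u)))) (ℚP.neg-distribˡ-* ℚ.1ℚ (sgnφ u)))
      go zero k<n = trans (cong sgnPerm (trans (absL-map (proj₁ (sp-compose U (gen-sp k<n)))) (trans (LP.map-cong-local (All.tabulate λ {z} m →
            trans (cong (λ x → + ∣ x ∣) (ev′ k<n z (posZ-wire m))) (same z))) (sym (absL-map (proj₁ U)))))) (sym (ℚP.*-identityˡ (sgnφ u)))
        where
        same : ∀ z → + ∣ ev u (ss -[1+ 0 ] (+ 1) z) ∣ ≡ + ∣ ev u z ∣
        same z with ssView -[1+ 0 ] (+ 1) z
        ... | at-a refl = cong +_ (sym (ℤP.∣-i∣≡∣i∣ (ev u (+ 1))))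
        ... | at-b refl = cong +_ (ℤP.∣-i∣≡∣i∣ (ev u (+ 1)))
        ... | at-a⁻ refl = cong +_ (ℤP.∣-i∣≡∣i∣ (ev u (+ 1)))
        ... | at-b⁻ refl = cong +_ (sym (ℤP.∣-i∣≡∣i∣ (ev u (+ 1))))
        ... | else p q r s = cong (λ x → + ∣ ev u x ∣) (ss-o p q r s)

    sgnφ-id : sgnφ (idP n) ≡ ℚ.1ℚ
    sgnφ-id = cong powNeg1 (trans (cong invZ (absL-pos (All.tabulate {xs = posZ n} id))) (inv-sorted (posZ-sorted n)))

    mult-word : ∀ ws {u} → SignedPerm n u → sgnφ (compose u (prodW n ws)) ≡ sgnφ u ℚ.* sgnφ (prodW n ws)
    mult-word [] {u} U = trans (cong sgnφ (compose-idʳ U)) (trans (sym (ℚP.*-identityʳ (sgnφ u))) (cong (sgnφ u ℚ.*_) (sym sgnφ-id)))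
    mult-word (i ∷ ws) {u} U = trans (cong sgnφ (sym (compose-assoc u s v))) (trans (mult-word ws (sp-compose U (gsp i)))
        (trans (cong (ℚ._* sgnφ v) (trans (sgnφ-gen U i) (ℚP.*-comm (ε k) (sgnφ u)))) (trans (ℚP.*-assoc (sgnφ u) (ε k) (sgnφ v))
          (cong (sgnφ u ℚ.*_) (sym (trans (mult-word ws (gsp i)) (cong (ℚ._* sgnφ v) gen-ε)))))))
      where
      k = toℕ i
      s = gen n k
      v = prodW n ws
      gen-ε : sgnφ s ≡ ε k
      gen-ε = trans (cong sgnφ (sym (compose-idˡ (gsp i)))) (trans (sgnφ-gen (idP-sp n) i) (trans (cong (ε k ℚ.*_) sgnφ-id) (ℚP.*-identityʳ (ε k))))

  -- Induction on a word of `v`: generator 0 changes no absolute value and acts as 1, any other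
  -- generator exchanges two positions and acts as -1.
  sgnφ-mult : ∀ {u v} → SignedPerm n u → SignedPerm n v → sgnφ (compose u v) ≡ sgnφ u ℚ.* sgnφ v
  sgnφ-mult U V with word V
  ... | ws , refl = mult-word ws U

powNeg1-sq : ∀ k → powNeg1 k ℚ.* powNeg1 k ≡ ℚ.1ℚ
powNeg1-sq zero = refl
powNeg1-sq (suc k) = trans (sym (ℚP.neg-distribˡ-* (powNeg1 k) (ℚ.- powNeg1 k))) (trans (cong ℚ.-_ (sym (ℚP.neg-distribʳ-* (powNeg1 k) (powNeg1 k)))) (trans (neg-invQ _) (powNeg1-sq k)))

unit-cancel : ∀ {s a b} → s ℚ.* s ≡ ℚ.1ℚ → s ℚ.* a ≡ b ℚ.* s → a ≡ b
unit-cancel {s} {a} {b} sq e = trans (sym (ℚP.*-identityˡ a)) (trans (cong (ℚ._* a) (sym sq)) (trans (ℚP.*-assoc s s a)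
  (trans (cong (s ℚ.*_) (trans e (ℚP.*-comm b s))) (trans (sym (ℚP.*-assoc s s b)) (trans (cong (ℚ._* b) sq) (ℚP.*-identityˡ b))))))

sgnφ-conj : ∀ {n x y g} → SignedPerm n x → SignedPerm n y → SignedPerm n g → compose x y ≡ compose g x → sgnφ y ≡ sgnφ g
sgnφ-conj {n} {x} X Y Gs e = unit-cancel {sgnφ x} (powNeg1-sq (invZ (absL x)))
  (trans (sym (sgnφ-mult n X Y)) (trans (cong sgnφ e) (sgnφ-mult n Gs X)))

-- Induced characters as sums over colorings.

ι-inverse : ∀ m → ι (suc m) ℚ.* ((+ 1) ℚ./ suc m) ≡ ℚ.1ℚ
ι-inverse m = ℚP.toℚᵘ-injective (ℚᵘP.≃-trans (ℚP.toℚᵘ-homo-* (ι (suc m)) ((+ 1) ℚ./ suc m))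
  (ℚᵘP.≃-trans (ℚᵘP.*-cong (ℚP.toℚᵘ-fromℚᵘ (ℚᵘ.mkℚᵘ (+ suc m) 0)) (ℚP.toℚᵘ-fromℚᵘ (ℚᵘ.mkℚᵘ (+ 1) m)))
    (ℚᵘ.*≡* (trans (ℤP.*-identityʳ (+ suc m ℤ.* + 1)) (trans (ℤP.*-identityʳ (+ suc m)) (sym (trans (ℤP.*-identityˡ (+ (1 ℕ.* suc m))) (cong +_ (ℕP.*-identityˡ (suc m))))))))))

divQ-ι : ∀ {h} q → h ≢ 0 → divQ (ι h ℚ.* q) h ≡ q
divQ-ι {zero} q ne = ⊥-elim (ne refl)
divQ-ι {suc m} q _ = trans (cong (ℚ._* r) (ℚP.*-comm (ι (suc m)) q)) (trans (ℚP.*-assoc q (ι (suc m)) r) (trans (cong (q ℚ.*_) (ι-inverse m)) (ℚP.*-identityʳ q)))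
  where r = (+ 1) ℚ./ suc m

Σ-const : ∀ {A : Set} c (xs : List A) → ΣQ (λ _ → c) xs ≡ ι (length xs) ℚ.* c
Σ-const c xs = trans (Σ-cong xs (λ _ → sym (ℚP.*-identityˡ c))) (trans (Σ-scaleʳ c (λ _ → ℚ.1ℚ) xs) (cong (ℚ._* c) (Σ-one xs)))

Σ-if-const : ∀ {A : Set} (p : A → Bool) c (xs : List A) → ΣQ (λ x → if p x then c else ℚ.0ℚ) xs ≡ ι (countB p xs) ℚ.* c
Σ-if-const p c xs = trans (Σ-filter p (λ _ → c) xs) (trans (Σ-const c (filterB p xs)) (cong (λ k → ι k ℚ.* c) (sym (countB-filter p xs))))

countB-≢0 : ∀ {A : Set} (p : A → Bool) {xs x} → x ∈ xs → p x ≡ true → countB p xs ≢ 0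
countB-≢0 p {y ∷ xs} (here refl) e rewrite e = λ ()
countB-≢0 p {y ∷ xs} (there m) e with p y
... | true  = λ ()
... | false = countB-≢0 p m e

eqLZ-false : ∀ {x y} → x ≢ y → eqLZ x y ≡ false
eqLZ-false {x} {y} ne with LP.≡-dec ℤ._≟_ x y
... | yes e = ⊥-elim (ne e)
... | no _  = refl

-- An induced character as a sum over a set Ω of "colorings" on which the cosets x H are the fibres of R.
ind-colorings : ∀ {n G} (S : Subgroup n G) (inH : List ℤ → Bool) (χ : List ℤ → ℚ) {g} → g ∈ G → (Ω : List (List ℤ)) (F : List ℤ → ℚ) (R : List ℤ → List ℤ → Bool) →
  (∀ {x y} → x ∈ G → y ∈ G → compose x y ≡ compose g x → (if inH y then χ y else ℚ.0ℚ) ≡ ΣQ (λ ω → if R x ω then F ω else ℚ.0ℚ) Ω) →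
  (∀ {ω} → ω ∈ Ω → countB (λ x → R x ω) G ≡ countB inH G) → inH (idP n) ≡ true →
  ind G inH χ g ≡ ΣQ F Ω
ind-colorings {n} {G} S inH χ {g} g∈ Ω F R h₁ h₂ hid =
  trans (cong (λ s → divQ s (countB inH G)) (trans (sumQ-concatMap {B = ℚ} _ G) (trans (Σ-cong G inner) (trans (Σ-swap (λ x ω → if R x ω then F ω else ℚ.0ℚ) G Ω)
    (trans (Σ-cong Ω (λ {ω} m → trans (Σ-if-const (λ x → R x ω) (F ω) G) (cong (λ k → ι k ℚ.* F ω) (h₂ m)))) (Σ-scale (ι (countB inH G)) F Ω))))))
    (divQ-ι (ΣQ F Ω) (countB-≢0 inH (id-in S) hid))
  where
  inner : ∀ {x} → x ∈ G → sumQ (map (λ y → if inH y ∧ eqLZ (compose x y) (compose g x) then χ y else ℚ.0ℚ) G) ≡ ΣQ (λ ω → if R x ω then F ω else ℚ.0ℚ) Ω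
  -- For fixed `x` the equation between the two composites has the single solution x⁻¹ g x, so only
  -- one `y` contributes.
  inner {x} x∈ = trans (Σ-single _ (uniqueG S) y∈ others) (trans here′ (h₁ x∈ y∈ e))
    where
    X = sp-of S x∈
    gx∈ = comp-in S g∈ x∈
    y = compose (invW X) (compose g x)
    y∈ = comp-in S (inv-in S x∈) gx∈
    e : compose x y ≡ compose g x
    e = trans (sym (compose-assoc x (invW X) (compose g x))) (trans (cong (λ u → compose u (compose g x)) (invW-r X)) (compose-idˡ (sp-of S gx∈)))
    undo : ∀ {v} → v ∈ G → compose (invW X) (compose x v) ≡ v
    undo {v} m = trans (sym (compose-assoc (invW X) x v)) (trans (cong (λ u → compose u v) (invW-l X)) (compose-idˡ (sp-of S m)))
    others : ∀ {y′} → y′ ∈ G → y′ ≢ y → (if inH y′ ∧ eqLZ (compose x y′) (compose g x) then χ y′ else ℚ.0ℚ) ≡ ℚ.0ℚ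
    others {y′} m ne = trans (cong (λ b → if inH y′ ∧ b then χ y′ else ℚ.0ℚ) (eqLZ-false (λ r → ne (trans (sym (undo m)) (cong (compose (invW X)) r)))))
      (cong (λ b → if b then χ y′ else ℚ.0ℚ) (∧-zeroʳ (inH y′)))
    here′ : (if inH y ∧ eqLZ (compose x y) (compose g x) then χ y else ℚ.0ℚ) ≡ (if inH y then χ y else ℚ.0ℚ)
    here′ = trans (cong (λ b → if inH y ∧ b then χ y else ℚ.0ℚ) (eqLZ-true e)) (cong (λ b → if b then χ y else ℚ.0ℚ) (∧-identityʳ (inH y)))

if-cong : ∀ {A : Set} {a b : Bool} {x y z : A} → a ≡ b → x ≡ y → (if a then x else z) ≡ (if b then y else z)
if-cong refl refl = refl

-- By `yb` the Young subgroup is the stabilizer of `ρ₀`, and `Ω` is its orbit; the coset of `x`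
-- corresponds to the coloring that `x` carries to `ρ₀`. The sign is a class function by `sgnφ-conj`
-- and comes out as a factor.
module Young {k : ℕ} {λ′ : List ℕ} {ρ₀ : List ℤ} (lρ : length ρ₀ ≡ k) (yb : ∀ {y} → y ↭ posZ k → inYoung λ′ y ≡ presB ρ₀ y)
             (Ω : List (List ℤ)) (Ω-unique : Unique Ω) (Ω-in : ∀ {ρ} → ρ ↭ ρ₀ → ρ ∈ Ω) (Ω-out : ∀ {ρ} → ρ ∈ Ω → ρ ↭ ρ₀) where
  private
    S = symGroup k
    out : ∀ {v} → v ∈ allPerm k → v ↭ posZ k
    out = perms-∈⁻ (posZ k)
    lenΩ : ∀ {ρ} → ρ ∈ Ω → length ρ ≡ k
    lenΩ m = trans (↭P.↭-length (Ω-out m)) lρ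

  eps-colorings : ∀ {σ} → σ ↭ posZ k → epsChar λ′ σ ≡ ΣQ (λ ρ → if presB ρ σ then sgnφ σ else ℚ.0ℚ) Ω
  eps-colorings {σ} s = trans (cong (λ j → ind (allPerm j) (inYoung λ′) sgnPerm σ) (proj₁ (pos-sp s)))
      (ind-colorings S (inYoung λ′) sgnPerm (perms-∈ (posZ k) s) Ω F R h₁ h₂ (trans (yb ↭-refl) (eqLZ-true (act-id ρ₀ lρ))))
    where
    Σσ = pos-sp s
    F : List ℤ → ℚ
    F ρ = if presB ρ σ then sgnφ σ else ℚ.0ℚ
    R : List ℤ → List ℤ → Bool
    R x ρ = eqLZ (act ρ x) ρ₀
    h₁ : ∀ {x y} → x ∈ allPerm k → y ∈ allPerm k → compose x y ≡ compose σ x →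
         (if inYoung λ′ y then sgnPerm y else ℚ.0ℚ) ≡ ΣQ (λ ρ → if R x ρ then F ρ else ℚ.0ℚ) Ω
    h₁ {x} {y} x∈ y∈ e = sym (trans (Σ-single _ Ω-unique ρ*∈ (λ {ρ} m ne → cong (λ b → if b then F ρ else ℚ.0ℚ) (eqLZ-false (λ r → ne (act-inj X (lenΩ m) (lenΩ ρ*∈) (trans r (sym act*)))))))
        (trans (cong (λ b → if b then F ρ* else ℚ.0ℚ) (eqLZ-true act*))
          (if-cong (trans (pres-conj X Y Σσ (lenΩ ρ*∈) e) (trans (cong (λ ρ → presB ρ y) act*) (sym (yb (out y∈)))))
            (trans (sym (sgnφ-conj X Y Σσ e)) (cong sgnPerm (absL-pos (perm-pos (out y∈))))))))
      where
      X = sp-of S x∈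
      Y = sp-of S y∈
      ρ* = act ρ₀ (invW X)
      ρ*∈ : ρ* ∈ Ω
      ρ*∈ = Ω-in (act-↭ (invW-sp X) lρ)
      act* : act ρ* x ≡ ρ₀
      act* = trans (act-compose ρ₀ (proj₁ (invW-sp X)) (sp-wires X)) (trans (cong (act ρ₀) (invW-l X)) (act-id ρ₀ lρ))
    h₂ : ∀ {ρ} → ρ ∈ Ω → countB (λ x → R x ρ) (allPerm k) ≡ countB (inYoung λ′) (allPerm k)
    -- Some `t` carries `ρ` to `ρ₀`; translation by `t` identifies the fibre over `ρ` with the
    -- stabilizer of `ρ₀`.
    h₂ {ρ} m with act-find (lenΩ m) (↭-sym (Ω-out m))
    ... | t , t↭ , at = trans (count-translate S (perms-∈ (posZ k) t↭) (λ x → R x ρ)) (countB-cong-∈ (allPerm k) λ {x} x∈ →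
          trans (cong (λ c → eqLZ c ρ₀) (trans (sym (act-compose ρ (proj₁ (pos-sp t↭)) (sp-wires (sp-of S x∈)))) (cong (λ c → act c x) at))) (sym (yb (out x∈))))

sgf-sq : ∀ c x → sgf c x ℚ.* sgf c x ≡ ℚ.1ℚ
sgf-sq c x with ltZ c (+ 0) ∧ ltZ x (+ 0)
... | true  = refl
... | false = refl

sgf-nonneg : ∀ c {x} → + 0 ≤ x → sgf c x ≡ ℚ.1ℚ
sgf-nonneg c {x} p = cong (λ b → if b then ℚ.- ℚ.1ℚ else ℚ.1ℚ) (trans (cong (ltZ c (+ 0) ∧_) (ltZ-false p)) (∧-zeroʳ (ltZ c (+ 0))))

sgf-ev : ∀ c u z → z ≢ + 0 → ev u (+ ∣ z ∣) ≢ + 0 → sgf c (ev u z) ≡ sgf c z ℚ.* sgf c (ev u (+ ∣ z ∣))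
sgf-ev c u (+ zero) z≢0 _ = ⊥-elim (z≢0 refl)
sgf-ev c u (+ suc k) _ _ = sym (trans (cong (ℚ._* sgf c (nthZ u k)) (sgf-nonneg c {+ suc k} (ℤ.+≤+ z≤n))) (ℚP.*-identityˡ _))
sgf-ev c u -[1+ k ] _ ne with ltZ c (+ 0)
... | false = refl
... | true with ℤP.<-cmp (nthZ u k) (+ 0)
...   | tri≈ _ e _ = ⊥-elim (ne e)
...   | tri< r _ _ rewrite ltZ-true r | ltZ-false (ℤP.<⇒≤ (ℤP.neg-mono-< r)) = refl
...   | tri> _ _ r rewrite ltZ-false (ℤP.<⇒≤ r) | ltZ-true (ℤP.neg-mono-< r) = refl

prodQ-* : ∀ {A : Set} (f g : A → ℚ) xs → prodQ (map (λ x → f x ℚ.* g x) xs) ≡ prodQ (map f xs) ℚ.* prodQ (map g xs)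
prodQ-* f g [] = refl
prodQ-* f g (x ∷ xs) = trans (cong ((f x ℚ.* g x) ℚ.*_) (prodQ-* f g xs)) (interchange (f x) (g x) (prodQ (map f xs)) (prodQ (map g xs)))
  where
  interchange : ∀ a b c d → (a ℚ.* b) ℚ.* (c ℚ.* d) ≡ (a ℚ.* c) ℚ.* (b ℚ.* d)
  interchange a b c d = trans (ℚP.*-assoc a b _) (trans (cong (a ℚ.*_) (trans (sym (ℚP.*-assoc b c d)) (trans (cong (ℚ._* d) (ℚP.*-comm b c)) (ℚP.*-assoc c b d)))) (sym (ℚP.*-assoc a c _)))

prodQ-cong : ∀ {A : Set} {f g : A → ℚ} xs → (∀ {x} → x ∈ xs → f x ≡ g x) → prodQ (map f xs) ≡ prodQ (map g xs)
prodQ-cong xs e = cong prodQ (LP.map-cong-local (All.tabulate e))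

absF-↭ : ∀ {n v} → SignedPerm n v → map (absF v) (posZ n) ↭ posZ n
absF-↭ {n} {v} V = subst (_↭ posZ n) (trans (sym (absL-abs v)) (absL-map (proj₁ V))) (↭P.map⁺ +_ (proj₂ V))

-- The signs s of y = x⁻¹ g x satisfy s_y(i) s_x(|y i|) = s_g(|x i|) s_x(i); in the product over a y-stable set the s_x cancel.
negSign-conj : ∀ {n x y g κ} → SignedPerm n x → SignedPerm n y → SignedPerm n g → length κ ≡ n → compose x y ≡ compose g x →
               presB (act κ x) y ≡ true → negSign n κ g ≡ negSign n (act κ x) y
negSign-conj {n} {x} {y} {g} {κ} X Y Gs l e pr = sym (unit-cancel {C} Csq (trans (ℚP.*-comm C A) (trans (cong (A ℚ.*_) (sym B≡C)) (trans AB≡CD (trans (cong (C ℚ.*_) D≡) (ℚP.*-comm C _))))))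
  where
  κ′ = act κ x
  c : ℤ → ℤ
  c = col κ′
  pres : Pres n κ′ y
  pres = presB-sound (trans (LP.length-map (col κ) x) (proj₁ X)) (proj₁ Y) pr
  A B C D : ℚ
  A = negSign n κ′ y
  B = prodQ (map (λ i → sgf (c i) (ev x (absF y i))) (posZ n))
  C = prodQ (map (λ i → sgf (c i) (ev x i)) (posZ n))
  D = prodQ (map (λ i → sgf (c i) (ev g (absF x i))) (posZ n))
  nz : ∀ {u v} → SignedPerm n u → SignedPerm n v → ∀ {i} → i ∈ posZ n → ev u (absF v i) ≢ + 0
  nz U V m = proj₁ (wire (sp-perm U) (posZ-wire (abs-pos (wire (sp-perm V) (posZ-wire m)))))
  AB≡CD : A ℚ.* B ≡ C ℚ.* D
  AB≡CD = trans (sym (prodQ-* _ _ (posZ n))) (trans (prodQ-cong (posZ n) (λ {i} m →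
      trans (sym (sgf-ev (c i) x (ev y i) (proj₁ (wire (sp-perm Y) (posZ-wire m))) (nz X Y m)))
        (trans (cong (sgf (c i)) (trans (sym (ev-compose x y i)) (trans (cong (λ v → ev v i) e) (ev-compose g x i))))
          (sgf-ev (c i) g (ev x i) (proj₁ (wire (sp-perm X) (posZ-wire m))) (nz Gs X m))))) (prodQ-* _ _ (posZ n)))
  B≡C : B ≡ C
  B≡C = trans (prodQ-cong (posZ n) (λ {i} m → cong (λ a → sgf a (ev x (absF y i))) (sym (pres i (posZ-wire m)))))
    (trans (cong prodQ (LP.map-∘ {g = λ j → sgf (c j) (ev x j)} {f = absF y} (posZ n))) (prodQ-↭ (↭P.map⁺ _ (absF-↭ Y))))
  D≡ : D ≡ negSign n κ g
  D≡ = trans (prodQ-cong (posZ n) (λ {i} m → cong (λ a → sgf a (ev g (absF x i))) (col-act κ (proj₁ X) i (posZ-wire m))))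
    (trans (cong prodQ (LP.map-∘ {g = λ j → sgf (col κ j) (ev g j)} {f = absF x} (posZ n))) (prodQ-↭ (↭P.map⁺ _ (absF-↭ X))))
  Csq : C ℚ.* C ≡ ℚ.1ℚ
  Csq = trans (sym (prodQ-* _ _ (posZ n))) (prodQ-ones (AllP.map⁺ {xs = posZ n} (All.tabulate λ {i} _ → sgf-sq (c i) (ev x i))))

signs-zip : List ℤ → List ℤ → ℚ
signs-zip κ v = prodQ (zipWith sgf κ v)

negSign-zip : ∀ {n κ v} → length κ ≡ n → length v ≡ n → negSign n κ v ≡ signs-zip κ v
negSign-zip {n} {κ} {v} lκ lv = trans (cong prodQ (go (posZ n))) (cong₂ signs-zip (map-col κ lκ) (win-map v lv))
  where
  go : ∀ xs → map (λ z → sgf (col κ z) (ev v z)) xs ≡ zipWith sgf (map (col κ) xs) (map (ev v) xs)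
  go [] = refl
  go (x ∷ xs) = cong (_ ∷_) (go xs)

signs-pos : ∀ {ρ} v → All (+ 0 <_) ρ → length ρ ≡ length v → ∀ ρ′ v′ → signs-zip (ρ ++ ρ′) (v ++ v′) ≡ signs-zip ρ′ v′
signs-pos [] [] _ ρ′ v′ = refl
signs-pos {c ∷ ρ} (x ∷ v) (p ∷ a) l ρ′ v′ rewrite ltZ-false (ℤP.<⇒≤ p) = trans (ℚP.*-identityˡ _) (signs-pos v a (ℕP.suc-injective l) ρ′ v′)

signs-neg : ∀ {ρ} v → All (_< + 0) ρ → length ρ ≡ length v → signs-zip ρ v ≡ powNeg1 (negCount v)
signs-neg [] [] _ = refl
signs-neg {c ∷ ρ} (x ∷ v) (p ∷ a) l rewrite ltZ-true p with ltZ x (+ 0)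
... | true  = trans (sym (ℚP.neg-distribˡ-* ℚ.1ℚ (signs-zip ρ v))) (cong ℚ.-_ (trans (ℚP.*-identityˡ _) (signs-neg v a (ℕP.suc-injective l))))
... | false = trans (ℚP.*-identityˡ _) (signs-neg v a (ℕP.suc-injective l))

powNeg1-+ : ∀ a b → powNeg1 (a ℕ.+ b) ≡ powNeg1 a ℚ.* powNeg1 b
powNeg1-+ zero b = sym (ℚP.*-identityˡ _)
powNeg1-+ (suc a) b = trans (cong ℚ.-_ (powNeg1-+ a b)) (ℚP.neg-distribˡ-* (powNeg1 a) (powNeg1 b))

inv-++-sep : ∀ A {B} → All (λ a → All (a <_) B) A → invZ (A ++ B) ≡ invZ A ℕ.+ invZ B
inv-++-sep [] _ = refl
inv-++-sep (a ∷ A) {B} (h ∷ hs) rewrite inv-++-sep A hs | countB-++ (λ y → ltZ y a) A B | below-none h =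
  trans (cong (ℕ._+ (invZ A ℕ.+ invZ B)) (ℕP.+-identityʳ (below a A))) (sym (ℕP.+-assoc (below a A) (invZ A) (invZ B)))

inv-map-mono : ∀ (f : ℤ → ℤ) {xs} → (∀ {x y} → x ∈ xs → y ∈ xs → ltZ (f x) (f y) ≡ ltZ x y) → invZ (map f xs) ≡ invZ xs
inv-map-mono f {[]} h = refl
inv-map-mono f {x ∷ xs} h = cong₂ ℕ._+_ (trans (countB-map (λ y → ltZ y (f x)) f xs) (countB-cong-∈ xs (λ m → h (there m) (here refl)))) (inv-map-mono f (λ p q → h (there p) (there q)))

take-len : ∀ {A : Set} (xs : List A) ys → take (length xs) (xs ++ ys) ≡ xs
take-len [] ys = refl
take-len (x ∷ xs) ys = cong (x ∷_) (take-len xs ys)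

++-inj : ∀ {A : Set} (xs xs′ : List A) {ys ys′} → length xs ≡ length xs′ → xs ++ ys ≡ xs′ ++ ys′ → (xs ≡ xs′) × (ys ≡ ys′)
++-inj [] [] _ e = refl , e
++-inj (x ∷ xs) (x′ ∷ xs′) l e = let a , b = ++-inj xs xs′ (ℕP.suc-injective l) (LP.∷-injectiveʳ e) in cong₂ _∷_ (LP.∷-injectiveˡ e) a , b

↭-drop-prefix : ∀ {A : Set} (xs : List A) {ys zs} → xs ++ ys ↭ xs ++ zs → ys ↭ zs
↭-drop-prefix [] r = r
↭-drop-prefix (x ∷ xs) r = ↭-drop-prefix xs (↭P.drop-∷ r)

abs-shiftDown : ∀ k x → ∣ shiftDown k x ∣ ≡ ∣ x ∣ ∸ k
abs-shiftDown k (+ m) = refl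
abs-shiftDown k -[1+ m ] = ℤP.∣-i∣≡∣i∣ (+ (suc m ∸ k))

col-left : ∀ ρ {ρ′ u} → u ≢ + 0 → ∣ u ∣ ℕ.≤ length ρ → col (ρ ++ ρ′) u ≡ col ρ u
col-left ρ {ρ′} {+ zero} ne _ = ⊥-elim (ne refl)
col-left ρ {ρ′} {+ suc k} _ p = nthZ-++ˡ ρ ρ′ p
col-left ρ {ρ′} { -[1+ k ]} _ p = nthZ-++ˡ ρ ρ′ p

pred-shift : ∀ a k → k ℕ.< a → a ∸ 1 ≡ k ℕ.+ (a ∸ k ∸ 1)
pred-shift (suc a) zero _ = refl
pred-shift (suc (suc a)) (suc k) (s≤s q) = cong suc (pred-shift (suc a) k q)
pred-shift (suc zero) (suc k) (s≤s ())

col-right : ∀ ρ {ρ′ u} → length ρ ℕ.< ∣ u ∣ → col (ρ ++ ρ′) u ≡ col ρ′ (shiftDown (length ρ) u)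
col-right ρ {ρ′} {u} p = trans (cong (nthZ (ρ ++ ρ′)) (trans (pred-shift ∣ u ∣ (length ρ) p) (cong (λ a → length ρ ℕ.+ (a ∸ 1)) (sym (abs-shiftDown (length ρ) u))))) (nthZ-++ʳ ρ ρ′ _)

≤ᵇ-ℕ : ∀ {a b} → a ℕ.≤ b → (a ℕ.≤ᵇ b) ≡ true
≤ᵇ-ℕ {a} {b} p with a ℕ.≤ᵇ b | ℕP.≤⇒≤ᵇ p
... | true | _ = refl

≤ᵇ-ℕ-sound : ∀ {a b} → (a ℕ.≤ᵇ b) ≡ true → a ℕ.≤ b
≤ᵇ-ℕ-sound {a} {b} e = ℕP.≤ᵇ⇒≤ a b (subst T (sym e) _)

posB : List ℤ → Bool
posB = allB (λ c → ltZ (+ 0) c)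

-- Signed permutations that preserve the first `k` absolute values are recognized by a coloring with
-- `k` positive colors followed by `m` negative ones: they are those that keep the positive colors
-- in front.
module TwoBlocks {k m : ℕ} where
  private n = k ℕ.+ m

  record Split (ρ ρ′ : List ℤ) : Set where
    field
      len  : length ρ ≡ k
      len′ : length ρ′ ≡ m
      pos  : All (+ 0 <_) ρ
      neg  : All (_< + 0) ρ′
  open Split public

  inH : List ℤ → Bool
  inH u = allB (λ x → ∣ x ∣ ℕ.≤ᵇ k) (take k u)

  split-length : ∀ {ρ ρ′} → Split ρ ρ′ → length (ρ ++ ρ′) ≡ n
  split-length {ρ} s = trans (LP.length-++ ρ) (cong₂ ℕ._+_ (len s) (len′ s))

  nthZ-in : ∀ {P : ℤ → Set} {xs j} → All P xs → j ℕ.< length xs → P (nthZ xs j)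
  nthZ-in {xs = xs} a p = All.lookup a (nthZ-∈ xs p)

  pred-< : ∀ {a b} → a ≢ 0 → a ℕ.≤ b → a ∸ 1 ℕ.< b
  pred-< {zero} ne _ = ⊥-elim (ne refl)
  pred-< {suc a} _ p = p

  wire-abs≤ : ∀ {n u} → Wire n u → ∣ u ∣ ℕ.≤ n
  wire-abs≤ {u = + zero} w = z≤n
  wire-abs≤ {u = + suc _} w = wire-pos w
  wire-abs≤ {u = -[1+ _ ]} w = wire-negsuc w

  abs≢0 : ∀ {u} → u ≢ + 0 → ∣ u ∣ ≢ 0
  abs≢0 ne e = ne (ℤP.∣i∣≡0⇒i≡0 e)

  col-pos : ∀ {ρ ρ′ u} → Split ρ ρ′ → Wire n u → ∣ u ∣ ℕ.≤ k → + 0 < col (ρ ++ ρ′) u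
  col-pos {ρ} {ρ′} {u} s w p = subst (+ 0 <_) (sym (col-left ρ {ρ′} (proj₁ w) p′)) (nthZ-in (pos s) (pred-< (abs≢0 (proj₁ w)) p′))
    where p′ = subst (∣ u ∣ ℕ.≤_) (sym (len s)) p

  col-neg′ : ∀ {ρ ρ′ u} → Split ρ ρ′ → Wire n u → k ℕ.< ∣ u ∣ → col (ρ ++ ρ′) u < + 0
  col-neg′ {ρ} {ρ′} {u} s w p = subst (_< + 0) (sym (col-right ρ {ρ′} {u} (subst (ℕ._< ∣ u ∣) (sym (len s)) p)))
      (nthZ-in (neg s) (subst (ℕ._< length ρ′) (cong (_∸ 1) (sym (trans (abs-shiftDown (length ρ) u) (cong (∣ u ∣ ∸_) (len s)))))
        (pred-< (λ e → ℕP.<⇒≱ p (ℕP.m∸n≡0⇒m≤n e)) (subst (∣ u ∣ ∸ k ℕ.≤_) (trans (ℕP.m+n∸m≡n k m) (sym (len′ s))) (ℕP.∸-monoˡ-≤ k (wire-abs≤ w))))))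

  pos-inH : ∀ {ρ ρ′ u} → Split ρ ρ′ → SignedPerm n u → posB (take k (act (ρ ++ ρ′) u)) ≡ inH u
  pos-inH {ρ} {ρ′} {u} s U = bool-iff
      (λ e → allB-true (take k u) λ {x} m → case k ℕ.<? ∣ x ∣ of λ
        { (no r) → ≤ᵇ-ℕ (ℕP.≮⇒≥ r)
        ; (yes r) → ⊥-elim (ℤP.<-asym (col-neg′ s (wr m) r) (ltZ-sound (allB-sound (take k (act (ρ ++ ρ′) u)) e (mem m)))) })
      (λ e → allB-true (take k (act (ρ ++ ρ′) u)) λ {c} m → case mem⁻ m of λ { (x , m′ , refl) →
        ltZ-true (col-pos s (wr m′) (≤ᵇ-ℕ-sound (allB-sound (take k u) e m′))) })
    where
    sub : ∀ {x} → x ∈ take k u → x ∈ u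
    sub {x} m = subst (x ∈_) (LP.take++drop≡id k u) (∈P.∈-++⁺ˡ m)
    wr : ∀ {x} → x ∈ take k u → Wire n x
    wr m = All.lookup (sp-wires U) (sub m)
    mem : ∀ {x} → x ∈ take k u → col (ρ ++ ρ′) x ∈ take k (act (ρ ++ ρ′) u)
    mem {x} m = subst (col (ρ ++ ρ′) x ∈_) (sym (LP.take-map k u)) (∈P.∈-map⁺ (col (ρ ++ ρ′)) m)
    mem⁻ : ∀ {c} → c ∈ take k (act (ρ ++ ρ′) u) → ∃ λ x → (x ∈ take k u) × (c ≡ col (ρ ++ ρ′) x)
    mem⁻ {c} m = ∈P.∈-map⁻ (col (ρ ++ ρ′)) (subst (c ∈_) (LP.take-map k u) m)

  pos-split : ∀ {ρ ρ′} → Split ρ ρ′ → posB (take k (ρ ++ ρ′)) ≡ true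
  pos-split {ρ} {ρ′} s = subst (λ j → posB (take j (ρ ++ ρ′)) ≡ true) (len s)
    (trans (cong posB (take-len ρ ρ′)) (allB-true ρ λ m → ltZ-true (All.lookup (pos s) m)))

  module Inside {y : List ℤ} (Y : SignedPerm n y) (yH : inH y ≡ true) where
    y₁ y₂ y₂′ : List ℤ
    y₁ = take k y
    y₂ = drop k y
    y₂′ = map (shiftDown k) y₂

    private
      y≡ : y₁ ++ y₂ ≡ y
      y≡ = LP.take++drop≡id k y
      len₁ : length y₁ ≡ k
      len₁ = trans (LP.length-take k y) (trans (cong (k ℕ.⊓_) (proj₁ Y)) (ℕP.m≤n⇒m⊓n≡m (ℕP.m≤m+n k m)))
      len₂ : length y₂ ≡ m
      len₂ = trans (LP.length-drop k y) (trans (cong (_∸ k) (proj₁ Y)) (ℕP.m+n∸m≡n k m))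
      uniq : Unique (map ∣_∣ y₁ ++ map ∣_∣ y₂)
      uniq = subst Unique (trans (cong (map ∣_∣) (sym y≡)) (LP.map-++ ∣_∣ y₁ y₂)) (↭-unique (↭-sym (proj₂ Y)) (upto1-unique n))
      wires : ∀ {x} → x ∈ y → Wire n x
      wires = All.lookup (sp-wires Y)
      in₁ : ∀ {x} → x ∈ y₁ → Wire n x × (∣ x ∣ ℕ.≤ k)
      in₁ {x} m = wires (subst (x ∈_) y≡ (∈P.∈-++⁺ˡ m)) , ≤ᵇ-ℕ-sound (allB-sound y₁ yH m)

    absL₁ : absL y₁ ↭ posZ k
    absL₁ = subst (_↭ posZ k) (sym (absL-abs y₁)) (↭P.map⁺ +_ (unique-⊆-↭ (left-unique (map ∣_∣ y₁) uniq) sub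
        (ℕP.≤-reflexive (trans (trans (LP.length-map suc (upTo k)) (LP.length-upTo k)) (sym (trans (LP.length-map ∣_∣ y₁) len₁))))))
      where
      left-unique : ∀ {A : Set} (xs : List A) {ys} → Unique (xs ++ ys) → Unique xs
      left-unique [] u = []
      left-unique (x ∷ xs) (h ∷ u) = AllP.++⁻ˡ xs h ∷ left-unique xs u
      sub : ∀ {a} → a ∈ map ∣_∣ y₁ → a ∈ upto1 k
      sub i with ∈P.∈-map⁻ ∣_∣ i
      ... | x , i′ , refl = let w , p = in₁ i′ in small ∣ x ∣ (abs≢0 (proj₁ w)) p
        where
        small : ∀ a → a ≢ 0 → a ℕ.≤ k → a ∈ upto1 k
        small zero ne _ = ⊥-elim (ne refl)
        small (suc a) _ p = ∈P.∈-map⁺ suc (∈P.∈-upTo⁺ p)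

    in₂ : ∀ {x} → x ∈ y₂ → Wire n x × (k ℕ.< ∣ x ∣)
    in₂ {x} i = w , big
      where
      w = wires (subst (x ∈_) y≡ (∈P.∈-++⁺ʳ y₁ i))
      big : k ℕ.< ∣ x ∣
      big with k ℕ.<? ∣ x ∣
      ... | yes r = r
      ... | no r = ⊥-elim (All.lookup (All.lookup (AllPairs-++-cross (map ∣_∣ y₁) uniq) occurs) (∈P.∈-map⁺ ∣_∣ i) refl)
        where
        x∈posk : + ∣ x ∣ ∈ posZ k
        x∈posk = ∈-posZ (ℤ.+<+ (ℕP.n≢0⇒n>0 (abs≢0 (proj₁ w)))) (ℤ.+≤+ (ℕP.≮⇒≥ r))
        occurs : ∣ x ∣ ∈ map ∣_∣ y₁
        occurs with ∈P.∈-map⁻ (λ z → + ∣ z ∣) (↭P.∈-resp-↭ (↭-sym absL₁) x∈posk)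
        ... | x′ , j , e = subst (_∈ map ∣_∣ y₁) (sym (ℤP.+-injective e)) (∈P.∈-map⁺ ∣_∣ j)

    private
      sh : ℤ → ℤ
      sh z = + (∣ z ∣ ∸ k)
      absL₂-map : absL y₂′ ≡ map sh (absL y₂)
      absL₂-map = trans (sym (LP.map-∘ y₂)) (trans (LP.map-cong (λ x → cong +_ (abs-shiftDown k x)) y₂) (LP.map-∘ y₂))
      big : ∀ {z} → z ∈ absL y₂ → k ℕ.< ∣ z ∣
      big i with ∈P.∈-map⁻ (λ z → + ∣ z ∣) i
      ... | x , i′ , refl = proj₂ (in₂ i′)

    absL₂ : absL y₂′ ↭ posZ m
    absL₂ = unique-⊆-↭ uni sub (ℕP.≤-reflexive (trans (length-posZ m) (sym (trans (LP.length-map _ y₂′) (trans (LP.length-map (shiftDown k) y₂) len₂)))))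
      where
      uni : Unique (absL y₂′)
      uni = subst Unique (sym absL₂-map) (unique-map sh (λ {p} {q} a b e → un a b e) (subst Unique (sym (absL-abs y₂)) (UP.map⁺ ℤP.+-injective (AllPairs-++ʳ (map ∣_∣ y₁) uniq))))
        where
        un : ∀ {p q} → p ∈ absL y₂ → q ∈ absL y₂ → sh p ≡ sh q → p ≡ q
        un a b e with ∈P.∈-map⁻ (λ z → + ∣ z ∣) a | ∈P.∈-map⁻ (λ z → + ∣ z ∣) b
        ... | x , i , refl | x′ , i′ , refl = cong +_ (ℕP.∸-cancelʳ-≡ (ℕP.<⇒≤ (proj₂ (in₂ i))) (ℕP.<⇒≤ (proj₂ (in₂ i′))) (ℤP.+-injective e))
      sub : ∀ {a} → a ∈ absL y₂′ → a ∈ posZ m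
      sub {a} i with ∈P.∈-map⁻ (λ z → + ∣ z ∣) i
      ... | x , i′ , refl with ∈P.∈-map⁻ (shiftDown k) i′
      ... | x′ , i″ , refl = subst (λ b → + b ∈ posZ m) (sym (abs-shiftDown k x′)) (∈-posZ (ℤ.+<+ (ℕP.m<n⇒0<n∸m (proj₂ (in₂ i″))))
            (ℤ.+≤+ (subst (∣ x′ ∣ ∸ k ℕ.≤_) (ℕP.m+n∸m≡n k m) (ℕP.∸-monoˡ-≤ k (wire-abs≤ (proj₁ (in₂ i″)))))))

    -- Absolute values in the first block are smaller than those in the second, so no inversion
    -- joins the blocks; shifting the second block preserves its order.
    sgn-split : sgnφ y ≡ sgnφ (absL y₁) ℚ.* sgnφ (absL y₂′)
    sgn-split = trans (cong powNeg1 (trans (cong invZ (trans (cong absL (sym y≡)) (LP.map-++ _ y₁ y₂))) (inv-++-sep (absL y₁) sep)))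
        (trans (powNeg1-+ (invZ (absL y₁)) (invZ (absL y₂))) (cong₂ ℚ._*_ (cong sgnPerm (sym (absL-pos (perm-pos absL₁))))
          (cong powNeg1 (trans (sym (inv-map-mono sh mono)) (cong invZ (trans (sym absL₂-map) (sym (absL-pos (perm-pos absL₂)))))))))
      where
      sep : All (λ a → All (a <_) (absL y₂)) (absL y₁)
      sep = AllP.map⁺ (All.tabulate λ i → AllP.map⁺ (All.tabulate λ j → ℤ.+<+ (ℕP.≤-<-trans (proj₂ (in₁ i)) (proj₂ (in₂ j)))))
      mono : ∀ {x z} → x ∈ absL y₂ → z ∈ absL y₂ → ltZ (sh x) (sh z) ≡ ltZ x z
      mono {x} {z} a b with ∈P.∈-map⁻ (λ z → + ∣ z ∣) a | ∈P.∈-map⁻ (λ z → + ∣ z ∣) b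
      ... | p , i , refl | q , j , refl with ∣ p ∣ ℕ.<? ∣ q ∣
      ...   | yes r = trans (ltZ-true (ℤ.+<+ (ℕP.∸-monoˡ-< r (ℕP.<⇒≤ (proj₂ (in₂ i)))))) (sym (ltZ-true (ℤ.+<+ r)))
      ...   | no r = trans (ltZ-false (ℤ.+≤+ (ℕP.∸-monoˡ-≤ k (ℕP.≮⇒≥ r)))) (sym (ltZ-false (ℤ.+≤+ (ℕP.≮⇒≥ r))))

    module _ {ρ ρ′ : List ℤ} (s : Split ρ ρ′) where
      act-split : act (ρ ++ ρ′) y ≡ act ρ (absL y₁) ++ act ρ′ (absL y₂′)
      act-split = trans (cong (act (ρ ++ ρ′)) (sym y≡)) (trans (LP.map-++ (col (ρ ++ ρ′)) y₁ y₂) (cong₂ _++_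
          (trans (LP.map-cong-local (All.tabulate λ {x} i → trans (col-left ρ {ρ′} (proj₁ (proj₁ (in₁ i))) (subst (∣ x ∣ ℕ.≤_) (sym (len s)) (proj₂ (in₁ i)))) (col-abs ρ {x} {+ ∣ x ∣} refl))) (LP.map-∘ y₁))
          (trans (LP.map-cong-local (All.tabulate λ {x} i → trans (col-right ρ {ρ′} {x} (subst (ℕ._< ∣ x ∣) (sym (len s)) (proj₂ (in₂ i))))
              (trans (cong (λ j → col ρ′ (shiftDown j x)) (len s)) (col-abs ρ′ {shiftDown k x} {+ ∣ shiftDown k x ∣} refl)))) (trans (LP.map-∘ y₂) (LP.map-∘ y₂′)))))

      pres-split : presB (ρ ++ ρ′) y ≡ presB ρ (absL y₁) ∧ presB ρ′ (absL y₂′)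
      pres-split = bool-iff
        (λ e → let a , b = ++-inj (act ρ (absL y₁)) ρ (trans (LP.length-map _ (absL y₁)) (trans (LP.length-map _ y₁) (trans len₁ (sym (len s))))) (trans (sym act-split) (eqLZ-sound e))
               in ∧-intro (eqLZ-true a) (eqLZ-true b))
        (λ e → let a , b = ∧-true {presB ρ (absL y₁)} e in eqLZ-true (trans act-split (cong₂ _++_ (eqLZ-sound a) (eqLZ-sound b))))

      neg-split : negSign n (ρ ++ ρ′) y ≡ powNeg1 (negCount y₂)
      neg-split = trans (negSign-zip {κ = ρ ++ ρ′} {v = y} (split-length s) (proj₁ Y)) (trans (cong (signs-zip (ρ ++ ρ′)) (sym y≡))
        (trans (signs-pos y₁ (pos s) (trans (len s) (sym len₁)) ρ′ y₂) (signs-neg y₂ (neg s) (trans (len′ s) (sym len₂)))))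

      term-split : (if presB (ρ ++ ρ′) y then signedTerm n (ρ ++ ρ′) y else ℚ.0ℚ) ≡
        (if presB ρ (absL y₁) then sgnφ (absL y₁) else ℚ.0ℚ) ℚ.* (powNeg1 (negCount y₂) ℚ.* (if presB ρ′ (absL y₂′) then sgnφ (absL y₂′) else ℚ.0ℚ))
      term-split rewrite pres-split with presB ρ (absL y₁) | presB ρ′ (absL y₂′)
      ... | false | b = sym (ℚP.*-zeroˡ (powNeg1 (negCount y₂) ℚ.* (if b then sgnφ (absL y₂′) else ℚ.0ℚ)))
      ... | true | false = sym (trans (cong (sgnφ (absL y₁) ℚ.*_) (ℚP.*-zeroʳ (powNeg1 (negCount y₂)))) (ℚP.*-zeroʳ (sgnφ (absL y₁))))
      ... | true | true = trans (cong₂ ℚ._*_ sgn-split neg-split) (trans (ℚP.*-assoc (sgnφ (absL y₁)) (sgnφ (absL y₂′)) _) (cong (sgnφ (absL y₁) ℚ.*_) (ℚP.*-comm (sgnφ (absL y₂′)) _)))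

filter-pos : ∀ {xs} → All (+ 0 <_) xs → filter (+ 0 ℤ.<?_) xs ≡ xs
filter-pos = LP.filter-all (+ 0 ℤ.<?_)

filter-neg : ∀ {xs} → All (_< + 0) xs → filter (+ 0 ℤ.<?_) xs ≡ []
filter-neg a = LP.filter-none (+ 0 ℤ.<?_) (All.map (λ p q → ℤP.<-asym p q) a)

-- The second stage of the induction. By `Young` the inducing character is a sum over pairs (`ρ`,
-- `ρ′`), that is, over the colorings whose positive colors come first; acting by `x` carries the
-- colorings selected by `R x` onto these.
module Outer {m : ℕ} {λ′ μ : List ℕ} {ρ₀ ρ₀′ : List ℤ}
    (lρ : length ρ₀ ≡ sum λ′) (lρ′ : length ρ₀′ ≡ m) (ρ₀-pos : All (+ 0 <_) ρ₀) (ρ₀′-neg : All (_< + 0) ρ₀′)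
    (yb : ∀ {y} → y ↭ posZ (sum λ′) → inYoung λ′ y ≡ presB ρ₀ y) (yb′ : ∀ {y} → y ↭ posZ m → inYoung μ y ≡ presB ρ₀′ y)
    (Ω₁ : List (List ℤ)) (Ω₁-unique : Unique Ω₁) (Ω₁-in : ∀ {ρ} → ρ ↭ ρ₀ → ρ ∈ Ω₁) (Ω₁-out : ∀ {ρ} → ρ ∈ Ω₁ → ρ ↭ ρ₀)
    (Ω₂ : List (List ℤ)) (Ω₂-unique : Unique Ω₂) (Ω₂-in : ∀ {ρ} → ρ ↭ ρ₀′ → ρ ∈ Ω₂) (Ω₂-out : ∀ {ρ} → ρ ∈ Ω₂ → ρ ↭ ρ₀′)
    (Ω : List (List ℤ)) (Ω-unique : Unique Ω) (Ω-in : ∀ {κ} → κ ↭ ρ₀ ++ ρ₀′ → κ ∈ Ω) (Ω-out : ∀ {κ} → κ ∈ Ω → κ ↭ ρ₀ ++ ρ₀′) where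
  private
    k n : ℕ
    k = sum λ′
    n = k ℕ.+ m
    open TwoBlocks {k} {m}
    S = signedGroup n

    split₁ : ∀ {ρ ρ′} → ρ ↭ ρ₀ → ρ′ ↭ ρ₀′ → Split ρ ρ′
    split₁ r r′ = record { len = trans (↭P.↭-length r) lρ ; len′ = trans (↭P.↭-length r′) lρ′
      ; pos = ↭P.All-resp-↭ (↭-sym r) ρ₀-pos ; neg = ↭P.All-resp-↭ (↭-sym r′) ρ₀′-neg }

    split₀ : Split ρ₀ ρ₀′
    split₀ = split₁ ↭-refl ↭-refl

    lenΩ : ∀ {κ} → κ ∈ Ω → length κ ≡ n
    lenΩ i = trans (↭P.↭-length (Ω-out i)) (split-length split₀)

    posk : List ℤ → Bool
    posk κ = posB (take k κ)

    prods : List (List ℤ)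
    prods = concatMap (λ ρ → map (ρ ++_) Ω₂) Ω₁

    prods-unique : Unique prods
    prods-unique = concatMap-unique (λ ρ → map (ρ ++_) Ω₂) Ω₁-unique (λ {ρ} _ → UP.map⁺ (LP.++-cancelˡ ρ _ _) Ω₂-unique)
      (λ {ρ} {ρ′} a b i j → case ∈P.∈-map⁻ (ρ ++_) i of λ { (_ , _ , refl) → case ∈P.∈-map⁻ (ρ′ ++_) j of λ { (_ , _ , e) →
        proj₁ (++-inj ρ ρ′ (trans (↭P.↭-length (Ω₁-out a)) (sym (↭P.↭-length (Ω₁-out b)))) e) } })

    -- The content has exactly `k` positive entries, and the first `k` positions hold positive ones,
    -- so these are all of them.
    decompose : ∀ {κ} → κ ∈ Ω → posk κ ≡ true → (take k κ ↭ ρ₀) × (drop k κ ↭ ρ₀′)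
    decompose {κ} i p = r , ↭-drop-prefix ρ₀ (↭-trans (↭P.++⁺ʳ ρ′ (↭-sym r)) whole)
      where
      ρ = take k κ
      ρ′ = drop k κ
      whole : ρ ++ ρ′ ↭ ρ₀ ++ ρ₀′
      whole = subst (_↭ ρ₀ ++ ρ₀′) (sym (LP.take++drop≡id k κ)) (Ω-out i)
      flt = filter (+ 0 ℤ.<?_)
      ρpos : All (+ 0 <_) ρ
      ρpos = All.tabulate λ j → ltZ-sound (allB-sound ρ p j)
      f : ρ ++ flt ρ′ ↭ ρ₀
      f = subst₂ _↭_ (trans (LP.filter-++ (+ 0 ℤ.<?_) ρ ρ′) (cong (_++ flt ρ′) (filter-pos ρpos)))
            (trans (LP.filter-++ (+ 0 ℤ.<?_) ρ₀ ρ₀′) (trans (cong₂ _++_ (filter-pos ρ₀-pos) (filter-neg ρ₀′-neg)) (LP.++-identityʳ ρ₀)))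
            (↭P.filter-↭ (+ 0 ℤ.<?_) whole)
      lenρ : length ρ ≡ k
      lenρ = trans (LP.length-take k κ) (trans (cong (k ℕ.⊓_) (lenΩ i)) (ℕP.m≤n⇒m⊓n≡m (ℕP.m≤m+n k m)))
      empty : ∀ (xs : List ℤ) → length (ρ ++ xs) ≡ k → xs ≡ []
      empty [] _ = refl
      empty (x ∷ xs) e = ⊥-elim (ℕP.m+1+n≢m k (trans (cong (ℕ._+ suc (length xs)) (sym lenρ)) (trans (sym (LP.length-++ ρ)) e)))
      r : ρ ↭ ρ₀
      r = subst (_↭ ρ₀) (trans (cong (ρ ++_) (empty (flt ρ′) (trans (↭P.↭-length f) lρ))) (LP.++-identityʳ ρ)) f

    filtered-↭ : filterB posk Ω ↭ prods
    filtered-↭ = unique-↭ (filterB-unique posk Ω-unique) prods-unique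
      (λ {κ} i → let a , b = filterB-∈ posk Ω i
                     r , r′ = decompose a b
                 in subst (_∈ prods) (LP.take++drop≡id k κ) (concatMap-∈ (λ ρ → map (ρ ++_) Ω₂) (Ω₁-in r) (∈P.∈-map⁺ (take k κ ++_) (Ω₂-in r′))))
      (λ i → case concatMap-∈⁻ (λ ρ → map (ρ ++_) Ω₂) Ω₁ i of λ { (ρ , a , b) → case ∈P.∈-map⁻ (ρ ++_) b of λ { (ρ′ , c , refl) →
        ∈-filterB posk Ω (Ω-in (↭P.++⁺ (Ω₁-out a) (Ω₂-out c))) (pos-split (split₁ (Ω₁-out a) (Ω₂-out c))) } })

    χ : List ℤ → ℚ
    χ u = epsChar λ′ (absL (take k u)) ℚ.* (powNeg1 (negCount (drop k u)) ℚ.* epsChar μ (absL (map (shiftDown k) (drop k u))))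

    module Y₁ = Young {k} {λ′} {ρ₀} lρ yb Ω₁ Ω₁-unique Ω₁-in Ω₁-out
    module Y₂ = Young {m} {μ} {ρ₀′} lρ′ yb′ Ω₂ Ω₂-unique Ω₂-in Ω₂-out

    term : List ℤ → List ℤ → ℚ
    term y κ = if presB κ y then signedTerm n κ y else ℚ.0ℚ

    inside : ∀ {y} → SignedPerm n y → inH y ≡ true → χ y ≡ ΣQ (λ ρ → ΣQ (λ ρ′ → term y (ρ ++ ρ′)) Ω₂) Ω₁
    inside {y} Y yH = trans (cong₂ (λ a b → a ℚ.* (pw ℚ.* b)) (Y₁.eps-colorings I.absL₁) (Y₂.eps-colorings I.absL₂))
        (trans (sym (Σ-scaleʳ (pw ℚ.* ΣQ b Ω₂) a Ω₁)) (Σ-cong Ω₁ λ {ρ} i → trans (cong (a ρ ℚ.*_) (sym (Σ-scale pw b Ω₂)))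
          (trans (sym (Σ-scale (a ρ) (λ ρ′ → pw ℚ.* b ρ′) Ω₂)) (Σ-cong Ω₂ λ j → sym (I.term-split (split₁ (Ω₁-out i) (Ω₂-out j)))))))
      where
      module I = Inside Y yH
      pw = powNeg1 (negCount I.y₂)
      a b : List ℤ → ℚ
      a ρ = if presB ρ (absL I.y₁) then sgnφ (absL I.y₁) else ℚ.0ℚ
      b ρ′ = if presB ρ′ (absL I.y₂′) then sgnφ (absL I.y₂′) else ℚ.0ℚ

    -- A split coloring fixed by `y` would put `y` into the subgroup by `pos-inH`; so every term
    -- vanishes.
    outside : ∀ {y} → SignedPerm n y → inH y ≡ false → ℚ.0ℚ ≡ ΣQ (λ ρ → ΣQ (λ ρ′ → term y (ρ ++ ρ′)) Ω₂) Ω₁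
    outside {y} Y yH = sym (Σ-zero _ Ω₁ λ {ρ} i → Σ-zero _ Ω₂ λ {ρ′} j → zero-term (split₁ (Ω₁-out i) (Ω₂-out j)))
      where
      zero-term : ∀ {ρ ρ′} → Split ρ ρ′ → term y (ρ ++ ρ′) ≡ ℚ.0ℚ
      zero-term {ρ} {ρ′} s with presB (ρ ++ ρ′) y in e
      ... | false = refl
      ... | true = ⊥-elim (case trans (sym yH) (trans (sym (pos-inH s Y)) (trans (cong (posB ∘ take k) (eqLZ-sound e)) (pos-split s))) of λ ())

    block-sum : ∀ {y} → SignedPerm n y → (if inH y then χ y else ℚ.0ℚ) ≡ ΣQ (λ κ → if posk κ then term y κ else ℚ.0ℚ) Ω
    block-sum {y} Y = trans (two (inH y) refl) (sym (trans (Σ-filter posk (term y) Ω) (trans (Σ-↭ (term y) filtered-↭)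
        (trans (Σ-concatMap (term y) (λ ρ → map (ρ ++_) Ω₂) Ω₁) (Σ-cong Ω₁ λ {ρ} _ → Σ-map (term y) (ρ ++_) Ω₂)))))
      where
      two : ∀ b → inH y ≡ b → (if b then χ y else ℚ.0ℚ) ≡ ΣQ (λ ρ → ΣQ (λ ρ′ → term y (ρ ++ ρ′)) Ω₂) Ω₁
      two true e = inside Y e
      two false e = outside Y e

  epsEps-colorings : ∀ {g} → SignedPerm n g → epsEps n λ′ μ g ≡ ΣQ (λ κ → if presB κ g then signedTerm n κ g else ℚ.0ℚ) Ω
  epsEps-colorings {g} Gs = ind-colorings S inH χ (allSigned-∈ Gs) Ω (term g) R h₁ h₂ idH
    where
    R : List ℤ → List ℤ → Bool
    R x κ = posk (act κ x)
    idH : inH (idP n) ≡ true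
    idH = trans (sym (pos-inH split₀ (idP-sp n))) (trans (cong posk (act-id (ρ₀ ++ ρ₀′) (split-length split₀))) (pos-split split₀))
    h₁ : ∀ {x y} → x ∈ allSigned n → y ∈ allSigned n → compose x y ≡ compose g x →
         (if inH y then χ y else ℚ.0ℚ) ≡ ΣQ (λ κ → if R x κ then term g κ else ℚ.0ℚ) Ω
    h₁ {x} {y} x∈ y∈ e = trans (block-sum Y) (trans (sym (Σ-↭ f (shuffle))) (trans (Σ-map f (λ κ → act κ x) Ω)
        (Σ-cong Ω λ {κ} i → cong (λ q → if posk (act κ x) then q else ℚ.0ℚ) (same i))))
      where
      X = sp-of S x∈
      Y = sp-of S y∈
      f : List ℤ → ℚ
      f κ = if posk κ then term y κ else ℚ.0ℚ
      shuffle : map (λ κ → act κ x) Ω ↭ Ω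
      shuffle = unique-⊆-↭ (unique-map (λ κ → act κ x) (λ a b r → act-inj X (lenΩ a) (lenΩ b) r) Ω-unique)
        (λ i → case ∈P.∈-map⁻ (λ κ → act κ x) i of λ { (κ , j , refl) → Ω-in (↭-trans (act-↭ X (lenΩ j)) (Ω-out j)) }) (ℕP.≤-reflexive (sym (LP.length-map _ Ω)))
      same : ∀ {κ} → κ ∈ Ω → term y (act κ x) ≡ term g κ
      same {κ} i = go (presB (act κ x) y) refl
        where
        go : ∀ b → presB (act κ x) y ≡ b → term y (act κ x) ≡ term g κ
        go true r = trans (cong (λ b → if b then signedTerm n (act κ x) y else ℚ.0ℚ) r)
          (trans (cong₂ ℚ._*_ (sgnφ-conj X Y Gs e) (sym (negSign-conj {κ = κ} X Y Gs (lenΩ i) e r)))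
            (cong (λ b → if b then signedTerm n κ g else ℚ.0ℚ) (sym (trans (pres-conj X Y Gs (lenΩ i) e) r))))
        go false r = trans (cong (λ b → if b then signedTerm n (act κ x) y else ℚ.0ℚ) r)
          (cong (λ b → if b then signedTerm n κ g else ℚ.0ℚ) (sym (trans (pres-conj X Y Gs (lenΩ i) e) r)))
    h₂ : ∀ {κ} → κ ∈ Ω → countB (λ x → R x κ) (allSigned n) ≡ countB inH (allSigned n)
    h₂ {κ} i with act-find (lenΩ i) (↭-sym (Ω-out i))
    ... | t , t↭ , at = trans (count-translate S (allSigned-∈ T′) (λ x → R x κ)) (countB-cong-∈ (allSigned n) λ {u} u∈ →
          trans (cong posk (trans (sym (act-compose κ (proj₁ T′) (sp-wires (sp-of S u∈)))) (cong (λ c → act c u) at))) (pos-inH split₀ (sp-of S u∈)))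
      where T′ = pos-sp t↭

-- Contents of colorings and Young subgroups.

cnt : ℤ → List ℤ → ℕ
cnt c = countB (λ y → eqZ y c)

cnt-∈ : ∀ {c} xs → cnt c xs ≢ 0 → c ∈ xs
cnt-∈ [] ne = ⊥-elim (ne refl)
cnt-∈ {c} (x ∷ xs) ne with x ℤ.≟ c
... | yes e = here (sym e)
... | no _  = there (cnt-∈ xs ne)

cnt-here : ∀ c xs → cnt c (c ∷ xs) ≡ suc (cnt c xs)
cnt-here c xs rewrite eqZ-refl c = refl

count-↭ : ∀ {xs ys} → (∀ c → cnt c xs ≡ cnt c ys) → xs ↭ ys
count-↭ {[]} {[]} _ = ↭-refl
count-↭ {[]} {y ∷ ys} h = ⊥-elim (case trans (h y) (cnt-here y ys) of λ ())
count-↭ {x ∷ xs} {ys} h with ∈P.∈-∃++ (cnt-∈ {x} ys (λ e → case trans (sym (cnt-here x xs)) (trans (h x) e) of λ ()))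
... | A , B , refl = ↭-trans (prep x (count-↭ rest)) (↭-sym (↭P.shift x A B))
  where
  rest : ∀ c → cnt c xs ≡ cnt c (A ++ B)
  rest c with trans (h c) (countB-↭ (λ y → eqZ y c) (↭P.shift x A B))
  ... | e with eqZ x c
  ...   | true  = ℕP.suc-injective e
  ...   | false = e

cnt-none : ∀ {c} xs → All (_≢ c) xs → cnt c xs ≡ 0
cnt-none [] _ = refl
cnt-none (x ∷ xs) (ne ∷ a) rewrite eqZ-false ne = cnt-none xs a

-- A list of pairs (multiplicity , color) and the coloring that lists each color with its multiplicity.
Labels : Set
Labels = List (ℕ × ℤ)

base : Labels → List ℤ
base = concatMap (λ (a , c) → replicate a c)

base-∈ : ∀ P {x} → x ∈ base P → x ∈ map proj₂ P
base-∈ P i with concatMap-∈⁻ (λ (a , c) → replicate a c) P i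
... | (a , c) , j , m = subst (_∈ map proj₂ P) (sym (rep a m)) (∈P.∈-map⁺ proj₂ j)
  where
  rep : ∀ a {x} → x ∈ replicate a c → x ≡ c
  rep (suc a) (here e) = e
  rep (suc a) (there m) = rep a m

base-length : ∀ P → length (base P) ≡ sum (map proj₁ P)
base-length [] = refl
base-length ((a , c) ∷ P) = trans (LP.length-++ (replicate a c)) (cong₂ ℕ._+_ (LP.length-replicate a) (base-length P))

base-↭ : ∀ {P Q} → P ↭ Q → base P ↭ base Q
base-↭ ↭.refl = ↭-refl
base-↭ (prep (a , c) r) = ↭P.++⁺ˡ (replicate a c) (base-↭ r)
base-↭ {_} {_ ∷ _ ∷ Q} (swap (a , c) (b , d) r) = ↭-trans (↭P.++⁺ˡ (replicate a c) (↭P.++⁺ˡ (replicate b d) (base-↭ r)))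
  (↭P.shifts (replicate a c) (replicate b d))
base-↭ (↭.trans r s) = ↭-trans (base-↭ r) (base-↭ s)

base-cnt : ∀ P → Unique (map proj₂ P) → ∀ {a c} → (a , c) ∈ P → cnt c (base P) ≡ a
base-cnt ((b , d) ∷ P) (h ∷ u) {a} {c} i = trans (countB-++ (λ y → eqZ y c) (replicate b d) (base P)) (go i)
  where
  same : ∀ b → cnt d (replicate b d) ≡ b
  same zero = refl
  same (suc b) rewrite eqZ-refl d = cong suc (same b)
  diff : ∀ b {c} → d ≢ c → cnt c (replicate b d) ≡ 0
  diff zero ne = refl
  diff (suc b) ne rewrite eqZ-false ne = diff b ne
  go : (a , c) ∈ (b , d) ∷ P → cnt c (replicate b d) ℕ.+ cnt c (base P) ≡ a
  go (here refl) = trans (cong₂ ℕ._+_ (same b) (cnt-none (base P) (All.tabulate λ m e → All.lookup h (base-∈ P m) (sym e)))) (ℕP.+-identityʳ b)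
  go (there i) = cong₂ ℕ._+_ (diff b (All.lookup h (∈P.∈-map⁺ proj₂ i))) (base-cnt P u i)

insD-↭ : ∀ x ys → insD x ys ↭ x ∷ ys
insD-↭ x [] = ↭-refl
insD-↭ x (y ∷ ys) with y ℕ.≤ᵇ x
... | true  = ↭-refl
... | false = ↭-trans (prep y (insD-↭ x ys)) (swap y x ↭-refl)

sortDesc-↭ : ∀ xs → sortDesc xs ↭ xs
sortDesc-↭ [] = ↭-refl
sortDesc-↭ (x ∷ xs) = ↭-trans (insD-↭ x (sortDesc xs)) (prep x (sortDesc-↭ xs))

nz : ℕ → Bool
nz a = not (a ℕ.≡ᵇ 0)

shape : List ℕ → List ℕ
shape α = sortDesc (filterB nz α)

-- Positions are counted from 1 in `blockOf` and from 0 in `nthZ`, whence `i ∸ 1`.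
block-col : ∀ P i → i ≢ 0 → i ℕ.≤ sum (map proj₁ P) →
  (nthZ (base P) (i ∸ 1) ≡ nthZ (map proj₂ P) (blockOf (map proj₁ P) i)) × (blockOf (map proj₁ P) i ℕ.< length (map proj₂ P))
block-col [] zero ne _ = ⊥-elim (ne refl)
block-col ((a , c) ∷ P) i ne p = go (i ℕ.≤? a)
  where
  rep : ∀ a j → j ℕ.< a → nthZ (replicate a c) j ≡ c
  rep (suc a) zero _ = refl
  rep (suc a) (suc j) (s≤s q) = rep a j q
  lr = LP.length-replicate a {c}
  Goal : Bool → Set
  Goal b = (nthZ (base ((a , c) ∷ P)) (i ∸ 1) ≡ nthZ (c ∷ map proj₂ P) (if b then 0 else suc (blockOf (map proj₁ P) (i ∸ a))))
         × ((if b then 0 else suc (blockOf (map proj₁ P) (i ∸ a))) ℕ.< suc (length (map proj₂ P)))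
  go : Dec (i ℕ.≤ a) → Goal (i ℕ.≤ᵇ a)
  go (yes q) = subst Goal (sym (≤ᵇ-ℕ q)) (trans (nthZ-++ˡ (replicate a c) (base P) (subst (i ∸ 1 ℕ.<_) (sym lr) i-1<a)) (rep a (i ∸ 1) i-1<a) , s≤s z≤n)
    where i-1<a = ℕP.<-≤-trans (ℕP.≤-reflexive (ℕP.suc-pred i {{ℕ.≢-nonZero ne}})) q
  go (no q) = subst Goal (sym false≡) (trans (cong (nthZ (base ((a , c) ∷ P))) (trans (pred-shift i a a<i) (cong (ℕ._+ (i ∸ a ∸ 1)) (sym lr))))
      (trans (nthZ-++ʳ (replicate a c) (base P) _) (proj₁ ih)) , s≤s (proj₂ ih))
    where
    a<i = ℕP.≰⇒> q
    false≡ : (i ℕ.≤ᵇ a) ≡ false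
    false≡ with i ℕ.≤ᵇ a in e
    ... | true  = ⊥-elim (q (≤ᵇ-ℕ-sound e))
    ... | false = refl
    ih = block-col P (i ∸ a) (λ e → ℕP.<⇒≱ a<i (ℕP.m∸n≡0⇒m≤n e)) (ℕP.m≤n+o⇒m∸n≤o i a p)

nthZ-inj : ∀ {xs} → Unique xs → ∀ {i j} → i ℕ.< length xs → j ℕ.< length xs → nthZ xs i ≡ nthZ xs j → i ≡ j
nthZ-inj {x ∷ xs} u {zero} {zero} _ _ _ = refl
nthZ-inj {x ∷ xs} (h ∷ u) {zero} {suc j} _ (s≤s q) e = ⊥-elim (All.lookup h (nthZ-∈ xs q) e)
nthZ-inj {x ∷ xs} (h ∷ u) {suc i} {zero} (s≤s p) _ e = ⊥-elim (All.lookup h (nthZ-∈ xs p) (sym e))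
nthZ-inj {x ∷ xs} (h ∷ u) {suc i} {suc j} (s≤s p) (s≤s q) e = cong suc (nthZ-inj u p q e)

inYoung-sound : ∀ λ′ i xs → inYoungAux λ′ i xs ≡ true → ∀ j → j ℕ.< length xs → blockOf λ′ ∣ nthZ xs j ∣ ≡ blockOf λ′ (i ℕ.+ j)
inYoung-sound λ′ i (x ∷ xs) e zero _ = trans (ℕP.≡ᵇ⇒≡ _ _ (subst T (sym (proj₁ (∧-true {blockOf λ′ ∣ x ∣ ℕ.≡ᵇ blockOf λ′ i} e))) _)) (cong (blockOf λ′) (sym (ℕP.+-identityʳ i)))
inYoung-sound λ′ i (x ∷ xs) e (suc j) (s≤s p) = trans (inYoung-sound λ′ (suc i) xs (proj₂ (∧-true {blockOf λ′ ∣ x ∣ ℕ.≡ᵇ blockOf λ′ i} e)) j p) (cong (blockOf λ′) (sym (ℕP.+-suc i j)))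

inYoung-true : ∀ λ′ i xs → (∀ j → j ℕ.< length xs → blockOf λ′ ∣ nthZ xs j ∣ ≡ blockOf λ′ (i ℕ.+ j)) → inYoungAux λ′ i xs ≡ true
inYoung-true λ′ i [] h = refl
inYoung-true λ′ i (x ∷ xs) h = ∧-intro (trans (cong (ℕ._≡ᵇ blockOf λ′ i) (trans (h 0 (s≤s z≤n)) (cong (blockOf λ′) (ℕP.+-identityʳ i)))) (≡ᵇ-true (blockOf λ′ i)))
  (inYoung-true λ′ (suc i) xs λ j p → trans (h (suc j) (s≤s p)) (cong (blockOf λ′) (ℕP.+-suc i j)))

-- The labels are distinct, so the color of a position and the index of its block determine each
-- other.
young-base : ∀ P → Unique (map proj₂ P) → ∀ {k y} → k ≡ sum (map proj₁ P) → y ↭ posZ k → inYoung (map proj₁ P) y ≡ presB (base P) y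
young-base P u {k} {y} refl r = bool-iff to from
  where
  λ′ = map proj₁ P
  ρ = base P
  Y = pos-sp r
  lρ = base-length P
  pres⁺ : ∀ {z} → z ∈ posZ k → ∃ λ j → (j ℕ.< k) × (z ≡ + suc j)
  pres⁺ {+ zero} i = ⊥-elim (proj₁ (posZ-wire i) refl)
  pres⁺ {+ suc j} i = j , wire-pos (posZ-wire i) , refl
  pres⁺ { -[1+ j ]} i = ⊥-elim (ℤP.<-asym (proj₁ (∈-posZ⁻ i)) ℤ.-<+)
  blk : ∀ {z} → Wire k z → (col ρ z ≡ nthZ (map proj₂ P) (blockOf λ′ ∣ z ∣)) × (blockOf λ′ ∣ z ∣ ℕ.< length (map proj₂ P))
  blk {z} w = block-col P ∣ z ∣ (λ e → proj₁ w (ℤP.∣i∣≡0⇒i≡0 e)) (TwoBlocks.wire-abs≤ {0} {0} w)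
  to : inYoung λ′ y ≡ true → presB ρ y ≡ true
  to e = eqLZ-true (trans (cong (map (col ρ)) (sym (win-map y (proj₁ Y)))) (trans (sym (LP.map-∘ (posZ k)))
    (trans (LP.map-cong-local (All.tabulate λ i → at (pres⁺ i))) (map-col ρ lρ))))
    where
    at : ∀ {z} → (∃ λ j → (j ℕ.< k) × (z ≡ + suc j)) → col ρ (ev y z) ≡ col ρ z
    at (j , j<k , refl) = trans (proj₁ (blk (wire (sp-perm Y) w))) (trans (cong (nthZ (map proj₂ P)) (inYoung-sound λ′ 1 y e j (subst (j ℕ.<_) (sym (proj₁ Y)) j<k))) (sym (proj₁ (blk w))))
      where w = pos-wire {k} j<k
  from : presB ρ y ≡ true → inYoung λ′ y ≡ true
  from e = inYoung-true λ′ 1 y λ j p → let w = pos-wire {k} (subst (j ℕ.<_) (proj₁ Y) p) in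
    nthZ-inj u (proj₂ (blk (wire (sp-perm Y) w))) (proj₂ (blk w)) (trans (sym (proj₁ (blk (wire (sp-perm Y) w)))) (trans (presB-sound lρ (proj₁ Y) e (+ suc j) w) (proj₁ (blk w))))

-- The coloring of content P₀ whose blocks are those of the partition shape (map proj₁ P₀).
record Based (P₀ : Labels) : Set where
  field
    labels   : Labels
    shape-≡  : shape (map proj₁ P₀) ≡ map proj₁ labels
    distinct : Unique (map proj₂ labels)
    same-↭   : base labels ↭ base P₀

-- The permutation that sorts the nonzero multiplicities is lifted to the pairs, so that each part
-- keeps its color. The pairs dropped have multiplicity zero and contribute nothing to `base`.
based : ∀ P₀ → Unique (map proj₂ P₀) → Based P₀
based P₀ u with ↭P.↭-map-inv proj₁ (↭-sym (subst (λ l → shape (map proj₁ P₀) ↭ l) (nonzero P₀) (sortDesc-↭ (filterB nz (map proj₁ P₀)))))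
  where
  nonzero : ∀ P → filterB nz (map proj₁ P) ≡ map proj₁ (filterB (nz ∘ proj₁) P)
  nonzero [] = refl
  nonzero ((a , c) ∷ P) with nz a
  ... | true  = cong (a ∷_) (nonzero P)
  ... | false = nonzero P
... | P , e , r = record { labels = P ; shape-≡ = e ; distinct = ↭-unique (↭P.map⁺ proj₂ r) (sub P₀ u)
    ; same-↭ = ↭-trans (base-↭ (↭-sym r)) (subst (base (filterB (nz ∘ proj₁) P₀) ↭_) (drop-zeros P₀) ↭-refl) }
  where
  sub : ∀ P → Unique (map proj₂ P) → Unique (map proj₂ (filterB (nz ∘ proj₁) P))
  sub [] [] = []
  sub ((a , c) ∷ P) (h ∷ u) with nz a
  ... | false = sub P u
  ... | true  = AllP.map⁺ (All.tabulate λ i → All.lookup (AllP.map⁻ h) (proj₁ (filterB-∈ (nz ∘ proj₁) P i))) ∷ sub P u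
  drop-zeros : ∀ P → base (filterB (nz ∘ proj₁) P) ≡ base P
  drop-zeros [] = refl
  drop-zeros ((zero , c) ∷ P) = drop-zeros P
  drop-zeros ((suc a , c) ∷ P) = cong (replicate (suc a) c ++_) (drop-zeros P)

-- Partitions and the coefficients of `YBC`.

sum-shape : ∀ α → sum (shape α) ≡ sum α
sum-shape α = trans (sum-↭ (sortDesc-↭ (filterB nz α))) (drop-zeros α)
  where
  sum-↭ : ∀ {xs ys} → xs ↭ ys → sum xs ≡ sum ys
  sum-↭ ↭.refl = refl
  sum-↭ (prep x r) = cong (x ℕ.+_) (sum-↭ r)
  sum-↭ {_} {_ ∷ _ ∷ ys} (swap x y r) = trans (cong (λ s → x ℕ.+ (y ℕ.+ s)) (sum-↭ r)) (trans (sym (ℕP.+-assoc x y (sum ys))) (trans (cong (ℕ._+ sum ys) (ℕP.+-comm x y)) (ℕP.+-assoc y x (sum ys))))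
  sum-↭ (↭.trans r s) = trans (sum-↭ r) (sum-↭ s)
  drop-zeros : ∀ xs → sum (filterB nz xs) ≡ sum xs
  drop-zeros [] = refl
  drop-zeros (zero ∷ xs) = drop-zeros xs
  drop-zeros (suc a ∷ xs) = cong (suc a ℕ.+_) (drop-zeros xs)

Desc : List ℕ → Set
Desc = AllPairs (λ a b → b ℕ.≤ a)

insD-desc : ∀ x ys → Desc ys → Desc (insD x ys)
insD-desc x [] _ = [] ∷ []
insD-desc x (y ∷ ys) (h ∷ d) with y ℕ.≤ᵇ x in e
... | true  = (≤ᵇ-ℕ-sound e ∷ All.map (λ p → ℕP.≤-trans p (≤ᵇ-ℕ-sound e)) h) ∷ h ∷ d
... | false = ↭P.All-resp-↭ (↭-sym (insD-↭ x ys)) (x≤y ∷ h) ∷ insD-desc x ys d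
  where
  x≤y : x ℕ.≤ y
  x≤y = ℕP.≰⇒≥ λ p → case trans (sym e) (≤ᵇ-ℕ p) of λ ()

sortDesc-desc : ∀ xs → Desc (sortDesc xs)
sortDesc-desc [] = []
sortDesc-desc (x ∷ xs) = insD-desc x (sortDesc xs) (sortDesc-desc xs)

shape-desc : ∀ α → Desc (shape α)
shape-desc α = sortDesc-desc (filterB nz α)

shape-pos : ∀ α → All (1 ℕ.≤_) (shape α)
shape-pos α = ↭P.All-resp-↭ (↭-sym (sortDesc-↭ (filterB nz α))) (All.tabulate λ i → pos (proj₂ (filterB-∈ nz α i)))
  where
  pos : ∀ {a} → nz a ≡ true → 1 ℕ.≤ a
  pos {suc a} _ = s≤s z≤n

∈-upto1 : ∀ {n j} → 1 ℕ.≤ j → j ℕ.≤ n → j ∈ upto1 n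
∈-upto1 {j = suc j} _ p = ∈P.∈-map⁺ suc (∈P.∈-upTo⁺ p)

∈-upto1⁻ : ∀ {n j} → j ∈ upto1 n → (1 ℕ.≤ j) × (j ℕ.≤ n)
∈-upto1⁻ i with ∈P.∈-map⁻ suc i
... | k , i′ , refl = s≤s z≤n , ∈P.∈-upTo⁻ i′

private
  parts : ℕ → ℕ → ℕ → List (List ℕ)
  parts f k j = map (j ∷_) (partsF f j (suc k ∸ j))

-- `f` bounds the depth of the recursion; `k ≤ f` is enough because every part is at least 1.
partsF-∈ : ∀ f m k {l} → Desc l → All (1 ℕ.≤_) l → All (ℕ._≤ m) l → sum l ≡ k → k ℕ.≤ f → l ∈ partsF f m k
partsF-∈ f m zero {[]} _ _ _ _ _ = here refl
partsF-∈ f m zero {suc j ∷ l} _ _ _ () _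
partsF-∈ f m zero {zero ∷ l} _ (() ∷ _) _ _ _
partsF-∈ (suc f) m (suc k) {j ∷ l} (h ∷ d) (1≤j ∷ ps) (j≤m ∷ _) e (s≤s p) =
  concatMap-∈ (parts f k) (∈-filterB (ℕ._≤ᵇ m) (upto1 (suc k)) (∈-upto1 1≤j (subst (j ℕ.≤_) e (ℕP.m≤m+n j (sum l)))) (≤ᵇ-ℕ j≤m))
    (∈P.∈-map⁺ (j ∷_) (partsF-∈ f j (suc k ∸ j) d ps h rest (subst (ℕ._≤ f) rest (ℕP.≤-trans (ℕP.≤-pred (ℕP.≤-trans (ℕP.+-monoˡ-≤ (sum l) 1≤j) (ℕP.≤-reflexive e))) p))))
  where
  rest : sum l ≡ suc k ∸ j
  rest = trans (sym (ℕP.m+n∸m≡n j (sum l))) (cong (_∸ j) e)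

partsF-sum : ∀ f m k {l} → l ∈ partsF f m k → sum l ≡ k
partsF-sum f m zero (here refl) = refl
partsF-sum (suc f) m (suc k) i with concatMap-∈⁻ (parts f k) (filterB (ℕ._≤ᵇ m) (upto1 (suc k))) i
... | j , a , b with ∈P.∈-map⁻ (j ∷_) b
... | l , c , refl = trans (cong (j ℕ.+_) (partsF-sum f j (suc k ∸ j) c)) (ℕP.m+[n∸m]≡n (proj₂ (∈-upto1⁻ (proj₁ (filterB-∈ (ℕ._≤ᵇ m) (upto1 (suc k)) a)))))

partsF-unique : ∀ f m k → Unique (partsF f m k)
partsF-unique f m zero = [] ∷ []
partsF-unique zero m (suc k) = []
partsF-unique (suc f) m (suc k) = concatMap-unique (parts f k) (filterB-unique (ℕ._≤ᵇ m) (upto1-unique (suc k)))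
  (λ {j} _ → UP.map⁺ LP.∷-injectiveʳ (partsF-unique f j (suc k ∸ j)))
  (λ {j} {j′} _ _ a b → case ∈P.∈-map⁻ (j ∷_) a of λ { (_ , _ , refl) → case ∈P.∈-map⁻ (j′ ∷_) b of λ { (_ , _ , e) → LP.∷-injectiveˡ e } })

shape-∈ : ∀ α → shape α ∈ partitions (sum α)
shape-∈ α = partsF-∈ (sum α) (sum α) (sum α) (shape-desc α) (shape-pos α) (subst (λ s → All (ℕ._≤ s) (shape α)) (sum-shape α) (≤-sum (shape α))) (sum-shape α) ℕP.≤-refl
  where
  ≤-sum : ∀ l → All (ℕ._≤ sum l) l
  ≤-sum [] = []
  ≤-sum (x ∷ l) = ℕP.m≤m+n x (sum l) ∷ All.map (λ p → ℕP.≤-trans p (ℕP.m≤n+m (sum l) x)) (≤-sum l)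

private
  bi : ℕ → ℕ → List (List ℕ × List ℕ)
  bi n k = concatMap (λ l → map (l ,_) (partitions (n ∸ k))) (partitions k)

bi-∈⁻ : ∀ n k {lm} → lm ∈ bi n k → (sum (proj₁ lm) ≡ k) × (sum (proj₂ lm) ≡ n ∸ k)
bi-∈⁻ n k i with concatMap-∈⁻ (λ l → map (l ,_) (partitions (n ∸ k))) (partitions k) i
... | l , a , b with ∈P.∈-map⁻ (l ,_) b
... | μ , c , refl = partsF-sum k k k a , partsF-sum (n ∸ k) (n ∸ k) (n ∸ k) c

bipartitions-sum : ∀ n {lm} → lm ∈ bipartitions n → sum (proj₁ lm) ℕ.+ sum (proj₂ lm) ≡ n
bipartitions-sum n i with concatMap-∈⁻ (bi n) (upTo (suc n)) i
... | k , a , b = let p , q = bi-∈⁻ n k b in trans (cong₂ ℕ._+_ p q) (ℕP.m+[n∸m]≡n (ℕP.≤-pred (∈P.∈-upTo⁻ a)))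

bipartitions-∈ : ∀ α β → (shape α , shape β) ∈ bipartitions (sum α ℕ.+ sum β)
bipartitions-∈ α β = concatMap-∈ (bi (sum α ℕ.+ sum β)) (∈P.∈-upTo⁺ (s≤s (ℕP.m≤m+n (sum α) (sum β))))
  (concatMap-∈ (λ l → map (l ,_) (partitions (sum α ℕ.+ sum β ∸ sum α))) (shape-∈ α)
    (∈P.∈-map⁺ (shape α ,_) (subst (λ s → shape β ∈ partitions s) (sym (ℕP.m+n∸m≡n (sum α) (sum β))) (shape-∈ β))))

bipartitions-unique : ∀ n → Unique (bipartitions n)
bipartitions-unique n = concatMap-unique (bi n) (UP.upTo⁺ (suc n))
  (λ {k} _ → concatMap-unique (λ l → map (l ,_) (partitions (n ∸ k))) (partsF-unique k k k)
    (λ {l} _ → UP.map⁺ (cong proj₂) (partsF-unique (n ∸ k) (n ∸ k) (n ∸ k)))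
    (λ {l} {l′} _ _ a b → case ∈P.∈-map⁻ (l ,_) a of λ { (_ , _ , refl) → case ∈P.∈-map⁻ (l′ ,_) b of λ { (_ , _ , e) → cong proj₁ e } }))
  (λ {k} {k′} _ _ a b → trans (sym (proj₁ (bi-∈⁻ n k a))) (proj₁ (bi-∈⁻ n k′ b)))

mCoef-refl : ∀ α → mCoef (shape α) α ≡ ℚ.1ℚ
mCoef-refl α with LP.≡-dec ℕ._≟_ (shape α) (shape α)
... | yes _ = refl
... | no n  = ⊥-elim (n refl)

mCoef-≢ : ∀ {l} α → l ≢ shape α → mCoef l α ≡ ℚ.0ℚ
mCoef-≢ {l} α ne with LP.≡-dec ℕ._≟_ (shape α) l
... | yes e = ⊥-elim (ne (sym e))
... | no _  = refl

coef-zero : ∀ s l μ α β → (l , μ) ≢ (shape α , shape β) → s ℚ.* (mCoef l α ℚ.* mCoef μ β) ≡ ℚ.0ℚ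
coef-zero s l μ α β ne = trans (cong (s ℚ.*_) (go (LP.≡-dec ℕ._≟_ l (shape α)) (LP.≡-dec ℕ._≟_ μ (shape β)))) (ℚP.*-zeroʳ s)
  where
  go : Dec (l ≡ shape α) → Dec (μ ≡ shape β) → mCoef l α ℚ.* mCoef μ β ≡ ℚ.0ℚ
  go (yes refl) (yes refl) = ⊥-elim (ne refl)
  go (no p) _ = trans (cong (ℚ._* mCoef μ β) (mCoef-≢ α p)) (ℚP.*-zeroˡ (mCoef μ β))
  go (yes _) (no q) = trans (cong (mCoef l α ℚ.*_) (mCoef-≢ β q)) (ℚP.*-zeroʳ (mCoef l α))

-- The monomial with exponents `α` and `β` occurs in only one product of monomial symmetric
-- functions, the one indexed by the two shapes, and there with coefficient 1.
YBC-shape : ∀ L α β → YBC (sum α ℕ.+ sum β) L α β ≡ ΣQ (epsEps (sum α ℕ.+ sum β) (shape α) (shape β)) L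
YBC-shape L α β = trans (Σ-single f (bipartitions-unique n) (bipartitions-∈ α β) (λ {(l , μ)} _ ne → coef-zero (c (l , μ)) l μ α β ne))
    (trans (cong (c (shape α , shape β) ℚ.*_) (cong₂ ℚ._*_ (mCoef-refl α) (mCoef-refl β))) (ℚP.*-identityʳ (c (shape α , shape β))))
  where
  n = sum α ℕ.+ sum β
  c f : List ℕ × List ℕ → ℚ
  c lm = sumQ (map (epsEps n (proj₁ lm) (proj₂ lm)) L)
  f lm = c lm ℚ.* (mCoef (proj₁ lm) α ℚ.* mCoef (proj₂ lm) β)

YBC-degree : ∀ n L α β → sum α ℕ.+ sum β ≢ n → YBC n L α β ≡ ℚ.0ℚ
YBC-degree n L α β ne = Σ-zero (λ lm → sumQ (map (epsEps n (proj₁ lm) (proj₂ lm)) L) ℚ.* (mCoef (proj₁ lm) α ℚ.* mCoef (proj₂ lm) β)) (bipartitions n)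
  λ {(l , μ)} i → coef-zero (sumQ (map (epsEps n l μ) L)) l μ α β λ e →
    ne (trans (cong₂ ℕ._+_ (trans (sym (sum-shape α)) (cong (sum ∘ proj₁) (sym e))) (trans (sym (sum-shape β)) (cong (sum ∘ proj₂) (sym e)))) (bipartitions-sum n i))

-- Marked colorings.

allB-cong : ∀ {A : Set} {p q : A → Bool} → (∀ x → p x ≡ q x) → ∀ xs → allB p xs ≡ allB q xs
allB-cong e [] = refl
allB-cong e (x ∷ xs) = cong₂ _∧_ (e x) (allB-cong e xs)

allB-map : ∀ {A B : Set} (p : B → Bool) (f : A → B) xs → allB p (map f xs) ≡ allB (p ∘ f) xs
allB-map p f [] = refl
allB-map p f (x ∷ xs) = cong (p (f x) ∧_) (allB-map p f xs)

marks : List ℤ → List (List (ℤ × Bool))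
marks []      = [] ∷ []
marks (c ∷ κ) = map ((c , false) ∷_) (marks κ) ++ map ((c , true) ∷_) (marks κ)

marks-∈ : ∀ κ {κ′} → κ′ ∈ marks κ → map proj₁ κ′ ≡ κ
marks-∈ [] (here refl) = refl
marks-∈ (c ∷ κ) i with ∈P.∈-++⁻ (map ((c , false) ∷_) (marks κ)) i
... | inj₁ j with ∈P.∈-map⁻ ((c , false) ∷_) j
...   | κ′ , m , refl = cong (c ∷_) (marks-∈ κ m)
marks-∈ (c ∷ κ) i | inj₂ j with ∈P.∈-map⁻ ((c , true) ∷_) j
...   | κ′ , m , refl = cong (c ∷_) (marks-∈ κ m)

Σ-marks-∷ : ∀ (h : List (ℤ × Bool) → ℚ) c κ → ΣQ h (marks (c ∷ κ)) ≡ ΣQ (h ∘ ((c , false) ∷_)) (marks κ) ℚ.+ ΣQ (h ∘ ((c , true) ∷_)) (marks κ)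
Σ-marks-∷ h c κ = trans (cong sumQ (LP.map-++ h (map ((c , false) ∷_) (marks κ)) _)) (trans (sumQ-++ {ℤ} (map h (map ((c , false) ∷_) (marks κ))) _)
  (cong₂ ℚ._+_ (Σ-map h ((c , false) ∷_) (marks κ)) (Σ-map h ((c , true) ∷_) (marks κ))))

dbl : ℤ → List (ℤ × Bool)
dbl c = (c , false) ∷ (c , true) ∷ []

Σ-marks : ∀ n (h : List (ℤ × Bool) → ℚ) cs → ΣQ h (allLists n (concatMap dbl cs)) ≡ ΣQ (λ κ → ΣQ h (marks κ)) (allLists n cs)
Σ-marks zero h cs = sym (ℚP.+-identityʳ (ΣQ h (marks [])))
Σ-marks (suc n) h cs = trans (Σ-concatMap h (λ x → map (x ∷_) A) D)
    (trans (Σ-cong D (λ {x} _ → trans (Σ-map h (x ∷_) A) (Σ-marks n (h ∘ (x ∷_)) cs)))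
    (trans (Σ-concatMap g dbl cs)
    (trans (Σ-cong cs (λ {c} _ → trans (cong (g (c , false) ℚ.+_) (ℚP.+-identityʳ (g (c , true))))
        (trans (sym (Σ-+ (λ κ → ΣQ (h ∘ ((c , false) ∷_)) (marks κ)) (λ κ → ΣQ (h ∘ ((c , true) ∷_)) (marks κ)) K))
          (trans (Σ-cong K (λ {κ} _ → sym (Σ-marks-∷ h c κ))) (sym (Σ-map (λ κ → ΣQ h (marks κ)) (c ∷_) K))))))
      (sym (Σ-concatMap (λ κ → ΣQ h (marks κ)) (λ c → map (c ∷_) K) cs)))))
  where
  D = concatMap dbl cs
  A = allLists n D
  K = allLists n cs
  g : ℤ × Bool → ℚ
  g x = ΣQ (λ κ → ΣQ (h ∘ (x ∷_)) (marks κ)) K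

cond : Bool → ℤ × Bool → Bool
cond g x = if g then ltZ (+ 0) (proj₁ x) else not (proj₂ x)

zipAll : List Bool → List (ℤ × Bool) → Bool
zipAll []       _        = true
zipAll (g ∷ gs) []       = true
zipAll (g ∷ gs) (x ∷ κ′) = cond g x ∧ zipAll gs κ′

map-upTo-suc : ∀ {A : Set} (f : ℕ → A) n → map f (upTo (suc n)) ≡ f 0 ∷ map (f ∘ suc) (upTo n)
map-upTo-suc f n = trans (LP.map-upTo f (suc n)) (cong (f 0 ∷_) (sym (LP.map-upTo (f ∘ suc) n)))

allB-zip : ∀ n (H : ℕ → Bool) κ′ → length κ′ ≡ n → allB (λ i → cond (H i) (kap κ′ i)) (upTo n) ≡ zipAll (map H (upTo n)) κ′
allB-zip zero H κ′ _ = refl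
allB-zip (suc n) H (x ∷ κ′) l = trans (cong (λ xs → cond (H 0) x ∧ allB p xs) (sym (LP.map-upTo suc n)))
    (trans (cong (cond (H 0) x ∧_) (trans (allB-map p suc (upTo n)) (allB-zip n (H ∘ suc) κ′ (ℕP.suc-injective l))))
      (cong (λ gs → zipAll gs (x ∷ κ′)) (sym (map-upTo-suc H n))))
  where
  p : ℕ → Bool
  p i = cond (H i) (kap (x ∷ κ′) i)

-- The number of admissible markings of a coloring: a grounded element of positive color may carry
-- either mark, one of any other color none, and an element that is not grounded has only the mark
-- 0.
markWeight : List Bool → List ℤ → ℕ
markWeight []       _       = 1
markWeight (g ∷ gs) []      = 1
markWeight (g ∷ gs) (c ∷ κ) = (if g then (if ltZ (+ 0) c then 2 else 0) else 1) ℕ.* markWeight gs κ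

Σ-zipAll : ∀ gs κ → length gs ≡ length κ → ΣQ (λ κ′ → if zipAll gs κ′ then ℚ.1ℚ else ℚ.0ℚ) (marks κ) ≡ ι (markWeight gs κ)
Σ-zipAll [] [] _ = refl
Σ-zipAll (g ∷ gs) (c ∷ κ) l = trans (Σ-marks-∷ (λ κ′ → if zipAll (g ∷ gs) κ′ then ℚ.1ℚ else ℚ.0ℚ) c κ) (go g (ltZ (+ 0) c) refl)
  where
  ih = Σ-zipAll gs κ (ℕP.suc-injective l)
  S : ℚ
  S = ΣQ (λ κ′ → if zipAll gs κ′ then ℚ.1ℚ else ℚ.0ℚ) (marks κ)
  one : ∀ g x → cond g x ≡ true → ΣQ (λ κ′ → if cond g x ∧ zipAll gs κ′ then ℚ.1ℚ else ℚ.0ℚ) (marks κ) ≡ ι (markWeight gs κ)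
  one g x e = trans (Σ-cong (marks κ) (λ {κ′} _ → cong (λ b → if b ∧ zipAll gs κ′ then ℚ.1ℚ else ℚ.0ℚ) e)) ih
  none : ∀ g x → cond g x ≡ false → ΣQ (λ κ′ → if cond g x ∧ zipAll gs κ′ then ℚ.1ℚ else ℚ.0ℚ) (marks κ) ≡ ℚ.0ℚ
  none g x e = Σ-zero _ (marks κ) (λ {κ′} _ → cong (λ b → if b ∧ zipAll gs κ′ then ℚ.1ℚ else ℚ.0ℚ) e)
  go : ∀ g b → ltZ (+ 0) c ≡ b → ΣQ (λ κ′ → if cond g (c , false) ∧ zipAll gs κ′ then ℚ.1ℚ else ℚ.0ℚ) (marks κ) ℚ.+ ΣQ (λ κ′ → if cond g (c , true) ∧ zipAll gs κ′ then ℚ.1ℚ else ℚ.0ℚ) (marks κ)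
       ≡ ι ((if g then (if b then 2 else 0) else 1) ℕ.* markWeight gs κ)
  go false b e = trans (cong₂ ℚ._+_ (one false (c , false) refl) (none false (c , true) refl)) (trans (ℚP.+-identityʳ _) (cong ι (sym (ℕP.+-identityʳ (markWeight gs κ)))))
  go true true e = trans (cong₂ ℚ._+_ (one true (c , false) e) (one true (c , true) e)) (trans (sym (ι-+ (markWeight gs κ) (markWeight gs κ))) (cong (λ w → ι (markWeight gs κ ℕ.+ w)) (sym (ℕP.+-identityʳ (markWeight gs κ)))))
  go true false e = cong₂ ℚ._+_ (none true (c , false) e) (none true (c , true) e)

kap-proj : ∀ κ′ j → proj₁ (kap κ′ j) ≡ nthZ (map proj₁ κ′) j
kap-proj [] j = refl
kap-proj (x ∷ κ′) zero = refl
kap-proj (x ∷ κ′) (suc j) = kap-proj κ′ j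

colors : List ℕ → List ℕ → List ℤ
colors α β = map (λ k → - (+ k)) (upto1 (length β)) ++ map +_ (upto1 (length α))

contB : List ℕ → List ℕ → List ℤ → Bool
contB α β κ = allB (λ i → cnt (+ i) κ ℕ.≡ᵇ nthN α (i ∸ 1)) (upto1 (length α)) ∧ allB (λ i → cnt (- (+ i)) κ ℕ.≡ᵇ nthN β (i ∸ 1)) (upto1 (length β))

contents : ℕ → List ℕ → List ℕ → List (List ℤ)
contents n α β = filterB (contB α β) (allLists n (colors α β))

module Colorings (n : ℕ) (Is : List Interval) (π : List (List ℤ)) where
  properB : List ℤ → Bool
  properB κ = allB (λ a → allB (λ b → not (incEdge n Is π a b) ∨ not (eqZ (nthZ κ (a ∸ 1)) (nthZ κ (b ∸ 1)))) (upto1 n)) (upto1 n)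

  gs : List Bool
  gs = map (grounded n Is π) (upto1 n)

  module _ (α β : List ℕ) where
    private
      groundB : List (ℤ × Bool) → Bool
      groundB κ′ = allB (λ i → cond (grounded n Is π i) (kap κ′ (i ∸ 1))) (upto1 n)

      good-≡ : ∀ {κ κ′} → map proj₁ κ′ ≡ κ → goodColoring n Is π α β κ′ ≡ groundB κ′ ∧ (properB κ ∧ contB α β κ)
      good-≡ {κ} {κ′} refl = cong (groundB κ′ ∧_) (cong₂ _∧_
        (allB-cong (λ a → allB-cong (λ b → cong₂ (λ x y → not (incEdge n Is π a b) ∨ not (eqZ x y)) (kap-proj κ′ (a ∸ 1)) (kap-proj κ′ (b ∸ 1))) (upto1 n)) (upto1 n))
        (cong₂ _∧_ (allB-cong (λ i → cong (ℕ._≡ᵇ nthN α (i ∸ 1)) (sym (countB-map (λ y → eqZ y (+ i)) proj₁ κ′))) (upto1 (length α)))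
          (allB-cong (λ i → cong (ℕ._≡ᵇ nthN β (i ∸ 1)) (sym (countB-map (λ y → eqZ y (- (+ i))) proj₁ κ′))) (upto1 (length β)))))

      ground-zip : ∀ {κ′} → length κ′ ≡ n → groundB κ′ ≡ zipAll gs κ′
      ground-zip {κ′} l = trans (allB-map (λ i → cond (grounded n Is π i) (kap κ′ (i ∸ 1))) suc (upTo n)) (trans (allB-zip n (grounded n Is π ∘ suc) κ′ l)
        (cong (λ g → zipAll g κ′) (LP.map-∘ (upTo n))))

      weight : List ℤ → ℚ
      weight κ = if properB κ then ι (markWeight gs κ) else ℚ.0ℚ

      per-coloring : ∀ {κ} → length κ ≡ n → ΣQ (λ κ′ → if goodColoring n Is π α β κ′ then ℚ.1ℚ else ℚ.0ℚ) (marks κ) ≡ (if contB α β κ then weight κ else ℚ.0ℚ)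
      per-coloring {κ} l = trans (Σ-cong (marks κ) (λ {κ′} i → cong (λ b → if b then ℚ.1ℚ else ℚ.0ℚ)
            (trans (good-≡ (marks-∈ κ i)) (cong (_∧ (properB κ ∧ contB α β κ)) (ground-zip {κ′} (trans (sym (LP.length-map proj₁ κ′)) (trans (cong length (marks-∈ κ i)) l))))))) (go (properB κ) (contB α β κ))
        where
        go : ∀ p c → ΣQ (λ κ′ → if zipAll gs κ′ ∧ (p ∧ c) then ℚ.1ℚ else ℚ.0ℚ) (marks κ) ≡ (if c then (if p then ι (markWeight gs κ) else ℚ.0ℚ) else ℚ.0ℚ)
        go true true = trans (Σ-cong (marks κ) (λ {κ′} _ → cong (λ b → if b then ℚ.1ℚ else ℚ.0ℚ) (∧-identityʳ (zipAll gs κ′))))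
          (Σ-zipAll gs κ (trans (LP.length-map _ (upto1 n)) (trans (LP.length-map suc (upTo n)) (trans (LP.length-upTo n) (sym l)))))
        go true false = Σ-zero _ (marks κ) (λ {κ′} _ → cong (λ b → if b then ℚ.1ℚ else ℚ.0ℚ) (∧-zeroʳ (zipAll gs κ′)))
        go false true = Σ-zero _ (marks κ) (λ {κ′} _ → cong (λ b → if b then ℚ.1ℚ else ℚ.0ℚ) (∧-zeroʳ (zipAll gs κ′)))
        go false false = Σ-zero _ (marks κ) (λ {κ′} _ → cong (λ b → if b then ℚ.1ℚ else ℚ.0ℚ) (∧-zeroʳ (zipAll gs κ′)))

    XBC-sum : XBC n Is π α β ≡ ΣQ (λ κ → if properB κ then ι (markWeight gs κ) else ℚ.0ℚ) (contents n α β)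
    XBC-sum = trans (sym (trans (Σ-if-const (goodColoring n Is π α β) ℚ.1ℚ (allLists n (colorsFor α β))) (ℚP.*-identityʳ _)))
      (trans (Σ-marks n (λ κ′ → if goodColoring n Is π α β κ′ then ℚ.1ℚ else ℚ.0ℚ) (colors α β))
        (trans (Σ-cong (allLists n (colors α β)) (λ i → per-coloring (proj₁ (allLists-∈⁻ n i)))) (Σ-filter (contB α β) weight (allLists n (colors α β)))))

-- Contents given by exponent vectors.

labelsOf : (ℕ → ℤ) → List ℕ → Labels
labelsOf f α = map (λ i → nthN α (i ∸ 1) , f i) (upto1 (length α))

labels-fst : ∀ f α → map proj₁ (labelsOf f α) ≡ α
labels-fst f α = trans (sym (LP.map-∘ (upto1 (length α)))) (trans (sym (LP.map-∘ (upTo (length α)))) (trans (LP.map-upTo (nthN α) (length α)) (go α)))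
  where
  go : ∀ α → applyUpTo (nthN α) (length α) ≡ α
  go [] = refl
  go (a ∷ α) = cong (a ∷_) (go α)

labels-snd : ∀ f α → map proj₂ (labelsOf f α) ≡ map f (upto1 (length α))
labels-snd f α = sym (LP.map-∘ (upto1 (length α)))

labels-unique : ∀ f → (∀ {i j} → f i ≡ f j → i ≡ j) → ∀ α → Unique (map proj₂ (labelsOf f α))
labels-unique f fi α = subst Unique (sym (labels-snd f α)) (UP.map⁺ fi (upto1-unique (length α)))

neg+ : ℕ → ℤ
neg+ k = - (+ k)

neg+-inj : ∀ {i j} → neg+ i ≡ neg+ j → i ≡ j
neg+-inj e = ℤP.+-injective (ℤP.neg-injective e)

posBase negBase : List ℕ → List ℤ
posBase α = base (labelsOf +_ α)
negBase β = base (labelsOf neg+ β)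

private
  base-color : ∀ f α {x} → x ∈ base (labelsOf f α) → ∃ λ i → (i ∈ upto1 (length α)) × (x ≡ f i)
  base-color f α {x} i = ∈P.∈-map⁻ f (subst (x ∈_) (labels-snd f α) (base-∈ (labelsOf f α) i))

  base-count : ∀ f → (∀ {i j} → f i ≡ f j → i ≡ j) → ∀ α {i} → i ∈ upto1 (length α) → cnt (f i) (base (labelsOf f α)) ≡ nthN α (i ∸ 1)
  base-count f fi α i∈ = base-cnt (labelsOf f α) (labels-unique f fi α) (∈P.∈-map⁺ (λ i → nthN α (i ∸ 1) , f i) i∈)

posBase-pos : ∀ α → All (+ 0 <_) (posBase α)
posBase-pos α = All.tabulate λ i → case base-color +_ α i of λ { (j , j∈ , refl) → ℤ.+<+ (proj₁ (∈-upto1⁻ j∈)) }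

negBase-neg : ∀ β → All (_< + 0) (negBase β)
negBase-neg β = All.tabulate λ i → case base-color neg+ β i of λ { (j , j∈ , refl) → ℤP.neg-mono-< (ℤ.+<+ (proj₁ (∈-upto1⁻ j∈))) }

module Content (α β : List ℕ) where
  κ₀ : List ℤ
  κ₀ = posBase α ++ negBase β

  κ₀-length : length κ₀ ≡ sum α ℕ.+ sum β
  κ₀-length = trans (LP.length-++ (posBase α)) (cong₂ ℕ._+_ (trans (base-length (labelsOf +_ α)) (cong sum (labels-fst +_ α)))
    (trans (base-length (labelsOf neg+ β)) (cong sum (labels-fst neg+ β))))

  private
    not-pos : ∀ {c} → c < + 0 → cnt c (posBase α) ≡ 0
    not-pos p = cnt-none (posBase α) (All.map (λ q e → ℤP.<-asym p (subst (+ 0 <_) e q)) (posBase-pos α))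
    not-neg : ∀ {c} → + 0 < c → cnt c (negBase β) ≡ 0
    not-neg p = cnt-none (negBase β) (All.map (λ q e → ℤP.<-asym p (subst (_< + 0) e q)) (negBase-neg β))

    cnt-pos : ∀ {i} → i ∈ upto1 (length α) → cnt (+ i) κ₀ ≡ nthN α (i ∸ 1)
    cnt-pos {i} i∈ = trans (countB-++ (λ y → eqZ y (+ i)) (posBase α) (negBase β))
      (trans (cong₂ ℕ._+_ (base-count +_ ℤP.+-injective α i∈) (not-neg (ℤ.+<+ (proj₁ (∈-upto1⁻ i∈))))) (ℕP.+-identityʳ _))
    cnt-neg : ∀ {i} → i ∈ upto1 (length β) → cnt (neg+ i) κ₀ ≡ nthN β (i ∸ 1)
    cnt-neg {i} i∈ = trans (countB-++ (λ y → eqZ y (neg+ i)) (posBase α) (negBase β))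
      (cong₂ ℕ._+_ (not-pos (ℤP.neg-mono-< (ℤ.+<+ (proj₁ (∈-upto1⁻ i∈))))) (base-count neg+ neg+-inj β i∈))

    κ₀-colors : All (_∈ colors α β) κ₀
    κ₀-colors = All.tabulate λ i → go (∈P.∈-++⁻ (posBase α) i)
      where
      go : ∀ {x} → (x ∈ posBase α) ⊎ (x ∈ negBase β) → x ∈ colors α β
      go (inj₁ i) = case base-color +_ α i of λ { (j , j∈ , refl) → ∈P.∈-++⁺ʳ (map neg+ (upto1 (length β))) (∈P.∈-map⁺ +_ j∈) }
      go (inj₂ i) = case base-color neg+ β i of λ { (j , j∈ , refl) → ∈P.∈-++⁺ˡ (∈P.∈-map⁺ neg+ j∈) }

  colors-unique : Unique (colors α β)
  colors-unique = UP.++⁺ (UP.map⁺ neg+-inj (upto1-unique (length β))) (UP.map⁺ ℤP.+-injective (upto1-unique (length α)))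
    λ (p , q) → case ∈P.∈-map⁻ neg+ p of λ { (i , i∈ , refl) → case ∈P.∈-map⁻ +_ q of λ { (j , j∈ , e) →
      ℤP.<-asym (ℤ.+<+ (proj₁ (∈-upto1⁻ j∈))) (subst (_< + 0) e (ℤP.neg-mono-< (ℤ.+<+ (proj₁ (∈-upto1⁻ i∈))))) } }

  color-≢0 : ∀ {c} → c ∈ colors α β → c ≢ + 0
  color-≢0 i refl with ∈P.∈-++⁻ (map neg+ (upto1 (length β))) i
  ... | inj₁ p = case ∈P.∈-map⁻ neg+ p of λ { (zero , j∈ , _) → case proj₁ (∈-upto1⁻ j∈) of λ () ; (suc j , _ , ()) }
  ... | inj₂ p = case ∈P.∈-map⁻ +_ p of λ { (zero , j∈ , _) → case proj₁ (∈-upto1⁻ j∈) of λ () ; (suc j , _ , ()) }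

  module _ {n : ℕ} where
    contents-unique : Unique (contents n α β)
    contents-unique = filterB-unique (contB α β) (allLists-unique n colors-unique)

    contents-out : ∀ {κ} → κ ∈ contents n α β → (length κ ≡ n) × All (_∈ colors α β) κ × (κ ↭ κ₀)
    contents-out {κ} i with filterB-∈ (contB α β) (allLists n (colors α β)) i
    ... | a , b with allLists-∈⁻ n a
    ...   | l , cs with ∧-true {allB (λ i → cnt (+ i) κ ℕ.≡ᵇ nthN α (i ∸ 1)) (upto1 (length α))} b
    ...     | b₁ , b₂ = l , cs , count-↭ counts
      where
      counts : ∀ c → cnt c κ ≡ cnt c κ₀
      counts c with Any.any? (c ℤ.≟_) (colors α β)
      ... | no c∉ = trans (cnt-none κ (All.map (λ { m refl → c∉ m }) cs)) (sym (cnt-none κ₀ (All.map (λ { m refl → c∉ m }) κ₀-colors)))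
      ... | yes c∈ with ∈P.∈-++⁻ (map neg+ (upto1 (length β))) c∈
      ...   | inj₁ p = case ∈P.∈-map⁻ neg+ p of λ { (j , j∈ , refl) → trans (ℕP.≡ᵇ⇒≡ _ _ (subst T (sym (allB-sound (upto1 (length β)) b₂ j∈)) _)) (sym (cnt-neg j∈)) }
      ...   | inj₂ p = case ∈P.∈-map⁻ +_ p of λ { (j , j∈ , refl) → trans (ℕP.≡ᵇ⇒≡ _ _ (subst T (sym (allB-sound (upto1 (length α)) b₁ j∈)) _)) (sym (cnt-pos j∈)) }

    contents-in : sum α ℕ.+ sum β ≡ n → ∀ {κ} → κ ↭ κ₀ → κ ∈ contents n α β
    contents-in e {κ} r = ∈-filterB (contB α β) (allLists n (colors α β)) (allLists-∈ n (trans (↭P.↭-length r) (trans κ₀-length e)) (↭P.All-resp-↭ (↭-sym r) κ₀-colors))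
      (∧-intro (allB-true (upto1 (length α)) λ {i} i∈ → trans (cong (ℕ._≡ᵇ nthN α (i ∸ 1)) (trans (countB-↭ (λ y → eqZ y (+ i)) r) (cnt-pos i∈))) (≡ᵇ-true (nthN α (i ∸ 1))))
               (allB-true (upto1 (length β)) λ {i} i∈ → trans (cong (ℕ._≡ᵇ nthN β (i ∸ 1)) (trans (countB-↭ (λ y → eqZ y (neg+ i)) r) (cnt-neg i∈))) (≡ᵇ-true (nthN β (i ∸ 1)))))

private
  relabel : ∀ f → (∀ {i j} → f i ≡ f j → i ≡ j) → ∀ α → Based (labelsOf f α)
  relabel f fi α = based (labelsOf f α) (labels-unique f fi α)

  based-shape : ∀ f (fi : ∀ {i j} → f i ≡ f j → i ≡ j) α → shape α ≡ map proj₁ (Based.labels (relabel f fi α))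
  based-shape f fi α = trans (cong shape (sym (labels-fst f α))) (Based.shape-≡ (relabel f fi α))

-- The character lists its blocks by decreasing size without zeros, the content lists them as in `α`
-- and `β`; the labels of `Based` reconcile the two. The colorings of each block are the contents
-- with the other exponent vector empty.
epsEps-contents : ∀ {n} α β → sum α ℕ.+ sum β ≡ n → ∀ {g} → SignedPerm n g →
  epsEps n (shape α) (shape β) g ≡ ΣQ (λ κ → if presB κ g then signedTerm n κ g else ℚ.0ℚ) (contents n α β)
epsEps-contents {n} α β e = subst (λ N → ∀ {g} → SignedPerm N g → epsEps N (shape α) (shape β) g ≡ ΣQ (λ κ → if presB κ g then signedTerm N κ g else ℚ.0ℚ) (contents n α β)) N≡n
    (Outer.epsEps-colorings {sum (shape β)} {shape α} {shape β} {base P} {base Q} lenP lenQ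
      (↭P.All-resp-↭ (↭-sym samP) (posBase-pos α)) (↭P.All-resp-↭ (↭-sym samQ) (negBase-neg β))
      (λ {y} r → trans (cong (λ l → inYoung l y) shP) (young-base P (Based.distinct bP) (cong sum shP) r))
      (λ {y} r → trans (cong (λ l → inYoung l y) shQ) (young-base Q (Based.distinct bQ) (cong sum shQ) r))
      (contents (sum α) α []) (Content.contents-unique α [] {sum α})
      (λ r → Content.contents-in α [] (ℕP.+-identityʳ (sum α)) (subst (_ ↭_) (sym (LP.++-identityʳ (posBase α))) (↭-trans r samP)))
      (λ i → ↭-trans (subst (_ ↭_) (LP.++-identityʳ (posBase α)) (proj₂ (proj₂ (Content.contents-out α [] {sum α} i)))) (↭-sym samP))
      (contents (sum β) [] β) (Content.contents-unique [] β {sum β})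
      (λ r → Content.contents-in [] β refl (↭-trans r samQ))
      (λ i → ↭-trans (proj₂ (proj₂ (Content.contents-out [] β {sum β} i))) (↭-sym samQ))
      (contents n α β) (Content.contents-unique α β {n})
      (λ r → Content.contents-in α β e (↭-trans r (↭P.++⁺ samP samQ)))
      (λ i → ↭-trans (proj₂ (proj₂ (Content.contents-out α β {n} i))) (↭-sym (↭P.++⁺ samP samQ))))
  where
  bP = relabel +_ ℤP.+-injective α
  bQ = relabel neg+ neg+-inj β
  P = Based.labels bP
  Q = Based.labels bQ
  shP = based-shape +_ ℤP.+-injective α
  shQ = based-shape neg+ neg+-inj β
  samP = Based.same-↭ bP
  samQ = Based.same-↭ bQ
  lenP : length (base P) ≡ sum (shape α)
  lenP = trans (base-length P) (cong sum (sym shP))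
  lenQ : length (base Q) ≡ sum (shape β)
  lenQ = trans (base-length Q) (cong sum (sym shQ))
  N≡n : sum (shape α) ℕ.+ sum (shape β) ≡ n
  N≡n = trans (cong₂ ℕ._+_ (sum-shape α) (sum-shape β)) e

markWeight-zero : ∀ (G : ℤ → Bool) (f : ℤ → ℤ) zs {z} → z ∈ zs → G z ≡ true → f z < + 0 → markWeight (map G zs) (map f zs) ≡ 0
markWeight-zero G f (z ∷ zs) (here refl) g p rewrite g | ltZ-false (ℤP.<⇒≤ p) = refl
markWeight-zero G f (z ∷ zs) (there i) g p rewrite markWeight-zero G f zs i g p = ℕP.*-zeroʳ (if G z then (if ltZ (+ 0) (f z) then 2 else 0) else 1)

markWeight-ground : ∀ (G : ℤ → Bool) (f : ℤ → ℤ) zs → (∀ {z} → z ∈ zs → G z ≡ true → + 0 < f z) → markWeight (map G zs) (map f zs) ≡ groundWeight G zs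
markWeight-ground G f [] h = refl
markWeight-ground G f (z ∷ zs) h = cong₂ ℕ._*_ (go (G z) refl) (markWeight-ground G f zs (h ∘ there))
  where
  go : ∀ b → G z ≡ b → (if b then (if ltZ (+ 0) (f z) then 2 else 0) else 1) ≡ (if b then 2 else 1)
  go false _ = refl
  go true e = cong (λ b → if b then 2 else 0) (ltZ-true (h (here refl) e))

-- Comparison of the signed sum with the markings.

module Weights {n : ℕ} {Is : List Interval} {w : List ℤ} (zg : ZigZag n Is) (sp : SignedPerm n w) (mx : IsMaxType Is (wiresZ n) (full w))
    (π : List (List ℤ)) (ok : famOk Is (wiresZ n) (wiresZ n) π ≡ true) (L : List (List ℤ)) (be : BruhatEnum n w L)
    {κ : List ℤ} (lκ : length κ ≡ n) (κ≢0 : All (_≢ + 0) κ) where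
  private
    z = zigzag-zz Is zg
  open SignedSum z (zigzag-good Is zg) sp mx L be κ lκ
  open IdentityFamily {n} z π ok
  open Colorings n Is π
  private
    G : ℤ → Bool
    G x = grounded n Is π ∣ x ∣

    G-as : ∀ {x} → x ∈ posZ n → G x ≡ shares Is (pathOf n π x) (pathOf n π (- x))
    G-as x∈ = cong (λ y → shares Is (pathOf n π y) (pathOf n π (- y))) (pos-abs x∈)

    G-share : ∀ {x} → x ∈ posZ n → G x ≡ true → Share Is x (- x)
    G-share x∈ e = let wx = posZ-wire x∈ in shares-share wx (Wire-neg wx) (≢-neg (proj₁ wx)) (trans (sym (G-as x∈)) e)

    share-G : ∀ {x} → x ∈ posZ n → Share Is x (- x) → G x ≡ true
    share-G x∈ s = let wx = posZ-wire x∈ in trans (G-as x∈) (share-shares wx (Wire-neg wx) (≢-neg (proj₁ wx)) s)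

    Bad : ℤ → Set
    Bad j = Any (λ i → Clash i j) (posZ n)

    bad? : ∀ j → Dec (Bad j)
    bad? j = Any.any? (λ i → (i ℤ.<? j) ×-dec ((col κ i ℤ.≟ col κ j) ×-dec share? Is i j)) (posZ n)

    -- The list increases, so searching the tail before the head finds the largest element with a
    -- clash.
    largest : ∀ {zs} → AllPairs _<_ zs → (∀ {j} → j ∈ zs → ¬ Bad j) ⊎ (∃ λ j → (j ∈ zs) × Bad j × (∀ {l} → l ∈ zs → j < l → ¬ Bad l))
    largest [] = inj₁ λ ()
    largest {x ∷ zs} (h ∷ s) with largest s
    ... | inj₂ (j , j∈ , b , m) = inj₂ (j , there j∈ , b , λ { (here refl) r → ⊥-elim (ℤP.<-asym r (All.lookup h j∈)) ; (there i) r → m i r })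
    ... | inj₁ none with bad? x
    ...   | yes b = inj₂ (x , here refl , b , λ { (here refl) r → ⊥-elim (ℤP.<-irrefl refl r) ; (there i) _ → none i })
    ...   | no nb = inj₁ λ { (here refl) → nb ; (there i) → none i }

    nat-pos : ∀ {a} → a ∈ upto1 n → + a ∈ posZ n
    nat-pos = ∈P.∈-map⁺ +_

    clash-edge : ∀ {i j} → i ∈ posZ n → j ∈ posZ n → Clash i j → properB κ ≡ false
    clash-edge {i} {j} i∈ j∈ (i<j , ce , s) with properB κ in e
    ... | false = refl
    ... | true = ⊥-elim (case trans (sym (allB-sound (upto1 n) (allB-sound (upto1 n) e (wire-abs (posZ-wire i∈))) (wire-abs (posZ-wire j∈)))) bad of λ ())
      where
      edge : incEdge n Is π ∣ i ∣ ∣ j ∣ ≡ true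
      edge = share-incEdge (subst (Wire n) (sym (pos-abs i∈)) (posZ-wire i∈)) (subst (Wire n) (sym (pos-abs j∈)) (posZ-wire j∈))
        (λ r → ℤP.<⇒≢ i<j (trans (sym (pos-abs i∈)) (trans (cong +_ r) (pos-abs j∈)))) (subst₂ (Share Is) (sym (pos-abs i∈)) (sym (pos-abs j∈)) s)
      bad : not (incEdge n Is π ∣ i ∣ ∣ j ∣) ∨ not (eqZ (nthZ κ (∣ i ∣ ∸ 1)) (nthZ κ (∣ j ∣ ∸ 1))) ≡ false
      bad = cong₂ (λ x y → not x ∨ not y) edge (trans (cong (eqZ (col κ i)) (sym ce)) (eqZ-refl (col κ i)))

    proper-true : (∀ {i j} → i ∈ posZ n → j ∈ posZ n → ¬ Clash i j) → properB κ ≡ true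
    proper-true pr = allB-true (upto1 n) λ {a} a∈ → allB-true (upto1 n) λ {b} b∈ → go a b a∈ b∈ (incEdge n Is π a b) refl (nthZ κ (a ∸ 1) ℤ.≟ nthZ κ (b ∸ 1))
      where
      go : ∀ a b → a ∈ upto1 n → b ∈ upto1 n → ∀ x → incEdge n Is π a b ≡ x → Dec (nthZ κ (a ∸ 1) ≡ nthZ κ (b ∸ 1)) →
           not x ∨ not (eqZ (nthZ κ (a ∸ 1)) (nthZ κ (b ∸ 1))) ≡ true
      go a b a∈ b∈ false _ _ = refl
      go a b a∈ b∈ true _ (no ne) = cong not (eqZ-false ne)
      go a b a∈ b∈ true e (yes ce) with incEdge-share (posZ-wire (nat-pos a∈)) (posZ-wire (nat-pos b∈)) e
      ... | ne , s with ℕP.<-cmp a b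
      ...   | tri< r _ _ = ⊥-elim (pr (nat-pos a∈) (nat-pos b∈) (ℤ.+<+ r , ce , s))
      ...   | tri≈ _ r _ = ⊥-elim (ne r)
      ...   | tri> _ _ r = ⊥-elim (pr (nat-pos b∈) (nat-pos a∈) (ℤ.+<+ r , sym ce , share-sym s))

    gs-map : gs ≡ map G (posZ n)
    gs-map = LP.map-∘ (upto1 n)

    weight-map : markWeight gs κ ≡ markWeight (map G (posZ n)) (map (col κ) (posZ n))
    weight-map = cong₂ markWeight gs-map (sym (map-col κ lκ))

    col-≢0 : ∀ {x} → x ∈ posZ n → col κ x ≢ + 0
    col-≢0 {x} x∈ = All.lookup κ≢0 (subst (col κ x ∈_) (map-col κ lκ) (∈P.∈-map⁺ (col κ) x∈))

  private
    pick : ∀ {P : ℤ → Set} {zs} → Any P zs → ∃ λ x → (x ∈ zs) × P x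
    pick (here c) = _ , here refl , c
    pick (there a) = let x , x∈ , c = pick a in x , there x∈ , c

    Answer : Set
    Answer = total ≡ (if properB κ then ι (markWeight gs κ) else ℚ.0ℚ)

    clashing : ∀ {j} → j ∈ posZ n → Bad j → (∀ {l} → l ∈ posZ n → j < l → ¬ Bad l) → Answer
    clashing {j} j∈ b m = let i , i∈ , c = pick b in
      trans (Clashing.total-zero i∈ j∈ c (λ l∈ c′ → m l∈ (proj₁ c′) (Any.map (λ { refl → c′ }) j∈)))
        (cong (λ b → if b then ι (markWeight gs κ) else ℚ.0ℚ) (sym (clash-edge i∈ j∈ c)))

    module Chains (proper : ∀ {i j} → i ∈ posZ n → j ∈ posZ n → ¬ Clash i j) where
      open Proper G G-share share-G proper

      -- A grounded element of negative color makes both sides zero: the signed sum cancels, and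
      -- `markWeight` has a factor 0. Without one, both sides have a factor 2 for each grounded
      -- element.
      ground : Dec (Any (λ x → (G x ≡ true) × (col κ x < + 0)) (posZ n)) → total ≡ ι (markWeight gs κ)
      ground (yes a) = let x , x∈ , g , c = pick a in trans (ground-zero x∈ g c) (cong ι (sym (trans weight-map (markWeight-zero G (col κ) (posZ n) x∈ g c))))
      ground (no na) = trans (total-count (λ {x} x∈ c → not-ground x∈ c (G x) refl))
          (cong ι (sym (trans weight-map (markWeight-ground G (col κ) (posZ n) λ {x} x∈ g → case ℤP.<-cmp (col κ x) (+ 0) of λ
            { (tri< c _ _) → ⊥-elim (na (Any.map (λ { refl → g , c }) x∈)) ; (tri≈ _ e _) → ⊥-elim (col-≢0 x∈ e) ; (tri> _ _ c) → c }))))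
        where
        not-ground : ∀ {x} → x ∈ posZ n → col κ x < + 0 → ∀ b → G x ≡ b → G x ≡ false
        not-ground x∈ c false e = e
        not-ground x∈ c true e = ⊥-elim (na (Any.map (λ { refl → e , c }) x∈))

      answer : Answer
      answer = trans (ground (Any.any? (λ x → (G x Bool.≟ true) ×-dec (col κ x ℤ.<? + 0)) (posZ n)))
        (cong (λ b → if b then ι (markWeight gs κ) else ℚ.0ℚ) (sym (proper-true proper)))

    decide : ((∀ {j} → j ∈ posZ n → ¬ Bad j) ⊎ (∃ λ j → (j ∈ posZ n) × Bad j × (∀ {l} → l ∈ posZ n → j < l → ¬ Bad l))) → Answer
    decide (inj₂ (j , j∈ , b , m)) = clashing j∈ b m
    decide (inj₁ none) = Chains.answer λ i∈ j∈ c → none j∈ (Any.map (λ { refl → c }) i∈)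

  total-weight : total ≡ (if properB κ then ι (markWeight gs κ) else ℚ.0ℚ)
  total-weight = decide (largest (posZ-sorted n))

theorem11p4 : (n : ℕ) (w : List ℤ) → SignedPerm n w → Avoids3412-4231 w →
    (Is : List Interval) → ZigZag n Is → IsMaxType Is (wiresZ n) (full w) →
    (π : List (List ℤ)) → famOk Is (wiresZ n) (wiresZ n) π ≡ true → covers Is (wiresZ n) π ≡ true →
    (L : List (List ℤ)) → BruhatEnum n w L →
    (α β : List ℕ) → YBC n L α β ≡ XBC n Is π α β
theorem11p4 n w sp _ Is zg mx π ok _ L be α β = trans (both (sum α ℕ.+ sum β ℕ.≟ n)) (sym (Colorings.XBC-sum n Is π α β))
  where
  term : List ℤ → List ℤ → ℚ
  term κ v = if presB κ v then signedTerm n κ v else ℚ.0ℚ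
  weight : List ℤ → ℚ
  weight κ = if Colorings.properB n Is π κ then ι (markWeight (Colorings.gs n Is π) κ) else ℚ.0ℚ
  both : Dec (sum α ℕ.+ sum β ≡ n) → YBC n L α β ≡ ΣQ weight (contents n α β)
  -- In the wrong degree no bipartition matches the exponents and no coloring of [n] has the
  -- required content, so both sides are zero.
  both (no ne) = trans (YBC-degree n L α β ne) (sym (Σ-zero weight (contents n α β) λ i →
    let l , _ , r = Content.contents-out α β {n} i in ⊥-elim (ne (trans (sym (Content.κ₀-length α β)) (trans (sym (↭P.↭-length r)) l)))))
  both (yes e) = trans (subst (λ N → YBC N L α β ≡ ΣQ (epsEps N (shape α) (shape β)) L) e (YBC-shape L α β))
    (trans (Σ-cong L (λ {v} i → epsEps-contents α β e (proj₁ (proj₁ (proj₂ be v) i))))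
    (trans (Σ-swap (λ v κ → term κ v) L (contents n α β))
      (Σ-cong (contents n α β) λ i → let l , cs , _ = Content.contents-out α β {n} i in
        Weights.total-weight zg sp mx π ok L be l (All.map (Content.color-≢0 α β) cs))))
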